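{- Let $\gamma=\frac{5+\sqrt{5}}{10}$. Fix $\epsilon>0$. Then \[ \lim_{g\to\infty}\mathbb{P}_{g}\left[\left|e(S)-\tfrac{1}{\sqrt{5}}\, g \right|< \epsilon g\right]=1 \quad\text{and}\quad \lim_{g\to\infty}\mathbb{P}_{g}\left[\left|t(S)-(1-\gamma) g \right|< \epsilon g\right]=1. \]
   Context: A numerical semigroup $S$ is a submonoid of $\mathbb{N}_0$ with finite complement; $\mathcal{H}(S)=\mathbb{N}_0\setminus S$ is its set of gaps and the genus is $g(S)=|\mathcal{H}(S)|$. The minimal generating set is $\mathcal{A}(S)=(S\setminus\{0\})\setminus\big((S\setminus\{0\})+(S\setminus\{0\})\big)$ and the embedding dimension is $e(S)=|\mathcal{A}(S)|$. The pseudo-Frobenius numbers are $PF(S)=\{P\in\mathcal{H}(S): P+s\in S \text{ for all } s\in S\setminus\{0\}\}$ and the type is $t(S)=|PF(S)|$. $\mathcal{S}_g$ denotes the (finite) set of numerical semigroups of genus $g$, and $\mathbb{P}_g$ is the uniform probability measure on $\mathcal{S}_g$, with $S$ denoting a random element. -}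

module Defs where

open import Data.Nat using (ℕ; zero; suc; _+_; _*_; _≤_; _<_; _<ᵇ_; _≡ᵇ_; _≤ᵇ_)
open import Data.Bool using (Bool; true; false; _∧_; _∨_; not; if_then_else_)
open import Data.Vec using (Vec; []; _∷_)
open import Data.List using (List; []; _∷_; concatMap)
open import Data.Integer using (ℤ; +_; -[1+_]; _-_) renaming (_+_ to _+ℤ_)
open import Data.Product using (∃-syntax)

countUpTo : ℕ → (ℕ → Bool) → ℕ
countUpTo zero    f = 0
countUpTo (suc n) f = countUpTo n f + (if f n then 1 else 0)

allUpTo : ℕ → (ℕ → Bool) → Bool
allUpTo zero    f = true
allUpTo (suc n) f = allUpTo n f ∧ f n

anyUpTo : ℕ → (ℕ → Bool) → Bool
anyUpTo zero    f = false
anyUpTo (suc n) f = anyUpTo n f ∨ f n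

countWhere : {A : Set} → List A → (A → Bool) → ℕ
countWhere []       f = 0
countWhere (x ∷ xs) f = countWhere xs f + (if f x then 1 else 0)

allVecs : (n : ℕ) → List (Vec Bool n)
allVecs zero    = [] ∷ []
allVecs (suc n) = concatMap (λ v → (false ∷ v) ∷ (true ∷ v) ∷ []) (allVecs n)

-- Subsets S of ℕ₀ with finite complement, given by a window v : Vec Bool L:
-- x ∈ S  iff  (x < L and v[x] = true) or x ≥ L.

mem : {L : ℕ} → Vec Bool L → ℕ → Bool
mem []      x       = true
mem (b ∷ v) zero    = b
mem (b ∷ v) (suc x) = mem v x

-- S is a submonoid of ℕ₀ (0 ∈ S, closed under +).  Pairs with a component
-- ≥ L have sum ≥ L, hence automatically in S, so checking x , y < L suffices.
isNumSg : {L : ℕ} → Vec Bool L → Bool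
isNumSg {L} v =
  mem v 0 ∧ allUpTo L (λ x → allUpTo L (λ y →
    not (mem v x ∧ mem v y) ∨ mem v (x + y)))

-- genus = number of gaps (all gaps lie below L)
genus : {L : ℕ} → Vec Bool L → ℕ
genus {L} v = countUpTo L (λ x → not (mem v x))

isAtom : {L : ℕ} → Vec Bool L → ℕ → Bool
isAtom v a =
  mem v a ∧ (1 ≤ᵇ a) ∧
  not (anyUpTo a (λ x → (1 ≤ᵇ x) ∧ mem v x ∧ mem v (Data.Nat._∸_ a x)))

-- embedding dimension.  Every atom a satisfies a ≤ 2L+1 (if L ≥ 1 and m is
-- the multiplicity, m ≤ L and a - m ∉ S∖{0} forces a < L + m; if L = 0 the
-- only atom is 1), so counting atoms below 2L+2 counts all of A(S).
edim : {L : ℕ} → Vec Bool L → ℕ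
edim {L} v = countUpTo (suc (suc (L + L))) (isAtom v)

-- P is pseudo-Frobenius: P ∉ S and P + s ∈ S for all s ∈ S∖{0}
-- (for s ≥ L, P + s ≥ L is automatically in S)
isPF : {L : ℕ} → Vec Bool L → ℕ → Bool
isPF {L} v P =
  not (mem v P) ∧
  allUpTo L (λ s → not ((1 ≤ᵇ s) ∧ mem v s) ∨ mem v (P + s))

-- type = |PF(S)|  (PF(S) ⊆ gaps, which all lie below L)
type : {L : ℕ} → Vec Bool L → ℕ
type {L} v = countUpTo L (isPF v)

-- 𝒮_g.  Every numerical semigroup of genus g has all its gaps ≤ 2g - 1,
-- so 𝒮_g is in bijection with the windows of length 2g that are numerical
-- semigroups of genus g.

window : ℕ → ℕ
window g = 2 * g

inSg : (g : ℕ) → Vec Bool (window g) → Bool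
inSg g v = isNumSg v ∧ (genus v ≡ᵇ g)

cardSg : ℕ → ℕ
cardSg g = countWhere (allVecs (window g)) (inSg g)

cardEvent : (E : (g : ℕ) → Vec Bool (window g) → Bool) → ℕ → ℕ
cardEvent E g = countWhere (allVecs (window g)) (λ v → inSg g v ∧ E g v)

-- lim_{g→∞} ℙ_g[E] = 1, i.e. for every rational δ = a/b > 0 there is N with
-- 1 - ℙ_g[E] < δ for g ≥ N; written without division:
-- b·|𝒮_g| < b·|E_g| + a·|𝒮_g|.
ProbTendsToOne : ((g : ℕ) → Vec Bool (window g) → Bool) → Set
ProbTendsToOne E =
  (a b : ℕ) → 0 < a → 0 < b →
  ∃[ N ] ((g : ℕ) → N ≤ g →
    b * cardSg g < b * cardEvent E g + a * cardSg g)

lt√5 : ℤ → ℕ → Bool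
lt√5 (+ k)      n = k * k <ᵇ 5 * (n * n)
lt√5 -[1+ k ]   n = true

gt√5 : ℤ → ℕ → Bool
gt√5 (+ k)      n = 5 * (n * n) <ᵇ k * k
gt√5 -[1+ k ]   n = false

band√5 : ℤ → ℤ → ℕ → Bool
band√5 lo hi n = lt√5 lo n ∧ gt√5 hi n

-- Event |e(S) - g/√5| < (p/q)·g, multiplied by 5q:
--   5qe - 5pg < qg·√5 < 5qe + 5pg
edimEvent : (p q : ℕ) → (g : ℕ) → Vec Bool (window g) → Bool
edimEvent p q g v =
  band√5 (+ (5 * q * edim v) - + (5 * p * g))
         (+ (5 * q * edim v) +ℤ + (5 * p * g))
         (q * g)

-- Event |t(S) - (1-γ)g| < (p/q)·g with 1 - γ = (5 - √5)/10, multiplied by 10q: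
--   5qg - 10qt - 10pg < qg·√5 < 5qg - 10qt + 10pg
typeEvent : (p q : ℕ) → (g : ℕ) → Vec Bool (window g) → Bool
typeEvent p q g v =
  band√5 (+ (5 * q * g) - + (10 * q * type v) - + (10 * p * g))
         (+ (5 * q * g) - + (10 * q * type v) +ℤ + (10 * p * g))
         (q * g)

-- A semigroup of multiplicity n + 1 is encoded by its Kunz word: for every nonzero
-- residue modulo n + 1, the number of gaps in it, so that the genus g is the sum of
-- the letters.  Words over {1, 2} are always admissible, hence there are at least
-- about φ^g semigroups of genus g, and it suffices to show that those violating
-- the claim number at most C Y^g for some Y < φ.
--
-- With x slightly below 1/φ a word of genus g has weight x^g, and the total weight of
-- all words of length n subject to positionwise conditions is the product over the
-- positions of the sums of x^k over the letters k allowed there.  Since x + x² ≤ 1,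
-- each such row is at most 1 for the letters 1, 2, and any saving at a positive
-- proportion of the positions is exponential.  Such savings exist for
--   * words with at most g/7 letters;
--   * words with many letters ≥ 3: the Kunz inequalities forbid pairs of small
--     letters, and the container method reduces the forbidden pairs to
--     positionwise conditions at subexponential cost;
--   * words in which a late residue is not a sum of two ones, or a position away from
--     both ends does not shift some one to a larger letter: then many pairs of
--     positions cannot both carry a 1, or a 1 at one of them forces a 1 at the other;
--   * words in which the letter 1 (or 2) is more frequent than typical: there the
--     weight of that letter can be raised.
-- In any other word the number e(S) is close to the number of ones and t(S) to the
-- number of twos, while ones + 2 twos is close to g; the upper bounds on both
-- frequencies, 1/√5 and (1 - 1/√5)/2, then give the lower bounds as well.

module Submission where

open import Algebra.Bundles using (CommutativeSemiring)
open import Defs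
open import Data.Bool using (Bool; true; false; _∧_; _∨_; not; if_then_else_) renaming (T to Holds)
open import Data.Bool.Properties using (∧-zeroʳ)
open import Data.Empty using (⊥; ⊥-elim)
open import Data.Integer.Base as ℤ using (ℤ)
import Data.Integer.Properties as ℤₚ
open import Data.List using (List; []; _∷_; _++_; map; concatMap; upTo; applyUpTo; length; cartesianProduct; cartesianProductWith)
open import Data.List.Membership.Propositional using (_∈_)
open import Data.List.Membership.Propositional.Properties using (∈-upTo⁺; ∈-upTo⁻; ∈-cartesianProductWith⁺; ∈-cartesianProductWith⁻; ∈-cartesianProduct⁺)
open import Data.List.Properties using (length-upTo; length-++; length-map)
open import Data.List.Relation.Unary.Any using (here; there)
open import Data.Nat
open import Data.Nat.Divisibility using (n∣m*n)
open import Data.Nat.DivMod using (/-congʳ; +-distrib-/-∣ʳ; m≡m%n+[m/n]*n; m%n<n; [m+kn]%n≡m%n; m<n⇒m%n≡m; m*n/n≡m; m/n*n≤m; m/n≤m; /-monoʳ-≤; /-monoˡ-≤; m<n⇒m/n≡0)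
open import Data.Nat.Properties
open import Data.Nat.Solver using (module +-*-Solver)
open import Data.Product using (_×_; _,_; proj₁; proj₂; Σ; ∃-syntax)
open import Data.Sum using (_⊎_; inj₁; inj₂; [_,_]′)
open import Data.Unit using (tt)
open import Data.Vec using (Vec; []; _∷_)
open import Function using (_∘_; id; case_of_)
open import Level using (0ℓ)
open import Relation.Binary.Bundles using (Poset)
open import Relation.Binary.Definitions using (tri<; tri≈; tri>)
open import Relation.Binary.PropositionalEquality
open import Relation.Binary.Structures using (IsEquivalence)
open import Relation.Nullary using (Dec; ¬_; yes; no)

-- The two limits come from a first-order balance. Divide the critical weight x = 1/φ by 1 + 1/V; a
-- letter may then be raised by 1 + 1/T with row sum still at most 1 roughly when T/V is at least
-- x/(x + 2x²) for the letter 1, or x²/(x + 2x²) for the letter 2. These ratios are 1/√5 and (5 -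
-- √5)/10. A word whose letter has frequency c/d ≥ T/V gains at least as much from the tilt as it
-- loses through x.
--
-- The number φ itself is never formed. Fibonacci quotients Y = P/R < φ serve as growth rates and x
-- = P/(P + R) as the untilted weight; 1/x exceeds φ but is at most (1 + 1/N) Y. Each bad class
-- therefore needs a saving that survives factors (1 + 1/N)^(kg) for a fixed k. Sums over lengths,
-- places and fingerprints, and the penalty 1/N of an exceptional letter where such letters are
-- rarer than n/N², are charged to these factors.
--
-- Hence two parameters in turn: N₁ depends on the tolerance, and letters ≥ 3 count as few when
-- there are at most n/N₁² of them; the words with more of them are handled with a far larger N₂
-- depending on N₁.

-- Arithmetic of nonnegative rationals

-- Nonnegative rationals, for which multiplication is monotone without side
-- conditions; equality is the setoid one induced by the order.
record ℚ₊ : Set where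
  constructor mkℚ₊
  field
    num   : ℕ
    den   : ℕ
    den≢0 : NonZero den

open ℚ₊

infix  4 _≼_ _≈_
infixl 6 _⊕_
infixl 7 _⊗_
infixr 8 _^^_

opaque
  _≼_ : ℚ₊ → ℚ₊ → Set
  a ≼ b = num a * den b ≤ num b * den a

  _⊕_ : ℚ₊ → ℚ₊ → ℚ₊
  a ⊕ b = mkℚ₊ (num a * den b + num b * den a) (den a * den b) (m*n≢0 (den a) (den b) {{den≢0 a}} {{den≢0 b}})

  _⊗_ : ℚ₊ → ℚ₊ → ℚ₊
  a ⊗ b = mkℚ₊ (num a * num b) (den a * den b) (m*n≢0 (den a) (den b) {{den≢0 a}} {{den≢0 b}})

  -- n / (1 + d)
  frac : ℕ → ℕ → ℚ₊
  frac n d = mkℚ₊ n (suc d) _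

ι : ℕ → ℚ₊
ι n = frac n 0

𝟘 𝟙 : ℚ₊
𝟘 = ι 0
𝟙 = ι 1

_≈_ : ℚ₊ → ℚ₊ → Set
a ≈ b = (a ≼ b) × (b ≼ a)

_^^_ : ℚ₊ → ℕ → ℚ₊
a ^^ zero  = 𝟙
a ^^ suc n = a ⊗ a ^^ n

private
  module ℚ₊-lemmas where
    open +-*-Solver
    open ≤-Reasoning

    trans-lemma : ∀ x y z A B C .{{_ : NonZero B}} → x * B ≤ y * A → y * C ≤ z * B → x * C ≤ z * A
    trans-lemma x y z A B C p q = *-cancelʳ-≤ (x * C) (z * A) B (begin
      x * C * B  ≡⟨ e x C B ⟩
      x * B * C  ≤⟨ *-monoˡ-≤ C p ⟩
      y * A * C  ≡⟨ e y A C ⟩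
      y * C * A  ≤⟨ *-monoˡ-≤ A q ⟩
      z * B * A  ≡⟨ e z B A ⟩
      z * A * B  ∎)
      where
      e : ∀ x y z → x * y * z ≡ x * z * y
      e = solve 3 (λ x y z → x :* y :* z := x :* z :* y) refl

    ⊕-mono-lemma : ∀ x y z w A B C D → x * B ≤ z * A → y * D ≤ w * C →
      (x * C + y * A) * (B * D) ≤ (z * D + w * B) * (A * C)
    ⊕-mono-lemma x y z w A B C D p q = begin
      (x * C + y * A) * (B * D)          ≡⟨ e x y A B C D ⟩
      x * B * (C * D) + y * D * (A * B)  ≤⟨ +-mono-≤ (*-monoˡ-≤ (C * D) p) (*-monoˡ-≤ (A * B) q) ⟩
      z * A * (C * D) + w * C * (A * B)  ≡⟨ e′ z w A B C D ⟩
      (z * D + w * B) * (A * C)          ∎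
      where
      e : ∀ x y A B C D → (x * C + y * A) * (B * D) ≡ x * B * (C * D) + y * D * (A * B)
      e = solve 6 (λ x y A B C D → (x :* C :+ y :* A) :* (B :* D) := x :* B :* (C :* D) :+ y :* D :* (A :* B)) refl
      e′ : ∀ x y A B C D → x * A * (C * D) + y * C * (A * B) ≡ (x * D + y * B) * (A * C)
      e′ = solve 6 (λ x y A B C D → x :* A :* (C :* D) :+ y :* C :* (A :* B) := (x :* D :+ y :* B) :* (A :* C)) refl

    ⊗-mono-lemma : ∀ x y z w A B C D → x * B ≤ z * A → y * D ≤ w * C → x * y * (B * D) ≤ z * w * (A * C)
    ⊗-mono-lemma x y z w A B C D p q = begin
      x * y * (B * D)    ≡⟨ e x y B D ⟩
      (x * B) * (y * D)  ≤⟨ *-mono-≤ p q ⟩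
      (z * A) * (w * C)  ≡⟨ e z w A C ⟨
      z * w * (A * C)    ∎
      where
      e : ∀ x y B D → x * y * (B * D) ≡ (x * B) * (y * D)
      e = solve 4 (λ x y B D → x :* y :* (B :* D) := (x :* B) :* (y :* D)) refl

    ⊕-assoc-lemma : ∀ x y z A B C → ((x * B + y * A) * C + z * (A * B)) * (A * (B * C))
      ≡ (x * (B * C) + (y * C + z * B) * A) * (A * B * C)
    ⊕-assoc-lemma = solve 6 (λ x y z A B C → ((x :* B :+ y :* A) :* C :+ z :* (A :* B)) :* (A :* (B :* C))
      := (x :* (B :* C) :+ (y :* C :+ z :* B) :* A) :* (A :* B :* C)) refl

    ⊕-comm-lemma : ∀ x y A B → (x * B + y * A) * (B * A) ≡ (y * A + x * B) * (A * B)
    ⊕-comm-lemma = solve 4 (λ x y A B → (x :* B :+ y :* A) :* (B :* A) := (y :* A :+ x :* B) :* (A :* B)) refl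

    ⊕-identity-lemma : ∀ x A → (0 * A + x * 1) * A ≡ x * (1 * A)
    ⊕-identity-lemma = solve 2 (λ x A → (con 0 :* A :+ x :* con 1) :* A := x :* (con 1 :* A)) refl

    ⊗-assoc-lemma : ∀ x y z A B C → (x * y * z) * (A * (B * C)) ≡ (x * (y * z)) * (A * B * C)
    ⊗-assoc-lemma = solve 6 (λ x y z A B C → (x :* y :* z) :* (A :* (B :* C)) := (x :* (y :* z)) :* (A :* B :* C)) refl

    ⊗-comm-lemma : ∀ x y A B → (x * y) * (B * A) ≡ (y * x) * (A * B)
    ⊗-comm-lemma = solve 4 (λ x y A B → (x :* y) :* (B :* A) := (y :* x) :* (A :* B)) refl

    ⊗-identity-lemma : ∀ x A → (1 * x) * A ≡ x * (1 * A)
    ⊗-identity-lemma = solve 2 (λ x A → (con 1 :* x) :* A := x :* (con 1 :* A)) refl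

    ⊗-distrib-lemma : ∀ x y z A B C → ((y * C + z * B) * x) * ((B * A) * (C * A))
      ≡ ((y * x) * (C * A) + (z * x) * (B * A)) * ((B * C) * A)
    ⊗-distrib-lemma = solve 6 (λ x y z A B C → ((y :* C :+ z :* B) :* x) :* ((B :* A) :* (C :* A))
      := ((y :* x) :* (C :* A) :+ (z :* x) :* (B :* A)) :* ((B :* C) :* A)) refl

open ℚ₊-lemmas

opaque
  unfolding _≼_ _⊕_ _⊗_ frac

  frac-≼ : ∀ {a b c d} → a * suc d ≤ c * suc b → frac a b ≼ frac c d
  frac-≼ p = p

  frac-≼⁻ : ∀ {a b c d} → frac a b ≼ frac c d → a * suc d ≤ c * suc b
  frac-≼⁻ p = p

  ≼-refl : ∀ {a} → a ≼ a
  ≼-refl = ≤-refl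

  ≼-trans : ∀ {a b c} → a ≼ b → b ≼ c → a ≼ c
  ≼-trans {a} {b} {c} = trans-lemma (num a) (num b) (num c) (den a) (den b) (den c) {{den≢0 b}}

  ⊕-mono : ∀ {a b c d} → a ≼ b → c ≼ d → a ⊕ c ≼ b ⊕ d
  ⊕-mono {a} {b} {c} {d} = ⊕-mono-lemma (num a) (num c) (num b) (num d) (den a) (den b) (den c) (den d)

  ⊗-mono : ∀ {a b c d} → a ≼ b → c ≼ d → a ⊗ c ≼ b ⊗ d
  ⊗-mono {a} {b} {c} {d} = ⊗-mono-lemma (num a) (num c) (num b) (num d) (den a) (den b) (den c) (den d)

  private
    cross : ∀ a b → num a * den b ≡ num b * den a → a ≈ b
    cross a b p = ≤-reflexive p , ≤-reflexive (sym p)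

  ⊕-assoc : ∀ a b c → (a ⊕ b) ⊕ c ≈ a ⊕ (b ⊕ c)
  ⊕-assoc a b c = cross ((a ⊕ b) ⊕ c) (a ⊕ (b ⊕ c)) (⊕-assoc-lemma (num a) (num b) (num c) (den a) (den b) (den c))

  ⊕-comm : ∀ a b → a ⊕ b ≈ b ⊕ a
  ⊕-comm a b = cross (a ⊕ b) (b ⊕ a) (⊕-comm-lemma (num a) (num b) (den a) (den b))

  ⊕-identityˡ : ∀ a → 𝟘 ⊕ a ≈ a
  ⊕-identityˡ a = cross (𝟘 ⊕ a) a (⊕-identity-lemma (num a) (den a))

  ⊗-assoc : ∀ a b c → (a ⊗ b) ⊗ c ≈ a ⊗ (b ⊗ c)
  ⊗-assoc a b c = cross ((a ⊗ b) ⊗ c) (a ⊗ (b ⊗ c)) (⊗-assoc-lemma (num a) (num b) (num c) (den a) (den b) (den c))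

  ⊗-comm : ∀ a b → a ⊗ b ≈ b ⊗ a
  ⊗-comm a b = cross (a ⊗ b) (b ⊗ a) (⊗-comm-lemma (num a) (num b) (den a) (den b))

  ⊗-identityˡ : ∀ a → 𝟙 ⊗ a ≈ a
  ⊗-identityˡ a = cross (𝟙 ⊗ a) a (⊗-identity-lemma (num a) (den a))

  ⊗-distribʳ-⊕ : ∀ a b c → (b ⊕ c) ⊗ a ≈ (b ⊗ a) ⊕ (c ⊗ a)
  ⊗-distribʳ-⊕ a b c = cross ((b ⊕ c) ⊗ a) ((b ⊗ a) ⊕ (c ⊗ a))
    (⊗-distrib-lemma (num a) (num b) (num c) (den a) (den b) (den c))

  𝟘≼ : ∀ {a} → 𝟘 ≼ a
  𝟘≼ = z≤n

  ⊗-zeroˡ : ∀ a → 𝟘 ⊗ a ≈ 𝟘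
  ⊗-zeroˡ a = z≤n , z≤n

  archimedean : ∀ a → ∃[ m ] a ≼ ι m
  archimedean a = num a , *-monoʳ-≤ (num a) (>-nonZero⁻¹ (den a) {{den≢0 a}})

  frac-⊕ : ∀ a b c d → frac a b ⊕ frac c d ≈ frac (a * suc d + c * suc b) (d + b * suc d)
  frac-⊕ a b c d = ≤-refl , ≤-refl

  frac-⊗ : ∀ a b c d → frac a b ⊗ frac c d ≈ frac (a * c) (d + b * suc d)
  frac-⊗ a b c d = ≤-refl , ≤-refl

≈-refl : ∀ {a} → a ≈ a
≈-refl = ≼-refl , ≼-refl

≈-sym : ∀ {a b} → a ≈ b → b ≈ a
≈-sym (p , q) = q , p

≈-trans : ∀ {a b c} → a ≈ b → b ≈ c → a ≈ c
≈-trans (p , q) (r , s) = ≼-trans p r , ≼-trans s q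

≈-reflexive : ∀ {a b} → a ≡ b → a ≈ b
≈-reflexive refl = ≈-refl

≈⇒≼ : ∀ {a b} → a ≈ b → a ≼ b
≈⇒≼ = proj₁

⊕-cong : ∀ {a b c d} → a ≈ b → c ≈ d → a ⊕ c ≈ b ⊕ d
⊕-cong (p , q) (r , s) = ⊕-mono p r , ⊕-mono q s

⊗-cong : ∀ {a b c d} → a ≈ b → c ≈ d → a ⊗ c ≈ b ⊗ d
⊗-cong (p , q) (r , s) = ⊗-mono p r , ⊗-mono q s

≈-isEquivalence : IsEquivalence _≈_
≈-isEquivalence = record { refl = ≈-refl ; sym = ≈-sym ; trans = ≈-trans }

⊗-identityʳ : ∀ a → a ⊗ 𝟙 ≈ a
⊗-identityʳ a = ≈-trans (⊗-comm a 𝟙) (⊗-identityˡ a)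

⊕-identityʳ : ∀ a → a ⊕ 𝟘 ≈ a
⊕-identityʳ a = ≈-trans (⊕-comm a 𝟘) (⊕-identityˡ a)

⊗-zeroʳ : ∀ a → a ⊗ 𝟘 ≈ 𝟘
⊗-zeroʳ a = ≈-trans (⊗-comm a 𝟘) (⊗-zeroˡ a)

⊗-distribˡ-⊕ : ∀ a b c → a ⊗ (b ⊕ c) ≈ (a ⊗ b) ⊕ (a ⊗ c)
⊗-distribˡ-⊕ a b c = ≈-trans (⊗-comm a (b ⊕ c))
  (≈-trans (⊗-distribʳ-⊕ a b c) (⊕-cong (⊗-comm b a) (⊗-comm c a)))

ℚ₊-commutativeSemiring : CommutativeSemiring 0ℓ 0ℓ
ℚ₊-commutativeSemiring = record
  { Carrier = ℚ₊ ; _≈_ = _≈_ ; _+_ = _⊕_ ; _*_ = _⊗_ ; 0# = 𝟘 ; 1# = 𝟙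
  ; isCommutativeSemiring = record
    { isSemiring = record
      { isSemiringWithoutAnnihilatingZero = record
        { +-isCommutativeMonoid = record
          { isMonoid = record
            { isSemigroup = record
              { isMagma = record { isEquivalence = ≈-isEquivalence ; ∙-cong = ⊕-cong }
              ; assoc = ⊕-assoc }
            ; identity = ⊕-identityˡ , ⊕-identityʳ }
          ; comm = ⊕-comm }
        ; *-cong = ⊗-cong
        ; *-assoc = ⊗-assoc
        ; *-identity = ⊗-identityˡ , ⊗-identityʳ
        ; distrib = ⊗-distribˡ-⊕ , ⊗-distribʳ-⊕ }
      ; zero = ⊗-zeroˡ , ⊗-zeroʳ }
    ; *-comm = ⊗-comm } }

≼-poset : Poset 0ℓ 0ℓ 0ℓ
≼-poset = record
  { Carrier = ℚ₊ ; _≈_ = _≈_ ; _≤_ = _≼_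
  ; isPartialOrder = record
    { isPreorder = record
      { isEquivalence = ≈-isEquivalence ; reflexive = ≈⇒≼ ; trans = ≼-trans }
    ; antisym = λ p q → p , q } }

import Relation.Binary.Reasoning.PartialOrder as PO
module ≼-Reasoning = PO ≼-poset

import Algebra.Solver.Ring.NaturalCoefficients.Default as NatCoeffSolver
module ℚ₊-Solver = NatCoeffSolver ℚ₊-commutativeSemiring

⊕-monoˡ : ∀ {a b} c → a ≼ b → a ⊕ c ≼ b ⊕ c
⊕-monoˡ c p = ⊕-mono p ≼-refl

⊕-monoʳ : ∀ {a b} c → a ≼ b → c ⊕ a ≼ c ⊕ b
⊕-monoʳ c p = ⊕-mono ≼-refl p

⊗-monoˡ : ∀ {a b} c → a ≼ b → a ⊗ c ≼ b ⊗ c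
⊗-monoˡ c p = ⊗-mono p ≼-refl

⊗-monoʳ : ∀ {a b} c → a ≼ b → c ⊗ a ≼ c ⊗ b
⊗-monoʳ c p = ⊗-mono ≼-refl p

≼-⊕ˡ : ∀ a b → a ≼ a ⊕ b
≼-⊕ˡ a b = ≼-trans (proj₂ (⊕-identityʳ a)) (⊕-monoʳ a 𝟘≼)

≼-⊕ʳ : ∀ a b → b ≼ a ⊕ b
≼-⊕ʳ a b = ≼-trans (proj₂ (⊕-identityˡ b)) (⊕-monoˡ b 𝟘≼)

ι-mono : ∀ {a b} → a ≤ b → ι a ≼ ι b
ι-mono p = frac-≼ (*-monoˡ-≤ 1 p)

ι-reflect : ∀ {a b} → ι a ≼ ι b → a ≤ b
ι-reflect {a} {b} p = subst₂ _≤_ (*-identityʳ a) (*-identityʳ b) (frac-≼⁻ p)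

frac-≈ : ∀ {a b c d} → a * suc d ≡ c * suc b → frac a b ≈ frac c d
frac-≈ p = frac-≼ (≤-reflexive p) , frac-≼ (≤-reflexive (sym p))

ι-⊕ : ∀ a b → ι (a + b) ≈ ι a ⊕ ι b
ι-⊕ a b = ≈-sym (≈-trans (frac-⊕ a 0 b 0) (≈-reflexive (cong ι (cong₂ _+_ (*-identityʳ a) (*-identityʳ b)))))

ι-⊗ : ∀ a b → ι (a * b) ≈ ι a ⊗ ι b
ι-⊗ a b = ≈-sym (frac-⊗ a 0 b 0)

frac-ι : ∀ a d → ι (suc d) ⊗ frac a d ≈ ι a
frac-ι a d = ≈-trans (frac-⊗ (suc d) 0 a d) (frac-≈ (e a (suc d)))
  where
  e : ∀ a d → d * a * 1 ≡ a * (d + 0 * d)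
  e = +-*-Solver.solve 2 (λ a d → d :* a :* con 1 := a :* (d :+ con 0 :* d)) refl
    where open +-*-Solver

^^-mono : ∀ {a b} n → a ≼ b → a ^^ n ≼ b ^^ n
^^-mono zero    p = ≼-refl
^^-mono (suc n) p = ⊗-mono p (^^-mono n p)

^^-cong : ∀ {a b} n → a ≈ b → a ^^ n ≈ b ^^ n
^^-cong n (p , q) = ^^-mono n p , ^^-mono n q

^^-+ : ∀ a m n → a ^^ (m + n) ≈ a ^^ m ⊗ a ^^ n
^^-+ a zero    n = ≈-sym (⊗-identityˡ _)
^^-+ a (suc m) n = ≈-trans (⊗-cong ≈-refl (^^-+ a m n)) (≈-sym (⊗-assoc _ _ _))

interchange : ∀ a b c d → (a ⊗ b) ⊗ (c ⊗ d) ≈ (a ⊗ c) ⊗ (b ⊗ d)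
interchange = solve 4 (λ a b c d → (a :* b) :* (c :* d) := (a :* c) :* (b :* d)) ≈-refl
  where open ℚ₊-Solver

⊕-interchange : ∀ a b c d → (a ⊕ b) ⊕ (c ⊕ d) ≈ (a ⊕ c) ⊕ (b ⊕ d)
⊕-interchange = solve 4 (λ a b c d → (a :+ b) :+ (c :+ d) := (a :+ c) :+ (b :+ d)) ≈-refl
  where open ℚ₊-Solver

^^-⊗ : ∀ a b n → (a ⊗ b) ^^ n ≈ a ^^ n ⊗ b ^^ n
^^-⊗ a b zero    = ≈-sym (⊗-identityˡ _)
^^-⊗ a b (suc n) = ≈-trans (⊗-cong ≈-refl (^^-⊗ a b n)) (interchange a b (a ^^ n) (b ^^ n))

𝟙^^ : ∀ n → 𝟙 ^^ n ≈ 𝟙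
𝟙^^ zero    = ≈-refl
𝟙^^ (suc n) = ≈-trans (⊗-identityˡ _) (𝟙^^ n)

^^-* : ∀ a m n → a ^^ (m * n) ≈ (a ^^ m) ^^ n
^^-* a m zero    = ≈-reflexive (cong (a ^^_) (*-zeroʳ m))
^^-* a m (suc n) = ≈-trans (≈-reflexive (cong (a ^^_) (*-suc m n)))
  (≈-trans (^^-+ a m (m * n)) (⊗-cong ≈-refl (^^-* a m n)))

𝟙≼^^ : ∀ {a} n → 𝟙 ≼ a → 𝟙 ≼ a ^^ n
𝟙≼^^ n p = ≼-trans (proj₂ (𝟙^^ n)) (^^-mono n p)

^^≼𝟙 : ∀ {a} n → a ≼ 𝟙 → a ^^ n ≼ 𝟙
^^≼𝟙 n p = ≼-trans (^^-mono n p) (proj₁ (𝟙^^ n))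

^^-monoʳ : ∀ {a m n} → 𝟙 ≼ a → m ≤ n → a ^^ m ≼ a ^^ n
^^-monoʳ {a} {m} {n} p m≤n = begin
  a ^^ m                   ≈⟨ ⊗-identityʳ _ ⟨
  a ^^ m ⊗ 𝟙               ≤⟨ ⊗-monoʳ _ (𝟙≼^^ (n ∸ m) p) ⟩
  a ^^ m ⊗ a ^^ (n ∸ m)    ≈⟨ ^^-+ a m (n ∸ m) ⟨
  a ^^ (m + (n ∸ m))       ≡⟨ cong (a ^^_) (m+[n∸m]≡n m≤n) ⟩
  a ^^ n                   ∎
  where open ≼-Reasoning

^^-antiʳ : ∀ {a m n} → a ≼ 𝟙 → m ≤ n → a ^^ n ≼ a ^^ m
^^-antiʳ {a} {m} {n} p m≤n = begin
  a ^^ n                   ≡⟨ cong (a ^^_) (m+[n∸m]≡n m≤n) ⟨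
  a ^^ (m + (n ∸ m))       ≈⟨ ^^-+ a m (n ∸ m) ⟩
  a ^^ m ⊗ a ^^ (n ∸ m)    ≤⟨ ⊗-monoʳ _ (^^≼𝟙 (n ∸ m) p) ⟩
  a ^^ m ⊗ 𝟙               ≈⟨ ⊗-identityʳ _ ⟩
  a ^^ m                   ∎
  where open ≼-Reasoning

-- The argument is N - 1.
1+1/ : ℕ → ℚ₊
1+1/ N-1 = frac (suc (suc N-1)) N-1

𝟙≼1+1/ : ∀ N → 𝟙 ≼ 1+1/ N
𝟙≼1+1/ N = frac-≼ (≤-trans (≤-reflexive (*-identityˡ (suc N))) (≤-trans (n≤1+n (suc N)) (≤-reflexive (sym (*-identityʳ _)))))

bernoulli : ∀ a n → 𝟙 ⊕ ι n ⊗ a ≼ (𝟙 ⊕ a) ^^ n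
bernoulli a zero    = ≈⇒≼ (≈-trans (⊕-cong ≈-refl (⊗-zeroˡ a)) (⊕-identityʳ 𝟙))
bernoulli a (suc n) = begin
  𝟙 ⊕ ι (suc n) ⊗ a                        ≈⟨ ⊕-cong ≈-refl (⊗-cong (ι-⊕ 1 n) ≈-refl) ⟩
  𝟙 ⊕ (𝟙 ⊕ ι n) ⊗ a                        ≤⟨ ≼-⊕ˡ _ (ι n ⊗ a ⊗ a) ⟩
  (𝟙 ⊕ (𝟙 ⊕ ι n) ⊗ a) ⊕ ι n ⊗ a ⊗ a        ≈⟨ e a (ι n) ⟩
  (𝟙 ⊕ a) ⊗ (𝟙 ⊕ ι n ⊗ a)                  ≤⟨ ⊗-monoʳ _ (bernoulli a n) ⟩
  (𝟙 ⊕ a) ⊗ (𝟙 ⊕ a) ^^ n                   ∎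
  where
  open ≼-Reasoning
  open ℚ₊-Solver using (solve; _:=_; _:+_; _:*_; con)
  e : ∀ a m → (𝟙 ⊕ (𝟙 ⊕ m) ⊗ a) ⊕ m ⊗ a ⊗ a ≈ (𝟙 ⊕ a) ⊗ (𝟙 ⊕ m ⊗ a)
  e = solve 2 (λ a m → (con 1 :+ (con 1 :+ m) :* a) :+ m :* a :* a := (con 1 :+ a) :* (con 1 :+ m :* a)) ≈-refl

-- Finite sums and products, and the weights of words

sumL : {A : Set} → List A → (A → ℚ₊) → ℚ₊
sumL []       f = 𝟘
sumL (x ∷ xs) f = f x ⊕ sumL xs f

sumL-mono : {A : Set} (xs : List A) {f g : A → ℚ₊} → (∀ x → f x ≼ g x) → sumL xs f ≼ sumL xs g
sumL-mono []       p = ≼-refl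
sumL-mono (x ∷ xs) p = ⊕-mono (p x) (sumL-mono xs p)

sumL-mono-∈ : {A : Set} (xs : List A) {f g : A → ℚ₊} → (∀ x → x ∈ xs → f x ≼ g x) → sumL xs f ≼ sumL xs g
sumL-mono-∈ []       p = ≼-refl
sumL-mono-∈ (x ∷ xs) p = ⊕-mono (p x (here refl)) (sumL-mono-∈ xs (λ y y∈ → p y (there y∈)))

sumL-cong : {A : Set} (xs : List A) {f g : A → ℚ₊} → (∀ x → f x ≈ g x) → sumL xs f ≈ sumL xs g
sumL-cong xs p = sumL-mono xs (λ x → proj₁ (p x)) , sumL-mono xs (λ x → proj₂ (p x))

sumL-𝟘 : {A : Set} (xs : List A) → sumL xs (λ _ → 𝟘) ≈ 𝟘
sumL-𝟘 []       = ≈-refl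
sumL-𝟘 (x ∷ xs) = ≈-trans (⊕-identityˡ _) (sumL-𝟘 xs)

sumL-⊕ : {A : Set} (xs : List A) (f g : A → ℚ₊) → sumL xs (λ x → f x ⊕ g x) ≈ sumL xs f ⊕ sumL xs g
sumL-⊕ []       f g = ≈-sym (⊕-identityˡ 𝟘)
sumL-⊕ (x ∷ xs) f g = ≈-trans (⊕-cong ≈-refl (sumL-⊕ xs f g)) (⊕-interchange (f x) (g x) _ _)

sumL-⊗ˡ : {A : Set} (xs : List A) (c : ℚ₊) (f : A → ℚ₊) → sumL xs (λ x → c ⊗ f x) ≈ c ⊗ sumL xs f
sumL-⊗ˡ []       c f = ≈-sym (⊗-zeroʳ c)
sumL-⊗ˡ (x ∷ xs) c f = ≈-trans (⊕-cong ≈-refl (sumL-⊗ˡ xs c f)) (≈-sym (⊗-distribˡ-⊕ c (f x) _))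

sumL-⊗ʳ : {A : Set} (xs : List A) (c : ℚ₊) (f : A → ℚ₊) → sumL xs (λ x → f x ⊗ c) ≈ sumL xs f ⊗ c
sumL-⊗ʳ xs c f = ≈-trans (sumL-cong xs (λ x → ⊗-comm (f x) c)) (≈-trans (sumL-⊗ˡ xs c f) (⊗-comm c _))

sumL-swap : {A B : Set} (xs : List A) (ys : List B) (f : A → B → ℚ₊) →
  sumL xs (λ x → sumL ys (f x)) ≈ sumL ys (λ y → sumL xs (λ x → f x y))
sumL-swap []       ys f = ≈-sym (sumL-𝟘 ys)
sumL-swap (x ∷ xs) ys f = ≈-trans (⊕-cong ≈-refl (sumL-swap xs ys f)) (≈-sym (sumL-⊕ ys (f x) _))

sumL-++ : {A : Set} (xs ys : List A) (f : A → ℚ₊) → sumL (xs ++ ys) f ≈ sumL xs f ⊕ sumL ys f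
sumL-++ []       ys f = ≈-sym (⊕-identityˡ _)
sumL-++ (x ∷ xs) ys f = ≈-trans (⊕-cong ≈-refl (sumL-++ xs ys f)) (≈-sym (⊕-assoc (f x) _ _))

sumL-map : {A B : Set} (h : A → B) (xs : List A) (f : B → ℚ₊) → sumL (map h xs) f ≡ sumL xs (f ∘ h)
sumL-map h []       f = refl
sumL-map h (x ∷ xs) f = cong (f (h x) ⊕_) (sumL-map h xs f)

sumL-cartesianProductWith : {A B C : Set} (h : A → B → C) (xs : List A) (ys : List B) (f : C → ℚ₊) →
  sumL (cartesianProductWith h xs ys) f ≈ sumL xs (λ x → sumL ys (λ y → f (h x y)))
sumL-cartesianProductWith h []       ys f = ≈-refl
sumL-cartesianProductWith h (x ∷ xs) ys f =
  ≈-trans (sumL-++ (map (h x) ys) _ f)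
    (⊕-cong (≈-reflexive (sumL-map (h x) ys f)) (sumL-cartesianProductWith h xs ys f))

∈⇒≼sumL : {A : Set} (xs : List A) (f : A → ℚ₊) {x : A} → x ∈ xs → f x ≼ sumL xs f
∈⇒≼sumL (x ∷ xs) f (here refl) = ≼-⊕ˡ _ _
∈⇒≼sumL (x ∷ xs) f (there p)   = ≼-trans (∈⇒≼sumL xs f p) (≼-⊕ʳ _ _)

sumL-const : {A : Set} (xs : List A) (c : ℚ₊) → sumL xs (λ _ → c) ≈ ι (length xs) ⊗ c
sumL-const []       c = ≈-sym (⊗-zeroˡ c)
sumL-const (x ∷ xs) c = ≈-trans (⊕-cong (≈-sym (⊗-identityˡ c)) (sumL-const xs c))
  (≈-trans (≈-sym (⊗-distribʳ-⊕ c 𝟙 (ι (length xs)))) (⊗-cong (≈-sym (ι-⊕ 1 (length xs))) ≈-refl))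

sumL-bound : {A : Set} (xs : List A) {f : A → ℚ₊} {c : ℚ₊} → (∀ x → f x ≼ c) → sumL xs f ≼ ι (length xs) ⊗ c
sumL-bound xs p = ≼-trans (sumL-mono xs p) (proj₁ (sumL-const xs _))

sumL-applyUpTo : (h : ℕ → ℕ) (n : ℕ) (f : ℕ → ℚ₊) → sumL (applyUpTo h n) f ≡ sumL (upTo n) (f ∘ h)
sumL-applyUpTo h zero    f = refl
sumL-applyUpTo h (suc n) f = cong (f (h 0) ⊕_)
  (trans (sumL-applyUpTo (h ∘ suc) n f) (sym (sumL-applyUpTo suc n (f ∘ h))))

sumL-upTo-suc : (n : ℕ) (f : ℕ → ℚ₊) → sumL (upTo (suc n)) f ≡ f 0 ⊕ sumL (upTo n) (f ∘ suc)
sumL-upTo-suc n f = cong (f 0 ⊕_) (sumL-applyUpTo suc n f)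

-- Peels off index 0, as `Vec` does, whereas `countUpTo` and `sumTo` peel off the last index;
-- `countUpTo-suc` and `sumTo-suc` bridge the two.
prodTo : ℕ → (ℕ → ℚ₊) → ℚ₊
prodTo zero    f = 𝟙
prodTo (suc n) f = f 0 ⊗ prodTo n (f ∘ suc)

prodTo-mono : ∀ n {f g : ℕ → ℚ₊} → (∀ i → i < n → f i ≼ g i) → prodTo n f ≼ prodTo n g
prodTo-mono zero    p = ≼-refl
prodTo-mono (suc n) p = ⊗-mono (p 0 z<s) (prodTo-mono n (λ i i<n → p (suc i) (s<s i<n)))

prodTo-cong : ∀ n {f g : ℕ → ℚ₊} → (∀ i → i < n → f i ≈ g i) → prodTo n f ≈ prodTo n g
prodTo-cong n p = prodTo-mono n (λ i i<n → proj₁ (p i i<n)) , prodTo-mono n (λ i i<n → proj₂ (p i i<n))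

prodTo-⊗ : ∀ n (f g : ℕ → ℚ₊) → prodTo n (λ i → f i ⊗ g i) ≈ prodTo n f ⊗ prodTo n g
prodTo-⊗ zero    f g = ≈-sym (⊗-identityˡ 𝟙)
prodTo-⊗ (suc n) f g = ≈-trans (⊗-cong ≈-refl (prodTo-⊗ n (f ∘ suc) (g ∘ suc))) (interchange (f 0) (g 0) _ _)

prodTo-const : ∀ n c → prodTo n (λ _ → c) ≈ c ^^ n
prodTo-const zero    c = ≈-refl
prodTo-const (suc n) c = ⊗-cong ≈-refl (prodTo-const n c)

prodTo-+ : ∀ m n (f : ℕ → ℚ₊) → prodTo (m + n) f ≈ prodTo m f ⊗ prodTo n (λ i → f (m + i))
prodTo-+ zero    n f = ≈-sym (⊗-identityˡ _)
prodTo-+ (suc m) n f = ≈-trans (⊗-cong ≈-refl (prodTo-+ m n (f ∘ suc))) (≈-sym (⊗-assoc (f 0) _ _))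

bit : Bool → ℕ
bit b = if b then 1 else 0

countUpTo-suc : ∀ n f → countUpTo (suc n) f ≡ bit (f 0) + countUpTo n (f ∘ suc)
countUpTo-suc zero    f = +-comm 0 (bit (f 0))
countUpTo-suc (suc n) f = trans (cong (_+ bit (f (suc n))) (countUpTo-suc n f)) (+-assoc (bit (f 0)) _ _)

infix 9 _^ᵇ_
_^ᵇ_ : ℚ₊ → Bool → ℚ₊
c ^ᵇ b = if b then c else 𝟙

prodTo-^ᵇ : ∀ n c (f : ℕ → Bool) → prodTo n (λ i → c ^ᵇ f i) ≈ c ^^ countUpTo n f
prodTo-^ᵇ zero    c f = ≈-refl
prodTo-^ᵇ (suc n) c f = ≈-trans (⊗-cong ≈-refl (prodTo-^ᵇ n c (f ∘ suc)))
  (≈-trans (head (f 0)) (≈-reflexive (cong (c ^^_) (sym (countUpTo-suc n f)))))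
  where
  head : ∀ b → c ^ᵇ b ⊗ c ^^ countUpTo n (f ∘ suc) ≈ c ^^ (bit b + countUpTo n (f ∘ suc))
  head true  = ≈-refl
  head false = ⊗-identityˡ _

sumTo : ℕ → (ℕ → ℕ) → ℕ
sumTo zero    f = 0
sumTo (suc n) f = sumTo n f + f n

sumTo-suc : ∀ n f → sumTo (suc n) f ≡ f 0 + sumTo n (f ∘ suc)
sumTo-suc zero    f = +-comm 0 (f 0)
sumTo-suc (suc n) f = trans (cong (_+ f (suc n)) (sumTo-suc n f)) (+-assoc (f 0) _ _)

prodTo-^^ : ∀ n c (f : ℕ → ℕ) → prodTo n (λ i → c ^^ f i) ≈ c ^^ sumTo n f
prodTo-^^ zero    c f = ≈-refl
prodTo-^^ (suc n) c f = ≈-trans (⊗-cong ≈-refl (prodTo-^^ n c (f ∘ suc)))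
  (≈-trans (≈-sym (^^-+ c (f 0) _)) (≈-reflexive (cong (c ^^_) (sym (sumTo-suc n f)))))

-- Entries outside the vector read as d.
at : {A : Set} {n : ℕ} → A → Vec A n → ℕ → A
at d []      i       = d
at d (a ∷ v) zero    = a
at d (a ∷ v) (suc i) = at d v i

vecs : {A : Set} → List A → (n : ℕ) → List (Vec A n)
vecs xs zero    = [] ∷ []
vecs xs (suc n) = cartesianProductWith _∷_ xs (vecs xs n)

∈-vecs : {A : Set} (d : A) (xs : List A) {n : ℕ} (v : Vec A n) → (∀ i → i < n → at d v i ∈ xs) → v ∈ vecs xs n
∈-vecs d xs []      p = here refl
∈-vecs d xs (a ∷ v) p = ∈-cartesianProductWith⁺ _∷_ (p 0 z<s) (∈-vecs d xs v (λ i i<n → p (suc i) (s<s i<n)))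

-- Distributivity. Positionwise conditions on a word make its weight a product, so a whole class of
-- words is summed by estimating one row per position. Every upper bound on a class of bad words
-- passes through this.
sum-of-products : {A : Set} (d : A) (xs : List A) (n : ℕ) (W : ℕ → A → ℚ₊) →
  sumL (vecs xs n) (λ v → prodTo n (λ i → W i (at d v i))) ≈ prodTo n (λ i → sumL xs (W i))
sum-of-products d xs zero    W = ⊕-identityʳ 𝟙
sum-of-products d xs (suc n) W = begin-equality
  sumL (cartesianProductWith _∷_ xs (vecs xs n)) _
    ≈⟨ sumL-cartesianProductWith _∷_ xs (vecs xs n) _ ⟩
  sumL xs (λ a → sumL (vecs xs n) (λ v → W 0 a ⊗ prodTo n (λ i → W (suc i) (at d v i))))
    ≈⟨ sumL-cong xs (λ a → sumL-⊗ˡ (vecs xs n) (W 0 a) _) ⟩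
  sumL xs (λ a → W 0 a ⊗ sumL (vecs xs n) (λ v → prodTo n (λ i → W (suc i) (at d v i))))
    ≈⟨ sumL-⊗ʳ xs _ (W 0) ⟩
  sumL xs (W 0) ⊗ sumL (vecs xs n) (λ v → prodTo n (λ i → W (suc i) (at d v i)))
    ≈⟨ ⊗-cong ≈-refl (sum-of-products d xs n (W ∘ suc)) ⟩
  sumL xs (W 0) ⊗ prodTo n (λ i → sumL xs (W (suc i)))
    ∎
  where open ≼-Reasoning

-- The hypothesis says `G ≥ 1/(1 - x)` without a subtraction or a division.
geometric : ∀ A {x G : ℚ₊} → 𝟙 ⊕ x ⊗ G ≼ G → sumL (upTo A) (λ a → x ^^ a) ≼ G
geometric zero    p = 𝟘≼
geometric (suc A) {x} {G} p = begin
  sumL (upTo (suc A)) (x ^^_)                   ≡⟨ sumL-upTo-suc A (x ^^_) ⟩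
  𝟙 ⊕ sumL (upTo A) (λ a → x ⊗ x ^^ a)          ≈⟨ ⊕-cong ≈-refl (sumL-⊗ˡ (upTo A) x (x ^^_)) ⟩
  𝟙 ⊕ x ⊗ sumL (upTo A) (x ^^_)                 ≤⟨ ⊕-monoʳ 𝟙 (⊗-monoʳ x (geometric A p)) ⟩
  𝟙 ⊕ x ⊗ G                                     ≤⟨ p ⟩
  G                                             ∎
  where open ≼-Reasoning

-- Boolean tests, bounded search and counting

≤ᵇ-true : ∀ {m n} → m ≤ n → (m ≤ᵇ n) ≡ true
≤ᵇ-true {m} {n} p with m ≤ᵇ n | ≤⇒≤ᵇ p
... | true | _ = refl

≤ᵇ-true⁻ : ∀ {m n} → (m ≤ᵇ n) ≡ true → m ≤ n
≤ᵇ-true⁻ {m} {n} p = ≤ᵇ⇒≤ m n (subst Holds (sym p) tt)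

≤ᵇ-false : ∀ {m n} → n < m → (m ≤ᵇ n) ≡ false
≤ᵇ-false {m} {n} p with m ≤ᵇ n in eq
... | false = refl
... | true  = ⊥-elim (<⇒≱ p (≤ᵇ-true⁻ eq))

≤ᵇ-false⁻ : ∀ {m n} → (m ≤ᵇ n) ≡ false → n < m
≤ᵇ-false⁻ {m} {n} p = ≰⇒> (λ m≤n → case trans (sym (≤ᵇ-true m≤n)) p of λ ())

<ᵇ-true : ∀ {m n} → m < n → (m <ᵇ n) ≡ true
<ᵇ-true {m} {n} p with m <ᵇ n | <⇒<ᵇ p
... | true | _ = refl

<ᵇ-true⁻ : ∀ {m n} → (m <ᵇ n) ≡ true → m < n
<ᵇ-true⁻ {m} {n} p = <ᵇ⇒< m n (subst Holds (sym p) tt)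

<ᵇ-false : ∀ {m n} → n ≤ m → (m <ᵇ n) ≡ false
<ᵇ-false {m} {n} p with m <ᵇ n in eq
... | false = refl
... | true  = ⊥-elim (<⇒≱ (<ᵇ-true⁻ eq) p)

≡ᵇ-true : ∀ {m n} → m ≡ n → (m ≡ᵇ n) ≡ true
≡ᵇ-true {m} {n} p with m ≡ᵇ n | ≡⇒≡ᵇ m n p
... | true | _ = refl

≡ᵇ-true⁻ : ∀ {m n} → (m ≡ᵇ n) ≡ true → m ≡ n
≡ᵇ-true⁻ {m} {n} p = ≡ᵇ⇒≡ m n (subst Holds (sym p) tt)

true≢false : true ≢ false
true≢false ()

¬true⇒false : ∀ {b} → b ≢ true → b ≡ false
¬true⇒false {true}  p = ⊥-elim (p refl)
¬true⇒false {false} p = refl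

not-true⁻ : ∀ {b} → not b ≡ true → b ≡ false
not-true⁻ {false} p = refl

∧-true : ∀ {a b} → a ≡ true → b ≡ true → a ∧ b ≡ true
∧-true refl refl = refl

∧-true⁻ : ∀ {a b} → a ∧ b ≡ true → a ≡ true × b ≡ true
∧-true⁻ {true} {true} p = refl , refl

∨-true⁻ : ∀ {a b} → a ∨ b ≡ true → a ≡ true ⊎ b ≡ true
∨-true⁻ {true}  p = inj₁ refl
∨-true⁻ {false} p = inj₂ p

∨-trueˡ : ∀ {a b} → a ≡ true → a ∨ b ≡ true
∨-trueˡ refl = refl

∨-trueʳ : ∀ {a b} → b ≡ true → a ∨ b ≡ true
∨-trueʳ {true}  p = refl
∨-trueʳ {false} p = p

split-< : ∀ {i n} → i < suc n → i < n ⊎ i ≡ n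
split-< (s≤s p) = m≤n⇒m<n∨m≡n p

allUpTo⁻ : ∀ n {f} → allUpTo n f ≡ true → ∀ i → i < n → f i ≡ true
allUpTo⁻ (suc n) {f} p i i<n with split-< i<n | ∧-true⁻ {allUpTo n f} p
... | inj₁ q    | a , b = allUpTo⁻ n a i q
... | inj₂ refl | a , b = b

allUpTo⁺ : ∀ n {f} → (∀ i → i < n → f i ≡ true) → allUpTo n f ≡ true
allUpTo⁺ zero    p = refl
allUpTo⁺ (suc n) p = ∧-true (allUpTo⁺ n (λ i i<n → p i (m<n⇒m<1+n i<n))) (p n ≤-refl)

anyUpTo⁻ : ∀ n {f} → anyUpTo n f ≡ true → ∃[ i ] (i < n × f i ≡ true)
anyUpTo⁻ (suc n) {f} p with ∨-true⁻ {anyUpTo n f} p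
... | inj₁ q = let i , i<n , r = anyUpTo⁻ n q in i , m<n⇒m<1+n i<n , r
... | inj₂ q = n , ≤-refl , q

anyUpTo⁺ : ∀ n {f} i → i < n → f i ≡ true → anyUpTo n f ≡ true
anyUpTo⁺ (suc n) {f} i i<n p with split-< i<n
... | inj₁ q    = ∨-trueˡ (anyUpTo⁺ n i q p)
... | inj₂ refl = ∨-trueʳ {anyUpTo n f} p

search : ∀ n (f : ℕ → Bool) → (∃[ i ] (i < n × f i ≡ true)) ⊎ (∀ i → i < n → f i ≡ false)
search n f with anyUpTo n f in eq
... | true  = inj₁ (anyUpTo⁻ n eq)
... | false = inj₂ (λ i i<n → ¬true⇒false (λ p → true≢false (trans (sym (anyUpTo⁺ n i i<n p)) eq)))

sumTo-mono : ∀ n {f g} → (∀ i → i < n → f i ≤ g i) → sumTo n f ≤ sumTo n g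
sumTo-mono zero    p = z≤n
sumTo-mono (suc n) p = +-mono-≤ (sumTo-mono n (λ i i<n → p i (m<n⇒m<1+n i<n))) (p n ≤-refl)

sumTo-cong : ∀ n {f g} → (∀ i → i < n → f i ≡ g i) → sumTo n f ≡ sumTo n g
sumTo-cong zero    p = refl
sumTo-cong (suc n) p = cong₂ _+_ (sumTo-cong n (λ i i<n → p i (m<n⇒m<1+n i<n))) (p n ≤-refl)

sumTo-0 : ∀ n → sumTo n (λ _ → 0) ≡ 0
sumTo-0 zero    = refl
sumTo-0 (suc n) = trans (+-identityʳ _) (sumTo-0 n)

+-interchange : ∀ a b c d → (a + b) + (c + d) ≡ (a + c) + (b + d)
+-interchange = solve 4 (λ a b c d → (a :+ b) :+ (c :+ d) := (a :+ c) :+ (b :+ d)) refl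
  where open +-*-Solver

sumTo-+ : ∀ n f g → sumTo n (λ i → f i + g i) ≡ sumTo n f + sumTo n g
sumTo-+ zero    f g = refl
sumTo-+ (suc n) f g = trans (cong (_+ (f n + g n)) (sumTo-+ n f g)) (+-interchange (sumTo n f) (sumTo n g) (f n) (g n))

sumTo-*ʳ : ∀ n f c → sumTo n (λ i → f i * c) ≡ sumTo n f * c
sumTo-*ʳ zero    f c = refl
sumTo-*ʳ (suc n) f c = trans (cong (_+ f n * c) (sumTo-*ʳ n f c)) (sym (*-distribʳ-+ c (sumTo n f) (f n)))

sumTo-swap : ∀ m n (f : ℕ → ℕ → ℕ) → sumTo m (λ i → sumTo n (f i)) ≡ sumTo n (λ j → sumTo m (λ i → f i j))
sumTo-swap zero    n f = sym (sumTo-0 n)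
sumTo-swap (suc m) n f = trans (cong (_+ sumTo n (f m)) (sumTo-swap m n f)) (sym (sumTo-+ n _ (f m)))

sumTo-split : ∀ m n f → sumTo (m + n) f ≡ sumTo m f + sumTo n (λ i → f (m + i))
sumTo-split m zero    f = trans (cong (λ z → sumTo z f) (+-identityʳ m)) (sym (+-identityʳ _))
sumTo-split m (suc n) f = trans (cong (λ z → sumTo z f) (+-suc m n))
  (trans (cong (_+ f (m + n)) (sumTo-split m n f)) (+-assoc (sumTo m f) _ _))

sumTo-lengthen : ∀ {m n} f → m ≤ n → sumTo m f ≤ sumTo n f
sumTo-lengthen {m} {n} f m≤n = subst (λ z → sumTo m f ≤ sumTo z f) (m+[n∸m]≡n m≤n)
  (≤-trans (m≤m+n _ _) (≤-reflexive (sym (sumTo-split m (n ∸ m) f))))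

sumTo-rev : ∀ n f → sumTo n (λ i → f (n ∸ suc i)) ≡ sumTo n f
sumTo-rev zero    f = refl
sumTo-rev (suc n) f = trans (sumTo-suc n _) (trans (cong (f n +_) (sumTo-rev n f)) (+-comm (f n) _))

count≡sum : ∀ n f → countUpTo n f ≡ sumTo n (bit ∘ f)
count≡sum zero    f = refl
count≡sum (suc n) f = cong (_+ bit (f n)) (count≡sum n f)

bit-mono : ∀ {a b} → (a ≡ true → b ≡ true) → bit a ≤ bit b
bit-mono {false} p = z≤n
bit-mono {true}  p = ≤-reflexive (cong bit (sym (p refl)))

bit≤1 : ∀ b → bit b ≤ 1
bit≤1 true  = ≤-refl
bit≤1 false = z≤n

count-mono : ∀ n {f g} → (∀ i → i < n → f i ≡ true → g i ≡ true) → countUpTo n f ≤ countUpTo n g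
count-mono n {f} {g} p = subst₂ _≤_ (sym (count≡sum n f)) (sym (count≡sum n g))
  (sumTo-mono n (λ i i<n → bit-mono (p i i<n)))

count-cong : ∀ n {f g} → (∀ i → i < n → f i ≡ g i) → countUpTo n f ≡ countUpTo n g
count-cong zero    p = refl
count-cong (suc n) p = cong₂ _+_ (count-cong n (λ i i<n → p i (m<n⇒m<1+n i<n))) (cong bit (p n ≤-refl))

count≤ : ∀ n f → countUpTo n f ≤ n
count≤ zero    f = z≤n
count≤ (suc n) f = ≤-trans (+-mono-≤ (count≤ n f) (bit≤1 (f n))) (≤-reflexive (+-comm n 1))

count-split : ∀ m n f → countUpTo (m + n) f ≡ countUpTo m f + countUpTo n (λ i → f (m + i))
count-split m n f = trans (count≡sum (m + n) f) (trans (sumTo-split m n (bit ∘ f))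
  (sym (cong₂ _+_ (count≡sum m f) (count≡sum n _))))

count-lengthen : ∀ {m n} f → m ≤ n → countUpTo m f ≤ countUpTo n f
count-lengthen {m} {n} f m≤n = subst₂ _≤_ (sym (count≡sum m f)) (sym (count≡sum n f)) (sumTo-lengthen (bit ∘ f) m≤n)

count-none : ∀ n {f} → (∀ i → i < n → f i ≡ false) → countUpTo n f ≡ 0
count-none zero    p = refl
count-none (suc n) p = cong₂ _+_ (count-none n (λ i i<n → p i (m<n⇒m<1+n i<n))) (cong bit (p n ≤-refl))

count-beyond : ∀ m n {f} → (∀ i → m ≤ i → f i ≡ false) → countUpTo n f ≤ countUpTo m f
count-beyond m n {f} p with ≤-total n m
... | inj₁ n≤m = count-lengthen f n≤m
... | inj₂ m≤n = ≤-reflexive (trans (cong (λ z → countUpTo z f) (sym (m+[n∸m]≡n m≤n)))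
  (trans (count-split m (n ∸ m) f) (trans (cong (countUpTo m f +_) (count-none (n ∸ m) (λ i _ → p (m + i) (m≤m+n m i))))
    (+-identityʳ _))))

count-∨ : ∀ n {f g h} → (∀ i → i < n → f i ≡ true → g i ≡ true ⊎ h i ≡ true) →
  countUpTo n f ≤ countUpTo n g + countUpTo n h
count-∨ zero    p = z≤n
count-∨ (suc n) {f} {g} {h} p = ≤-trans
  (+-mono-≤ (count-∨ n (λ i i<n → p i (m<n⇒m<1+n i<n))) (last (f n) refl))
  (≤-reflexive (+-interchange (countUpTo n g) (countUpTo n h) (bit (g n)) (bit (h n))))
  where
  last : ∀ b → f n ≡ b → bit b ≤ bit (g n) + bit (h n)
  last false _ = z≤n
  last true eq with p n ≤-refl eq
  ... | inj₁ q = ≤-trans (≤-reflexive (cong bit (sym q))) (m≤m+n _ _)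
  ... | inj₂ q = ≤-trans (≤-reflexive (cong bit (sym q))) (m≤n+m _ _)

count-rev : ∀ n f → countUpTo n (λ i → f (n ∸ suc i)) ≡ countUpTo n f
count-rev n f = trans (count≡sum n _) (trans (sumTo-rev n (bit ∘ f)) (sym (count≡sum n f)))

count-shift : ∀ s r n {f g} → (∀ i → s ≤ i → i < n → f i ≡ true → ∃[ t ] (t < r × i ≡ s + t × g t ≡ true)) →
  (∀ i → i < s → f i ≡ false) → countUpTo n f ≤ countUpTo r g
count-shift s r n {f} {g} p q with ≤-total n s
... | inj₁ n≤s = ≤-trans (≤-reflexive (count-none n (λ i i<n → q i (<-≤-trans i<n n≤s)))) z≤n
... | inj₂ s≤n = begin
  countUpTo n f                                              ≡⟨ cong (λ z → countUpTo z f) (m+[n∸m]≡n s≤n) ⟨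
  countUpTo (s + (n ∸ s)) f                                  ≡⟨ count-split s (n ∸ s) f ⟩
  countUpTo s f + countUpTo (n ∸ s) (λ i → f (s + i))        ≡⟨ cong (_+ countUpTo (n ∸ s) (λ i → f (s + i))) (count-none s q) ⟩
  countUpTo (n ∸ s) (λ i → f (s + i))                        ≤⟨ count-mono (n ∸ s) shifted ⟩
  countUpTo (n ∸ s) (λ i → (i <ᵇ r) ∧ g i)                   ≤⟨ count-beyond r (n ∸ s) (λ i r≤i → cong (_∧ g i) (<ᵇ-false r≤i)) ⟩
  countUpTo r (λ i → (i <ᵇ r) ∧ g i)                         ≤⟨ count-mono r (λ i _ e → proj₂ (∧-true⁻ {i <ᵇ r} e)) ⟩
  countUpTo r g                                              ∎
  where
  open ≤-Reasoning
  shifted : ∀ i → i < n ∸ s → f (s + i) ≡ true → (i <ᵇ r) ∧ g i ≡ true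
  shifted i i<n∸s e with p (s + i) (m≤m+n s i) (subst (s + i <_) (m+[n∸m]≡n s≤n) (+-monoʳ-< s i<n∸s)) e
  ... | t , t<r , eq , gt with +-cancelˡ-≡ s i t eq
  ... | refl = ∧-true (<ᵇ-true t<r) gt

interval : ℕ → ℕ → ℕ → Bool
interval s r i = (s ≤ᵇ i) ∧ (i <ᵇ s + r)

interval⁺ : ∀ {s r i} → s ≤ i → i < s + r → interval s r i ≡ true
interval⁺ p q = ∧-true (≤ᵇ-true p) (<ᵇ-true q)

interval⁻ : ∀ {s r i} → interval s r i ≡ true → s ≤ i × i < s + r
interval⁻ {s} {r} {i} p = let a , b = ∧-true⁻ {s ≤ᵇ i} p in ≤ᵇ-true⁻ a , <ᵇ-true⁻ b

count-interval : ∀ s r n → countUpTo n (interval s r) ≤ r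
count-interval s r n = ≤-trans (count-shift s r n {g = λ _ → true} inside outside) (count≤ r _)
  where
  inside : ∀ i → s ≤ i → i < n → interval s r i ≡ true → ∃[ t ] (t < r × i ≡ s + t × true ≡ true)
  inside i s≤i _ e = i ∸ s , +-cancelˡ-< s _ _ (subst (_< s + r) (sym (m+[n∸m]≡n s≤i)) (proj₂ (interval⁻ {s} e)))
    , sym (m+[n∸m]≡n s≤i) , refl
  outside : ∀ i → i < s → interval s r i ≡ false
  outside i i<s = cong (_∧ (i <ᵇ s + r)) (≤ᵇ-false i<s)

-- Numerical semigroups and their Kunz words

tabV : {A : Set} (n : ℕ) → (ℕ → A) → Vec A n
tabV zero    f = []
tabV (suc n) f = f 0 ∷ tabV n (f ∘ suc)

at-tabV : {A : Set} (d : A) (n : ℕ) (f : ℕ → A) → ∀ i → i < n → at d (tabV n f) i ≡ f i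
at-tabV d (suc n) f zero    _         = refl
at-tabV d (suc n) f (suc i) (s≤s i<n) = at-tabV d n (f ∘ suc) i i<n

tabV-at : {A : Set} (d : A) {n : ℕ} (v : Vec A n) → tabV n (at d v) ≡ v
tabV-at d []      = refl
tabV-at d (a ∷ v) = cong (a ∷_) (tabV-at d v)

tabV-cong : {A : Set} (n : ℕ) {f g : ℕ → A} → (∀ i → i < n → f i ≡ g i) → tabV n f ≡ tabV n g
tabV-cong zero    p = refl
tabV-cong (suc n) p = cong₂ _∷_ (p 0 z<s) (tabV-cong n (λ i i<n → p (suc i) (s<s i<n)))

at-beyond : {A : Set} (d : A) {n : ℕ} (v : Vec A n) → ∀ i → n ≤ i → at d v i ≡ d
at-beyond d []      i       _         = refl
at-beyond d (a ∷ v) (suc i) (s≤s n≤i) = at-beyond d v i n≤i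

mem≡at : {L : ℕ} (v : Vec Bool L) (x : ℕ) → mem v x ≡ at true v x
mem≡at []      x       = refl
mem≡at (b ∷ v) zero    = refl
mem≡at (b ∷ v) (suc x) = mem≡at v x

mem-beyond : {L : ℕ} (v : Vec Bool L) (x : ℕ) → L ≤ x → mem v x ≡ true
mem-beyond v x p = trans (mem≡at v x) (at-beyond true v x p)

≤ᵇ≡<ᵇsuc : ∀ a b → (a ≤ᵇ b) ≡ (a <ᵇ suc b)
≤ᵇ≡<ᵇsuc zero    b = refl
≤ᵇ≡<ᵇsuc (suc a) b = refl

-- An upward closed predicate is determined by its number of failures. This is why the Kunz
-- coordinate of a residue class can be defined as a count of gaps and still decide membership.
threshold : ∀ L {p : ℕ → Bool} → (∀ j → p j ≡ true → p (suc j) ≡ true) → (∀ j → L ≤ j → p j ≡ true) →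
  ∀ j → p j ≡ (countUpTo L (not ∘ p) ≤ᵇ j)
threshold zero    up past j = past j z≤n
threshold (suc L) {p} up past j rewrite countUpTo-suc L (not ∘ p) with p 0 in eq
... | true  = trans (all j) (sym (≤ᵇ-true (≤-trans (≤-reflexive (count-none L (λ i _ → cong not (all (suc i))))) z≤n)))
  where
  all : ∀ j → p j ≡ true
  all zero    = eq
  all (suc j) = up j (all j)
... | false with j
...   | zero   = eq
...   | suc j′ = trans (threshold L (λ i → up (suc i)) (λ i L≤i → past (suc i) (s≤s L≤i)) j′) (≤ᵇ≡<ᵇsuc (countUpTo L (not ∘ p ∘ suc)) j′)

sumTo-grid : ∀ L m F → sumTo L (λ j → sumTo m (λ i → F (i + j * m))) ≡ sumTo (L * m) F
sumTo-grid zero    m F = refl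
sumTo-grid (suc L) m F = begin
  sumTo L (λ j → sumTo m (λ i → F (i + j * m))) + sumTo m (λ i → F (i + L * m))
    ≡⟨ cong₂ _+_ (sumTo-grid L m F) (sumTo-cong m (λ i _ → cong F (+-comm i (L * m)))) ⟩
  sumTo (L * m) F + sumTo m (λ i → F (L * m + i))  ≡⟨ sumTo-split (L * m) m F ⟨
  sumTo (L * m + m) F                              ≡⟨ cong (λ z → sumTo z F) (+-comm (L * m) m) ⟩
  sumTo (m + L * m) F                              ∎
  where open ≡-Reasoning

-- The multiplicity is `suc n`, so that `n` is the number of nonzero residues and hence the length
-- of the word.
record IsSemigroup (M : ℕ → Bool) (L n : ℕ) : Set where
  field
    0∈         : M 0 ≡ true
    +-closed   : ∀ x y → M x ≡ true → M y ≡ true → M (x + y) ≡ true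
    beyond     : ∀ x → L ≤ x → M x ≡ true
    mult∈      : M (suc n) ≡ true
    below-mult : ∀ i → i < n → M (suc i) ≡ false

least : ∀ L (p : ℕ → Bool) → p L ≡ true → ∃[ n ] (p n ≡ true × (∀ i → i < n → p i ≡ false))
least zero    p q = 0 , q , λ i ()
least (suc L) p q with p 0 in eq
... | true  = 0 , eq , λ i ()
... | false with least L (p ∘ suc) q
...   | n , pn , lt = suc n , pn , λ { zero _ → eq ; (suc i) (s≤s i<n) → lt i i<n }

isNumSg⇒closed : {L : ℕ} (v : Vec Bool L) → isNumSg v ≡ true →
  ∀ x y → mem v x ≡ true → mem v y ≡ true → mem v (x + y) ≡ true
isNumSg⇒closed {L} v sg x y x∈ y∈ with x <? L | y <? L
... | no x≮L | _      = mem-beyond v (x + y) (≤-trans (≮⇒≥ x≮L) (m≤m+n x y))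
... | yes _  | no y≮L = mem-beyond v (x + y) (≤-trans (≮⇒≥ y≮L) (m≤n+m y x))
... | yes x< | yes y< with allUpTo⁻ L (allUpTo⁻ L (proj₂ (∧-true⁻ {mem v 0} sg)) x x<) y y<
... | p rewrite x∈ | y∈ = p

isSemigroup : {L : ℕ} (v : Vec Bool (suc L)) → isNumSg v ≡ true → ∃[ n ] IsSemigroup (mem v) (suc L) n
isSemigroup {L} v sg with least L (mem v ∘ suc) (mem-beyond v (suc L) ≤-refl)
... | n , n∈ , lt = n , record
  { 0∈ = proj₁ (∧-true⁻ {mem v 0} sg) ; +-closed = isNumSg⇒closed v sg
  ; beyond = mem-beyond v ; mult∈ = n∈ ; below-mult = lt }

module _ {M : ℕ → Bool} {L n : ℕ} (S : IsSemigroup M L n) where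
  open IsSemigroup S

  private
    m : ℕ
    m = suc n

  depth : ℕ → ℕ
  depth i = countUpTo L (λ j → not (M (i + j * m)))

  multiples∈ : ∀ j → M (j * m) ≡ true
  multiples∈ zero    = 0∈
  multiples∈ (suc j) = +-closed m (j * m) mult∈ (multiples∈ j)

  depth-threshold : ∀ i j → M (i + j * m) ≡ (depth i ≤ᵇ j)
  depth-threshold i = threshold L up past
    where
    up : ∀ j → M (i + j * m) ≡ true → M (i + suc j * m) ≡ true
    up j p = subst (λ z → M z ≡ true) (e i (j * m) m) (+-closed (i + j * m) m p mult∈)
      where
      e : ∀ i a m → (i + a) + m ≡ i + (m + a)
      e = solve 3 (λ i a m → (i :+ a) :+ m := i :+ (m :+ a)) refl
        where open +-*-Solver
    past : ∀ j → L ≤ j → M (i + j * m) ≡ true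
    past j L≤j = beyond _ (≤-trans L≤j (≤-trans (m≤m*n j m) (m≤n+m _ i)))

  depth-sum : sumTo n (depth ∘ suc) ≡ countUpTo L (not ∘ M)
  depth-sum = begin
    sumTo n (depth ∘ suc)                                        ≡⟨ cong (_+ sumTo n (depth ∘ suc)) depth₀ ⟨
    depth 0 + sumTo n (depth ∘ suc)                              ≡⟨ sumTo-suc n depth ⟨
    sumTo m depth                                                ≡⟨ sumTo-cong m (λ i _ → count≡sum L _) ⟩
    sumTo m (λ i → sumTo L (λ j → bit (not (M (i + j * m)))))    ≡⟨ sumTo-swap m L _ ⟩
    sumTo L (λ j → sumTo m (λ i → bit (not (M (i + j * m)))))    ≡⟨ sumTo-grid L m (bit ∘ not ∘ M) ⟩
    sumTo (L * m) (bit ∘ not ∘ M)                                ≡⟨ count≡sum (L * m) (not ∘ M) ⟨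
    -- The grid of `L` rows covers everything below `L * m`, but no gap lies at or beyond `L`.
    countUpTo (L * m) (not ∘ M)                                  ≡⟨ ≤-antisym (count-beyond L (L * m) (λ i L≤i → cong not (beyond i L≤i)))
                                                                     (count-lengthen (not ∘ M) (m≤m*n L m)) ⟩
    countUpTo L (not ∘ M)                                        ∎
    where
    open ≡-Reasoning
    depth₀ : depth 0 ≡ 0
    depth₀ = count-none L (λ j _ → cong not (multiples∈ j))

  depth-positive : ∀ i → i < n → 0 < depth (suc i)
  depth-positive i i<n = ≰⇒> (λ p → case trans (sym (≤ᵇ-true p))
    (trans (sym (depth-threshold (suc i) 0)) (trans (cong M (+-identityʳ (suc i))) (below-mult i i<n))) of λ ())

  depth∈ : ∀ i j → depth i ≤ j → M (i + j * m) ≡ true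
  depth∈ i j p = trans (depth-threshold i j) (≤ᵇ-true p)

  ∈⇒depth : ∀ i j → M (i + j * m) ≡ true → depth i ≤ j
  ∈⇒depth i j p = ≤ᵇ-true⁻ (trans (sym (depth-threshold i j)) p)

-- Kunz coordinates.  Position i < n stands for the residue class of i + 1
-- modulo the multiplicity n + 1, and a word stores the coordinates minus one.
kw : {n : ℕ} → Vec ℕ n → ℕ → ℕ
kw w i = suc (at 0 w i)

residue∈ : {n : ℕ} → Vec ℕ n → ℕ → ℕ → Bool
residue∈ w zero    j = true
residue∈ w (suc i) j = kw w i ≤ᵇ j

member : (n : ℕ) → Vec ℕ n → ℕ → Bool
member n w x = residue∈ w (x % suc n) (x / suc n)

decode : (L n : ℕ) → Vec ℕ n → Vec Bool L
decode L n w = tabV L (member n w)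

-- A position is a residue minus one, so the residues at `i` and `j` add up to the one at
-- `suc (i + j)`. The equation `i + j ≡ l + n` describes a sum that wraps around the multiplicity
-- once, which costs the extra one in `kunz->`. The bound `kw-<L` holds because the last gap of a
-- class lies in the window; for words longer than g/7 it confines the letters to at most 14.
record KunzWord {L : ℕ} (v : Vec Bool L) (n : ℕ) (w : Vec ℕ n) : Set where
  field
    isSg    : IsSemigroup (mem v) L n
    kw∈     : ∀ i j → i < n → mem v (suc i + j * suc n) ≡ (kw w i ≤ᵇ j)
    sum-kw  : sumTo n (kw w) ≡ genus v
    kunz-<  : ∀ i j → suc (i + j) < n → kw w (suc (i + j)) ≤ kw w i + kw w j
    kunz->  : ∀ i j l → i < n → j < n → l < n → i + j ≡ l + n → kw w l ≤ suc (kw w i + kw w j)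
    kw-<L   : ∀ i → i < n → at 0 w i * suc n < L
    decoded : decode L n w ≡ v

kunzWord : {L : ℕ} (v : Vec Bool (suc L)) → isNumSg v ≡ true → ∃[ n ] ∃[ w ] KunzWord v n w
kunzWord {L} v sg with isSemigroup v sg
... | n , S = n , w , record
  { isSg = S ; kw∈ = kw∈ ; sum-kw = trans (sumTo-cong n kw≡) (depth-sum S)
  ; kunz-< = λ i j p → subst₂ _≤_ (sym (kw≡ _ p)) (sym (cong₂ _+_ (kw≡ i (<-trans (s≤s (m≤m+n i j)) p))
                         (kw≡ j (<-trans (s≤s (m≤n+m j i)) p)))) (kunz₁ i j)
  ; kunz-> = λ i j l i<n j<n l<n e → subst₂ _≤_ (sym (kw≡ l l<n)) (cong suc (sym (cong₂ _+_ (kw≡ i i<n) (kw≡ j j<n)))) (kunz₂ i j l e)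
  ; kw-<L = bounded
  ; decoded = trans (tabV-cong (suc L) (λ x _ → decoded x)) (tabV-at true v) }
  where
  open IsSemigroup S
  open +-*-Solver using (solve; _:=_; _:+_; _:*_; con)
  m : ℕ
  m = suc n
  w : Vec ℕ n
  w = tabV n (λ i → pred (depth S (suc i)))
  kw≡ : ∀ i → i < n → kw w i ≡ depth S (suc i)
  kw≡ i i<n = trans (cong suc (at-tabV 0 n _ i i<n)) (suc-pred (depth S (suc i)) {{>-nonZero (depth-positive S i i<n)}})
  kw∈ : ∀ i j → i < n → mem v (suc i + j * m) ≡ (kw w i ≤ᵇ j)
  kw∈ i j i<n = trans (depth-threshold S (suc i) j) (cong (_≤ᵇ j) (sym (kw≡ i i<n)))
  self : ∀ i → mem v (i + depth S i * m) ≡ true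
  self i = depth∈ S i (depth S i) ≤-refl
  e₁ : ∀ i j a b m → (suc i + a * m) + (suc j + b * m) ≡ suc (suc (i + j)) + (a + b) * m
  e₁ = solve 5 (λ i j a b m → ((con 1 :+ i) :+ a :* m) :+ ((con 1 :+ j) :+ b :* m)
    := (con 2 :+ (i :+ j)) :+ (a :+ b) :* m) refl
  kunz₁ : ∀ i j → depth S (suc (suc (i + j))) ≤ depth S (suc i) + depth S (suc j)
  kunz₁ i j = ∈⇒depth S _ _ (subst (λ z → mem v z ≡ true) (e₁ i j (depth S (suc i)) (depth S (suc j)) m)
    (+-closed _ _ (self (suc i)) (self (suc j))))
  kunz₂ : ∀ i j l → i + j ≡ l + n → depth S (suc l) ≤ suc (depth S (suc i) + depth S (suc j))
  kunz₂ i j l e = ∈⇒depth S _ _ (subst (λ z → mem v z ≡ true) eq (+-closed _ _ (self (suc i)) (self (suc j))))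
    where
    a = depth S (suc i)
    b = depth S (suc j)
    eq : (suc i + a * m) + (suc j + b * m) ≡ suc l + suc (a + b) * m
    eq = trans (e₁ i j a b m) (trans (cong (λ z → suc (suc z) + (a + b) * m) e)
      (solve 3 (λ l n c → (con 2 :+ (l :+ n)) :+ c := (con 1 :+ l) :+ ((con 1 :+ n) :+ c)) refl l n ((a + b) * m)))
  bounded : ∀ i → i < n → at 0 w i * m < suc L
  bounded i i<n = ≰⇒> λ p → case trans (sym (mem-beyond v (suc i + at 0 w i * m) (≤-trans p (m≤n+m _ (suc i)))))
    (trans (kw∈ i (at 0 w i) i<n) (≤ᵇ-false {kw w i} ≤-refl)) of λ ()
  residue≡ : ∀ r j → r < m → residue∈ w r j ≡ mem v (r + j * m)
  residue≡ zero    j _         = sym (multiples∈ S j)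
  residue≡ (suc i) j (s≤s i<n) = sym (kw∈ i j i<n)
  decoded : ∀ x → member n w x ≡ at true v x
  decoded x = trans (residue≡ (x % m) (x / m) (m%n<n x m)) (trans (cong (mem v) (sym (m≡m%n+[m/n]*n x m))) (mem≡at v x))

-- Counting windows by the weights of words

ind : Bool → ℚ₊
ind b = if b then 𝟙 else 𝟘

ind≼𝟙 : ∀ b → ind b ≼ 𝟙
ind≼𝟙 true  = ≼-refl
ind≼𝟙 false = 𝟘≼

countWhere≈sumL : {A : Set} (xs : List A) (P : A → Bool) → ι (countWhere xs P) ≈ sumL xs (ind ∘ P)
countWhere≈sumL []       P = ≈-refl
countWhere≈sumL (x ∷ xs) P = ≈-trans (ι-⊕ (countWhere xs P) (bit (P x)))
  (≈-trans (⊕-cong (countWhere≈sumL xs P) (bit≈ind (P x))) (⊕-comm _ _))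
  where
  bit≈ind : ∀ b → ι (bit b) ≈ ind b
  bit≈ind true  = ≈-refl
  bit≈ind false = ≈-refl

sumL-allVecs : ∀ n (f : Vec Bool (suc n) → ℚ₊) →
  sumL (allVecs (suc n)) f ≈ sumL (allVecs n) (λ v → f (false ∷ v) ⊕ f (true ∷ v))
sumL-allVecs n f = go (allVecs n)
  where
  go : ∀ xs → sumL (concatMap (λ v → (false ∷ v) ∷ (true ∷ v) ∷ []) xs) f ≈ sumL xs (λ v → f (false ∷ v) ⊕ f (true ∷ v))
  go []       = ≈-refl
  go (x ∷ xs) = ≈-trans (≈-sym (⊕-assoc _ _ _)) (⊕-cong ≈-refl (go xs))

eqᵇ : Bool → Bool → Bool
eqᵇ false b = not b
eqᵇ true  b = b

eqV : {n : ℕ} → Vec Bool n → Vec Bool n → Bool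
eqV []      []      = true
eqV (a ∷ u) (b ∷ v) = eqᵇ a b ∧ eqV u v

eqV-refl : {n : ℕ} (u : Vec Bool n) → eqV u u ≡ true
eqV-refl []          = refl
eqV-refl (false ∷ u) = eqV-refl u
eqV-refl (true ∷ u)  = eqV-refl u

eqV⇒≡ : {n : ℕ} (u v : Vec Bool n) → eqV u v ≡ true → u ≡ v
eqV⇒≡ []          []          p = refl
eqV⇒≡ (false ∷ u) (false ∷ v) p = cong (false ∷_) (eqV⇒≡ u v p)
eqV⇒≡ (true ∷ u)  (true ∷ v)  p = cong (true ∷_) (eqV⇒≡ u v p)

sum-eqV : {n : ℕ} (u : Vec Bool n) → sumL (allVecs n) (ind ∘ eqV u) ≈ 𝟙
sum-eqV []          = ⊕-identityʳ 𝟙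
sum-eqV {suc n} (false ∷ u) = ≈-trans (sumL-allVecs n _) (≈-trans (sumL-cong (allVecs n) (λ v → ⊕-identityʳ _)) (sum-eqV u))
sum-eqV {suc n} (true ∷ u)  = ≈-trans (sumL-allVecs n _) (≈-trans (sumL-cong (allVecs n) (λ v → ⊕-identityˡ _)) (sum-eqV u))

total : (B A : ℕ) → ((n : ℕ) → Vec ℕ n → ℚ₊) → ℚ₊
total B A Φ = sumL (upTo B) (λ n → sumL (vecs (upTo A) n) (Φ n))

-- Decoding a word yields only one window, so windows are counted by their words.
count≼total : (L B A : ℕ) (P : Vec Bool L → Bool) (Φ : (n : ℕ) → Vec ℕ n → ℚ₊) →
  (∀ v → P v ≡ true → ∃[ n ] ∃[ w ] (n < B × (∀ i → i < n → at 0 w i < A) × decode L n w ≡ v × 𝟙 ≼ Φ n w)) →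
  ι (countWhere (allVecs L) P) ≼ total B A Φ
count≼total L B A P Φ code = begin
  ι (countWhere (allVecs L) P)                                   ≈⟨ countWhere≈sumL (allVecs L) P ⟩
  sumL (allVecs L) (ind ∘ P)                                     ≤⟨ sumL-mono (allVecs L) coded ⟩
  sumL (allVecs L) (λ v → total B A (λ n w → ind (eqV (decode L n w) v) ⊗ Φ n w))
    ≈⟨ sumL-swap (allVecs L) (upTo B) _ ⟩
  sumL (upTo B) (λ n → sumL (allVecs L) (λ v → sumL (vecs (upTo A) n) (λ w → ind (eqV (decode L n w) v) ⊗ Φ n w)))
    ≈⟨ sumL-cong (upTo B) (λ n → sumL-swap (allVecs L) (vecs (upTo A) n) _) ⟩
  total B A (λ n w → sumL (allVecs L) (λ v → ind (eqV (decode L n w) v) ⊗ Φ n w))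
    ≈⟨ sumL-cong (upTo B) (λ n → sumL-cong (vecs (upTo A) n) (λ w → decode-once n w)) ⟩
  total B A Φ ∎
  where
  open ≼-Reasoning
  decode-once : ∀ n w → sumL (allVecs L) (λ v → ind (eqV (decode L n w) v) ⊗ Φ n w) ≈ Φ n w
  decode-once n w = ≈-trans (sumL-⊗ʳ (allVecs L) (Φ n w) _) (≈-trans (⊗-cong (sum-eqV (decode L n w)) ≈-refl) (⊗-identityˡ _))
  coded : ∀ v → ind (P v) ≼ total B A (λ n w → ind (eqV (decode L n w) v) ⊗ Φ n w)
  coded v with P v in eq
  ... | false = 𝟘≼
  ... | true with code v eq
  ...   | n , w , n<B , w<A , refl , 1≼ = ≼-trans
    (≼-trans 1≼ (≼-trans (proj₂ (⊗-identityˡ _)) (⊗-monoˡ (Φ n w) (≈⇒≼ (≈-reflexive (cong ind (sym (eqV-refl (decode L n w)))))))))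
    (≼-trans (∈⇒≼sumL (vecs (upTo A) n) (λ w′ → ind (eqV (decode L n w′) (decode L n w)) ⊗ Φ n w′)
        (∈-vecs 0 (upTo A) w (λ i i<n → ∈-upTo⁺ (w<A i i<n))))
      (∈⇒≼sumL (upTo B) (λ n′ → sumL (vecs (upTo A) n′) (λ w′ → ind (eqV (decode L n′ w′) (decode L n w)) ⊗ Φ n′ w′)) (∈-upTo⁺ n<B)))

total-⊕ : ∀ B A (Φ Ψ : (n : ℕ) → Vec ℕ n → ℚ₊) → total B A (λ n w → Φ n w ⊕ Ψ n w) ≈ total B A Φ ⊕ total B A Ψ
total-⊕ B A Φ Ψ = ≈-trans (sumL-cong (upTo B) (λ n → sumL-⊕ (vecs (upTo A) n) (Φ n) (Ψ n))) (sumL-⊕ (upTo B) _ _)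

-- Lower bound: words over 1 and 2, and Fibonacci growth

mem-tabV : ∀ L f x → x < L → mem (tabV L f) x ≡ f x
mem-tabV L f x p = trans (mem≡at (tabV L f) x) (at-tabV true L f x p)

member-residue : ∀ {n} (w : Vec ℕ n) r j → r < suc n → member n w (r + j * suc n) ≡ residue∈ w r j
member-residue {n} w r j r<m = cong₂ (residue∈ w)
  (trans ([m+kn]%n≡m%n r j m) (m<n⇒m%n≡m r<m))
  (trans (+-distrib-/-∣ʳ r (n∣m*n j {m})) (cong₂ _+_ (m<n⇒m/n≡0 r<m) (m*n/n≡m j m)))
  where
  m : ℕ
  m = suc n

≤ᵇ-injective : ∀ a b → (∀ j → (a ≤ᵇ j) ≡ (b ≤ᵇ j)) → a ≡ b
≤ᵇ-injective a b p = ≤-antisym (≤ᵇ-true⁻ (trans (p b) (≤ᵇ-true {b} ≤-refl))) (≤ᵇ-true⁻ (trans (sym (p a)) (≤ᵇ-true {a} ≤-refl)))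

multiplicity-unique : ∀ {M L n n′} → IsSemigroup M L n → IsSemigroup M L n′ → n ≡ n′
multiplicity-unique {n = n} {n′} S S′ with <-cmp n n′
... | tri≈ _ eq _ = eq
... | tri< lt _ _ = ⊥-elim (true≢false (trans (sym (IsSemigroup.mult∈ S)) (IsSemigroup.below-mult S′ n lt)))
... | tri> _ _ gt = ⊥-elim (true≢false (trans (sym (IsSemigroup.mult∈ S′)) (IsSemigroup.below-mult S n′ gt)))

-- With letters 1 and 2 every number from `2m` on is a member, while two nonzero members add up to
-- at least `2m`. Closure under addition is therefore automatic, and `2m ≤ L` keeps all gaps inside
-- the window.
module TwoLetterWord {n : ℕ} (w : Vec ℕ n) (w<2 : ∀ i → i < n → at 0 w i < 2) (L : ℕ) (2m≤L : suc n + suc n ≤ L) where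

  private
    m : ℕ
    m = suc n
    v : Vec Bool L
    v = decode L n w

  residue∈-≥2 : ∀ r j → r < m → 2 ≤ j → residue∈ w r j ≡ true
  residue∈-≥2 zero    j _         _   = refl
  residue∈-≥2 (suc i) j (s≤s i<n) 2≤j = ≤ᵇ-true (≤-trans (w<2 i i<n) 2≤j)

  decode-residue : ∀ r j → r < m → mem v (r + j * m) ≡ residue∈ w r j
  decode-residue r j r<m with (r + j * m) <? L
  ... | yes x<L = trans (mem-tabV L (member n w) _ x<L) (member-residue w r j r<m)
  ... | no x≮L  = trans (mem-beyond v _ (≮⇒≥ x≮L)) (sym (residue∈-≥2 r j r<m (2≤ j (≤-trans 2m≤L (≮⇒≥ x≮L)))))
    where
    2≤ : ∀ j → m + m ≤ r + j * m → 2 ≤ j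
    2≤ zero p = ⊥-elim (<⇒≱ r<m (≤-trans (m≤m+n m m) (≤-trans p (≤-reflexive (+-identityʳ r)))))
    2≤ (suc zero) p = ⊥-elim (<⇒≱ r<m (+-cancelʳ-≤ m m r (≤-trans p (≤-reflexive (cong (r +_) (+-identityʳ m))))))
    2≤ (suc (suc j)) p = s≤s (s≤s z≤n)

  private
    decomp : ∀ x → x ≡ x % m + x / m * m
    decomp x = m≡m%n+[m/n]*n x m

  mem-decomp : ∀ x → mem v x ≡ residue∈ w (x % m) (x / m)
  mem-decomp x = trans (cong (mem v) (decomp x)) (decode-residue (x % m) (x / m) (m%n<n x m))

  mem-≥2m : ∀ x → m + m ≤ x → mem v x ≡ true
  mem-≥2m x 2m≤x = trans (mem-decomp x) (residue∈-≥2 (x % m) (x / m) (m%n<n x m) (≮⇒≥ small))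
    where
    small : ¬ (x / m < 2)
    small q<2 = <⇒≱ (<-≤-trans (+-mono-<-≤ (m%n<n x m) (*-monoˡ-≤ m (s≤s⁻¹ q<2)))
      (≤-reflexive (cong (m +_) (*-identityˡ m)))) (≤-trans 2m≤x (≤-reflexive (decomp x)))

  member⇒≥m : ∀ x → mem v (suc x) ≡ true → m ≤ suc x
  member⇒≥m x p with suc x <? m
  ... | no x≮m  = ≮⇒≥ x≮m
  ... | yes (s≤s x<n) = case trans (sym p) (trans (cong (mem v) (sym (+-identityʳ (suc x)))) (decode-residue (suc x) 0 (s≤s x<n))) of λ ()

  closed : ∀ x y → mem v x ≡ true → mem v y ≡ true → mem v (x + y) ≡ true
  closed zero    y       p q = q
  closed (suc x) zero    p q = subst (λ z → mem v z ≡ true) (sym (+-identityʳ (suc x))) p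
  closed (suc x) (suc y) p q = mem-≥2m _ (+-mono-≤ (member⇒≥m x p) (member⇒≥m y q))

  0∈v : mem v 0 ≡ true
  0∈v = decode-residue 0 0 z<s

  decode-isSemigroup : IsSemigroup (mem v) L n
  decode-isSemigroup = record
    { 0∈ = 0∈v ; +-closed = closed ; beyond = mem-beyond v
    ; mult∈ = trans (cong (mem v) (sym (+-identityʳ m))) (decode-residue 0 1 z<s)
    ; below-mult = λ i i<n → trans (cong (mem v) (sym (+-identityʳ (suc i)))) (decode-residue (suc i) 0 (s≤s i<n)) }

  decode-isNumSg : isNumSg v ≡ true
  decode-isNumSg = ∧-true 0∈v (allUpTo⁺ L (λ x _ → allUpTo⁺ L (λ y _ → closedᵇ x y)))
    where
    closedᵇ : ∀ x y → not (mem v x ∧ mem v y) ∨ mem v (x + y) ≡ true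
    closedᵇ x y with mem v x in ex | mem v y in ey
    ... | false | _     = refl
    ... | true  | false = refl
    ... | true  | true  = closed x y ex ey

  decode-genus : genus v ≡ sumTo n (kw w)
  decode-genus = trans (sym (depth-sum decode-isSemigroup)) (sumTo-cong n (λ i i<n → ≤ᵇ-injective _ _ (λ j →
    trans (sym (depth-threshold decode-isSemigroup (suc i) j)) (decode-residue (suc i) j (s≤s i<n)))))

  decode-unique : ∀ {n₀ w₀} → KunzWord v n₀ w₀ → n ≡ n₀ × (∀ i → i < n → at 0 w i ≡ at 0 w₀ i)
  decode-unique {n₀} {w₀} k with multiplicity-unique decode-isSemigroup (KunzWord.isSg k)
  ... | refl = refl , λ i i<n → suc-injective (≤ᵇ-injective _ _ (λ j →
    trans (sym (decode-residue (suc i) j (s≤s i<n))) (KunzWord.kw∈ k i j i<n)))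

sumL-upTo-lengthen : ∀ {m n} (f : ℕ → ℚ₊) → m ≤ n → sumL (upTo m) f ≼ sumL (upTo n) f
sumL-upTo-lengthen f z≤n = 𝟘≼
sumL-upTo-lengthen {suc m} {suc n} f (s≤s p) = begin
  sumL (upTo (suc m)) f              ≡⟨ sumL-upTo-suc m f ⟩
  f 0 ⊕ sumL (upTo m) (f ∘ suc)      ≤⟨ ⊕-monoʳ (f 0) (sumL-upTo-lengthen (f ∘ suc) p) ⟩
  f 0 ⊕ sumL (upTo n) (f ∘ suc)      ≡⟨ sumL-upTo-suc n f ⟨
  sumL (upTo (suc n)) f              ∎
  where open ≼-Reasoning

sum-≡ᵇ : ∀ B k → sumL (upTo B) (λ a → ind (a ≡ᵇ k)) ≼ 𝟙
sum-≡ᵇ zero    k       = 𝟘≼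
sum-≡ᵇ (suc B) zero    = ≈⇒≼ (≈-trans (≈-reflexive (sumL-upTo-suc B _)) (≈-trans (⊕-cong ≈-refl (sumL-𝟘 (upTo B))) (⊕-identityʳ 𝟙)))
sum-≡ᵇ (suc B) (suc k) = ≼-trans (≈⇒≼ (≈-trans (≈-reflexive (sumL-upTo-suc B _)) (⊕-identityˡ _))) (sum-≡ᵇ B k)

compositions : ℕ → ℕ → ℚ₊
compositions g n = sumL (vecs (upTo 2) n) (λ w → ind (sumTo n (kw w) ≡ᵇ g))

-- Compositions of `g` into ones and twos with fewer than `g` parts, a Fibonacci number minus one.
-- Leaving out the word of `g` ones ensures that twice the multiplicity fits into the window of
-- length `2g`; the price is that the recurrence becomes an inequality.
fibonacci : ℕ → ℚ₊
fibonacci g = sumL (upTo g) (compositions g)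

prodTo-ind : ∀ n {f : ℕ → Bool} → (∀ i → i < n → f i ≡ true) → prodTo n (ind ∘ f) ≈ 𝟙
prodTo-ind n {f} p = ≈-trans (prodTo-cong n (λ i i<n → ≈-reflexive (cong ind (p i i<n)))) (≈-trans (prodTo-const n 𝟙) (𝟙^^ n))

-- Double counting of pairs of a word and a window. Each admissible word hits the window that it
-- decodes to, and no window is hit twice, because a semigroup determines its multiplicity and its
-- word.
fibonacci≼cardSg : ∀ g → fibonacci (suc g) ≼ ι (cardSg (suc g))
fibonacci≼cardSg g = begin
  fibonacci (suc g)
    ≤⟨ sumL-mono-∈ (upTo (suc g)) (λ n n∈ → sumL-mono-∈ (vecs (upTo 2) n) (λ w w∈ → place n w (∈-upTo⁻ n∈) (vecs<2 w w∈))) ⟩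
  sumL (upTo (suc g)) (λ n → sumL (vecs (upTo 2) n) (λ w → sumL (allVecs L) (hit n w)))
    ≈⟨ sumL-cong (upTo (suc g)) (λ n → sumL-swap (vecs (upTo 2) n) (allVecs L) (hit n)) ⟩
  sumL (upTo (suc g)) (λ n → sumL (allVecs L) (λ v → sumL (vecs (upTo 2) n) (λ w → hit n w v)))
    ≈⟨ sumL-swap (upTo (suc g)) (allVecs L) _ ⟩
  sumL (allVecs L) (λ v → sumL (upTo (suc g)) (λ n → sumL (vecs (upTo 2) n) (λ w → hit n w v)))
    ≤⟨ sumL-mono (allVecs L) once ⟩
  sumL (allVecs L) (ind ∘ inSg (suc g))
    ≈⟨ countWhere≈sumL (allVecs L) (inSg (suc g)) ⟨
  ι (cardSg (suc g)) ∎
  where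
  open ≼-Reasoning
  L : ℕ
  L = window (suc g)
  short : ∀ {n} → n < suc g → suc n + suc n ≤ L
  short p = +-mono-≤ p (≤-trans p (m≤m+n (suc g) 0))
  vecs<2 : ∀ {n} (w : Vec ℕ n) → w ∈ vecs (upTo 2) n → ∀ i → i < n → at 0 w i < 2
  vecs<2 {suc n} w w∈ i i<n with ∈-cartesianProductWith⁻ _∷_ (upTo 2) (vecs (upTo 2) n) w∈
  vecs<2 w w∈ zero    i<n       | a , u , a∈ , u∈ , refl = ∈-upTo⁻ a∈
  vecs<2 w w∈ (suc i) (s≤s i<n) | a , u , a∈ , u∈ , refl = vecs<2 u u∈ i i<n
  valid : ∀ n → Vec ℕ n → Vec Bool L → Bool
  valid n w v = (sumTo n (kw w) ≡ᵇ suc g) ∧ (eqV (decode L n w) v ∧ allUpTo n (λ i → at 0 w i <ᵇ 2))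
  hit : ∀ n → Vec ℕ n → Vec Bool L → ℚ₊
  hit n w v = ind (valid n w v) ⊗ ind ((n <ᵇ suc g) ∧ inSg (suc g) v)
  place : ∀ n w → n < suc g → (∀ i → i < n → at 0 w i < 2) → ind (sumTo n (kw w) ≡ᵇ suc g) ≼ sumL (allVecs L) (hit n w)
  place n w n<g w<2 with sumTo n (kw w) ≡ᵇ suc g in eq
  ... | false = 𝟘≼
  ... | true  = begin
    𝟙                                                                       ≈⟨ sum-eqV (decode L n w) ⟨
    sumL (allVecs L) (λ v → ind (eqV (decode L n w) v))                     ≤⟨ sumL-mono (allVecs L) point ⟩
    sumL (allVecs L) (λ v → ind (eqV (decode L n w) v ∧ allUpTo n (λ i → at 0 w i <ᵇ 2)) ⊗ ind ((n <ᵇ suc g) ∧ inSg (suc g) v)) ∎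
    where
    open TwoLetterWord w w<2 L (short n<g)
    point : ∀ v → ind (eqV (decode L n w) v)
      ≼ ind (eqV (decode L n w) v ∧ allUpTo n (λ i → at 0 w i <ᵇ 2)) ⊗ ind ((n <ᵇ suc g) ∧ inSg (suc g) v)
    point v with eqV (decode L n w) v in e
    ... | false = 𝟘≼
    ... | true with eqV⇒≡ (decode L n w) v e
    ...   | refl rewrite allUpTo⁺ n {λ i → at 0 w i <ᵇ 2} (λ i i<n → <ᵇ-true (w<2 i i<n)) | <ᵇ-true n<g
      | decode-isNumSg | decode-genus | eq = proj₂ (⊗-identityˡ 𝟙)
  -- Uniqueness is phrased as a product of positionwise indicators, so that `sum-of-products` bounds
  -- the number of hits by 1.
  hit-unique : ∀ v n₀ w₀ → KunzWord v n₀ w₀ → ∀ n w →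
    hit n w v ≼ ind (n ≡ᵇ n₀) ⊗ prodTo n (λ i → ind (at 0 w i ≡ᵇ at 0 w₀ i))
  hit-unique v n₀ w₀ k n w with valid n w v in ev | n <ᵇ suc g in en
  ... | false | _     = ≼-trans (≈⇒≼ (⊗-zeroˡ _)) 𝟘≼
  ... | true  | false = ≼-trans (≈⇒≼ (⊗-zeroʳ _)) 𝟘≼
  ... | true  | true with ∧-true⁻ {sumTo n (kw w) ≡ᵇ suc g} ev
  ...   | _ , ev′ with ∧-true⁻ {eqV (decode L n w) v} ev′
  ...   | ed , e2 with eqV⇒≡ (decode L n w) v ed
  ...   | refl with TwoLetterWord.decode-unique w (λ i i<n → <ᵇ-true⁻ (allUpTo⁻ n e2 i i<n)) L (short (<ᵇ-true⁻ en)) k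
  ...   | refl , same = ⊗-mono (≈⇒≼ (≈-reflexive (cong ind (sym (≡ᵇ-true {n} refl)))))
            (≼-trans (ind≼𝟙 (inSg (suc g) (decode L n w))) (proj₂ (prodTo-ind n (λ i i<n → ≡ᵇ-true (same i i<n)))))
  once′ : ∀ v b → inSg (suc g) v ≡ b → sumL (upTo (suc g)) (λ n → sumL (vecs (upTo 2) n) (λ w → hit n w v)) ≼ ind b
  once′ v false eq = ≈⇒≼ (≈-trans (sumL-cong (upTo (suc g)) (λ n → ≈-trans
      (sumL-cong (vecs (upTo 2) n) (λ w → ≈-trans (⊗-cong ≈-refl (≈-reflexive (cong ind
        (trans (cong ((n <ᵇ suc g) ∧_) eq) (∧-zeroʳ (n <ᵇ suc g)))))) (⊗-zeroʳ _))) (sumL-𝟘 (vecs (upTo 2) n))))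
      (sumL-𝟘 (upTo (suc g))))
  once′ v true eq = let n₀ , w₀ , k = kunzWord v (proj₁ (∧-true⁻ {isNumSg v} eq)) in begin
    sumL (upTo (suc g)) (λ n → sumL (vecs (upTo 2) n) (λ w → hit n w v))
      ≤⟨ sumL-mono (upTo (suc g)) (λ n → sumL-mono (vecs (upTo 2) n) (hit-unique v n₀ w₀ k n)) ⟩
    sumL (upTo (suc g)) (λ n → sumL (vecs (upTo 2) n) (λ w → ind (n ≡ᵇ n₀) ⊗ prodTo n (λ i → ind (at 0 w i ≡ᵇ at 0 w₀ i))))
      ≈⟨ sumL-cong (upTo (suc g)) (λ n → ≈-trans (sumL-⊗ˡ (vecs (upTo 2) n) (ind (n ≡ᵇ n₀)) _)
           (⊗-cong ≈-refl (sum-of-products 0 (upTo 2) n (λ i a → ind (a ≡ᵇ at 0 w₀ i))))) ⟩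
    sumL (upTo (suc g)) (λ n → ind (n ≡ᵇ n₀) ⊗ prodTo n (λ i → sumL (upTo 2) (λ a → ind (a ≡ᵇ at 0 w₀ i))))
      ≤⟨ sumL-mono (upTo (suc g)) (λ n → ≼-trans (⊗-monoʳ (ind (n ≡ᵇ n₀)) (≼-trans (prodTo-mono n (λ i _ → sum-≡ᵇ 2 (at 0 w₀ i)))
           (≈⇒≼ (≈-trans (prodTo-const n 𝟙) (𝟙^^ n))))) (≈⇒≼ (⊗-identityʳ _))) ⟩
    sumL (upTo (suc g)) (λ n → ind (n ≡ᵇ n₀))
      ≤⟨ sum-≡ᵇ (suc g) n₀ ⟩
    𝟙 ∎
  once : ∀ v → sumL (upTo (suc g)) (λ n → sumL (vecs (upTo 2) n) (λ w → hit n w v)) ≼ ind (inSg (suc g) v)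
  once v = once′ v (inSg (suc g) v) refl

compositions-rec : ∀ g n → compositions (suc (suc g)) (suc n) ≈ compositions (suc g) n ⊕ compositions g n
compositions-rec g n = ≈-trans (sumL-cartesianProductWith _∷_ (upTo 2) (vecs (upTo 2) n) _)
  (⊕-cong (sumL-cong (vecs (upTo 2) n) (λ w → ≈-reflexive (cong (λ z → ind (z ≡ᵇ suc (suc g))) (sumTo-suc n _))))
    (≈-trans (⊕-identityʳ _) (sumL-cong (vecs (upTo 2) n) (λ w → ≈-reflexive (cong (λ z → ind (z ≡ᵇ suc (suc g))) (sumTo-suc n _))))))

fibonacci-rec : ∀ g → fibonacci (suc g) ⊕ fibonacci g ≼ fibonacci (suc (suc g))
fibonacci-rec g = begin
  fibonacci (suc g) ⊕ fibonacci g
    ≤⟨ ⊕-monoʳ (fibonacci (suc g)) (sumL-upTo-lengthen (compositions g) (n≤1+n g)) ⟩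
  fibonacci (suc g) ⊕ sumL (upTo (suc g)) (compositions g)
    ≈⟨ sumL-⊕ (upTo (suc g)) (compositions (suc g)) (compositions g) ⟨
  sumL (upTo (suc g)) (λ n → compositions (suc g) n ⊕ compositions g n)
    ≈⟨ sumL-cong (upTo (suc g)) (compositions-rec g) ⟨
  sumL (upTo (suc g)) (λ n → compositions (suc (suc g)) (suc n))
    ≤⟨ ≼-⊕ʳ (compositions (suc (suc g)) 0) _ ⟩
  compositions (suc (suc g)) 0 ⊕ sumL (upTo (suc g)) (λ n → compositions (suc (suc g)) (suc n))
    ≡⟨ sumL-upTo-suc (suc g) (compositions (suc (suc g))) ⟨
  fibonacci (suc (suc g)) ∎
  where open ≼-Reasoning

𝟙≼fibonacci₂ : 𝟙 ≼ fibonacci 2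
𝟙≼fibonacci₂ = ≼-trans (≼-trans (≼-trans (≼-⊕ˡ 𝟙 𝟘) (≼-⊕ʳ 𝟘 _)) (≼-⊕ˡ _ 𝟘)) (≼-⊕ʳ (compositions 2 0) _)

-- The hypothesis `Y² ≤ Y + 1` expresses `Y ≤ φ` rationally and matches the Fibonacci recurrence.
-- The factor 2 absorbs the start of the induction, where only `Y ≤ 2` is known.
growth : ∀ Y → Y ≼ ι 2 → Y ⊗ Y ≼ Y ⊕ 𝟙 → ∀ g → Y ^^ g ≼ ι 2 ⊗ fibonacci (suc (suc g))
growth Y Y≼2 Y²≼ zero = ⊗-mono {𝟙} {ι 2} {𝟙} (ι-mono (s≤s z≤n)) 𝟙≼fibonacci₂ ∘⟨ proj₂ (⊗-identityˡ 𝟙) ⟩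
  where
  _∘⟨_⟩ : ∀ {a b c} → b ≼ c → a ≼ b → a ≼ c
  q ∘⟨ p ⟩ = ≼-trans p q
growth Y Y≼2 Y²≼ (suc zero) = ⊗-mono Y≼2 (≼-trans 𝟙≼fibonacci₂ (≼-trans (≼-⊕ˡ _ (fibonacci 1)) (fibonacci-rec 1)))
growth Y Y≼2 Y²≼ (suc (suc g)) = begin
  Y ⊗ (Y ⊗ Y ^^ g)                                                        ≈⟨ ⊗-assoc Y Y _ ⟨
  (Y ⊗ Y) ⊗ Y ^^ g                                                        ≤⟨ ⊗-monoˡ _ Y²≼ ⟩
  (Y ⊕ 𝟙) ⊗ Y ^^ g                                                        ≈⟨ ⊗-distribʳ-⊕ _ Y 𝟙 ⟩
  Y ^^ suc g ⊕ 𝟙 ⊗ Y ^^ g                                                 ≤⟨ ⊕-mono (growth Y Y≼2 Y²≼ (suc g)) (≼-trans (≈⇒≼ (⊗-identityˡ _)) (growth Y Y≼2 Y²≼ g)) ⟩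
  ι 2 ⊗ fibonacci (suc (suc (suc g))) ⊕ ι 2 ⊗ fibonacci (suc (suc g))     ≈⟨ ⊗-distribˡ-⊕ (ι 2) _ _ ⟨
  ι 2 ⊗ (fibonacci (suc (suc (suc g))) ⊕ fibonacci (suc (suc g)))         ≤⟨ ⊗-monoʳ (ι 2) (fibonacci-rec (suc (suc g))) ⟩
  ι 2 ⊗ fibonacci (suc (suc (suc (suc g))))                               ∎
  where open ≼-Reasoning

cardSg-growth : ∀ Y → Y ≼ ι 2 → Y ⊗ Y ≼ Y ⊕ 𝟙 → ∀ g → Y ^^ g ≼ ι 2 ⊗ ι (cardSg (suc (suc g)))
cardSg-growth Y Y≼2 Y²≼ g = ≼-trans (growth Y Y≼2 Y²≼ g) (⊗-monoʳ (ι 2) (fibonacci≼cardSg (suc g)))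

-- Embedding dimension and type of typical words

ones twos : {n : ℕ} → Vec ℕ n → ℕ
ones {n} w = countUpTo n (λ i → kw w i ≡ᵇ 1)
twos {n} w = countUpTo n (λ i → kw w i ≡ᵇ 2)

-- A word that behaves like a typical one: beyond position 2r every residue is a
-- sum of two generators below 2m, no depth exceeds 3, and no small gap between
-- r and n - r is pseudo-Frobenius.
record Typical {n : ℕ} (w : Vec ℕ n) (r : ℕ) : Set where
  field
    sums    : ∀ l → r + r ≤ l → l < n → ∃[ i ] ∃[ j ] (suc (i + j) ≡ l × kw w i ≡ 1 × kw w j ≡ 1)
    depth≤3 : ∀ l → l < n → kw w l ≤ 3
    escapes : ∀ z → r ≤ z → z + r ≤ n → ∃[ j ] (j + z < n × kw w j ≡ 1 × 2 ≤ kw w (j + z))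

module Invariants {L n : ℕ} {v : Vec Bool L} {w : Vec ℕ n} {r : ℕ} (k : KunzWord v n w) (typ : Typical w r) where
  open KunzWord k
  open IsSemigroup isSg
  open Typical typ
  open +-*-Solver using (solve; _:=_; _:+_; _:*_; con)

  private
    m : ℕ
    m = suc n
    K : ℕ → ℕ
    K = kw w

  K≤2 : ∀ l → r + r ≤ l → l < n → K l ≤ 2
  K≤2 l p l<n with sums l p l<n
  ... | i , j , refl , Ki , Kj = ≤-trans (kunz-< i j l<n) (≤-reflexive (cong₂ _+_ Ki Kj))

  K≡1⇒i<n : ∀ i j → suc (i + j) < n → i < n × j < n
  K≡1⇒i<n i j p = ≤-<-trans (m≤m+n i j) (<-trans ≤-refl p) , ≤-<-trans (m≤n+m j i) (<-trans ≤-refl p)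

  in⁺ : ∀ i j → i < n → K i ≤ j → mem v (suc i + j * m) ≡ true
  in⁺ i j i<n p = trans (kw∈ i j i<n) (≤ᵇ-true p)

  in⁻ : ∀ i j → i < n → mem v (suc i + j * m) ≡ true → K i ≤ j
  in⁻ i j i<n p = ≤ᵇ-true⁻ (trans (sym (kw∈ i j i<n)) p)

  out⁻ : ∀ i j → i < n → mem v (suc i + j * m) ≡ false → j < K i
  out⁻ i j i<n p = ≤ᵇ-false⁻ (trans (sym (kw∈ i j i<n)) p)

  out⁺ : ∀ i j → i < n → j < K i → mem v (suc i + j * m) ≡ false
  out⁺ i j i<n p = trans (kw∈ i j i<n) (≤ᵇ-false p)

  data Residue : ℕ → Set where
    multiple : ∀ j → Residue (j * m)
    other    : ∀ i j → i < n → Residue (suc i + j * m)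

  residue : ∀ x → Residue x
  residue x = subst Residue (sym (m≡m%n+[m/n]*n x m)) (go (x % m) (x / m) (m%n<n x m))
    where
    go : ∀ r j → r < m → Residue (r + j * m)
    go zero    j _         = multiple j
    go (suc i) j (s≤s i<n) = other i j i<n

  member≥m : ∀ x → 1 ≤ x → mem v x ≡ true → m ≤ x
  member≥m (suc x) _ x∈ with suc x <? m
  ... | no x≮m        = ≮⇒≥ x≮m
  ... | yes (s≤s x<n) = case trans (sym x∈) (below-mult x x<n) of λ ()

  n≤L : n ≤ L
  n≤L = ≮⇒≥ (λ L<n → case trans (sym (beyond n (<⇒≤ L<n))) (gap n L<n ≤-refl) of λ ())
    where
    gap : ∀ x → L < x → x ≤ n → mem v x ≡ false
    gap (suc x) _ x<n = below-mult x x<n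

  Indecomposable : ℕ → Set
  Indecomposable a = ∀ x y → x + y ≡ a → 1 ≤ x → 1 ≤ y → mem v x ≡ true → mem v y ≡ true → ⊥

  atom⁻ : ∀ {a} → isAtom v a ≡ true → mem v a ≡ true × 1 ≤ a ×
    Indecomposable a
  atom⁻ {a} p with ∧-true⁻ {mem v a} p
  ... | a∈ , p′ with ∧-true⁻ {1 ≤ᵇ a} p′
  ... | 1≤a , p″ = a∈ , ≤ᵇ-true⁻ 1≤a , indecomposable
    where
    indecomposable : Indecomposable a
    indecomposable x y refl 1≤x 1≤y x∈ y∈ = true≢false (trans (sym
      (anyUpTo⁺ (x + y) x (m<m+n x 1≤y) (∧-true (≤ᵇ-true 1≤x) (∧-true x∈ (trans (cong (mem v) (m+n∸m≡n x y)) y∈)))))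
      (not-true⁻ p″))

  -- Nonzero members are at least `m`, so a decomposable number is at least `2m`.
  atom⁺ : ∀ {a} → mem v a ≡ true → 1 ≤ a → a < m + m → isAtom v a ≡ true
  atom⁺ {a} a∈ 1≤a a<2m = ∧-true a∈ (∧-true (≤ᵇ-true 1≤a) (cong not (¬true⇒false decomposable)))
    where
    decomposable : anyUpTo a (λ x → (1 ≤ᵇ x) ∧ mem v x ∧ mem v (a ∸ x)) ≢ true
    decomposable p with anyUpTo⁻ a p
    ... | x , x<a , q with ∧-true⁻ {1 ≤ᵇ x} q
    ... | 1≤x , q′ with ∧-true⁻ {mem v x} q′
    ... | x∈ , y∈ = <⇒≱ a<2m (≤-trans (+-mono-≤ (member≥m x (≤ᵇ-true⁻ 1≤x) x∈) (member≥m (a ∸ x) (m<n⇒0<n∸m x<a) y∈))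
      (≤-reflexive (m+[n∸m]≡n (<⇒≤ x<a))))

  private
    letter : ℕ → ℕ → Bool
    letter c a = (suc m ≤ᵇ a) ∧ (K (a ∸ suc m) ≡ᵇ c) ∧ (a ∸ suc m <ᵇ n)

    letter⁺ : ∀ c i a → i < n → a ≡ suc i + 1 * m → K i ≡ c → letter c a ≡ true
    letter⁺ c i .(suc i + 1 * m) i<n refl Ki = ∧-true (≤ᵇ-true (≤-trans (m≤m+n (suc m) i) (≤-reflexive e)))
      (∧-true (≡ᵇ-true (trans (cong K f) Ki)) (<ᵇ-true (subst (_< n) (sym f) i<n)))
      where
      e : suc m + i ≡ suc i + 1 * m
      e = solve 2 (λ m i → (con 1 :+ m) :+ i := (con 1 :+ i) :+ con 1 :* m) refl m i
      f : (suc i + 1 * m) ∸ suc m ≡ i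
      f = trans (cong (_∸ suc m) (sym e)) (m+n∸m≡n (suc m) i)

    count-letter : ∀ c N → countUpTo N (letter c) ≤ countUpTo n (λ i → K i ≡ᵇ c)
    count-letter c N = count-shift (suc m) n N inside (λ i i<s → cong (_∧ ((K (i ∸ suc m) ≡ᵇ c) ∧ (i ∸ suc m <ᵇ n))) (≤ᵇ-false i<s))
      where
      inside : ∀ i → suc m ≤ i → i < N → letter c i ≡ true → ∃[ t ] (t < n × i ≡ suc m + t × (K t ≡ᵇ c) ≡ true)
      inside i p _ e with ∧-true⁻ {suc m ≤ᵇ i} e
      ... | _ , e′ with ∧-true⁻ {K (i ∸ suc m) ≡ᵇ c} e′
      ... | Kt , t<n = i ∸ suc m , <ᵇ-true⁻ t<n , sym (m+[n∸m]≡n p) , Kt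

    -- The numbers from `j m` on whose position is below `2r`, where `Typical` does not provide sums
    -- of two ones. They account for error terms of order `r`.
    near : ℕ → ℕ → Bool
    near j = interval (j * m) (suc (r + r))

    near⁺ : ∀ j i → i < r + r → near j (suc i + j * m) ≡ true
    near⁺ j i p = interval⁺ {j * m} {suc (r + r)} (m≤n+m (j * m) (suc i))
      (≤-trans (≤-reflexive (cong suc (+-comm (suc i) (j * m))))
        (≤-trans (≤-reflexive (sym (+-suc (j * m) (suc i)))) (+-monoʳ-≤ (j * m) (s≤s p))))

  ones≤edim : ones w ≤ edim v
  ones≤edim = begin
    ones w                                         ≤⟨ count-mono n atomic ⟩
    countUpTo n (λ i → isAtom v (suc m + i))       ≤⟨ m≤n+m _ _ ⟩
    countUpTo (suc m) (isAtom v) + countUpTo n (λ i → isAtom v (suc m + i))  ≡⟨ count-split (suc m) n (isAtom v) ⟨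
    countUpTo (suc m + n) (isAtom v)               ≤⟨ count-lengthen (isAtom v) (s≤s (s≤s (+-mono-≤ n≤L n≤L))) ⟩
    edim v                                         ∎
    where
    open ≤-Reasoning
    atomic : ∀ i → i < n → (K i ≡ᵇ 1) ≡ true → isAtom v (suc m + i) ≡ true
    atomic i i<n e = atom⁺ (subst (λ z → mem v z ≡ true) eq (in⁺ i 1 i<n (≤-reflexive (≡ᵇ-true⁻ e)))) (s≤s z≤n)
      (≤-trans (≤-reflexive (cong suc (sym (+-suc m i)))) (s≤s (+-monoʳ-≤ m i<n) ∘≤ ≤-reflexive (sym (+-suc m n))))
      where
      eq : suc i + 1 * m ≡ suc m + i
      eq = solve 2 (λ m i → (con 1 :+ i) :+ con 1 :* m := (con 1 :+ m) :+ i) refl m i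
      _∘≤_ : ∀ {a b c} → a ≤ b → b ≤ c → a ≤ c
      p ∘≤ q = ≤-trans p q

  -- A class of depth 2 beyond position `2r` has its least element split by `sums` into two
  -- generators, and depth 3 occurs only before `2r`. What remains are the ones and the few classes
  -- near the start.
  minimal-atom : ∀ i j → i < n → K i ≡ j → Indecomposable (suc i + j * m) →
    (interval m 1 (suc i + j * m) ∨ letter 1 (suc i + j * m) ≡ true) ⊎ (near 2 (suc i + j * m) ∨ near 3 (suc i + j * m) ≡ true)
  minimal-atom i 1 i<n eqK _ = inj₁ (∨-trueʳ {interval m 1 (suc i + 1 * m)} (letter⁺ 1 i _ i<n refl eqK))
  minimal-atom i 3 i<n eqK _ = inj₂ (∨-trueʳ {near 2 (suc i + 3 * m)} (near⁺ 3 i (≰⇒> (λ p → <⇒≱ (≤-reflexive (sym eqK)) (K≤2 i p i<n)))))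
  minimal-atom i (suc (suc (suc (suc j)))) i<n eqK _ = ⊥-elim (<⇒≱ (≤-trans (s≤s (s≤s (s≤s (s≤s z≤n)))) (≤-reflexive (sym eqK))) (depth≤3 i i<n))
  minimal-atom i 2 i<n eqK ind = inj₂ (∨-trueˡ (near⁺ 2 i (≰⇒> decomposes)))
    where
    decomposes : r + r ≤ i → ⊥
    decomposes p with sums i p i<n
    ... | i′ , j′ , refl , Ki′ , Kj′ = ind (suc i′ + 1 * m) (suc j′ + 1 * m) (e i′ j′ m) (s≤s z≤n) (s≤s z≤n)
      (in⁺ i′ 1 (proj₁ (K≡1⇒i<n i′ j′ i<n)) (≤-reflexive Ki′)) (in⁺ j′ 1 (proj₂ (K≡1⇒i<n i′ j′ i<n)) (≤-reflexive Kj′))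
      where
      e : ∀ i j m → (suc i + 1 * m) + (suc j + 1 * m) ≡ suc (suc (i + j)) + 2 * m
      e = solve 3 (λ i j m → ((con 1 :+ i) :+ con 1 :* m) :+ ((con 1 :+ j) :+ con 1 :* m) := (con 2 :+ (i :+ j)) :+ con 2 :* m) refl

  atom-location : ∀ a → isAtom v a ≡ true → (interval m 1 a ∨ letter 1 a ≡ true) ⊎ (near 2 a ∨ near 3 a ≡ true)
  atom-location a p with atom⁻ p | residue a
  ... | a∈ , 1≤a , ind | multiple zero          = ⊥-elim (<⇒≱ 1≤a z≤n)
  ... | a∈ , 1≤a , ind | multiple (suc zero)    = inj₁ (∨-trueˡ (interval⁺ {m} {1} (m≤m+n m 0)
        (≤-reflexive (trans (cong suc (+-identityʳ m)) (+-comm 1 m)))))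
  ... | a∈ , 1≤a , ind | multiple (suc (suc j)) = ⊥-elim (ind m (suc j * m) refl (s≤s z≤n) (s≤s z≤n) mult∈ (multiples∈ isSg (suc j)))
  ... | a∈ , 1≤a , ind | other i j i<n with <-cmp (K i) j
  ...   | tri> _ _ j<K = ⊥-elim (<⇒≱ j<K (in⁻ i j i<n a∈))
  ...   | tri< K<j _ _ = ⊥-elim (not-minimal j K<j refl)
    where
    not-minimal : ∀ j′ → K i < j′ → j′ ≡ j → ⊥
    not-minimal (suc j′) (s≤s K≤j′) refl = ind m (suc i + j′ * m) (e m i (j′ * m)) (s≤s z≤n) (s≤s z≤n) mult∈ (in⁺ i j′ i<n K≤j′)
      where
      e : ∀ m i c → m + (suc i + c) ≡ suc i + (m + c)
      e = solve 3 (λ m i c → m :+ ((con 1 :+ i) :+ c) := (con 1 :+ i) :+ (m :+ c)) refl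
  ...   | tri≈ _ eq _ = minimal-atom i j i<n eq ind

  edim≤ : edim v ≤ (1 + ones w) + (suc (r + r) + suc (r + r))
  edim≤ = ≤-trans (count-∨ N atom-location′) (+-mono-≤
    (≤-trans (count-∨ N (λ a _ → ∨-true⁻ {interval m 1 a})) (+-mono-≤ (count-interval m 1 N) (count-letter 1 N)))
    (≤-trans (count-∨ N (λ a _ → ∨-true⁻ {near 2 a})) (+-mono-≤ (count-interval (2 * m) _ N) (count-interval (3 * m) _ N))))
    where
    N : ℕ
    N = suc (suc (L + L))
    atom-location′ : ∀ a → a < N → isAtom v a ≡ true → (interval m 1 a ∨ letter 1 a ≡ true) ⊎ (near 2 a ∨ near 3 a ≡ true)
    atom-location′ a _ = atom-location a

  pf⁻ : ∀ {P} → isPF v P ≡ true → mem v P ≡ false × (∀ s → 1 ≤ s → mem v s ≡ true → mem v (P + s) ≡ true)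
  pf⁻ {P} p with ∧-true⁻ {not (mem v P)} p
  ... | P∉ , q = not-true⁻ P∉ , absorbs
    where
    absorbs : ∀ s → 1 ≤ s → mem v s ≡ true → mem v (P + s) ≡ true
    absorbs s 1≤s s∈ with s <? L
    ... | no s≮L = beyond (P + s) (≤-trans (≮⇒≥ s≮L) (m≤n+m s P))
    ... | yes s<L with allUpTo⁻ L q s s<L
    ...   | e rewrite ≤ᵇ-true 1≤s | s∈ = e

  pf⁺ : ∀ {P} → mem v P ≡ false → (∀ s → 1 ≤ s → mem v s ≡ true → mem v (P + s) ≡ true) → isPF v P ≡ true
  pf⁺ {P} P∉ absorbs = ∧-true (cong not P∉) (allUpTo⁺ L (λ s _ → test s))
    where
    test : ∀ s → not ((1 ≤ᵇ s) ∧ mem v s) ∨ mem v (P + s) ≡ true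
    test s with 1 ≤ᵇ s in e₁ | mem v s in e₂
    ... | false | _     = refl
    ... | true  | false = refl
    ... | true  | true  = absorbs s (≤ᵇ-true⁻ e₁) e₂

  -- A gap below `m` away from both ends is sent to another gap by the generator that `escapes`
  -- provides. A higher pseudo-Frobenius number `P` has `P + m` in the semigroup, so it is the last
  -- gap of a class of depth at least 2: either a letter 2, or a letter 3 before position `2r`.
  pf-location : ∀ P → isPF v P ≡ true → (interval 0 r P ∨ interval (m ∸ r) r P ≡ true) ⊎ (letter 2 P ∨ near 2 P ≡ true)
  pf-location P p with pf⁻ p | residue P
  ... | P∉ , absorbs | multiple j = case trans (sym (multiples∈ isSg j)) P∉ of λ ()
  ... | P∉ , absorbs | other i zero i<n with suc i + 0 <? r | (suc i + 0) + r ≤? n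
  ...   | yes z<r | _ = inj₁ (∨-trueˡ (interval⁺ {0} {r} z≤n z<r))
  ...   | no _    | no z+r≰n = inj₁ (∨-trueʳ {interval 0 r (suc i + 0)} (interval⁺ {m ∸ r} {r}
            (≤-trans (∸-monoˡ-≤ r (≰⇒> z+r≰n)) (≤-reflexive (m+n∸n≡m (suc i + 0) r)))
            (≤-trans (s≤s (≤-trans (≤-reflexive (+-identityʳ (suc i))) i<n)) (≤-trans (m≤n+m∸n m r) (≤-reflexive (+-comm r (m ∸ r)))))))
  ...   | no z≮r  | yes z+r≤n with escapes (suc i + 0) (≮⇒≥ z≮r) z+r≤n
  ...     | j , j+z<n , Kj , K≥2 = case trans (sym (subst (λ z → mem v z ≡ true) (e i j m)
              (absorbs (suc j + 1 * m) (s≤s z≤n) (in⁺ j 1 (≤-<-trans (m≤m+n j _) j+z<n) (≤-reflexive Kj)))))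
              (out⁺ (j + (suc i + 0)) 1 j+z<n K≥2) of λ ()
    where
    e : ∀ i j m → (suc i + 0) + (suc j + 1 * m) ≡ suc (j + (suc i + 0)) + 1 * m
    e = solve 3 (λ i j m → ((con 1 :+ i) :+ con 0) :+ ((con 1 :+ j) :+ con 1 :* m) := (con 1 :+ (j :+ ((con 1 :+ i) :+ con 0))) :+ con 1 :* m) refl
  pf-location P p | P∉ , absorbs | other i (suc j) i<n = inj₂ (deep j (out⁻ i (suc j) i<n P∉)
      (in⁻ i (suc (suc j)) i<n (subst (λ z → mem v z ≡ true) (e i (j * m) m) (absorbs m (s≤s z≤n) mult∈))))
    where
    e : ∀ i c m → (suc i + (m + c)) + m ≡ suc i + (m + (m + c))
    e = solve 3 (λ i c m → ((con 1 :+ i) :+ (m :+ c)) :+ m := (con 1 :+ i) :+ (m :+ (m :+ c))) refl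
    deep : ∀ j → suc j < K i → K i ≤ suc (suc j) → letter 2 (suc i + suc j * m) ∨ near 2 (suc i + suc j * m) ≡ true
    deep zero          lt le = ∨-trueˡ (letter⁺ 2 i _ i<n refl (≤-antisym le lt))
    deep (suc zero)    lt le = ∨-trueʳ {letter 2 (suc i + 2 * m)} (near⁺ 2 i (≰⇒> (λ p → <⇒≱ lt (K≤2 i p i<n))))
    deep (suc (suc j)) lt le = ⊥-elim (<⇒≱ (≤-trans (s≤s (s≤s (s≤s (s≤s z≤n)))) lt) (depth≤3 i i<n))

  type≤ : type v ≤ (r + r) + (twos w + suc (r + r))
  type≤ = ≤-trans (count-∨ L (λ P _ → pf-location P)) (+-mono-≤
    (≤-trans (count-∨ L (λ P _ → ∨-true⁻ {interval 0 r P})) (+-mono-≤ (count-interval 0 r L) (count-interval (m ∸ r) r L)))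
    (≤-trans (count-∨ L (λ P _ → ∨-true⁻ {letter 2 P})) (+-mono-≤ (count-letter 2 L) (count-interval (2 * m) _ L))))

  -- Any other nonzero member contributes at least one multiple of `m`. If the residues do not wrap,
  -- the sum stays beyond position `2r`, where the depth is at most 2; if they wrap, a further
  -- multiple of `m` is gained and depth at most 3 is enough.
  two-pf : ∀ i → r + r ≤ i → i < n → K i ≡ 2 → isPF v (suc i + 1 * m) ≡ true
  two-pf i p i<n Ki = pf⁺ (out⁺ i 1 i<n (≤-reflexive (sym Ki))) absorbs
    where
    absorbs : ∀ s → 1 ≤ s → mem v s ≡ true → mem v ((suc i + 1 * m) + s) ≡ true
    absorbs s 1≤s s∈ with residue s
    ... | multiple zero    = ⊥-elim (<⇒≱ 1≤s z≤n)
    ... | multiple (suc j) = subst (λ z → mem v z ≡ true) (e i (j * m) m) (in⁺ i (2 + j) i<n (≤-trans (≤-reflexive Ki) (m≤m+n 2 j)))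
      where
      e : ∀ i c m → suc i + (m + (m + c)) ≡ (suc i + 1 * m) + (m + c)
      e = solve 3 (λ i c m → (con 1 :+ i) :+ (m :+ (m :+ c)) := ((con 1 :+ i) :+ con 1 :* m) :+ (m :+ c)) refl
    ... | other i′ j i′<n with in⁻ i′ j i′<n s∈
    absorbs s 1≤s s∈ | other i′ (suc j) i′<n | _ with suc (i + i′) <? n | n ≤? i + i′
    ... | yes lt | _ = subst (λ z → mem v z ≡ true) (e i i′ j m)
          (in⁺ (suc (i + i′)) (2 + j) lt (≤-trans (K≤2 _ (≤-trans p (≤-trans (m≤m+n i i′) (n≤1+n _))) lt) (m≤m+n 2 j)))
      where
      e : ∀ i i′ j m → suc (suc (i + i′)) + (2 + j) * m ≡ (suc i + 1 * m) + (suc i′ + (1 + j) * m)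
      e = solve 4 (λ i i′ j m → (con 2 :+ (i :+ i′)) :+ (con 2 :+ j) :* m := ((con 1 :+ i) :+ con 1 :* m) :+ ((con 1 :+ i′) :+ (con 1 :+ j) :* m)) refl
    ... | no _ | yes n≤ = subst (λ z → mem v z ≡ true) eq (in⁺ l (3 + j) l<n (≤-trans (depth≤3 l l<n) (m≤m+n 3 j)))
      where
      l : ℕ
      l = (i + i′) ∸ n
      l+n : l + n ≡ i + i′
      l+n = m∸n+n≡m n≤
      l<n : l < n
      l<n = +-cancelʳ-< n l n (subst (_< n + n) (sym l+n) (+-mono-< i<n i′<n))
      e : ∀ i i′ l n j → l + n ≡ i + i′ → suc l + (3 + j) * suc n ≡ (suc i + 1 * suc n) + (suc i′ + (1 + j) * suc n)
      e i i′ l n j q = trans (solve 3 (λ l n j → (con 1 :+ l) :+ (con 3 :+ j) :* (con 1 :+ n) := (con 2 :+ (l :+ n)) :+ (con 2 :+ j) :* (con 1 :+ n)) refl l n j)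
        (trans (cong (λ z → (2 + z) + (2 + j) * suc n) q)
          (solve 4 (λ i i′ j m → (con 2 :+ (i :+ i′)) :+ (con 2 :+ j) :* m := ((con 1 :+ i) :+ con 1 :* m) :+ ((con 1 :+ i′) :+ (con 1 :+ j) :* m)) refl i i′ j (suc n)))
      eq : suc l + (3 + j) * m ≡ (suc i + 1 * m) + (suc i′ + suc j * m)
      eq = e i i′ l n j l+n
    ... | no ≮n | no ≰n = subst (λ z → mem v z ≡ true) eq (multiples∈ isSg (3 + j))
      where
      i+i′ : suc (i + i′) ≡ n
      i+i′ = ≤-antisym (≰⇒> ≰n) (≮⇒≥ ≮n)
      eq : (3 + j) * m ≡ (suc i + 1 * m) + (suc i′ + suc j * m)
      eq = trans (cong (_+ (2 + j) * m) (cong suc (sym i+i′)))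
        (solve 4 (λ i i′ j m → (con 2 :+ (i :+ i′)) :+ (con 2 :+ j) :* m := ((con 1 :+ i) :+ con 1 :* m) :+ ((con 1 :+ i′) :+ (con 1 :+ j) :* m)) refl i i′ j m)

  twos≤type : twos w ≤ (r + r) + type v
  twos≤type = ≤-trans (count-∨ n split) (+-mono-≤ (count-interval 0 (r + r) n) shifted)
    where
    split : ∀ i → i < n → (K i ≡ᵇ 2) ≡ true → interval 0 (r + r) i ≡ true ⊎ isPF v (suc m + i) ≡ true
    split i i<n e with i <? r + r
    ... | yes lt = inj₁ (interval⁺ {0} {r + r} z≤n lt)
    ... | no ≮   = inj₂ (subst (λ z → isPF v z ≡ true) (eq m i) (two-pf i (≮⇒≥ ≮) i<n (≡ᵇ-true⁻ e)))
      where
      eq : ∀ m i → suc i + 1 * m ≡ suc m + i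
      eq = solve 2 (λ m i → (con 1 :+ i) :+ con 1 :* m := (con 1 :+ m) :+ i) refl
    shifted : countUpTo n (λ i → isPF v (suc m + i)) ≤ type v
    shifted = begin
      countUpTo n (λ i → isPF v (suc m + i))                               ≤⟨ m≤n+m _ _ ⟩
      countUpTo (suc m) (isPF v) + countUpTo n (λ i → isPF v (suc m + i))  ≡⟨ count-split (suc m) n (isPF v) ⟨
      countUpTo (suc m + n) (isPF v)                                       ≤⟨ count-beyond L (suc m + n) (λ P L≤P → cong (λ b → not b ∧ allUpTo L (λ s → not ((1 ≤ᵇ s) ∧ mem v s) ∨ mem v (P + s))) (beyond P L≤P)) ⟩
      type v                                                               ∎
      where open ≤-Reasoning

-- Sum graphs and the container method

-- Containers for the sum graph, in which i < a and j are adjacent when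
-- 1 + i + j lies in a set Λ ⊆ [a, b).  An independent set of ones is determined
-- up to few possibilities by a small subset F of it: its neighbourhood N is free
-- of ones, and every one has at least half of its neighbours in N.
neighbours : (Λ : ℕ → Bool) (a : ℕ) → (ℕ → Bool) → ℕ → Bool
neighbours Λ a F j = anyUpTo a (λ t → F t ∧ Λ (suc (t + j)))

degree : (Λ : ℕ → Bool) (b : ℕ) → (ℕ → Bool) → ℕ → ℕ
degree Λ b N i = countUpTo b (λ j → Λ (suc (i + j)) ∧ N j)

-- Demanding a positive degree makes the saturated set empty when `Λ` is, where the comparison with
-- half of the full degree would hold trivially.
saturated : (Λ : ℕ → Bool) (b : ℕ) → (ℕ → Bool) → ℕ → Bool
saturated Λ b N i = (1 ≤ᵇ degree Λ b N i) ∧ (countUpTo b Λ ≤ᵇ 2 * degree Λ b N i)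

count-disjoint : ∀ n {f g h : ℕ → Bool} → (∀ i → i < n → f i ≡ true → h i ≡ true) → (∀ i → i < n → g i ≡ true → h i ≡ true) →
  (∀ i → f i ≡ true → g i ≡ false) → countUpTo n f + countUpTo n g ≤ countUpTo n h
count-disjoint n {f} {g} {h} p q d = subst₂ _≤_
  (trans (sumTo-+ n (bit ∘ f) (bit ∘ g)) (sym (cong₂ _+_ (count≡sum n f) (count≡sum n g)))) (sym (count≡sum n h))
  (sumTo-mono n pointwise)
  where
  pointwise : ∀ i → i < n → bit (f i) + bit (g i) ≤ bit (h i)
  pointwise i i<n with f i in ef | g i in eg
  ... | false | false = z≤n
  ... | false | true  = ≤-reflexive (cong bit (sym (q i i<n eg)))
  ... | true  | true  = ⊥-elim (true≢false (trans (sym eg) (d i ef)))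
  ... | true  | false = ≤-reflexive (cong bit (sym (p i i<n ef)))

bit-∧ : ∀ x y → bit (x ∧ y) ≡ bit x * bit y
bit-∧ false y = refl
bit-∧ true  y = sym (+-identityʳ (bit y))

module SumGraph (Λ : ℕ → Bool) (a b : ℕ) (Λ⊆ : ∀ l → Λ l ≡ true → a ≤ l × l < b) where

  private
    D : ℕ
    D = countUpTo b Λ

    Λ-below : ∀ l → l < a → Λ l ≡ false
    Λ-below l l<a = ¬true⇒false (λ e → <⇒≱ l<a (proj₁ (Λ⊆ l e)))

    Λ-above : ∀ l → b ≤ l → Λ l ≡ false
    Λ-above l b≤l = ¬true⇒false (λ e → <⇒≱ (proj₂ (Λ⊆ l e)) b≤l)

  -- All of `Λ` lies above `i`, so each `l` in `Λ` yields a neighbour `l ∸ suc i`: every vertex on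
  -- the left has the same full degree.
  full-degree : ∀ i → i < a → D ≤ countUpTo b (λ j → Λ (suc (i + j)))
  full-degree i i<a = count-shift (suc i) b b
    (λ l p l<b e → l ∸ suc i , ≤-<-trans (m∸n≤m l (suc i)) l<b , sym (m+[n∸m]≡n p) , trans (cong Λ (m+[n∸m]≡n p)) e)
    (λ l l≤i → Λ-below l (<-≤-trans l≤i i<a))

  shifted≤D : ∀ s c → countUpTo c (λ i → Λ (s + i)) ≤ D
  shifted≤D s c = begin
    countUpTo c (λ i → Λ (s + i))                    ≤⟨ m≤n+m _ _ ⟩
    countUpTo s Λ + countUpTo c (λ i → Λ (s + i))    ≡⟨ count-split s c Λ ⟨
    countUpTo (s + c) Λ                              ≤⟨ count-beyond b (s + c) Λ-above ⟩
    D                                                ∎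
    where open ≤-Reasoning

  -- Count the edges into `N` twice. Each saturated vertex sends at least `D / 2` of them, and each
  -- vertex of `N` receives at most `D`.
  saturated-few : (N : ℕ → Bool) → countUpTo a (saturated Λ b N) ≤ 2 * countUpTo b N
  saturated-few N = go D refl
    where
    open ≤-Reasoning
    deg : ℕ → ℕ
    deg = degree Λ b N
    sat : ℕ → Bool
    sat = saturated Λ b N
    deg≤D : ∀ i → deg i ≤ D
    deg≤D i = ≤-trans (count-mono b (λ j _ e → proj₁ (∧-true⁻ {Λ (suc (i + j))} e))) (shifted≤D (suc i) b)
    total-degree : sumTo a deg ≤ countUpTo b N * D
    total-degree = begin
      sumTo a deg
        ≡⟨ sumTo-cong a (λ i _ → trans (count≡sum b _) (sumTo-cong b (λ j _ → bit-∧ (Λ (suc (i + j))) (N j)))) ⟩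
      sumTo a (λ i → sumTo b (λ j → bit (Λ (suc (i + j))) * bit (N j)))
        ≡⟨ sumTo-swap a b _ ⟩
      sumTo b (λ j → sumTo a (λ i → bit (Λ (suc (i + j))) * bit (N j)))
        ≡⟨ sumTo-cong b (λ j _ → sumTo-*ʳ a _ (bit (N j))) ⟩
      sumTo b (λ j → sumTo a (λ i → bit (Λ (suc (i + j)))) * bit (N j))
        ≤⟨ sumTo-mono b (λ j _ → *-monoˡ-≤ (bit (N j)) (≤-trans (≤-reflexive (trans
             (sumTo-cong a (λ i _ → cong (bit ∘ Λ ∘ suc) (+-comm i j))) (sym (count≡sum a _)))) (shifted≤D (suc j) a))) ⟩
      sumTo b (λ j → D * bit (N j))
        ≡⟨ sumTo-cong b (λ j _ → *-comm D (bit (N j))) ⟩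
      sumTo b (λ j → bit (N j) * D)
        ≡⟨ trans (sumTo-*ʳ b _ D) (cong (_* D) (sym (count≡sum b N))) ⟩
      countUpTo b N * D ∎
    sat-degree : ∀ i → bit (sat i) * D ≤ deg i * 2
    sat-degree i with sat i in e
    ... | false = z≤n
    ... | true  = ≤-trans (≤-reflexive (+-identityʳ D)) (≤-trans (≤ᵇ-true⁻ (proj₂ (∧-true⁻ {1 ≤ᵇ deg i} e))) (≤-reflexive (*-comm 2 (deg i))))
    go : ∀ d → D ≡ d → countUpTo a sat ≤ 2 * countUpTo b N
    go zero    D≡0 = ≤-trans (≤-reflexive (count-none a (λ i _ → ¬true⇒false (λ e →
      <⇒≱ (≤ᵇ-true⁻ {1} {deg i} (proj₁ (∧-true⁻ {1 ≤ᵇ deg i} e))) (≤-trans (deg≤D i) (≤-reflexive D≡0)))))) z≤n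
    go (suc d) D≡ = *-cancelʳ-≤ (countUpTo a sat) (2 * countUpTo b N) (suc d) (begin
      countUpTo a sat * suc d            ≡⟨ cong (countUpTo a sat *_) D≡ ⟨
      countUpTo a sat * D                ≡⟨ cong (_* D) (count≡sum a sat) ⟩
      sumTo a (bit ∘ sat) * D            ≡⟨ sumTo-*ʳ a (bit ∘ sat) D ⟨
      sumTo a (λ i → bit (sat i) * D)    ≤⟨ sumTo-mono a (λ i _ → sat-degree i) ⟩
      sumTo a (λ i → deg i * 2)          ≡⟨ sumTo-*ʳ a deg 2 ⟩
      sumTo a deg * 2                    ≤⟨ *-monoˡ-≤ 2 total-degree ⟩
      countUpTo b N * D * 2              ≡⟨ e (countUpTo b N) D ⟩
      2 * countUpTo b N * D              ≡⟨ cong (2 * countUpTo b N *_) D≡ ⟩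
      2 * countUpTo b N * suc d          ∎)
      where
      e : ∀ x d → x * d * 2 ≡ 2 * x * d
      e = solve 2 (λ x d → x :* d :* con 2 := con 2 :* x :* d) refl
        where open +-*-Solver

  module Fingerprint (One : ℕ → Bool) where

    record Print (c : ℕ) : Set where
      field
        F         : ℕ → Bool
        F⊆        : ∀ t → F t ≡ true → t < c × One t ≡ true
        small     : countUpTo a F * D ≤ 2 * countUpTo b (neighbours Λ a F)
        saturates : ∀ i → i < c → One i ≡ true → D ≤ 2 * degree Λ b (neighbours Λ a F) i

    -- Greedy scan. A one enters `F` only if fewer than half of its neighbours are already covered,
    -- so each entry covers at least `D / 2` new vertices, which keeps `F` small; a one that is
    -- passed over already has half of its neighbours covered.
    print : ∀ c → c ≤ a → Print c
    print zero    _   = record { F = λ _ → false ; F⊆ = λ _ ()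
      ; small = ≤-trans (≤-reflexive (cong (_* D) (count-none a (λ _ _ → refl)))) z≤n ; saturates = λ _ () }
    print (suc c) c<a with print c (<⇒≤ c<a)
    ... | P with One c in eo | D ≤? 2 * degree Λ b (neighbours Λ a (Print.F P)) c
    ...   | false | _ = record { F = F ; F⊆ = λ t e → m<n⇒m<1+n (proj₁ (F⊆ t e)) , proj₂ (F⊆ t e) ; small = small ; saturates = sat′ }
      where
      open Print P
      sat′ : ∀ i → i < suc c → One i ≡ true → D ≤ 2 * degree Λ b (neighbours Λ a F) i
      sat′ i i<1+c e with split-< i<1+c
      ... | inj₁ i<c  = saturates i i<c e
      ... | inj₂ refl = ⊥-elim (true≢false (trans (sym e) eo))
    ...   | true | yes D≤ = record { F = F ; F⊆ = λ t e → m<n⇒m<1+n (proj₁ (F⊆ t e)) , proj₂ (F⊆ t e) ; small = small ; saturates = sat′ }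
      where
      open Print P
      sat′ : ∀ i → i < suc c → One i ≡ true → D ≤ 2 * degree Λ b (neighbours Λ a F) i
      sat′ i i<1+c e with split-< i<1+c
      ... | inj₁ i<c  = saturates i i<c e
      ... | inj₂ refl = D≤
    ...   | true | no D≰ = record { F = F′ ; F⊆ = F′⊆ ; small = small′ ; saturates = sat′ }
      where
      open Print P
      open ≤-Reasoning
      N : ℕ → Bool
      N = neighbours Λ a F
      F′ : ℕ → Bool
      F′ t = F t ∨ interval c 1 t
      N′ : ℕ → Bool
      N′ = neighbours Λ a F′
      fresh : ℕ → Bool
      fresh j = Λ (suc (c + j)) ∧ not (N j)
      F′⊆ : ∀ t → F′ t ≡ true → t < suc c × One t ≡ true
      F′⊆ t e with ∨-true⁻ {F t} e
      ... | inj₁ e′ = m<n⇒m<1+n (proj₁ (F⊆ t e′)) , proj₂ (F⊆ t e′)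
      ... | inj₂ e′ with interval⁻ {c} {1} e′
      ...   | c≤t , t<c+1 = subst (t <_) (+-comm c 1) t<c+1 , subst (λ z → One z ≡ true) (≤-antisym c≤t (s≤s⁻¹ (subst (t <_) (+-comm c 1) t<c+1))) eo
      N⊆N′ : ∀ j → N j ≡ true → N′ j ≡ true
      N⊆N′ j e with anyUpTo⁻ a e
      ... | t , t<a , e′ with ∧-true⁻ {F t} e′
      ...   | Ft , Λt = anyUpTo⁺ a t t<a (∧-true (∨-trueˡ Ft) Λt)
      Λ⊆N′ : ∀ j → Λ (suc (c + j)) ≡ true → N′ j ≡ true
      Λ⊆N′ j e = anyUpTo⁺ a c c<a (∧-true (∨-trueʳ {F c} (interval⁺ {c} {1} ≤-refl (m<m+n c z<s))) e)
      grows : countUpTo b N + countUpTo b fresh ≤ countUpTo b N′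
      grows = count-disjoint b (λ j _ → N⊆N′ j) (λ j _ e → Λ⊆N′ j (proj₁ (∧-true⁻ {Λ (suc (c + j))} e)))
        (λ j e → ¬true⇒false (λ e′ → true≢false (trans (sym (proj₂ (∧-true⁻ {Λ (suc (c + j))} e′))) (cong not e))))
      D≤2fresh : D ≤ 2 * countUpTo b fresh
      D≤2fresh = +-cancelʳ-≤ (2 * degree Λ b N c) D (2 * countUpTo b fresh) (begin
        D + 2 * degree Λ b N c                                ≤⟨ +-monoʳ-≤ D (<⇒≤ (≰⇒> D≰)) ⟩
        D + D                                                 ≤⟨ +-mono-≤ D≤ D≤ ⟩
        (degree Λ b N c + countUpTo b fresh) + (degree Λ b N c + countUpTo b fresh)  ≡⟨ e (degree Λ b N c) (countUpTo b fresh) ⟩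
        2 * countUpTo b fresh + 2 * degree Λ b N c            ∎)
        where
        e : ∀ x y → (x + y) + (x + y) ≡ 2 * y + 2 * x
        e = solve 2 (λ x y → (x :+ y) :+ (x :+ y) := con 2 :* y :+ con 2 :* x) refl
          where open +-*-Solver
        D≤ : D ≤ degree Λ b N c + countUpTo b fresh
        D≤ = ≤-trans (full-degree c c<a) (count-∨ b covered)
          where
          covered : ∀ j → j < b → Λ (suc (c + j)) ≡ true → (Λ (suc (c + j)) ∧ N j ≡ true) ⊎ (fresh j ≡ true)
          covered j _ e with N j in eN
          ... | true  = inj₁ (∧-true e refl)
          ... | false = inj₂ (∧-true e refl)
      small′ : countUpTo a F′ * D ≤ 2 * countUpTo b N′
      small′ = begin
        countUpTo a F′ * D                               ≤⟨ *-monoˡ-≤ D (≤-trans (count-∨ a (λ t _ → ∨-true⁻ {F t})) (+-monoʳ-≤ (countUpTo a F) (count-interval c 1 a))) ⟩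
        (countUpTo a F + 1) * D                          ≡⟨ *-distribʳ-+ D (countUpTo a F) 1 ⟩
        countUpTo a F * D + 1 * D                        ≤⟨ +-mono-≤ small (≤-trans (≤-reflexive (*-identityˡ D)) D≤2fresh) ⟩
        2 * countUpTo b N + 2 * countUpTo b fresh        ≡⟨ *-distribˡ-+ 2 (countUpTo b N) (countUpTo b fresh) ⟨
        2 * (countUpTo b N + countUpTo b fresh)          ≤⟨ *-monoʳ-≤ 2 grows ⟩
        2 * countUpTo b N′                               ∎
      sat′ : ∀ i → i < suc c → One i ≡ true → D ≤ 2 * degree Λ b N′ i
      sat′ i i<1+c e with split-< i<1+c
      ... | inj₁ i<c  = ≤-trans (saturates i i<c e) (*-monoʳ-≤ 2 (count-mono b (λ j _ e′ →
              let x , y = ∧-true⁻ {Λ (suc (i + j))} e′ in ∧-true x (N⊆N′ j y))))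
      ... | inj₂ refl = ≤-trans (full-degree c c<a) (≤-trans (count-mono b (λ j _ e′ → ∧-true e′ (Λ⊆N′ j e′))) (m≤m+n _ _))

  -- `F` is a vector of the length of the word so that a sum can run over all candidates. The
  -- neighbourhood and the saturated set are then functions of `F` and `Λ` alone and no longer
  -- mention the word.
  record Container (One : ℕ → Bool) (n : ℕ) : Set where
    field
      F    : Vec Bool n
    N : ℕ → Bool
    N = neighbours Λ a (at false F)
    field
      small     : countUpTo n (at false F) * D ≤ 2 * countUpTo b N
      reached   : ∀ j → N j ≡ true → ∃[ t ] (t < a × One t ≡ true × Λ (suc (t + j)) ≡ true)
      contained : ∀ i → i < a → One i ≡ true → 1 ≤ D → saturated Λ b N i ≡ true

  container : ∀ One n → a ≤ n → Container One n
  container One n a≤n = record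
    { F = F̂
    ; small = subst₂ _≤_ (cong (_* D) count-F) (cong (2 *_) (count-cong b (λ j _ → sym (same-N j)))) small
    ; reached = reached
    ; contained = λ i i<a e 1≤D → subst (λ f → f ≡ true) (sym (cong₂ _∧_ (cong (1 ≤ᵇ_) (same-deg i)) (cong (λ z → D ≤ᵇ 2 * z) (same-deg i))))
        (∧-true (≤ᵇ-true (positive (degree Λ b (neighbours Λ a F) i) (≤-trans 1≤D (saturates i i<a e)))) (≤ᵇ-true (saturates i i<a e))) }
    where
    open Fingerprint One
    open Print (print a ≤-refl)
    F̂ : Vec Bool n
    F̂ = tabV n F
    same : ∀ t → t < n → at false F̂ t ≡ F t
    same = at-tabV false n F
    same-N : ∀ j → neighbours Λ a (at false F̂) j ≡ neighbours Λ a F j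
    same-N j = go a a≤n
      where
      go : ∀ c → c ≤ n → anyUpTo c (λ t → at false F̂ t ∧ Λ (suc (t + j))) ≡ anyUpTo c (λ t → F t ∧ Λ (suc (t + j)))
      go zero    _   = refl
      go (suc c) c<n = cong₂ _∨_ (go c (<⇒≤ c<n)) (cong (_∧ Λ (suc (c + j))) (same c c<n))
    same-deg : ∀ i → degree Λ b (neighbours Λ a (at false F̂)) i ≡ degree Λ b (neighbours Λ a F) i
    same-deg i = count-cong b (λ j _ → cong (Λ (suc (i + j)) ∧_) (same-N j))
    count-F : countUpTo a F ≡ countUpTo n (at false F̂)
    count-F = trans (≤-antisym (count-lengthen F a≤n) (count-beyond a n (λ i a≤i → ¬true⇒false (λ e → <⇒≱ (proj₁ (F⊆ i e)) a≤i))))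
      (count-cong n (λ t t<n → sym (same t t<n)))
    positive : ∀ x → 1 ≤ 2 * x → 1 ≤ x
    positive (suc x) _ = s≤s z≤n
    reached : ∀ j → neighbours Λ a (at false F̂) j ≡ true → ∃[ t ] (t < a × One t ≡ true × Λ (suc (t + j)) ≡ true)
    reached j e with anyUpTo⁻ a (trans (sym (same-N j)) e)
    ... | t , t<a , e′ with ∧-true⁻ {F t} e′
    ...   | Ft , Λt = t , t<a , proj₂ (F⊆ t Ft) , Λt

-- Row weights at a single position

≼-via-frac : ∀ {a n d} → ι (suc d) ⊗ a ≼ ι n → a ≼ frac n d
≼-via-frac {a} {n} {d} p = begin
  a                                      ≈⟨ ⊗-identityˡ a ⟨
  𝟙 ⊗ a                                  ≈⟨ ⊗-cong (frac-ι 1 d) ≈-refl ⟨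
  (ι (suc d) ⊗ frac 1 d) ⊗ a             ≈⟨ e (ι (suc d)) (frac 1 d) a ⟩
  (ι (suc d) ⊗ a) ⊗ frac 1 d             ≤⟨ ⊗-monoˡ (frac 1 d) p ⟩
  ι n ⊗ frac 1 d                         ≈⟨ frac-⊗ n 0 1 d ⟩
  frac (n * 1) (d + 0 * suc d)           ≡⟨ cong₂ frac (*-identityʳ n) (+-identityʳ d) ⟩
  frac n d                               ∎
  where
  open ≼-Reasoning
  e : ∀ a b c → (a ⊗ b) ⊗ c ≈ (a ⊗ c) ⊗ b
  e = solve 3 (λ a b c → (a :* b) :* c := (a :* c) :* b) ≈-refl
    where open ℚ₊-Solver

-- The generating polynomial of f 0, …, f (n - 1) without constant term.
horner : ℚ₊ → (ℕ → Bool) → ℕ → ℚ₊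
horner x f zero    = 𝟘
horner x f (suc n) = x ⊗ (ind (f 0) ⊕ horner x (f ∘ suc) n)

horner-mono : ∀ {x y} → x ≼ y → ∀ f n → horner x f n ≼ horner y f n
horner-mono p f zero    = ≼-refl
horner-mono p f (suc n) = ⊗-mono p (⊕-monoʳ (ind (f 0)) (horner-mono p (f ∘ suc) n))

sum≼horner : ∀ A x f n → sumL (upTo A) (λ a → x ^^ suc a ⊗ ind ((a <ᵇ n) ∧ f a)) ≼ horner x f n
sum≼horner zero    x f n    = 𝟘≼
sum≼horner (suc A) x f zero = ≈⇒≼ (≈-trans (sumL-cong (upTo (suc A)) (λ a → ⊗-zeroʳ _)) (sumL-𝟘 (upTo (suc A))))
sum≼horner (suc A) x f (suc n) = begin
  sumL (upTo (suc A)) (λ a → x ^^ suc a ⊗ ind ((a <ᵇ suc n) ∧ f a))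
    ≡⟨ sumL-upTo-suc A _ ⟩
  (x ⊗ 𝟙) ⊗ ind (f 0) ⊕ sumL (upTo A) (λ a → (x ⊗ x ^^ suc a) ⊗ ind ((a <ᵇ n) ∧ f (suc a)))
    ≈⟨ ⊕-cong (⊗-cong (⊗-identityʳ x) ≈-refl) (≈-trans (sumL-cong (upTo A) (λ a → ⊗-assoc x _ _)) (sumL-⊗ˡ (upTo A) x _)) ⟩
  x ⊗ ind (f 0) ⊕ x ⊗ sumL (upTo A) (λ a → x ^^ suc a ⊗ ind ((a <ᵇ n) ∧ f (suc a)))
    ≈⟨ ⊗-distribˡ-⊕ x _ _ ⟨
  x ⊗ (ind (f 0) ⊕ sumL (upTo A) (λ a → x ^^ suc a ⊗ ind ((a <ᵇ n) ∧ f (suc a))))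
    ≤⟨ ⊗-monoʳ x (⊕-monoʳ (ind (f 0)) (sum≼horner A x (f ∘ suc) n)) ⟩
  x ⊗ (ind (f 0) ⊕ horner x (f ∘ suc) n) ∎
  where open ≼-Reasoning

-- 34/55 is slightly larger than 1/φ.
x₀ : ℚ₊
x₀ = frac 34 54

-- Clears the denominator `55 ^ n`, so that row estimates become comparisons of integers decided by
-- evaluation.
horner-numerator : (ℕ → Bool) → ℕ → ℕ
horner-numerator f zero    = 0
horner-numerator f (suc n) = 34 * (bit (f 0) * 55 ^ n + horner-numerator (f ∘ suc) n)

horner-x₀ : ∀ f n → ι (55 ^ n) ⊗ horner x₀ f n ≈ ι (horner-numerator f n)
horner-x₀ f zero    = ⊗-zeroʳ _
horner-x₀ f (suc n) = begin-equality
  ι (55 * 55 ^ n) ⊗ (x₀ ⊗ (ind (f 0) ⊕ horner x₀ (f ∘ suc) n))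
    ≈⟨ ⊗-cong (ι-⊗ 55 (55 ^ n)) ≈-refl ⟩
  (ι 55 ⊗ ι (55 ^ n)) ⊗ (x₀ ⊗ (ind (f 0) ⊕ horner x₀ (f ∘ suc) n))
    ≈⟨ interchange (ι 55) (ι (55 ^ n)) x₀ _ ⟩
  (ι 55 ⊗ x₀) ⊗ (ι (55 ^ n) ⊗ (ind (f 0) ⊕ horner x₀ (f ∘ suc) n))
    ≈⟨ ⊗-cong (frac-ι 34 54) (⊗-distribˡ-⊕ _ _ _) ⟩
  ι 34 ⊗ (ι (55 ^ n) ⊗ ind (f 0) ⊕ ι (55 ^ n) ⊗ horner x₀ (f ∘ suc) n)
    ≈⟨ ⊗-cong ≈-refl (⊕-cong (scale (f 0)) (horner-x₀ (f ∘ suc) n)) ⟩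
  ι 34 ⊗ (ι (bit (f 0) * 55 ^ n) ⊕ ι (horner-numerator (f ∘ suc) n))
    ≈⟨ ⊗-cong ≈-refl (ι-⊕ (bit (f 0) * 55 ^ n) _) ⟨
  ι 34 ⊗ ι (bit (f 0) * 55 ^ n + horner-numerator (f ∘ suc) n)
    ≈⟨ ι-⊗ 34 _ ⟨
  ι (horner-numerator f (suc n)) ∎
  where
  open ≼-Reasoning
  scale : ∀ b → ι (55 ^ n) ⊗ ind b ≈ ι (bit b * 55 ^ n)
  scale true  = ≈-trans (⊗-identityʳ _) (≈-reflexive (cong ι (sym (+-identityʳ (55 ^ n)))))
  scale false = ⊗-zeroʳ _

-- Letters 1 + a that are compatible with the container: a neighbour
-- of a one is at least cap - 1, and ones occur only at saturated positions.
allowed : (cap : ℕ) (sat nbr : Bool) → ℕ → Bool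
allowed cap sat nbr a = not (nbr ∧ (suc a <ᵇ cap ∸ 1)) ∧ (not (suc a ≡ᵇ 1) ∨ sat)

-- The gain factors of a saturated position are chosen so that the row tests below
-- hold at x = 34/55 with the uniform saving κ < 1.
gain-num gain-den : ℕ → ℕ
gain-num 3 = 63
gain-num 4 = 3
gain-num _ = 5
gain-den 3 = 50
gain-den 4 = 2
gain-den _ = 3

-- Equal to 1999/2000. The limiting row is cap 14 with neither flag: at 34/55 the letters 2 to 14
-- weigh about 0.9989. Without a cap the letters from 2 on would weigh 1 at 1/φ, so the bound on the
-- letters is what makes a saving possible.
κ : ℚ₊
κ = frac 9995 9999

bound-num bound-den : ℕ → Bool → Bool → ℕ
bound-num cap sat nbr = 9995 * (if sat then gain-num cap else 1) * (if nbr then gain-den cap * gain-den cap else 1)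
bound-den cap sat nbr = 10000 * (if sat then gain-den cap else 1) * (if nbr then gain-num cap * gain-num cap else 1)

fraction-test : ℕ → ℕ → ℕ → ℕ → ℕ → Bool
fraction-test k h d bn bd = (h * suc k + 1 * d) * bd ≤ᵇ bn * (d * suc k)

fraction-test⁻ : ∀ k h d bn bd → 0 < d → 0 < bd → fraction-test k h d bn bd ≡ true →
  frac h (pred d) ⊕ frac 1 k ≼ frac bn (pred bd)
fraction-test⁻ k h (suc d) bn (suc bd) _ _ e = ≼-trans (≈⇒≼ (frac-⊕ h d 1 k)) (frac-≼ (≤ᵇ-true⁻ {(h * suc k + 1 * suc d) * suc bd} e))

-- The argument 9999 stands for a summand 1/10000, the room left for the penalties of letters above
-- the cap.
row-test : ℕ → Bool → Bool → Bool
row-test cap sat nbr = fraction-test 9999 (horner-numerator (allowed cap sat nbr) cap) (55 ^ cap) (bound-num cap sat nbr) (bound-den cap sat nbr)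

private
  pick : (f : Bool → Bool → Bool) → (f false false ∧ f false true) ∧ (f true false ∧ f true true) ≡ true → ∀ a b → f a b ≡ true
  pick f e false false = proj₁ (∧-true⁻ {f false false} (proj₁ (∧-true⁻ {f false false ∧ f false true} e)))
  pick f e false true  = proj₂ (∧-true⁻ {f false false} (proj₁ (∧-true⁻ {f false false ∧ f false true} e)))
  pick f e true  false = proj₁ (∧-true⁻ {f true false} (proj₂ (∧-true⁻ {f false false ∧ f false true} e)))
  pick f e true  true  = proj₂ (∧-true⁻ {f true false} (proj₂ (∧-true⁻ {f false false ∧ f false true} e)))

  four-tests : ℕ → Bool
  four-tests c = (row-test (3 + c) false false ∧ row-test (3 + c) false true) ∧ (row-test (3 + c) true false ∧ row-test (3 + c) true true)

  all-row-tests : allUpTo 12 four-tests ≡ true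
  all-row-tests = refl

-- Twelve caps, 3 to 14, since letters of words longer than g/7 do not exceed 14.
row-tests : ∀ c → c < 12 → ∀ sat nbr → row-test (3 + c) sat nbr ≡ true
row-tests c c<12 = pick (row-test (3 + c)) (allUpTo⁻ 12 {four-tests} all-row-tests c c<12)

gain loss : ℕ → ℚ₊
gain cap = frac (gain-num cap) (pred (gain-den cap))
loss cap = frac (gain-den cap) (pred (gain-num cap))

private
  product₄ : ∀ a b c d e f → frac a b ⊗ (frac c d ⊗ (frac e f ⊗ frac e f))
    ≈ frac (a * (c * (e * e))) ((f + f * suc f + d * suc (f + f * suc f)) + b * suc (f + f * suc f + d * suc (f + f * suc f)))
  product₄ a b c d e f = ≈-trans (⊗-cong ≈-refl (≈-trans (⊗-cong ≈-refl (frac-⊗ e f e f)) (frac-⊗ c d (e * e) _))) (frac-⊗ a b _ _)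

  product₃ : ∀ a b c d → frac a b ⊗ (frac c d ⊗ 𝟙) ≈ frac (a * c) (d + b * suc d)
  product₃ a b c d = ≈-trans (⊗-cong ≈-refl (⊗-identityʳ _)) (frac-⊗ a b c d)

  via₃ : ∀ {n m} a b c d → (n * suc (d + b * suc d) ≤ᵇ (a * c) * suc m) ≡ true → frac n m ≼ frac a b ⊗ (frac c d ⊗ 𝟙)
  via₃ a b c d e = ≼-trans (frac-≼ (≤ᵇ-true⁻ e)) (proj₂ (product₃ a b c d))

  via₄ : ∀ {n m} a b c d e f → (n * suc ((f + f * suc f + d * suc (f + f * suc f)) + b * suc (f + f * suc f + d * suc (f + f * suc f)))
    ≤ᵇ (a * (c * (e * e))) * suc m) ≡ true → frac n m ≼ frac a b ⊗ (frac c d ⊗ (frac e f ⊗ frac e f))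
  via₄ a b c d e f p = ≼-trans (frac-≼ (≤ᵇ-true⁻ p)) (proj₂ (product₄ a b c d e f))

bound≼ : ∀ c sat nbr → frac (bound-num (3 + c) sat nbr) (pred (bound-den (3 + c) sat nbr))
  ≼ κ ⊗ (gain (3 + c) ^ᵇ sat ⊗ (loss (3 + c) ⊗ loss (3 + c)) ^ᵇ nbr)
bound≼ 0 false false = via₃ 9995 9999 1 0 refl
bound≼ 0 true  false = via₃ 9995 9999 63 49 refl
bound≼ 0 false true  = via₄ 9995 9999 1 0 50 62 refl
bound≼ 0 true  true  = via₄ 9995 9999 63 49 50 62 refl
bound≼ 1 false false = via₃ 9995 9999 1 0 refl
bound≼ 1 true  false = via₃ 9995 9999 3 1 refl
bound≼ 1 false true  = via₄ 9995 9999 1 0 2 2 refl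
bound≼ 1 true  true  = via₄ 9995 9999 3 1 2 2 refl
bound≼ (suc (suc c)) false false = via₃ 9995 9999 1 0 refl
bound≼ (suc (suc c)) true  false = via₃ 9995 9999 5 2 refl
bound≼ (suc (suc c)) false true  = via₄ 9995 9999 1 0 3 4 refl
bound≼ (suc (suc c)) true  true  = via₄ 9995 9999 5 2 3 4 refl

gain-facts : ∀ c → 𝟙 ≼ gain (3 + c) × gain (3 + c) ≼ ι 2 × gain (3 + c) ⊗ loss (3 + c) ≼ 𝟙
gain-facts 0 = frac-≼ (≤ᵇ-true⁻ refl) , frac-≼ (≤ᵇ-true⁻ refl) , ≼-trans (≈⇒≼ (frac-⊗ 63 49 50 62)) (frac-≼ (≤ᵇ-true⁻ refl))
gain-facts 1 = frac-≼ (≤ᵇ-true⁻ refl) , frac-≼ (≤ᵇ-true⁻ refl) , ≼-trans (≈⇒≼ (frac-⊗ 3 1 2 2)) (frac-≼ (≤ᵇ-true⁻ refl))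
gain-facts (suc (suc c)) = frac-≼ (≤ᵇ-true⁻ refl) , frac-≼ (≤ᵇ-true⁻ refl) , ≼-trans (≈⇒≼ (frac-⊗ 5 2 3 4)) (frac-≼ (≤ᵇ-true⁻ refl))

bound-den>0 : ∀ c sat nbr → 0 < bound-den (3 + c) sat nbr
bound-den>0 0 false false = z<s
bound-den>0 0 false true  = z<s
bound-den>0 0 true  false = z<s
bound-den>0 0 true  true  = z<s
bound-den>0 1 false false = z<s
bound-den>0 1 false true  = z<s
bound-den>0 1 true  false = z<s
bound-den>0 1 true  true  = z<s
bound-den>0 (suc (suc c)) false false = z<s
bound-den>0 (suc (suc c)) false true  = z<s
bound-den>0 (suc (suc c)) true  false = z<s
bound-den>0 (suc (suc c)) true  true  = z<s

≼-via-frac′ : ∀ {a n} d → 0 < d → ι d ⊗ a ≼ ι n → a ≼ frac n (pred d)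
≼-via-frac′ (suc d) _ p = ≼-via-frac p

horner-test⁻ : ∀ cap sat nbr → 0 < bound-den cap sat nbr → row-test cap sat nbr ≡ true →
  horner x₀ (allowed cap sat nbr) cap ⊕ frac 1 9999 ≼ frac (bound-num cap sat nbr) (pred (bound-den cap sat nbr))
horner-test⁻ cap sat nbr den>0 e = ≼-trans
  (⊕-monoˡ (frac 1 9999) (≼-via-frac′ (55 ^ cap) (m^n>0 55 cap) (≈⇒≼ (horner-x₀ (allowed cap sat nbr) cap))))
  (fraction-test⁻ 9999 (horner-numerator (allowed cap sat nbr) cap) (55 ^ cap) (bound-num cap sat nbr) (bound-den cap sat nbr)
    (m^n>0 55 cap) den>0 e)

horner-bound : ∀ c → c < 12 → ∀ sat nbr → horner x₀ (allowed (3 + c) sat nbr) (3 + c) ⊕ frac 1 9999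
  ≼ κ ⊗ (gain (3 + c) ^ᵇ sat ⊗ (loss (3 + c) ⊗ loss (3 + c)) ^ᵇ nbr)
horner-bound c c<12 sat nbr = ≼-trans (horner-test⁻ (3 + c) sat nbr (bound-den>0 c sat nbr) (row-tests c c<12 sat nbr)) (bound≼ c sat nbr)

-- Weight of the letter 1 + a at a position with the given cap; letters above the
-- cap are exceptional and cost the penalty p.
capped : (p : ℚ₊) (cap : ℕ) (f : ℕ → Bool) → ℕ → ℚ₊
capped p cap f a = if a <ᵇ cap then ind (f a) else p

local : (p : ℚ₊) (cap : ℕ) (sat nbr : Bool) → ℕ → ℚ₊
local p cap sat nbr = capped p cap (allowed cap sat nbr)

geometric₃ : ∀ A x → x ≼ frac 2 2 → sumL (upTo A) (λ a → x ^^ a) ≼ ι 3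
geometric₃ A x x≼ = geometric A (≼-trans (⊕-monoʳ 𝟙 (⊗-monoˡ (ι 3) x≼)) (≼-trans (⊕-monoʳ 𝟙 (≈⇒≼ (frac-⊗ 2 2 3 0)))
  (≼-trans (≈⇒≼ (frac-⊕ 1 0 6 2)) (frac-≼ (≤ᵇ-true⁻ refl)))))

sum-^^suc≼3 : ∀ A x → x ≼ frac 2 2 → sumL (upTo A) (λ a → x ^^ suc a) ≼ ι 3
sum-^^suc≼3 A x x≼ = ≼-trans (sumL-mono (upTo A) (λ a → ≼-trans (⊗-monoˡ _ (≼-trans x≼ (frac-≼ (≤ᵇ-true⁻ refl)))) (≈⇒≼ (⊗-identityˡ _))))
  (geometric₃ A x x≼)

capped-row : ∀ A x p cap f → x ≼ frac 2 2 →
  sumL (upTo A) (λ a → x ^^ suc a ⊗ capped p cap f a) ≼ horner x f cap ⊕ ι 3 ⊗ p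
capped-row A x p cap f x≼ = begin
  sumL (upTo A) (λ a → x ^^ suc a ⊗ capped p cap f a)
    ≤⟨ sumL-mono (upTo A) (λ a → ≼-trans (⊗-monoʳ _ (split a)) (≈⇒≼ (⊗-distribˡ-⊕ _ _ _))) ⟩
  sumL (upTo A) (λ a → x ^^ suc a ⊗ ind ((a <ᵇ cap) ∧ f a) ⊕ x ^^ suc a ⊗ p)
    ≈⟨ sumL-⊕ (upTo A) _ _ ⟩
  sumL (upTo A) (λ a → x ^^ suc a ⊗ ind ((a <ᵇ cap) ∧ f a)) ⊕ sumL (upTo A) (λ a → x ^^ suc a ⊗ p)
    ≤⟨ ⊕-mono (sum≼horner A x f cap) (≼-trans (≈⇒≼ (sumL-⊗ʳ (upTo A) p _)) (⊗-monoˡ p (sum-^^suc≼3 A x x≼))) ⟩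
  horner x f cap ⊕ ι 3 ⊗ p ∎
  where
  open ≼-Reasoning
  split : ∀ a → capped p cap f a ≼ ind ((a <ᵇ cap) ∧ f a) ⊕ p
  split a with a <ᵇ cap
  ... | true  = ≼-⊕ˡ _ p
  ... | false = ≼-⊕ʳ 𝟘 p

horner₂≼ : ∀ {x} f → x ⊕ x ⊗ x ≼ 𝟙 → horner x f 2 ≼ 𝟙
horner₂≼ {x} f x+x²≼ = begin
  x ⊗ (ind (f 0) ⊕ x ⊗ (ind (f 1) ⊕ 𝟘))  ≤⟨ ⊗-monoʳ x (⊕-mono (ind≼𝟙 (f 0)) (⊗-monoʳ x (≼-trans (≈⇒≼ (⊕-identityʳ _)) (ind≼𝟙 (f 1))))) ⟩
  x ⊗ (𝟙 ⊕ x ⊗ 𝟙)                      ≈⟨ ≈-trans (⊗-distribˡ-⊕ x 𝟙 _) (⊕-cong (⊗-identityʳ x) (⊗-cong ≈-refl (⊗-identityʳ x))) ⟩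
  x ⊕ x ⊗ x                            ≤⟨ x+x²≼ ⟩
  𝟙                                    ∎
  where open ≼-Reasoning

x₀≼2/3 : x₀ ≼ frac 2 2
x₀≼2/3 = frac-≼ (≤ᵇ-true⁻ refl)

local-row-bound : ∀ A x p c sat nbr → c < 12 → x ≼ x₀ → ι 3 ⊗ p ≼ frac 1 9999 →
  sumL (upTo A) (λ a → x ^^ suc a ⊗ local p (3 + c) sat nbr a) ≼ κ ⊗ (gain (3 + c) ^ᵇ sat ⊗ (loss (3 + c) ⊗ loss (3 + c)) ^ᵇ nbr)
local-row-bound A x p c sat nbr c<12 x≼ p≼ = ≼-trans (capped-row A x p (3 + c) (allowed (3 + c) sat nbr) (≼-trans x≼ x₀≼2/3))
  (≼-trans (⊕-mono (horner-mono x≼ (allowed (3 + c) sat nbr) (3 + c)) p≼) (horner-bound c c<12 sat nbr))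

-- With cap 2 nothing is gained, but x + x² ≤ 1 keeps the row below 1 + 3p.
local-row-bound₂ : ∀ A x p sat nbr → x ≼ x₀ → x ⊕ x ⊗ x ≼ 𝟙 →
  sumL (upTo A) (λ a → x ^^ suc a ⊗ local p 2 sat nbr a) ≼ 𝟙 ⊕ ι 3 ⊗ p
local-row-bound₂ A x p sat nbr x≼ x+x²≼ = ≼-trans (capped-row A x p 2 (allowed 2 sat nbr) (≼-trans x≼ x₀≼2/3))
  (⊕-monoˡ _ (horner₂≼ (allowed 2 sat nbr) x+x²≼))

-- A saturated position may carry the letter 1 and is charged `r`; a neighbour of a one loses its
-- small letters and repays `ρ²`, at most `1/r²`. Saturated positions are at most about twice as
-- many as neighbours, so only `factor` survives in the product.
record RowBound (A : ℕ) (x p : ℚ₊) (cap : ℕ) : Set where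
  field
    factor r ρ : ℚ₊
    𝟙≼r : 𝟙 ≼ r
    r≼2 : r ≼ ι 2
    rρ≼𝟙 : r ⊗ ρ ≼ 𝟙
    row : ∀ sat nbr → sumL (upTo A) (λ α → x ^^ suc α ⊗ local p cap sat nbr α) ≼ factor ⊗ (r ^ᵇ sat ⊗ (ρ ⊗ ρ) ^ᵇ nbr)

𝟙^ᵇ : ∀ b → 𝟙 ^ᵇ b ≈ 𝟙
𝟙^ᵇ true  = ≈-refl
𝟙^ᵇ false = ≈-refl

rowBound₂ : ∀ A x p → x ≼ x₀ → x ⊕ x ⊗ x ≼ 𝟙 → RowBound A x p 2
rowBound₂ A x p x≼ x+x² = record
  { factor = 𝟙 ⊕ ι 3 ⊗ p ; r = 𝟙 ; ρ = 𝟙 ; 𝟙≼r = ≼-refl ; r≼2 = ι-mono (s≤s z≤n) ; rρ≼𝟙 = ≈⇒≼ (⊗-identityˡ 𝟙)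
  ; row = λ sat nbr → ≼-trans (local-row-bound₂ A x p sat nbr x≼ x+x²) (≼-trans (proj₂ (⊗-identityʳ _))
      (⊗-monoʳ _ (proj₂ (≈-trans (⊗-cong (𝟙^ᵇ sat) (≈-trans (^ᵇ-cong nbr) (𝟙^ᵇ nbr))) (⊗-identityˡ 𝟙))))) }
  where
  ^ᵇ-cong : ∀ b → (𝟙 ⊗ 𝟙) ^ᵇ b ≈ 𝟙 ^ᵇ b
  ^ᵇ-cong true  = ⊗-identityˡ 𝟙
  ^ᵇ-cong false = ≈-refl

rowBound₃ : ∀ A x p c → c < 12 → x ≼ x₀ → ι 3 ⊗ p ≼ frac 1 9999 → RowBound A x p (3 + c)
rowBound₃ A x p c c<12 x≼ p≼ = record
  { factor = κ ; r = gain (3 + c) ; ρ = loss (3 + c)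
  ; 𝟙≼r = proj₁ (gain-facts c) ; r≼2 = proj₁ (proj₂ (gain-facts c)) ; rρ≼𝟙 = proj₂ (proj₂ (gain-facts c))
  ; row = λ sat nbr → local-row-bound A x p c sat nbr c<12 x≼ p≼ }

-- Here `c` counts the saturated positions, `ν` the neighbours outside the block and `s` the length
-- of the block. Two gains are paid by one neighbour, and at most `2s` gains, each at most 2, are
-- left over.
gain-cancel : ∀ {r ρ} c ν s → 𝟙 ≼ r → r ≼ ι 2 → r ⊗ ρ ≼ 𝟙 → c ≤ 2 * (ν + s) → r ^^ c ⊗ (ρ ⊗ ρ) ^^ ν ≼ ι 4 ^^ s
gain-cancel {r} {ρ} c ν s 1≼r r≼2 rρ≼1 c≤ = begin
  r ^^ c ⊗ (ρ ⊗ ρ) ^^ ν                            ≤⟨ ⊗-monoˡ _ (^^-monoʳ 1≼r c≤) ⟩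
  r ^^ (2 * (ν + s)) ⊗ (ρ ⊗ ρ) ^^ ν                ≈⟨ ⊗-cong (≈-trans (^^-* r 2 (ν + s)) (^^-+ (r ^^ 2) ν s)) ≈-refl ⟩
  ((r ^^ 2) ^^ ν ⊗ (r ^^ 2) ^^ s) ⊗ (ρ ⊗ ρ) ^^ ν   ≈⟨ e _ _ _ ⟩
  ((r ^^ 2) ^^ ν ⊗ (ρ ⊗ ρ) ^^ ν) ⊗ (r ^^ 2) ^^ s   ≈⟨ ⊗-cong (^^-⊗ (r ^^ 2) (ρ ⊗ ρ) ν) ≈-refl ⟨
  (r ^^ 2 ⊗ (ρ ⊗ ρ)) ^^ ν ⊗ (r ^^ 2) ^^ s          ≤⟨ ⊗-mono (^^≼𝟙 ν cancels) (^^-mono s square) ⟩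
  𝟙 ⊗ ι 4 ^^ s                                     ≈⟨ ⊗-identityˡ _ ⟩
  ι 4 ^^ s                                         ∎
  where
  open ≼-Reasoning
  e : ∀ a b c → (a ⊗ b) ⊗ c ≈ (a ⊗ c) ⊗ b
  e = solve 3 (λ a b c → (a :* b) :* c := (a :* c) :* b) ≈-refl
    where open ℚ₊-Solver
  r² : r ^^ 2 ≈ r ⊗ r
  r² = ⊗-cong ≈-refl (⊗-identityʳ r)
  cancels : r ^^ 2 ⊗ (ρ ⊗ ρ) ≼ 𝟙
  cancels = ≼-trans (≈⇒≼ (≈-trans (⊗-cong r² ≈-refl) (interchange r r ρ ρ))) (≼-trans (⊗-mono rρ≼1 rρ≼1) (≈⇒≼ (⊗-identityˡ 𝟙)))
  square : r ^^ 2 ≼ ι 4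
  square = ≼-trans (≈⇒≼ r²) (≼-trans (⊗-mono r≼2 r≼2) (proj₂ (ι-⊗ 2 2)))

-- Weight of the words compatible with a container

-- A container for words of length n: Λ ⊆ [a, a + s) marks positions of letters
-- at least q; below a the cap is q and sums lie in Λ, above a + s the cap is
-- q - 1 and the reversed word is used.
module Cover (q a s n : ℕ) (Λv : Vec Bool s) (F₁ F₂ : Vec Bool n) where

  b a₂ b₂ : ℕ
  b  = a + s
  a₂ = n ∸ b
  b₂ = n ∸ a

  Λ₁ Λ₂ N₁ N₂ S₁ S₂ : ℕ → Bool
  Λ₁ l = (l <ᵇ n) ∧ (interval a s l ∧ at false Λv (l ∸ a))
  Λ₂ l = (l <ᵇ n) ∧ Λ₁ (n ∸ suc l)
  N₁ = neighbours Λ₁ a (at false F₁)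
  N₂ = neighbours Λ₂ a₂ (at false F₂)
  S₁ = saturated Λ₁ b N₁
  S₂ = saturated Λ₂ b₂ N₂

  Λ₁⊆ : ∀ l → Λ₁ l ≡ true → a ≤ l × l < b
  Λ₁⊆ l e = interval⁻ {a} {s} (proj₁ (∧-true⁻ {interval a s l} (proj₂ (∧-true⁻ {l <ᵇ n} e))))

  Λ₂⊆ : ∀ l → Λ₂ l ≡ true → a₂ ≤ l × l < b₂
  Λ₂⊆ l e with ∧-true⁻ {l <ᵇ n} e
  ... | l<n , e′ with Λ₁⊆ (n ∸ suc l) e′
  ... | a≤ , <b = ≤-trans (∸-monoˡ-≤ b upper) (≤-reflexive (m+n∸m≡n b l)) , m+n≤o⇒m≤o∸n (suc l) lower
    where
    rev : n ∸ suc l + suc l ≡ n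
    rev = m∸n+n≡m (<ᵇ-true⁻ l<n)
    upper : n ≤ b + l
    upper = s≤s⁻¹ (subst (λ z → suc z ≤ suc (b + l)) rev (≤-trans (+-monoˡ-≤ (suc l) <b) (≤-reflexive (+-suc b l))))
    lower : suc l + a ≤ n
    lower = subst (suc l + a ≤_) (trans (+-comm (suc l) _) rev) (+-monoʳ-≤ (suc l) a≤)

  -- The block itself is left unconstrained; it is short, and each of its positions costs at most
  -- the factor 3.
  coefficient : ℚ₊ → ℕ → ℕ → ℚ₊
  coefficient p i α = if i <ᵇ a then local p q (S₁ i) (N₁ i) α else
    if i <ᵇ b then 𝟙 else local p (pred q) (S₂ (n ∸ suc i)) (N₂ (n ∸ suc i)) α

  above : ℕ → Bool
  above i = b ≤ᵇ i

  module _ {A : ℕ} {x p : ℚ₊} (x≼ : x ≼ frac 2 2) (R₁ : RowBound A x p q) (R₂ : RowBound A x p (pred q)) (a≤n : a ≤ n) where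
    private
      module R₁ = RowBound R₁
      module R₂ = RowBound R₂

      f₁ f₂ f₃ : ℕ → ℚ₊
      f₁ i = R₁.factor ^ᵇ (i <ᵇ a) ⊗ (R₁.r ^ᵇ ((i <ᵇ a) ∧ S₁ i) ⊗ (R₁.ρ ⊗ R₁.ρ) ^ᵇ ((i <ᵇ a) ∧ N₁ i))
      f₂ i = ι 3 ^ᵇ interval a s i
      f₃ i = R₂.factor ^ᵇ above i ⊗ (R₂.r ^ᵇ (above i ∧ S₂ (n ∸ suc i)) ⊗ (R₂.ρ ⊗ R₂.ρ) ^ᵇ (above i ∧ N₂ (n ∸ suc i)))

      row : ℕ → ℚ₊
      row i = sumL (upTo A) (λ α → x ^^ suc α ⊗ coefficient p i α)

      row≼ : ∀ i → row i ≼ f₁ i ⊗ (f₂ i ⊗ f₃ i)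
      row≼ i with i <? a | i <? b
      ... | yes i<a | _ rewrite <ᵇ-true i<a | ≤ᵇ-false i<a | ≤ᵇ-false {b} {i} (<-≤-trans i<a (m≤m+n a s)) =
        ≼-trans (R₁.row (S₁ i) (N₁ i)) (proj₂ (≈-trans (⊗-cong ≈-refl (≈-trans (⊗-identityˡ _) (≈-trans (⊗-identityˡ _) (⊗-identityˡ _)))) (⊗-identityʳ _)))
      ... | no i≮a  | yes i<b rewrite <ᵇ-false (≮⇒≥ i≮a) | <ᵇ-true i<b | ≤ᵇ-true (≮⇒≥ i≮a) | ≤ᵇ-false {b} {i} i<b =
        ≼-trans (≼-trans (sumL-mono (upTo A) (λ α → ≈⇒≼ (⊗-identityʳ _))) (sum-^^suc≼3 A x x≼))
          (proj₂ (≈-trans (⊗-cong (≈-trans (⊗-identityˡ _) (⊗-identityˡ _)) (≈-trans (⊗-cong ≈-refl (≈-trans (⊗-identityˡ _) (⊗-identityˡ _))) (⊗-identityʳ _))) (⊗-identityˡ _)))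
      ... | no i≮a  | no i≮b rewrite <ᵇ-false (≮⇒≥ i≮a) | <ᵇ-false (≮⇒≥ i≮b) | ≤ᵇ-true (≮⇒≥ i≮a) | ≤ᵇ-true {b} {i} (≮⇒≥ i≮b) =
        ≼-trans (R₂.row (S₂ (n ∸ suc i)) (N₂ (n ∸ suc i)))
          (proj₂ (≈-trans (⊗-cong (≈-trans (⊗-identityˡ _) (⊗-identityˡ _)) (⊗-identityˡ _)) (⊗-identityˡ _)))

      low-count : countUpTo n (λ i → (i <ᵇ a) ∧ S₁ i) ≤ 2 * (countUpTo n (λ i → (i <ᵇ a) ∧ N₁ i) + s)
      low-count = begin
        countUpTo n (λ i → (i <ᵇ a) ∧ S₁ i)
          ≤⟨ count-beyond a n (λ i a≤i → cong (_∧ S₁ i) (<ᵇ-false a≤i)) ⟩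
        countUpTo a (λ i → (i <ᵇ a) ∧ S₁ i)
          ≤⟨ count-mono a (λ i _ e → proj₂ (∧-true⁻ {i <ᵇ a} e)) ⟩
        countUpTo a S₁
          ≤⟨ SumGraph.saturated-few Λ₁ a b Λ₁⊆ N₁ ⟩
        2 * countUpTo b N₁
          ≤⟨ *-monoʳ-≤ 2 (≤-trans (≤-reflexive (count-split a s N₁)) (+-mono-≤ (≤-trans
               (count-mono a (λ i i<a e → ∧-true (<ᵇ-true i<a) e)) (count-lengthen (λ i → (i <ᵇ a) ∧ N₁ i) a≤n)) (count≤ s _))) ⟩
        2 * (countUpTo n (λ i → (i <ᵇ a) ∧ N₁ i) + s) ∎
        where open ≤-Reasoning

      reversed : ∀ (G : ℕ → Bool) → countUpTo n (λ i → above i ∧ G (n ∸ suc i)) ≡ countUpTo n (λ i → above (n ∸ suc i) ∧ G i)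
      reversed G = trans (count-cong n (λ i i<n → cong (λ z → above z ∧ G (n ∸ suc i)) (sym (involutive i i<n))))
        (count-rev n (λ i → above (n ∸ suc i) ∧ G i))
        where
        involutive : ∀ i → i < n → n ∸ suc (n ∸ suc i) ≡ i
        involutive i i<n = trans (cong (n ∸_) (sym (+-∸-assoc 1 i<n))) (m∸[m∸n]≡n (<⇒≤ i<n))

      above⇒<a₂ : ∀ i → i < n → above (n ∸ suc i) ≡ true → i < a₂
      above⇒<a₂ i i<n e = m+n≤o⇒m≤o∸n (suc i) (≤-trans (+-monoʳ-≤ (suc i) (≤ᵇ-true⁻ {b} {n ∸ suc i} e)) (≤-reflexive (m+[n∸m]≡n i<n)))

      <a₂⇒above : ∀ i → i < a₂ → above (n ∸ suc i) ≡ true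
      <a₂⇒above i i<a₂ = ≤ᵇ-true (m+n≤o⇒m≤o∸n b (subst (_≤ n) (+-comm (suc i) b) (≤-trans (+-monoˡ-≤ b i<a₂)
        (≤-reflexive (m∸n+n≡m {n} {b} (<⇒≤ (m∸n≢0⇒n<m (λ a₂≡0 → <⇒≱ i<a₂ (≤-trans (≤-reflexive a₂≡0) z≤n)))))))))

      high-count : countUpTo n (λ i → above i ∧ S₂ (n ∸ suc i)) ≤ 2 * (countUpTo n (λ i → above i ∧ N₂ (n ∸ suc i)) + s)
      high-count = begin
        countUpTo n (λ i → above i ∧ S₂ (n ∸ suc i))            ≡⟨ reversed S₂ ⟩
        countUpTo n (λ i → above (n ∸ suc i) ∧ S₂ i)
          ≤⟨ count-shift 0 a₂ n (λ i _ i<n e → i , above⇒<a₂ i i<n (proj₁ (∧-true⁻ {above (n ∸ suc i)} e)) , refl , proj₂ (∧-true⁻ {above (n ∸ suc i)} e)) (λ i ()) ⟩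
        countUpTo a₂ S₂                                          ≤⟨ SumGraph.saturated-few Λ₂ a₂ b₂ Λ₂⊆ N₂ ⟩
        2 * countUpTo b₂ N₂
          ≤⟨ *-monoʳ-≤ 2 (≤-trans (count-lengthen N₂ b₂≤) (≤-trans (≤-reflexive (count-split a₂ s N₂)) (+-mono-≤ (≤-trans
               (count-mono a₂ (λ i i<a₂ e → ∧-true (<a₂⇒above i i<a₂) e)) (count-lengthen (λ i → above (n ∸ suc i) ∧ N₂ i) (m∸n≤m n b))) (count≤ s _)))) ⟩
        2 * (countUpTo n (λ i → above (n ∸ suc i) ∧ N₂ i) + s)   ≡⟨ cong (λ z → 2 * (z + s)) (reversed N₂) ⟨
        2 * (countUpTo n (λ i → above i ∧ N₂ (n ∸ suc i)) + s)   ∎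
        where
        open ≤-Reasoning
        b₂≤ : b₂ ≤ a₂ + s
        b₂≤ = ≤-trans (m≤n+m∸n (n ∸ a) s) (≤-reflexive (trans (+-comm s _) (cong (_+ s) (∸-+-assoc n a s))))

    -- The base 48 is 3 * 4 * 4: a factor 3 for a free position of the block, and a factor 4 for the
    -- gains left over on each side of it.
    cover-product : prodTo n row ≼ (R₁.factor ^^ a ⊗ R₂.factor ^^ countUpTo n above) ⊗ ι 48 ^^ s
    cover-product = begin
      prodTo n row
        ≤⟨ prodTo-mono n (λ i _ → row≼ i) ⟩
      prodTo n (λ i → f₁ i ⊗ (f₂ i ⊗ f₃ i))
        ≈⟨ ≈-trans (prodTo-⊗ n f₁ _) (⊗-cong ≈-refl (prodTo-⊗ n f₂ f₃)) ⟩
      prodTo n f₁ ⊗ (prodTo n f₂ ⊗ prodTo n f₃)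
        ≤⟨ ⊗-mono bound₁ (⊗-mono bound₂ bound₃) ⟩
      (R₁.factor ^^ a ⊗ ι 4 ^^ s) ⊗ (ι 3 ^^ s ⊗ (R₂.factor ^^ countUpTo n above ⊗ ι 4 ^^ s))
        ≈⟨ e _ _ _ _ _ ⟩
      (R₁.factor ^^ a ⊗ R₂.factor ^^ countUpTo n above) ⊗ (ι 3 ^^ s ⊗ (ι 4 ^^ s ⊗ ι 4 ^^ s))
        ≈⟨ ⊗-cong ≈-refl (≈-trans (⊗-cong ≈-refl (≈-sym (^^-⊗ (ι 4) (ι 4) s))) (≈-trans (≈-sym (^^-⊗ (ι 3) _ s))
             (^^-cong s (≈-trans (⊗-cong ≈-refl (≈-sym (ι-⊗ 4 4))) (≈-sym (ι-⊗ 3 16)))))) ⟩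
      (R₁.factor ^^ a ⊗ R₂.factor ^^ countUpTo n above) ⊗ ι 48 ^^ s ∎
      where
      open ≼-Reasoning
      e : ∀ a b c d f → (a ⊗ b) ⊗ (c ⊗ (d ⊗ f)) ≈ (a ⊗ d) ⊗ (c ⊗ (b ⊗ f))
      e = solve 5 (λ a b c d f → (a :* b) :* (c :* (d :* f)) := (a :* d) :* (c :* (b :* f))) ≈-refl
        where open ℚ₊-Solver
      count-below : countUpTo n (_<ᵇ a) ≡ a
      count-below = ≤-antisym (≤-trans (count-beyond a n (λ i → <ᵇ-false)) (count≤ a _))
        (≤-trans (≤-reflexive (sym (count-all a))) (≤-trans (count-mono a (λ i i<a _ → <ᵇ-true i<a)) (count-lengthen (_<ᵇ a) a≤n)))
        where
        count-all : ∀ n → countUpTo n (λ _ → true) ≡ n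
        count-all zero    = refl
        count-all (suc n) = trans (cong (_+ 1) (count-all n)) (+-comm n 1)
      bound₁ : prodTo n f₁ ≼ R₁.factor ^^ a ⊗ ι 4 ^^ s
      bound₁ = ≼-trans (≈⇒≼ (≈-trans (prodTo-⊗ n _ _) (⊗-cong (prodTo-^ᵇ n R₁.factor (_<ᵇ a))
          (≈-trans (prodTo-⊗ n _ _) (⊗-cong (prodTo-^ᵇ n R₁.r _) (prodTo-^ᵇ n (R₁.ρ ⊗ R₁.ρ) _))))))
        (⊗-mono (≈⇒≼ (≈-reflexive (cong (R₁.factor ^^_) count-below)))
          (gain-cancel _ (countUpTo n (λ i → (i <ᵇ a) ∧ N₁ i)) s R₁.𝟙≼r R₁.r≼2 R₁.rρ≼𝟙 low-count))
      bound₂ : prodTo n f₂ ≼ ι 3 ^^ s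
      bound₂ = ≼-trans (≈⇒≼ (prodTo-^ᵇ n (ι 3) (interval a s))) (^^-monoʳ (ι-mono (s≤s z≤n)) (count-interval a s n))
      bound₃ : prodTo n f₃ ≼ R₂.factor ^^ countUpTo n above ⊗ ι 4 ^^ s
      bound₃ = ≼-trans (≈⇒≼ (≈-trans (prodTo-⊗ n _ _) (⊗-cong (prodTo-^ᵇ n R₂.factor above)
          (≈-trans (prodTo-⊗ n _ _) (⊗-cong (prodTo-^ᵇ n R₂.r _) (prodTo-^ᵇ n (R₂.ρ ⊗ R₂.ρ) _))))))
        (⊗-monoʳ _ (gain-cancel _ (countUpTo n (λ i → above i ∧ N₂ (n ∸ suc i))) s R₂.𝟙≼r R₂.r≼2 R₂.rρ≼𝟙 high-count))

-- From a word with a dense block to its containers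

record KunzInequalities {n : ℕ} (w : Vec ℕ n) : Set where
  field
    ineq-< : ∀ i j → suc (i + j) < n → kw w (suc (i + j)) ≤ kw w i + kw w j
    ineq-> : ∀ i j l → i < n → j < n → l < n → i + j ≡ l + n → kw w l ≤ suc (kw w i + kw w j)

kunzInequalities : ∀ {L n} {v : Vec Bool L} {w : Vec ℕ n} → KunzWord v n w → KunzInequalities w
kunzInequalities k = record { ineq-< = KunzWord.kunz-< k ; ineq-> = KunzWord.kunz-> k }

^ᵇ≼𝟙 : ∀ {p} b → p ≼ 𝟙 → p ^ᵇ b ≼ 𝟙
^ᵇ≼𝟙 true  p≼ = p≼
^ᵇ≼𝟙 false p≼ = ≼-refl

-- `dense` supplies the many sums that keep the fingerprints small. Letters above the cap, namely at
-- least `q` to the right of the block and at least `q + 1` anywhere, are few by hypothesis and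
-- become the exceptional ones.
module Covered {n : ℕ} (w : Vec ℕ n) (ineq : KunzInequalities w) (q′ a s D₀ E : ℕ) (a≤n : a ≤ n) (1≤D₀ : 1 ≤ D₀)
  (dense : D₀ ≤ countUpTo n (λ i → interval a s i ∧ (suc q′ ≤ᵇ kw w i)))
  (few-above : countUpTo n (λ i → (a + s ≤ᵇ i) ∧ (suc q′ ≤ᵇ kw w i)) ≤ E)
  (few : countUpTo n (λ i → suc (suc q′) ≤ᵇ kw w i) ≤ E) where

  open KunzInequalities ineq

  private
    K : ℕ → ℕ
    K = kw w
    q : ℕ
    q = suc q′

  Λv : Vec Bool s
  Λv = tabV s (λ t → q ≤ᵇ K (a + t))

  private
    module C₀ = Cover q a s n Λv (tabV n (λ _ → false)) (tabV n (λ _ → false))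
    open C₀ using (b; a₂; b₂; Λ₁; Λ₂; Λ₁⊆; Λ₂⊆)

    Λ₁⁻ : ∀ l → Λ₁ l ≡ true → l < n × q ≤ K l
    Λ₁⁻ l e with ∧-true⁻ {l <ᵇ n} e
    ... | l<n , e′ with ∧-true⁻ {interval a s l} e′
    ... | i , Λt with interval⁻ {a} {s} i
    ... | a≤l , l<b = <ᵇ-true⁻ l<n , ≤ᵇ-true⁻ (subst (λ z → (q ≤ᵇ K z) ≡ true) (m+[n∸m]≡n a≤l)
      (trans (sym (at-tabV false s _ (l ∸ a) (+-cancelˡ-< a _ _ (subst (_< a + s) (sym (m+[n∸m]≡n a≤l)) l<b)))) Λt))

    Λ₁⁺ : ∀ l → l < n → interval a s l ∧ (q ≤ᵇ K l) ≡ true → Λ₁ l ≡ true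
    Λ₁⁺ l l<n e with ∧-true⁻ {interval a s l} e
    ... | i , q≤ with interval⁻ {a} {s} i
    ... | a≤l , l<b = ∧-true (<ᵇ-true l<n) (∧-true i (trans (at-tabV false s _ (l ∸ a)
      (+-cancelˡ-< a _ _ (subst (_< a + s) (sym (m+[n∸m]≡n a≤l)) l<b))) (subst (λ z → (q ≤ᵇ K z) ≡ true) (sym (m+[n∸m]≡n a≤l)) q≤)))

    count-Λ₁ : D₀ ≤ countUpTo n Λ₁
    count-Λ₁ = ≤-trans dense (count-mono n Λ₁⁺)

    dense₁ : D₀ ≤ countUpTo b Λ₁
    dense₁ = ≤-trans count-Λ₁ (count-beyond b n (λ l b≤l → ¬true⇒false (λ e → <⇒≱ (proj₂ (Λ₁⊆ l e)) b≤l)))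

    dense₂ : D₀ ≤ countUpTo b₂ Λ₂
    dense₂ = ≤-trans (≤-trans count-Λ₁ (≤-trans (≤-reflexive (sym (count-rev n Λ₁)))
        (count-mono n (λ l l<n e → ∧-true (<ᵇ-true l<n) e))))
      (count-beyond b₂ n (λ l b₂≤l → ¬true⇒false (λ e → <⇒≱ (proj₂ (Λ₂⊆ l e)) b₂≤l)))

    one₁ one₂ : ℕ → Bool
    one₁ i = K i ≡ᵇ 1
    one₂ i = K (n ∸ suc i) ≡ᵇ 1

    module G₁ = SumGraph Λ₁ a b Λ₁⊆
    module G₂ = SumGraph Λ₂ a₂ b₂ Λ₂⊆
    c₁ : G₁.Container one₁ n
    c₁ = G₁.container one₁ n a≤n
    c₂ : G₂.Container one₂ n
    c₂ = G₂.container one₂ n (m∸n≤m n b)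

  F₁ F₂ : Vec Bool n
  F₁ = G₁.Container.F c₁
  F₂ = G₂.Container.F c₂

  small₁ : countUpTo n (at false F₁) * D₀ ≤ 2 * (a + s)
  small₁ = ≤-trans (*-monoʳ-≤ (countUpTo n (at false F₁)) dense₁) (≤-trans (G₁.Container.small c₁) (*-monoʳ-≤ 2 (count≤ b _)))

  small₂ : countUpTo n (at false F₂) * D₀ ≤ 2 * n
  small₂ = ≤-trans (*-monoʳ-≤ (countUpTo n (at false F₂)) dense₂)
    (≤-trans (G₂.Container.small c₂) (*-monoʳ-≤ 2 (≤-trans (count≤ b₂ _) (m∸n≤m n a))))

  module C = Cover q a s n Λv F₁ F₂

  exceptional : ℕ → Bool
  exceptional i = ((a + s ≤ᵇ i) ∧ (q ≤ᵇ K i)) ∨ (suc q ≤ᵇ K i)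

  exceptional-few : countUpTo n exceptional ≤ E + E
  exceptional-few = ≤-trans (count-∨ n (λ i _ → ∨-true⁻ {(a + s ≤ᵇ i) ∧ (q ≤ᵇ K i)})) (+-mono-≤ few-above few)

  private
    mirror : ∀ i → i < n → n ∸ suc (n ∸ suc i) ≡ i
    mirror i i<n = trans (cong (n ∸_) (sym (+-∸-assoc 1 i<n))) (m∸[m∸n]≡n (<⇒≤ i<n))

    near-one : ∀ i → C.N₁ i ≡ true → q ≤ suc (K i)
    near-one i e with G₁.Container.reached c₁ i e
    ... | t , t<a , Kt , Λt with Λ₁⁻ (suc (t + i)) Λt
    ... | l<n , q≤ = ≤-trans q≤ (≤-trans (ineq-< t i l<n) (≤-reflexive (cong (_+ K i) (≡ᵇ-true⁻ {K t} {1} Kt))))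

    -- In the reversed word sums wrap around the multiplicity, and the wrapped Kunz inequality is
    -- weaker by one. This loss is matched by the cap `q - 1` used to the right of the block, so a
    -- neighbour of a one is still at least its cap minus one.
    near-one′ : ∀ i → i < n → C.N₂ (n ∸ suc i) ≡ true → q ≤ suc (suc (K i))
    near-one′ i i<n e with G₂.Container.reached c₂ (n ∸ suc i) e
    ... | t , t<a₂ , Kt , Λt with ∧-true⁻ {suc (t + (n ∸ suc i)) <ᵇ n} Λt
    ... | <n , Λ₁l with Λ₁⁻ (n ∸ suc (suc (t + (n ∸ suc i)))) Λ₁l
    ... | l<n , q≤ = ≤-trans q≤ (≤-trans (ineq-> t̂ i l (∸-monoʳ-< z<s t<n) i<n l<n sums) (s≤s (≤-reflexive (cong (_+ K i) (≡ᵇ-true⁻ {K (n ∸ suc t)} {1} Kt)))))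
      where
      j t̂ l : ℕ
      j = n ∸ suc i
      t̂ = n ∸ suc t
      l = n ∸ suc (suc (t + j))
      <n′ : suc (t + j) < n
      <n′ = <ᵇ-true⁻ <n
      t<n : suc t ≤ n
      t<n = ≤-trans (s≤s (m≤m+n t j)) (<⇒≤ <n′)
      sums : t̂ + i ≡ l + n
      sums = +-cancelʳ-≡ (suc t + suc j) (t̂ + i) (l + n) (trans
        (trans (e₁ t̂ i t j) (cong₂ _+_ (m∸n+n≡m t<n) (trans (+-comm (suc i) j) (m∸n+n≡m i<n))))
        (sym (trans (e₂ l n t j) (cong (_+ n) (m∸n+n≡m <n′)))))
        where
        open +-*-Solver
        e₁ : ∀ t̂ i t j → (t̂ + i) + (suc t + suc j) ≡ (t̂ + suc t) + (suc i + j)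
        e₁ = solve 4 (λ t̂ i t j → (t̂ :+ i) :+ ((con 1 :+ t) :+ (con 1 :+ j)) := (t̂ :+ (con 1 :+ t)) :+ ((con 1 :+ i) :+ j)) refl
        e₂ : ∀ l n t j → (l + n) + (suc t + suc j) ≡ (l + suc (suc (t + j))) + n
        e₂ = solve 4 (λ l n t j → (l :+ n) :+ ((con 1 :+ t) :+ (con 1 :+ j)) := (l :+ (con 2 :+ (t :+ j))) :+ n) refl

    allowed⁺ : ∀ cap sat nbr α → (nbr ≡ true → cap ≤ suc (suc α)) → (α ≡ 0 → sat ≡ true) → allowed cap sat nbr α ≡ true
    allowed⁺ cap sat nbr α f g = ∧-true (cong not (¬true⇒false no-small)) (saturated-one α g)
      where
      no-small : nbr ∧ (suc α <ᵇ cap ∸ 1) ≢ true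
      no-small e with ∧-true⁻ {nbr} e
      ... | enbr , lt = <⇒≱ (<ᵇ-true⁻ {suc α} {cap ∸ 1} lt) (∸-monoˡ-≤ 1 (f enbr))
      saturated-one : ∀ α → (α ≡ 0 → sat ≡ true) → not (suc α ≡ᵇ 1) ∨ sat ≡ true
      saturated-one zero    h = h refl
      saturated-one (suc α) h = refl

    local⁺ : ∀ {p} cap sat nbr α exc → p ≼ 𝟙 → (nbr ≡ true → cap ≤ suc (suc α)) → (α ≡ 0 → sat ≡ true) →
      (cap ≤ α → exc ≡ true) → p ^ᵇ exc ≼ local p cap sat nbr α
    local⁺ cap sat nbr α exc p≼ f g h with α <? cap
    ... | yes α<cap rewrite <ᵇ-true α<cap | allowed⁺ cap sat nbr α f g = ^ᵇ≼𝟙 exc p≼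
    ... | no α≮cap rewrite <ᵇ-false (≮⇒≥ α≮cap) | h (≮⇒≥ α≮cap) = ≼-refl

    coefficient⁺ : ∀ {p} → p ≼ 𝟙 → ∀ i → i < n → p ^ᵇ exceptional i ≼ C.coefficient p i (at 0 w i)
    coefficient⁺ p≼ i i<n with i <? a | i <? a + s
    ... | yes i<a | _ rewrite <ᵇ-true i<a = local⁺ q (C.S₁ i) (C.N₁ i) (at 0 w i) (exceptional i) p≼ (near-one i)
            (λ e → G₁.Container.contained c₁ i i<a (≡ᵇ-true (cong suc e)) (≤-trans 1≤D₀ dense₁))
            (λ q≤α → ∨-trueʳ {(a + s ≤ᵇ i) ∧ (q ≤ᵇ K i)} (≤ᵇ-true (s≤s q≤α)))
    ... | no i≮a | yes i<b rewrite <ᵇ-false (≮⇒≥ i≮a) | <ᵇ-true i<b = ^ᵇ≼𝟙 (exceptional i) p≼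
    ... | no i≮a | no i≮b rewrite <ᵇ-false (≮⇒≥ i≮a) | <ᵇ-false (≮⇒≥ i≮b) =
            local⁺ q′ (C.S₂ j) (C.N₂ j) (at 0 w i) (exceptional i) p≼ (λ e → s≤s⁻¹ (near-one′ i i<n e))
            (λ e → G₂.Container.contained c₂ j (m+n≤o⇒m≤o∸n (suc j) (subst (suc j + b ≤_) (m+[n∸m]≡n i<n)
                      (≤-trans (≤-reflexive (cong suc (+-comm j b))) (+-monoˡ-≤ j (s≤s (≮⇒≥ i≮b))))))
                (≡ᵇ-true (trans (cong K (mirror i i<n)) (cong suc e))) (≤-trans 1≤D₀ dense₂))
            (λ q′≤α → ∨-trueˡ (∧-true (≤ᵇ-true (≮⇒≥ i≮b)) (≤ᵇ-true (s≤s q′≤α))))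
      where
      j : ℕ
      j = n ∸ suc i

  covered : ∀ {p} → p ≼ 𝟙 → p ^^ (E + E) ≼ prodTo n (λ i → C.coefficient p i (at 0 w i))
  covered {p} p≼ = begin
    p ^^ (E + E)                                              ≤⟨ ^^-antiʳ p≼ exceptional-few ⟩
    p ^^ countUpTo n exceptional                              ≈⟨ prodTo-^ᵇ n p exceptional ⟨
    prodTo n (λ i → p ^ᵇ exceptional i)                       ≤⟨ prodTo-mono n (coefficient⁺ p≼) ⟩
    prodTo n (λ i → C.coefficient p i (at 0 w i))             ∎
    where open ≼-Reasoning

-- Words with many letters at least 3

bools : List Bool
bools = false ∷ true ∷ []

∈-bools : ∀ b → b ∈ bools
∈-bools false = here refl
∈-bools true  = there (here refl)

at-∈-bools : ∀ {n} (v : Vec Bool n) → v ∈ vecs bools n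
at-∈-bools v = ∈-vecs false bools v (λ i _ → ∈-bools (at false v i))

length-vecs-bools : ∀ s → sumL (vecs bools s) (λ _ → 𝟙) ≈ ι 2 ^^ s
length-vecs-bools s = ≈-trans (sumL-cong (vecs bools s) (λ v → ≈-sym (≈-trans (prodTo-const s 𝟙) (𝟙^^ s))))
  (≈-trans (sum-of-products false bools s (λ _ _ → 𝟙)) (≈-trans (prodTo-cong s (λ _ _ → two)) (prodTo-const s (ι 2))))
  where
  two : 𝟙 ⊕ (𝟙 ⊕ 𝟘) ≈ ι 2
  two = ≈-trans (⊕-cong ≈-refl (⊕-identityʳ 𝟙)) (≈-sym (ι-⊕ 1 1))

sum-^ᵇ : ∀ n p → sumL (vecs bools n) (λ F → prodTo n (λ i → p ^ᵇ at false F i)) ≈ (𝟙 ⊕ p) ^^ n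
sum-^ᵇ n p = ≈-trans (sum-of-products false bools n (λ _ b → p ^ᵇ b))
  (≈-trans (prodTo-cong n (λ _ _ → ⊕-cong ≈-refl (⊕-identityʳ p))) (prodTo-const n (𝟙 ⊕ p)))

1+1/≈ : ∀ N′ → 1+1/ N′ ≈ 𝟙 ⊕ frac 1 N′
1+1/≈ N′ = ≈-sym (≈-trans (frac-⊕ 1 0 1 N′) (frac-≈ (e N′)))
  where
  e : ∀ N → (1 * suc N + 1 * 1) * suc N ≡ suc (suc N) * suc (N + 0 * suc N)
  e = solve 1 (λ N → (con 1 :* (con 1 :+ N) :+ con 1 :* con 1) :* (con 1 :+ N) := (con 2 :+ N) :* (con 1 :+ (N :+ con 0 :* (con 1 :+ N)))) refl
    where open +-*-Solver

2≼[1+1/N]^N : ∀ N′ → ι 2 ≼ 1+1/ N′ ^^ suc N′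
2≼[1+1/N]^N N′ = begin
  ι 2                                ≈⟨ ι-⊕ 1 1 ⟩
  𝟙 ⊕ ι 1                            ≈⟨ ⊕-cong ≈-refl (frac-ι 1 N′) ⟨
  𝟙 ⊕ ι (suc N′) ⊗ frac 1 N′         ≤⟨ bernoulli (frac 1 N′) (suc N′) ⟩
  (𝟙 ⊕ frac 1 N′) ^^ suc N′          ≈⟨ ^^-cong (suc N′) (1+1/≈ N′) ⟨
  1+1/ N′ ^^ suc N′                  ∎
  where open ≼-Reasoning

ι≼2^ : ∀ n → ι n ≼ ι 2 ^^ n
ι≼2^ zero    = 𝟘≼
ι≼2^ (suc n) = begin
  ι (1 + n)              ≈⟨ ι-⊕ 1 n ⟩
  𝟙 ⊕ ι n                ≤⟨ ⊕-mono (𝟙≼^^ n (ι-mono (s≤s z≤n))) (ι≼2^ n) ⟩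
  ι 2 ^^ n ⊕ ι 2 ^^ n    ≈⟨ ⊕-cong (⊗-identityˡ _) (⊗-identityˡ _) ⟨
  𝟙 ⊗ ι 2 ^^ n ⊕ 𝟙 ⊗ ι 2 ^^ n  ≈⟨ ⊗-distribʳ-⊕ _ 𝟙 𝟙 ⟨
  (𝟙 ⊕ 𝟙) ⊗ ι 2 ^^ n     ≈⟨ ⊗-cong (ι-⊕ 1 1) ≈-refl ⟨
  ι 2 ^^ suc n           ∎
  where open ≼-Reasoning

-- Passes through `N ≤ 2 ^ N`. The crude exponent `N²` fixes the density `1/N²` below which a
-- penalty `1/N` per letter can be absorbed.
ιN≼ : ∀ N′ → ι (suc N′) ≼ 1+1/ N′ ^^ (suc N′ * suc N′)
ιN≼ N′ = ≼-trans (ι≼2^ (suc N′)) (≼-trans (^^-mono (suc N′) (2≼[1+1/N]^N N′)) (proj₂ (^^-* (1+1/ N′) (suc N′) (suc N′))))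

-- The factor N for each element of a set of size f ≤ n / N² is absorbed by (1 + 1/N) ^ n.
absorb : ∀ N′ f n → suc N′ * suc N′ * f ≤ n → 𝟙 ≼ 1+1/ N′ ^^ n ⊗ frac 1 N′ ^^ f
absorb N′ f n p = begin
  𝟙                                                ≈⟨ 𝟙^^ f ⟨
  𝟙 ^^ f                                           ≈⟨ ^^-cong f (frac-ι 1 N′) ⟨
  (ι (suc N′) ⊗ frac 1 N′) ^^ f                    ≈⟨ ^^-⊗ _ _ f ⟩
  ι (suc N′) ^^ f ⊗ frac 1 N′ ^^ f                 ≤⟨ ⊗-monoˡ _ (≼-trans (^^-mono f (ιN≼ N′)) (proj₂ (^^-* (1+1/ N′) (suc N′ * suc N′) f))) ⟩
  1+1/ N′ ^^ (suc N′ * suc N′ * f) ⊗ frac 1 N′ ^^ f ≤⟨ ⊗-monoˡ _ (^^-monoʳ (𝟙≼1+1/ N′) p) ⟩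
  1+1/ N′ ^^ n ⊗ frac 1 N′ ^^ f                    ∎
  where open ≼-Reasoning

𝟙≼⊗ : ∀ {a b} → 𝟙 ≼ a → 𝟙 ≼ b → 𝟙 ≼ a ⊗ b
𝟙≼⊗ p q = ≼-trans (proj₂ (⊗-identityˡ 𝟙)) (⊗-mono p q)

word-weight : ∀ {n} (w : Vec ℕ n) x → prodTo n (λ i → x ^^ kw w i) ≈ x ^^ sumTo n (kw w)
word-weight {n} w x = prodTo-^^ n x (kw w)

inverse-powers : ∀ {x h} g → h ⊗ x ≈ 𝟙 → h ^^ g ⊗ x ^^ g ≈ 𝟙
inverse-powers g e = ≈-trans (≈-sym (^^-⊗ _ _ g)) (≈-trans (^^-cong g e) (𝟙^^ g))

module ManyThrees (N′ e′ g A : ℕ) (x h : ℚ₊) where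

  -- There are `N` blocks, and a block is dense if it contains `D₀` large letters. A fingerprint of
  -- size f then satisfies `f * D₀ ≤ 4 (n + 1)`, so `D₀ = 4N²` gives `N² f ≤ n + 1`, the density
  -- that `absorb` can pay for. `E` bounds the large letters to the right of the last dense block.
  N D₀ E e : ℕ
  N  = suc N′
  D₀ = 4 * (N * N)
  E  = N * D₀
  e  = 4 * suc e′

  p u : ℚ₊
  p = frac 1 N′
  u = 1+1/ N′

  size : ℕ → ℕ
  size n = suc (n / N)

  -- For `c = 0` the cap to the right of the block is 2, where nothing is saved; the block must then
  -- start far enough to the right for the left part to be a positive proportion of the word.
  admissible : ℕ → ℕ → ℕ → Bool
  admissible c β n = (β * size n ≤ᵇ n) ∧ ((1 ≤ᵇ c) ∨ (n ≤ᵇ e * (β * size n)))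

  -- What the weight of a bad word lacks to reach 1: `N` for each of at most `2E` exceptional
  -- letters, `u ^ (n + 1)` for each of the two fingerprints, and `h ^ g` against `x ^ g`.
  constant : ℕ → ℚ₊
  constant n = (ι N ^^ (E + E) ⊗ (u ^^ suc n ⊗ u ^^ suc n)) ⊗ h ^^ g

  term : (n c β : ℕ) → Vec Bool (size n) → Vec Bool n → Vec Bool n → Vec ℕ n → ℚ₊
  term n c β Λv F₁ F₂ w = prodTo n (λ i → x ^^ kw w i ⊗ Cover.coefficient (3 + c) (β * size n) (size n) n Λv F₁ F₂ p i (at 0 w i))

  prints : (n : ℕ) → Vec Bool n → Vec Bool n → ℚ₊
  prints n F₁ F₂ = prodTo n (λ i → p ^ᵇ at false F₁ i) ⊗ prodTo n (λ i → p ^ᵇ at false F₂ i)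

  covers : {n : ℕ} (f : ℕ → ℕ → Vec Bool (size n) → Vec Bool n → Vec Bool n → ℚ₊) → ℚ₊
  covers {n} f = sumL (upTo 12) (λ c → sumL (upTo N) (λ β → sumL (vecs bools (size n)) (λ Λv →
    sumL (vecs bools n) (λ F₁ → sumL (vecs bools n) (f c β Λv F₁)))))

  Φ : (n : ℕ) → Vec ℕ n → ℚ₊
  Φ n w = covers (λ c β Λv F₁ F₂ → (ind (admissible c β n) ⊗ (constant n ⊗ prints n F₁ F₂)) ⊗ term n c β Λv F₁ F₂ w)

  size-large : ∀ n → n ≤ N * size n
  size-large n = begin
    n                        ≡⟨ m≡m%n+[m/n]*n n N ⟩
    n % N + n / N * N        ≤⟨ +-monoˡ-≤ (n / N * N) (<⇒≤ (m%n<n n N)) ⟩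
    N + n / N * N            ≡⟨ *-comm (size n) N ⟩
    N * size n               ∎
    where open ≤-Reasoning

  module _ {n : ℕ} (w : Vec ℕ n) (ineq : KunzInequalities w) where

    private
      K : ℕ → ℕ
      K = kw w
      s : ℕ
      s = size n

    Found : ℕ → Set
    Found q = ∃[ β ] (β < N × D₀ ≤ countUpTo n (λ i → interval (β * s) s i ∧ (q ≤ᵇ K i))
      × countUpTo n (λ i → (β * s + s ≤ᵇ i) ∧ (q ≤ᵇ K i)) ≤ E)

    -- Blocks are tried from the right. At the last dense one, each block beyond it holds fewer than
    -- `D₀` letters at least `q`, hence at most `E` in total; with no dense block, `E` bounds all of
    -- them.
    scan : ∀ q → Found q ⊎ countUpTo n (λ i → q ≤ᵇ K i) ≤ E
    scan q with go N 0 (+-identityʳ N)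
      where
      go : ∀ j β → j + β ≡ N → Found q ⊎ countUpTo n (λ i → (β * s ≤ᵇ i) ∧ (q ≤ᵇ K i)) ≤ j * D₀
      go zero    .N refl = inj₂ (≤-trans (≤-reflexive (count-none n (λ i i<n → cong (_∧ (q ≤ᵇ K i)) (≤ᵇ-false (<-≤-trans i<n (size-large n)))))) z≤n)
      go (suc j) β eq with go j (suc β) (trans (+-suc j β) eq)
      ... | inj₁ found = inj₁ found
      ... | inj₂ few with D₀ ≤? countUpTo n (λ i → interval (β * s) s i ∧ (q ≤ᵇ K i))
      ...   | yes D₀≤ = inj₁ (β , ≤-trans (s≤s (m≤n+m β j)) (≤-reflexive eq) , D₀≤
                , ≤-trans (≤-reflexive (cong (λ z → countUpTo n (λ i → (z ≤ᵇ i) ∧ (q ≤ᵇ K i))) (+-comm (β * s) s)))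
                    (≤-trans few (*-monoˡ-≤ D₀ (≤-trans (n≤1+n j) (≤-trans (m≤m+n (suc j) β) (≤-reflexive eq))))))
      ...   | no D₀≰ = inj₂ (≤-trans (count-∨ n split) (+-mono-≤ (<⇒≤ (≰⇒> D₀≰)) few))
        where
        split : ∀ i → i < n → (β * s ≤ᵇ i) ∧ (q ≤ᵇ K i) ≡ true → (interval (β * s) s i ∧ (q ≤ᵇ K i) ≡ true) ⊎ ((suc β * s ≤ᵇ i) ∧ (q ≤ᵇ K i) ≡ true)
        split i _ e′ with ∧-true⁻ {β * s ≤ᵇ i} e′
        ... | lo , qK with i <? β * s + s
        ...   | yes hi = inj₁ (∧-true (interval⁺ {β * s} {s} (≤ᵇ-true⁻ {β * s} lo) hi) qK)
        ...   | no  hi = inj₂ (∧-true (≤ᵇ-true (≤-trans (≤-reflexive (+-comm s (β * s))) (≮⇒≥ hi))) qK)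
    ... | inj₁ found = inj₁ found
    ... | inj₂ few   = inj₂ (≤-trans (count-mono n (λ i _ e′ → ∧-true (≤ᵇ-true {0} {i} z≤n) e′)) few)

    1≤D₀ : 1 ≤ D₀
    1≤D₀ = s≤s z≤n

    p≼𝟙 : p ≼ 𝟙
    p≼𝟙 = frac-≼ (≤-trans (≤-reflexive (*-identityʳ 1)) (s≤s z≤n))

    found⇒𝟙≼Φ : h ⊗ x ≈ 𝟙 → sumTo n K ≡ g → ∀ c → c < 12 → (found : Found (3 + c)) → (c ≡ 0 → n ≤ e * (proj₁ found * s)) →
      countUpTo n (λ i → 4 + c ≤ᵇ K i) ≤ E → 𝟙 ≼ Φ n w
    found⇒𝟙≼Φ hx sum≡g c c<12 (β , β<N , dense , few-above) large few = ≼-trans 𝟙≼summand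
      (≼-trans (∈⇒≼sumL (vecs bools n) (λ F₂ → summand c β Λv F₁ F₂) (at-∈-bools F₂))
      (≼-trans (∈⇒≼sumL (vecs bools n) (λ F₁ → sumL (vecs bools n) (summand c β Λv F₁)) (at-∈-bools F₁))
      (≼-trans (∈⇒≼sumL (vecs bools s) (λ Λv → sumL (vecs bools n) (λ F₁ → sumL (vecs bools n) (summand c β Λv F₁))) (at-∈-bools Λv))
      (≼-trans (∈⇒≼sumL (upTo N) (λ β → sumL (vecs bools s) (λ Λv → sumL (vecs bools n) (λ F₁ → sumL (vecs bools n) (summand c β Λv F₁)))) (∈-upTo⁺ β<N))
        (∈⇒≼sumL (upTo 12) (λ c → sumL (upTo N) (λ β → sumL (vecs bools s) (λ Λv → sumL (vecs bools n) (λ F₁ → sumL (vecs bools n) (summand c β Λv F₁))))) (∈-upTo⁺ c<12))))))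
      where
      summand : ℕ → ℕ → Vec Bool s → Vec Bool n → Vec Bool n → ℚ₊
      summand c β Λv F₁ F₂ = (ind (admissible c β n) ⊗ (constant n ⊗ prints n F₁ F₂)) ⊗ term n c β Λv F₁ F₂ w
      a≤n : β * s ≤ n
      a≤n = ≮⇒≥ (λ n<a → <⇒≱ (≤-trans 1≤D₀ dense) (≤-reflexive (count-none n (λ i i<n →
        cong (_∧ (3 + c ≤ᵇ K i)) (cong (_∧ (i <ᵇ β * s + s)) (≤ᵇ-false (<-trans i<n n<a)))))))
      open Covered w ineq (2 + c) (β * s) s D₀ E a≤n 1≤D₀ dense few-above few using (Λv; F₁; F₂; small₁; small₂; covered)
      admissible⁺ : admissible c β n ≡ true
      admissible⁺ = ∧-true (≤ᵇ-true a≤n) (go c large)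
        where
        go : ∀ c → (c ≡ 0 → n ≤ e * (β * s)) → (1 ≤ᵇ c) ∨ (n ≤ᵇ e * (β * s)) ≡ true
        go zero    l = ≤ᵇ-true (l refl)
        go (suc c) l = refl
      shrink : ∀ f m → f * D₀ ≤ 2 * m → m ≤ 2 * suc n → N * N * f ≤ suc n
      shrink f m q m≤ = *-cancelˡ-≤ 4 (begin
        4 * (N * N * f)        ≡⟨ solve 2 (λ n f → con 4 :* (n :* n :* f) := f :* (con 4 :* (n :* n))) refl N f ⟩
        f * D₀                 ≤⟨ q ⟩
        2 * m                  ≤⟨ *-monoʳ-≤ 2 m≤ ⟩
        2 * (2 * suc n)        ≡⟨ *-assoc 2 2 (suc n) ⟨
        4 * suc n              ∎)
        where
        open ≤-Reasoning
        open +-*-Solver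
      print-absorbed : ∀ (F : Vec Bool n) m → countUpTo n (at false F) * D₀ ≤ 2 * m → m ≤ 2 * suc n →
        𝟙 ≼ u ^^ suc n ⊗ prodTo n (λ i → p ^ᵇ at false F i)
      print-absorbed F m q m≤ = ≼-trans (absorb N′ (countUpTo n (at false F)) (suc n) (shrink _ m q m≤))
        (⊗-monoʳ _ (proj₂ (prodTo-^ᵇ n p (at false F))))
      a+s≤ : β * s + s ≤ 2 * suc n
      a+s≤ = ≤-trans (+-mono-≤ (≤-trans a≤n (n≤1+n n)) (s≤s (m/n≤m n N))) (≤-reflexive (cong (suc n +_) (sym (+-identityʳ (suc n)))))
      n≤ : n ≤ 2 * suc n
      n≤ = ≤-trans (n≤1+n n) (m≤m+n (suc n) _)
      𝟙≼summand : 𝟙 ≼ summand c β Λv F₁ F₂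
      𝟙≼summand = begin
        𝟙
          ≤⟨ 𝟙≼⊗ (𝟙≼⊗ (print-absorbed F₁ _ small₁ a+s≤) (print-absorbed F₂ _ small₂ n≤))
               (𝟙≼⊗ (proj₂ (inverse-powers g hx)) (≼-trans (proj₂ (inverse-powers (E + E) (frac-ι 1 N′))) (⊗-monoʳ _ (covered p≼𝟙)))) ⟩
        ((U ⊗ P₁) ⊗ (U ⊗ P₂)) ⊗ ((h ^^ g ⊗ x ^^ g) ⊗ (ι N ^^ (E + E) ⊗ Co))
          ≈⟨ rearrange U P₁ P₂ (h ^^ g) (x ^^ g) (ι N ^^ (E + E)) Co ⟩
        (𝟙 ⊗ (((ι N ^^ (E + E) ⊗ (U ⊗ U)) ⊗ h ^^ g) ⊗ (P₁ ⊗ P₂))) ⊗ (x ^^ g ⊗ Co)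
          ≈⟨ ⊗-cong (⊗-cong (≈-reflexive (cong ind (sym admissible⁺))) ≈-refl)
               (≈-trans (⊗-cong (≈-trans (≈-reflexive (cong (x ^^_) (sym sum≡g))) (≈-sym (word-weight w x))) ≈-refl) (≈-sym (prodTo-⊗ n _ _))) ⟩
        summand c β Λv F₁ F₂ ∎
        where
        open ≼-Reasoning
        U P₁ P₂ Co : ℚ₊
        U  = u ^^ suc n
        P₁ = prodTo n (λ i → p ^ᵇ at false F₁ i)
        P₂ = prodTo n (λ i → p ^ᵇ at false F₂ i)
        Co = prodTo n (λ i → Cover.coefficient (3 + c) (β * s) s n Λv F₁ F₂ p i (at 0 w i))
        rearrange : ∀ U P₁ P₂ H X M Co → ((U ⊗ P₁) ⊗ (U ⊗ P₂)) ⊗ ((H ⊗ X) ⊗ (M ⊗ Co)) ≈ (𝟙 ⊗ (((M ⊗ (U ⊗ U)) ⊗ H) ⊗ (P₁ ⊗ P₂))) ⊗ (X ⊗ Co)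
        rearrange = solve 7 (λ U P₁ P₂ H X M Co → ((U :* P₁) :* (U :* P₂)) :* ((H :* X) :* (M :* Co)) := (con 1 :* (((M :* (U :* U)) :* H) :* (P₁ :* P₂))) :* (X :* Co)) ≈-refl
          where open ℚ₊-Solver

    -- Too many letters ≥ 3 force a dense block at some level.
    many-threes⇒𝟙≼Φ : h ⊗ x ≈ 𝟙 → sumTo n K ≡ g → (∀ i → i < n → K i ≤ 14) → 4 * suc e′ ≤ N → 4 * (suc e′ * suc E) ≤ n →
      n < suc e′ * countUpTo n (λ i → 3 ≤ᵇ K i) → 𝟙 ≼ Φ n w
    many-threes⇒𝟙≼Φ hx sum≡g K≤14 e≤N n-large many = descend 11 (s≤s ≤-refl) (≤-trans (≤-reflexive (count-none n (λ i i<n → ≤ᵇ-false (s≤s (K≤14 i i<n))))) z≤n)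
      where
      open ≤-Reasoning
      -- The caps are tried downwards from 14. A failed scan at one cap is exactly the scarcity of
      -- letters above the next lower cap.
      descend : ∀ c → c < 12 → countUpTo n (λ i → 4 + c ≤ᵇ K i) ≤ E → 𝟙 ≼ Φ n w
      descend c c<12 few with scan (3 + c)
      descend (suc c) c<12 few | inj₁ found = found⇒𝟙≼Φ hx sum≡g (suc c) c<12 found (λ ()) few
      descend (suc c) c<12 few | inj₂ few′  = descend c (<-trans ≤-refl c<12) few′
      descend zero    c<12 few | inj₂ few′  = ⊥-elim (<⇒≱ many (≤-trans (*-monoʳ-≤ (suc e′) (≤-trans few′ (n≤1+n E))) (≤-trans (m≤m+n _ _) n-large)))
      descend zero    c<12 few | inj₁ found@(β , β<N , dense , few-above) = found⇒𝟙≼Φ hx sum≡g 0 c<12 found (λ _ → large) few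
        where
        a : ℕ
        a = β * s
        ε : ℕ
        ε = suc e′
        threes≤ : countUpTo n (λ i → 3 ≤ᵇ K i) ≤ (a + s) + E
        threes≤ = ≤-trans (count-∨ n split) (+-mono-≤ (count-interval 0 (a + s) n) few-above)
          where
          split : ∀ i → i < n → (3 ≤ᵇ K i) ≡ true → interval 0 (a + s) i ≡ true ⊎ ((a + s ≤ᵇ i) ∧ (3 ≤ᵇ K i) ≡ true)
          split i _ e₃ with i <? a + s
          ... | yes lt = inj₁ (interval⁺ {0} {a + s} z≤n lt)
          ... | no  ge = inj₂ (∧-true (≤ᵇ-true (≮⇒≥ ge)) e₃)
        4εs≤ : 4 * ε * s ≤ 4 * ε + n
        4εs≤ = ≤-trans (≤-reflexive (*-suc (4 * ε) (n / N))) (+-monoʳ-≤ (4 * ε) (≤-trans (*-monoˡ-≤ (n / N) e≤N)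
          (≤-trans (≤-reflexive (*-comm N (n / N))) (m/n*n≤m n N))))
        -- Letters at least 3 are bounded by `a + s + E`, where `s` is about `n / N` and `E` is
        -- constant. Since there are more than n/(e′ + 1) of them, `a` must be a positive proportion
        -- of `n`.
        large : n ≤ e * a
        large = *-cancelˡ-≤ 2 (+-cancelʳ-≤ (2 * n) (2 * n) (2 * (e * a)) (begin
          2 * n + 2 * n                                 ≡⟨ solve 1 (λ n → con 2 :* n :+ con 2 :* n := con 4 :* n) refl n ⟩
          4 * n                                         ≤⟨ *-monoʳ-≤ 4 (<⇒≤ (<-≤-trans many (*-monoʳ-≤ ε threes≤))) ⟩
          4 * (ε * ((a + s) + E))                       ≡⟨ solve 4 (λ ε a s E → con 4 :* (ε :* ((a :+ s) :+ E)) := con 4 :* ε :* a :+ (con 4 :* ε :* s :+ con 4 :* (ε :* E))) refl ε a s E ⟩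
          e * a + (4 * ε * s + 4 * (ε * E))             ≤⟨ +-monoʳ-≤ (e * a) (+-monoˡ-≤ (4 * (ε * E)) 4εs≤) ⟩
          e * a + ((4 * ε + n) + 4 * (ε * E))           ≡⟨ solve 4 (λ X ε n E → X :+ ((con 4 :* ε :+ n) :+ con 4 :* (ε :* E)) := X :+ (n :+ con 4 :* (ε :* (con 1 :+ E)))) refl (e * a) ε n E ⟩
          e * a + (n + 4 * (ε * suc E))                 ≤⟨ +-monoʳ-≤ (e * a) (+-monoʳ-≤ n n-large) ⟩
          e * a + (n + n)                               ≤⟨ +-monoˡ-≤ (n + n) (m≤m+n (e * a) _) ⟩
          2 * (e * a) + (n + n)                         ≡⟨ cong (2 * (e * a) +_) (cong (n +_) (+-identityʳ n)) ⟨
          2 * (e * a) + 2 * n                           ∎))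
          where open +-*-Solver

module Nested {A₁ A₂ A₃ A₄ : Set} (l₁ : List A₁) (l₂ : List A₂) (l₃ : List A₃) (l₄ : List A₄) where

  nested : (A₁ → A₂ → A₃ → A₄ → A₄ → ℚ₊) → ℚ₊
  nested f = sumL l₁ (λ a → sumL l₂ (λ b → sumL l₃ (λ c → sumL l₄ (λ d → sumL l₄ (f a b c d)))))

  nested-mono : ∀ {f f′ : A₁ → A₂ → A₃ → A₄ → A₄ → ℚ₊} → (∀ a → a ∈ l₁ → ∀ b c d d′ → f a b c d d′ ≼ f′ a b c d d′) →
    nested f ≼ nested f′
  nested-mono p = sumL-mono-∈ l₁ (λ a a∈ → sumL-mono l₂ (λ b → sumL-mono l₃ (λ c → sumL-mono l₄ (λ d → sumL-mono l₄ (p a a∈ b c d)))))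

  nested-swap : {B : Set} (ws : List B) (t : A₁ → A₂ → A₃ → A₄ → A₄ → B → ℚ₊) →
    sumL ws (λ w → nested (λ a b c d d′ → t a b c d d′ w)) ≈ nested (λ a b c d d′ → sumL ws (t a b c d d′))
  nested-swap ws t = ≈-trans (sumL-swap ws l₁ _) (sumL-cong l₁ (λ a →
    ≈-trans (sumL-swap ws l₂ _) (sumL-cong l₂ (λ b →
    ≈-trans (sumL-swap ws l₃ _) (sumL-cong l₃ (λ c →
    ≈-trans (sumL-swap ws l₄ _) (sumL-cong l₄ (λ d → sumL-swap ws l₄ _))))))))

  nested-const : ∀ {U S} (P : A₄ → ℚ₊) (B : ℚ₊) → sumL l₄ P ≈ U → sumL l₃ (λ _ → 𝟙) ≈ S →
    nested (λ a b c d d′ → (P d ⊗ P d′) ⊗ B) ≈ (ι (length l₁) ⊗ (ι (length l₂) ⊗ S)) ⊗ ((U ⊗ U) ⊗ B)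
  nested-const {U} {S} P B sumP sumS = begin-equality
    nested (λ a b c d d′ → (P d ⊗ P d′) ⊗ B)
      ≈⟨ sumL-cong l₁ (λ a → sumL-cong l₂ (λ b → sumL-cong l₃ (λ c → inner))) ⟩
    sumL l₁ (λ a → sumL l₂ (λ b → sumL l₃ (λ c → X)))
      ≈⟨ sumL-cong l₁ (λ a → sumL-cong l₂ (λ b → ≈-trans (sumL-cong l₃ (λ _ → ≈-sym (⊗-identityˡ X)))
           (≈-trans (sumL-⊗ʳ l₃ X _) (⊗-cong sumS ≈-refl)))) ⟩
    sumL l₁ (λ a → sumL l₂ (λ b → S ⊗ X))
      ≈⟨ sumL-cong l₁ (λ a → sumL-const l₂ (S ⊗ X)) ⟩
    sumL l₁ (λ a → ι (length l₂) ⊗ (S ⊗ X))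
      ≈⟨ ≈-trans (sumL-const l₁ _) (⊗-cong ≈-refl (≈-sym (⊗-assoc _ S X))) ⟩
    ι (length l₁) ⊗ ((ι (length l₂) ⊗ S) ⊗ X)
      ≈⟨ ⊗-assoc (ι (length l₁)) _ X ⟨
    (ι (length l₁) ⊗ (ι (length l₂) ⊗ S)) ⊗ X ∎
    where
    open ≼-Reasoning
    X : ℚ₊
    X = (U ⊗ U) ⊗ B
    inner : sumL l₄ (λ d → sumL l₄ (λ d′ → (P d ⊗ P d′) ⊗ B)) ≈ X
    inner = ≈-trans (sumL-cong l₄ (λ d → ≈-trans (sumL-⊗ʳ l₄ B _) (⊗-cong (≈-trans (sumL-⊗ˡ l₄ (P d) P) (⊗-cong ≈-refl sumP)) ≈-refl)))
      (≈-trans (sumL-⊗ʳ l₄ B _) (⊗-cong (≈-trans (sumL-⊗ʳ l₄ U P) (⊗-cong sumP ≈-refl)) ≈-refl))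

module ManyThreesTotal (N′ e′ g A : ℕ) (x h : ℚ₊) (x≼x₀ : x ≼ x₀) (x+x²≼𝟙 : x ⊕ x ⊗ x ≼ 𝟙)
  (3p≼ : ι 3 ⊗ frac 1 N′ ≼ frac 1 9999) (4≤N : 4 ≤ suc N′) where

  open ManyThrees N′ e′ g A x h

  private
    W : (n : ℕ) → List (Vec ℕ n)
    W = vecs (upTo A)

  rowBound : ∀ c → c < 12 → RowBound A x p (2 + c)
  rowBound zero    _ = rowBound₂ A x p x≼x₀ x+x²≼𝟙
  rowBound (suc c) c<12 = rowBound₃ A x p c (<-trans ≤-refl c<12) x≼x₀ 3p≼

  rowBound⁺ : ∀ c → c < 12 → RowBound A x p (3 + c)
  rowBound⁺ c c<12 = rowBound₃ A x p c c<12 x≼x₀ 3p≼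

  κ≼𝟙 : κ ≼ 𝟙
  κ≼𝟙 = frac-≼ (≤ᵇ-true⁻ refl)

  u≈ : u ≈ 𝟙 ⊕ p
  u≈ = 1+1/≈ N′

  n/e≤ : ∀ n → 2 ≤ n → size n + n / e ≤ n
  n/e≤ n 2≤n = begin
    suc (n / N + n / e)        ≤⟨ s≤s (+-mono-≤ (/-monoʳ-≤ n 4≤N) (/-monoʳ-≤ n (m≤m*n 4 (suc e′)))) ⟩
    suc (n / 4 + n / 4)        ≤⟨ go (n / 4) (m/n*n≤m n 4) ⟩
    n                          ∎
    where
    open ≤-Reasoning
    go : ∀ t → t * 4 ≤ n → suc (t + t) ≤ n
    go zero    _  = ≤-trans (s≤s z≤n) 2≤n
    go (suc t) 4t = ≤-trans (s≤s (≤-trans (m≤m+n (suc t + suc t) (suc (t + t))) (≤-reflexive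
      (solve 1 (λ t → ((con 1 :+ t) :+ (con 1 :+ t)) :+ (con 1 :+ (t :+ t)) := con 3 :+ t :* con 4) refl t)))) 4t
      where open +-*-Solver

  rows : (n c β : ℕ) (Λv : Vec Bool (size n)) (F₁ F₂ : Vec Bool n) → 2 ≤ n → c < 12 → admissible c β n ≡ true →
    sumL (W n) (term n c β Λv F₁ F₂) ≼ (u ^^ (3 * n) ⊗ κ ^^ (n / e)) ⊗ ι 48 ^^ size n
  rows n c β Λv F₁ F₂ 2≤n c<12 adm = ≼-trans (≈⇒≼ (sum-of-products 0 (upTo A) n (λ i α → x ^^ suc α ⊗ coefficient p i α)))
    (≼-trans (cover-product (≼-trans x≼x₀ x₀≼2/3) (rowBound⁺ c c<12) (rowBound c c<12) a≤n) (⊗-monoˡ _ (factors c c<12 large)))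
    where
    a s : ℕ
    a = β * size n
    s = size n
    open Cover (3 + c) a s n Λv F₁ F₂
    a≤n : a ≤ n
    a≤n = ≤ᵇ-true⁻ (proj₁ (∧-true⁻ {a ≤ᵇ n} adm))
    large : (1 ≤ᵇ c) ∨ (n ≤ᵇ e * a) ≡ true
    large = proj₂ (∧-true⁻ {a ≤ᵇ n} adm)
    1≼u³ⁿ : 𝟙 ≼ u ^^ (3 * n)
    1≼u³ⁿ = 𝟙≼^^ (3 * n) (𝟙≼1+1/ N′)
    cnt : ℕ
    cnt = countUpTo n above
    n≤ : n ≤ (a + s) + cnt
    n≤ = ≤-trans (≤-reflexive (sym (count-all n))) (≤-trans (count-∨ n split) (+-monoˡ-≤ cnt (count-interval 0 (a + s) n)))
      where
      count-all : ∀ n → countUpTo n (λ _ → true) ≡ n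
      count-all zero    = refl
      count-all (suc n) = trans (cong (_+ 1) (count-all n)) (+-comm n 1)
      split : ∀ i → i < n → true ≡ true → interval 0 (a + s) i ≡ true ⊎ above i ≡ true
      split i _ _ with i <? a + s
      ... | yes lt = inj₁ (interval⁺ {0} {a + s} z≤n lt)
      ... | no  ge = inj₂ (≤ᵇ-true (≮⇒≥ ge))
    factors : ∀ c (c<12 : c < 12) → (1 ≤ᵇ c) ∨ (n ≤ᵇ e * a) ≡ true →
      RowBound.factor (rowBound⁺ c c<12) ^^ a ⊗ RowBound.factor (rowBound c c<12) ^^ cnt ≼ u ^^ (3 * n) ⊗ κ ^^ (n / e)
    factors zero _ lg = ≼-trans (⊗-mono (^^-antiʳ κ≼𝟙 n/e≤a) v-bound) (≈⇒≼ (⊗-comm _ _))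
      where
      n/e≤a : n / e ≤ a
      n/e≤a = ≤-trans (/-monoˡ-≤ e (≤-trans (≤ᵇ-true⁻ {n} lg) (≤-reflexive (*-comm e a)))) (≤-reflexive (m*n/n≡m a e))
      v-bound : (𝟙 ⊕ ι 3 ⊗ p) ^^ cnt ≼ u ^^ (3 * n)
      v-bound = begin
        (𝟙 ⊕ ι 3 ⊗ p) ^^ cnt      ≤⟨ ^^-monoʳ (≼-⊕ˡ 𝟙 _) (count≤ n above) ⟩
        (𝟙 ⊕ ι 3 ⊗ p) ^^ n        ≤⟨ ^^-mono n (≼-trans (bernoulli p 3) (^^-mono 3 (proj₂ u≈))) ⟩
        (u ^^ 3) ^^ n             ≈⟨ ^^-* u 3 n ⟨
        u ^^ (3 * n)              ∎
        where open ≼-Reasoning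
    factors (suc c) _ lg = begin
      κ ^^ a ⊗ κ ^^ cnt             ≈⟨ ^^-+ κ a cnt ⟨
      κ ^^ (a + cnt)                ≤⟨ ^^-antiʳ κ≼𝟙 (+-cancelˡ-≤ s (n / e) (a + cnt) (≤-trans (n/e≤ n 2≤n) (≤-trans n≤ (≤-reflexive eq)))) ⟩
      κ ^^ (n / e)                  ≈⟨ ⊗-identityˡ _ ⟨
      𝟙 ⊗ κ ^^ (n / e)              ≤⟨ ⊗-monoˡ _ 1≼u³ⁿ ⟩
      u ^^ (3 * n) ⊗ κ ^^ (n / e)   ∎
      where
      open ≼-Reasoning
      eq : (a + s) + cnt ≡ s + (a + cnt)
      eq = solve 3 (λ a s c → (a :+ s) :+ c := s :+ (a :+ c)) refl a s cnt
        where open +-*-Solver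

  covers-const : ∀ n (Bn : ℚ₊) → covers {n} (λ c β Λv F₁ F₂ → prints n F₁ F₂ ⊗ Bn)
    ≈ (ι 12 ⊗ (ι N ⊗ ι 2 ^^ size n)) ⊗ ((u ^^ n ⊗ u ^^ n) ⊗ Bn)
  covers-const n Bn = ≈-trans
    (Nested.nested-const (upTo 12) (upTo N) (vecs bools (size n)) (vecs bools n) (λ F → prodTo n (λ i → p ^ᵇ at false F i)) Bn
      (≈-trans (sum-^ᵇ n p) (^^-cong n (≈-sym u≈))) (length-vecs-bools (size n)))
    (⊗-cong (⊗-cong ≈-refl (⊗-cong (≈-reflexive (cong ι (length-upTo N))) ≈-refl)) ≈-refl)

  Constant : ℚ₊
  Constant = ((ι 12 ⊗ ι N) ⊗ ι N ^^ (E + E)) ⊗ ((u ⊗ u) ⊗ u ^^ (7 * N))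

  -- The choice of `Λv` and the block together cost 96 per position, less than `2 ^ 7`; as the block
  -- has about `n / N` positions and `2 ≤ u ^ N`, this is only `u ^ (7n)` up to a constant.
  sizes : ∀ n → ι 2 ^^ size n ⊗ ι 48 ^^ size n ≼ u ^^ (7 * N) ⊗ u ^^ (7 * n)
  sizes n = begin
    ι 2 ^^ size n ⊗ ι 48 ^^ size n             ≈⟨ ^^-⊗ (ι 2) (ι 48) (size n) ⟨
    (ι 2 ⊗ ι 48) ^^ size n                     ≤⟨ ^^-mono (size n) 96≼ ⟩
    (ι 2 ^^ 7) ^^ size n                       ≈⟨ ^^-* (ι 2) 7 (size n) ⟨
    ι 2 ^^ (7 * size n)                        ≤⟨ ^^-mono (7 * size n) (2≼[1+1/N]^N N′) ⟩
    (u ^^ N) ^^ (7 * size n)                   ≈⟨ ^^-* u N (7 * size n) ⟨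
    u ^^ (N * (7 * size n))                    ≤⟨ ^^-monoʳ (𝟙≼1+1/ N′) exponent ⟩
    u ^^ (7 * N + 7 * n)                       ≈⟨ ^^-+ u (7 * N) (7 * n) ⟩
    u ^^ (7 * N) ⊗ u ^^ (7 * n)                ∎
    where
    open ≼-Reasoning
    pow : ∀ k → ι 2 ^^ k ≈ ι (2 ^ k)
    pow zero    = ≈-refl
    pow (suc k) = ≈-trans (⊗-cong ≈-refl (pow k)) (≈-sym (ι-⊗ 2 (2 ^ k)))
    96≼ : ι 2 ⊗ ι 48 ≼ ι 2 ^^ 7
    96≼ = ≼-trans (proj₂ (ι-⊗ 2 48)) (≼-trans (ι-mono (≤ᵇ-true⁻ {96} {128} refl)) (proj₂ (pow 7)))
    exponent : N * (7 * size n) ≤ 7 * N + 7 * n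
    exponent = ≤-trans (≤-reflexive (solve 2 (λ N d → N :* (con 7 :* (con 1 :+ d)) := con 7 :* N :+ con 7 :* (d :* N)) refl N (n / N)))
      (+-monoʳ-≤ (7 * N) (*-monoʳ-≤ 7 (m/n*n≤m n N)))
      where open +-*-Solver

  -- The exponent 14 adds 2 for summing over the two fingerprints, 2 for absorbing their penalties,
  -- 3 for rows that save nothing and 7 for the block.
  total-bound : ∀ n → 2 ≤ n → sumL (W n) (Φ n) ≼ Constant ⊗ (u ^^ (14 * n) ⊗ (h ^^ g ⊗ κ ^^ (n / e)))
  total-bound n 2≤n = begin
    sumL (W n) (Φ n)
      ≈⟨ Nested.nested-swap (upTo 12) (upTo N) (vecs bools (size n)) (vecs bools n) (W n) (λ c β Λv F₁ F₂ w → (ind (admissible c β n) ⊗ (constant n ⊗ prints n F₁ F₂)) ⊗ term n c β Λv F₁ F₂ w) ⟩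
    covers {n} (λ c β Λv F₁ F₂ → sumL (W n) (λ w → (ind (admissible c β n) ⊗ (constant n ⊗ prints n F₁ F₂)) ⊗ term n c β Λv F₁ F₂ w))
      ≤⟨ Nested.nested-mono (upTo 12) (upTo N) (vecs bools (size n)) (vecs bools n) (λ c c∈ → bounded c (∈-upTo⁻ c∈)) ⟩
    covers {n} (λ c β Λv F₁ F₂ → prints n F₁ F₂ ⊗ (constant n ⊗ rowB))
      ≈⟨ covers-const n (constant n ⊗ rowB) ⟩
    (ι 12 ⊗ (ι N ⊗ ι 2 ^^ size n)) ⊗ ((u ^^ n ⊗ u ^^ n) ⊗ (constant n ⊗ rowB))
      ≈⟨ rearrange₁ (ι 12) (ι N) (ι 2 ^^ size n) (u ^^ n) M u (h ^^ g) (u ^^ (3 * n)) (κ ^^ (n / e)) (ι 48 ^^ size n) ⟩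
    (((ι 12 ⊗ ι N) ⊗ M) ⊗ (u ⊗ u)) ⊗ ((((u ^^ n ⊗ u ^^ n) ⊗ (u ^^ n ⊗ u ^^ n)) ⊗ u ^^ (3 * n)) ⊗ ((h ^^ g ⊗ κ ^^ (n / e)) ⊗ (ι 2 ^^ size n ⊗ ι 48 ^^ size n)))
      ≤⟨ ⊗-monoʳ _ (⊗-monoʳ _ (⊗-monoʳ _ (sizes n))) ⟩
    (((ι 12 ⊗ ι N) ⊗ M) ⊗ (u ⊗ u)) ⊗ ((((u ^^ n ⊗ u ^^ n) ⊗ (u ^^ n ⊗ u ^^ n)) ⊗ u ^^ (3 * n)) ⊗ ((h ^^ g ⊗ κ ^^ (n / e)) ⊗ (u ^^ (7 * N) ⊗ u ^^ (7 * n))))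
      ≈⟨ rearrange₂ ((ι 12 ⊗ ι N) ⊗ M) (u ⊗ u) ((u ^^ n ⊗ u ^^ n) ⊗ (u ^^ n ⊗ u ^^ n)) (u ^^ (3 * n)) (h ^^ g ⊗ κ ^^ (n / e)) (u ^^ (7 * N)) (u ^^ (7 * n)) ⟩
    Constant ⊗ ((((u ^^ n ⊗ u ^^ n) ⊗ (u ^^ n ⊗ u ^^ n)) ⊗ (u ^^ (3 * n) ⊗ u ^^ (7 * n))) ⊗ (h ^^ g ⊗ κ ^^ (n / e)))
      ≈⟨ ⊗-cong ≈-refl (⊗-cong powers ≈-refl) ⟩
    Constant ⊗ (u ^^ (14 * n) ⊗ (h ^^ g ⊗ κ ^^ (n / e))) ∎
    where
    open ≼-Reasoning
    M rowB : ℚ₊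
    M = ι N ^^ (E + E)
    rowB = (u ^^ (3 * n) ⊗ κ ^^ (n / e)) ⊗ ι 48 ^^ size n
    bounded : ∀ c → c < 12 → ∀ β Λv F₁ F₂ → sumL (W n) (λ w → (ind (admissible c β n) ⊗ (constant n ⊗ prints n F₁ F₂)) ⊗ term n c β Λv F₁ F₂ w)
      ≼ prints n F₁ F₂ ⊗ (constant n ⊗ rowB)
    bounded c c<12 β Λv F₁ F₂ with admissible c β n in adm
    ... | false = ≼-trans (≈⇒≼ (≈-trans (sumL-⊗ˡ (W n) _ _) (≈-trans (⊗-cong (⊗-zeroˡ _) ≈-refl) (⊗-zeroˡ _)))) 𝟘≼
    ... | true  = ≼-trans (≈⇒≼ (sumL-⊗ˡ (W n) _ _)) (≼-trans (⊗-monoʳ _ (rows n c β Λv F₁ F₂ 2≤n c<12 adm))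
      (≈⇒≼ (e₀ (constant n) (prints n F₁ F₂) rowB)))
      where
      e₀ : ∀ C P B → (𝟙 ⊗ (C ⊗ P)) ⊗ B ≈ P ⊗ (C ⊗ B)
      e₀ = solve 3 (λ C P B → (con 1 :* (C :* P)) :* B := P :* (C :* B)) ≈-refl
        where open ℚ₊-Solver
    rearrange₁ : ∀ a b c un M u H u3 k f → (a ⊗ (b ⊗ c)) ⊗ ((un ⊗ un) ⊗ (((M ⊗ ((u ⊗ un) ⊗ (u ⊗ un))) ⊗ H) ⊗ ((u3 ⊗ k) ⊗ f)))
      ≈ (((a ⊗ b) ⊗ M) ⊗ (u ⊗ u)) ⊗ ((((un ⊗ un) ⊗ (un ⊗ un)) ⊗ u3) ⊗ ((H ⊗ k) ⊗ (c ⊗ f)))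
    rearrange₁ = solve 10 (λ a b c un M u H u3 k f → (a :* (b :* c)) :* ((un :* un) :* (((M :* ((u :* un) :* (u :* un))) :* H) :* ((u3 :* k) :* f)))
      := (((a :* b) :* M) :* (u :* u)) :* ((((un :* un) :* (un :* un)) :* u3) :* ((H :* k) :* (c :* f)))) ≈-refl
      where open ℚ₊-Solver
    rearrange₂ : ∀ a b c d f y z → (a ⊗ b) ⊗ ((c ⊗ d) ⊗ (f ⊗ (y ⊗ z))) ≈ (a ⊗ (b ⊗ y)) ⊗ ((c ⊗ (d ⊗ z)) ⊗ f)
    rearrange₂ = solve 7 (λ a b c d f y z → (a :* b) :* ((c :* d) :* (f :* (y :* z))) := (a :* (b :* y)) :* ((c :* (d :* z)) :* f)) ≈-refl
      where open ℚ₊-Solver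
    powers : ((u ^^ n ⊗ u ^^ n) ⊗ (u ^^ n ⊗ u ^^ n)) ⊗ (u ^^ (3 * n) ⊗ u ^^ (7 * n)) ≈ u ^^ (14 * n)
    powers = ≈-trans (⊗-cong (≈-trans (⊗-cong (≈-sym (^^-+ u n n)) (≈-sym (^^-+ u n n))) (≈-sym (^^-+ u (n + n) (n + n)))) (≈-sym (^^-+ u (3 * n) (7 * n))))
      (≈-trans (≈-sym (^^-+ u ((n + n) + (n + n)) (3 * n + 7 * n))) (≈-reflexive (cong (u ^^_)
        (solve 1 (λ n → ((n :+ n) :+ (n :+ n)) :+ (con 3 :* n :+ con 7 :* n) := con 14 :* n) refl n))))
      where open +-*-Solver

-- Matched pairs of positions and untypical words

length-cartesianProduct : {A B : Set} (xs : List A) (ys : List B) → length (cartesianProduct xs ys) ≡ length xs * length ys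
length-cartesianProduct []       ys = refl
length-cartesianProduct (x ∷ xs) ys = trans (length-++ (map (x ,_) ys))
  (cong₂ _+_ (length-map (x ,_) ys) (length-cartesianProduct xs ys))

prodTo-last : ∀ n (f : ℕ → ℚ₊) → prodTo (suc n) f ≈ prodTo n f ⊗ f n
prodTo-last n f = ≈-trans (≈-reflexive (cong (λ z → prodTo z f) (+-comm 1 n))) (≈-trans (prodTo-+ n 1 f)
  (⊗-cong ≈-refl (≈-trans (⊗-identityʳ _) (≈-reflexive (cong f (+-identityʳ n))))))

prodTo-rev : ∀ n (f : ℕ → ℚ₊) → prodTo n (λ t → f (n ∸ suc t)) ≈ prodTo n f
prodTo-rev zero    f = ≈-refl
prodTo-rev (suc n) f = ≈-trans (⊗-cong ≈-refl (prodTo-rev n f)) (≈-trans (⊗-comm (f n) _) (≈-sym (prodTo-last n f)))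

on : ℕ → ℕ → (ℕ → ℚ₊) → ℕ → ℚ₊
on s r f i = if interval s r i then f (i ∸ s) else 𝟙

prodTo-on : ∀ s r n f → s + r ≤ n → prodTo n (on s r f) ≈ prodTo r f
prodTo-on s r n f s+r≤n = begin-equality
  prodTo n (on s r f)                                                  ≡⟨ cong (λ z → prodTo z (on s r f)) n≡ ⟨
  prodTo (s + (r + d)) (on s r f)                                      ≈⟨ ≈-trans (prodTo-+ s (r + d) _) (⊗-cong ≈-refl (prodTo-+ r d _)) ⟩
  prodTo s (on s r f) ⊗ (prodTo r (λ i → on s r f (s + i)) ⊗ prodTo d (λ i → on s r f (s + (r + i))))
    ≈⟨ ⊗-cong (ones′ s before) (⊗-cong (prodTo-cong r inside) (ones′ d after)) ⟩
  𝟙 ⊗ (prodTo r f ⊗ 𝟙)                                                 ≈⟨ ≈-trans (⊗-identityˡ _) (⊗-identityʳ _) ⟩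
  prodTo r f                                                           ∎
  where
  open ≼-Reasoning
  d : ℕ
  d = n ∸ (s + r)
  n≡ : s + (r + d) ≡ n
  n≡ = trans (sym (+-assoc s r d)) (m+[n∸m]≡n s+r≤n)
  ones′ : ∀ k {h : ℕ → ℚ₊} → (∀ i → i < k → h i ≈ 𝟙) → prodTo k h ≈ 𝟙
  ones′ k p = ≈-trans (prodTo-cong k p) (≈-trans (prodTo-const k 𝟙) (𝟙^^ k))
  before : ∀ i → i < s → on s r f i ≈ 𝟙
  before i i<s rewrite ≤ᵇ-false i<s = ≈-refl
  inside : ∀ i → i < r → on s r f (s + i) ≈ f i
  inside i i<r rewrite interval⁺ {s} {r} {s + i} (m≤m+n s i) (+-monoʳ-< s i<r) = ≈-reflexive (cong f (m+n∸m≡n s i))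
  after : ∀ i → i < d → on s r f (s + (r + i)) ≈ 𝟙
  after i _ rewrite ¬true⇒false {interval s r (s + (r + i))} (λ e → <⇒≱ (proj₂ (interval⁻ {s} {r} e)) (+-monoʳ-≤ s (m≤m+n r i))) = ≈-refl

-- Two disjoint intervals [s₁, s₁ + r) and [s₂, s₂ + r) of positions are matched,
-- by translation or (if rev holds) by reflection; a one in the first interval
-- forces a one (a non-one, if rev holds) at the matched position.  Summing over
-- the set U of ones in the first interval saves a factor 4/5 per pair.
module Pairs (n r : ℕ) where

  mirror : Bool → ℕ → ℕ
  mirror rev t = if rev then r ∸ suc t else t

  mirror<r : ∀ rev t → t < r → mirror rev t < r
  mirror<r false t t<r = t<r
  mirror<r true  t t<r = ∸-monoʳ-< z<s t<r

  mirror-involutive : ∀ rev t → t < r → mirror rev (mirror rev t) ≡ t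
  mirror-involutive false t t<r = refl
  mirror-involutive true  t t<r = trans (cong (r ∸_) (sym (+-∸-assoc 1 t<r))) (m∸[m∸n]≡n (<⇒≤ t<r))

  forced : Bool → Bool → ℕ → Bool
  forced rev b α = not b ∨ eqᵇ (not rev) (α ≡ᵇ 0)

  condition : (rev : Bool) (s₁ s₂ : ℕ) (U : ℕ → Bool) → ℕ → ℕ → Bool
  condition rev s₁ s₂ U i α = if interval s₁ r i then eqᵇ (U (i ∸ s₁)) (α ≡ᵇ 0) else
    if interval s₂ r i then forced rev (U (mirror rev (i ∸ s₂))) α else true

  -- Row weights once it is known whether the letter is 1: including the penalty term, at most 0.62
  -- for a one and at most 0.39 for a larger letter. A pair then weighs at most 0.39 + 0.62 * 0.62,
  -- below 4/5.
  small₁ small₂ : Bool → ℚ₊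
  small₁ b = if b then frac 62 99 else frac 39 99
  small₂ b = if b then frac 62 99 else 𝟙

  module _ (A N′ : ℕ) (x : ℚ₊) (x≼x₀ : x ≼ x₀) (x+x²≼𝟙 : x ⊕ x ⊗ x ≼ 𝟙) (3p≼ : ι 3 ⊗ frac 1 N′ ≼ frac 1 9999)
    (rev : Bool) (s₁ s₂ : ℕ) (U : ℕ → Bool) (s₁+r≤s₂ : s₁ + r ≤ s₂) (s₂+r≤n : s₂ + r ≤ n) where

    private
      p u : ℚ₊
      p = frac 1 N′
      u = 1+1/ N′

      cond : ℕ → ℕ → Bool
      cond = condition rev s₁ s₂ U

      row : ℕ → ℚ₊
      row i = sumL (upTo A) (λ α → x ^^ suc α ⊗ capped p 2 (cond i) α)

      one≼ : ∀ f → (f 1 ≡ false) → horner x f 2 ⊕ ι 3 ⊗ p ≼ frac 62 99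
      one≼ f f1 = ≼-trans (⊕-mono (≼-trans (⊗-mono x≼x₀ (⊕-mono (ind≼𝟙 (f 0)) (⊗-mono x≼x₀ (≈⇒≼ (⊕-identityʳ _)))))
          (≼-trans (⊗-monoʳ x₀ (⊕-monoʳ 𝟙 (≈⇒≼ (≈-trans (⊗-cong ≈-refl (≈-reflexive (cong ind f1))) (⊗-zeroʳ x₀))))) (≈⇒≼ (≈-trans (⊗-cong ≈-refl (⊕-identityʳ 𝟙)) (⊗-identityʳ x₀))))) 3p≼)
        (≼-trans (≈⇒≼ (frac-⊕ 34 54 1 9999)) (frac-≼ (≤ᵇ-true⁻ refl)))

      two≼ : ∀ f → (f 0 ≡ false) → horner x f 2 ⊕ ι 3 ⊗ p ≼ frac 39 99
      two≼ f f0 = ≼-trans (⊕-mono (≼-trans (⊗-mono x≼x₀ (⊕-mono (≈⇒≼ (≈-reflexive (cong ind f0))) (⊗-mono x≼x₀ (≼-trans (≈⇒≼ (⊕-identityʳ _)) (ind≼𝟙 (f 1))))))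
          (≈⇒≼ (≈-trans (⊗-cong ≈-refl (≈-trans (⊕-identityˡ _) (⊗-identityʳ x₀))) (frac-⊗ 34 54 34 54)))) 3p≼)
        (≼-trans (≈⇒≼ (frac-⊕ (34 * 34) (54 + 54 * 55) 1 9999)) (frac-≼ (≤ᵇ-true⁻ refl)))

      1≼u³ : 𝟙 ≼ u ^^ 3
      1≼u³ = 𝟙≼^^ 3 (𝟙≼1+1/ N′)

      1+3p≼u³ : 𝟙 ⊕ ι 3 ⊗ p ≼ u ^^ 3
      1+3p≼u³ = ≼-trans (bernoulli p 3) (^^-mono 3 (proj₂ (1+1/≈ N′)))

      39≼62 : frac 39 99 ≼ frac 62 99
      39≼62 = frac-≼ (≤ᵇ-true⁻ refl)

      first≼ : ∀ b → horner x (λ α → eqᵇ b (α ≡ᵇ 0)) 2 ⊕ ι 3 ⊗ p ≼ small₁ b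
      first≼ true  = one≼ (λ α → eqᵇ true (α ≡ᵇ 0)) refl
      first≼ false = two≼ (λ α → eqᵇ false (α ≡ᵇ 0)) refl

      second≼ : ∀ rv b → horner x (forced rv b) 2 ⊕ ι 3 ⊗ p ≼ u ^^ 3 ⊗ small₂ b
      second≼ rv    false = ≼-trans (⊕-monoˡ _ (horner₂≼ (forced rv false) x+x²≼𝟙)) (≼-trans 1+3p≼u³ (proj₂ (⊗-identityʳ _)))
      -- A forced non-one weighs only 0.39; weakening this to 0.62 lets reflections and translations
      -- share one estimate.
      second≼ true  true  = ≼-trans (≼-trans (two≼ (forced true true) refl) 39≼62) (≼-trans (proj₂ (⊗-identityˡ _)) (⊗-monoˡ _ 1≼u³))
      second≼ false true  = ≼-trans (one≼ (forced false true) refl) (≼-trans (proj₂ (⊗-identityˡ _)) (⊗-monoˡ _ 1≼u³))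

      h₁ h₂ : ℕ → ℚ₊
      h₁ = on s₁ r (λ t → small₁ (U t))
      h₂ = on s₂ r (λ t → small₂ (U (mirror rev t)))

      row≼ : ∀ i → row i ≼ u ^^ 3 ⊗ (h₁ i ⊗ h₂ i)
      row≼ i = ≼-trans (capped-row A x p 2 (cond i) (≼-trans x≼x₀ x₀≼2/3)) (go (interval s₁ r i) (interval s₂ r i) refl refl)
        where
        go : ∀ b₁ b₂ → interval s₁ r i ≡ b₁ → interval s₂ r i ≡ b₂ → horner x (cond i) 2 ⊕ ι 3 ⊗ p ≼ u ^^ 3 ⊗ (h₁ i ⊗ h₂ i)
        go true true e₁ e₂ = ⊥-elim (<⇒≱ (proj₂ (interval⁻ {s₁} {r} e₁)) (≤-trans s₁+r≤s₂ (proj₁ (interval⁻ {s₂} {r} e₂))))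
        go true false e₁ e₂ rewrite e₁ | e₂ = ≼-trans (first≼ (U (i ∸ s₁)))
          (≼-trans (proj₂ (⊗-identityˡ _)) (⊗-mono 1≼u³ (proj₂ (⊗-identityʳ _))))
        go false true e₁ e₂ rewrite e₁ | e₂ = ≼-trans (second≼ rev (U (mirror rev (i ∸ s₂)))) (⊗-monoʳ _ (proj₂ (⊗-identityˡ _)))
        go false false e₁ e₂ rewrite e₁ | e₂ = ≼-trans (⊕-monoˡ _ (horner₂≼ (λ _ → true) x+x²≼𝟙))
          (≼-trans 1+3p≼u³ (proj₂ (≈-trans (⊗-cong ≈-refl (⊗-identityˡ 𝟙)) (⊗-identityʳ _))))

    pair-product : prodTo n row ≼ u ^^ (3 * n) ⊗ prodTo r (λ t → small₁ (U t) ⊗ small₂ (U t))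
    pair-product = begin
      prodTo n row                                             ≤⟨ prodTo-mono n (λ i _ → row≼ i) ⟩
      prodTo n (λ i → u ^^ 3 ⊗ (h₁ i ⊗ h₂ i))                  ≈⟨ ≈-trans (prodTo-⊗ n _ _) (⊗-cong (≈-trans (prodTo-const n _) (≈-sym (^^-* u 3 n))) (prodTo-⊗ n h₁ h₂)) ⟩
      u ^^ (3 * n) ⊗ (prodTo n h₁ ⊗ prodTo n h₂)
        ≈⟨ ⊗-cong ≈-refl (⊗-cong (prodTo-on s₁ r n _ (≤-trans s₁+r≤s₂ (≤-trans (m≤m+n s₂ r) s₂+r≤n))) (≈-trans (prodTo-on s₂ r n _ s₂+r≤n) (unmirror rev))) ⟩
      u ^^ (3 * n) ⊗ (prodTo r (λ t → small₁ (U t)) ⊗ prodTo r (λ t → small₂ (U t)))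
        ≈⟨ ⊗-cong ≈-refl (prodTo-⊗ r _ _) ⟨
      u ^^ (3 * n) ⊗ prodTo r (λ t → small₁ (U t) ⊗ small₂ (U t)) ∎
      where
      open ≼-Reasoning
      unmirror : ∀ rv → prodTo r (λ t → small₂ (U (mirror rv t))) ≈ prodTo r (λ t → small₂ (U t))
      unmirror false = ≈-refl
      unmirror true  = prodTo-rev r (λ t → small₂ (U t))

  sum-pairs : sumL (vecs bools r) (λ U → prodTo r (λ t → small₁ (at false U t) ⊗ small₂ (at false U t))) ≼ frac 4 4 ^^ r
  sum-pairs = ≼-trans (≈⇒≼ (sum-of-products false bools r (λ _ b → small₁ b ⊗ small₂ b)))
    (≼-trans (prodTo-mono r (λ _ _ → ≼-trans (≈⇒≼ (≈-trans (⊕-cong (⊗-identityʳ _) (≈-trans (⊕-identityʳ _) (frac-⊗ 62 99 62 99))) (frac-⊕ 39 99 (62 * 62) (99 + 99 * 100))))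
      (frac-≼ (≤ᵇ-true⁻ refl)))) (≈⇒≼ (prodTo-const r (frac 4 4))))

-- Turns polynomial factors, the numbers of lengths and of places, into a constant times a power of
-- `1 + 1/N`.
ι[1+n]≼ : ∀ N′ n → ι (suc n) ≼ ι (suc N′) ⊗ 1+1/ N′ ^^ n
ι[1+n]≼ N′ n = begin
  ι (1 + n)                           ≈⟨ ι-⊕ 1 n ⟩
  𝟙 ⊕ ι n                             ≤⟨ ⊕-monoˡ _ (ι-mono (s≤s z≤n)) ⟩
  ι N ⊕ ι n                           ≈⟨ ⊕-cong (⊗-identityʳ _) (≈-trans (⊗-cong ≈-refl (frac-ι 1 N′)) (⊗-identityʳ _)) ⟨
  ι N ⊗ 𝟙 ⊕ ι n ⊗ (ι N ⊗ p)           ≈⟨ e (ι N) (ι n) p ⟩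
  ι N ⊗ (𝟙 ⊕ ι n ⊗ p)                 ≤⟨ ⊗-monoʳ (ι N) (≼-trans (bernoulli p n) (^^-mono n (proj₂ (1+1/≈ N′)))) ⟩
  ι N ⊗ u ^^ n                        ∎
  where
  open ≼-Reasoning
  N : ℕ
  N = suc N′
  p u : ℚ₊
  p = frac 1 N′
  u = 1+1/ N′
  e : ∀ a b c → a ⊗ 𝟙 ⊕ b ⊗ (a ⊗ c) ≈ a ⊗ (𝟙 ⊕ b ⊗ c)
  e = solve 3 (λ a b c → a :* con 1 :+ b :* (a :* c) := a :* (con 1 :+ b :* c)) ≈-refl
    where open ℚ₊-Solver

module Untypical (N′ g A : ℕ) (r : ℕ → ℕ) (x h : ℚ₊) where

  private
    N : ℕ
    N = suc N′
    p u : ℚ₊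
    p = frac 1 N′
    u = 1+1/ N′

  places : ℕ → List (Bool × ℕ × ℕ)
  places n = cartesianProduct bools (cartesianProduct (upTo (suc n)) (upTo (suc n)))

  apart : (n : ℕ) → Bool × ℕ × ℕ → Bool
  apart n (_ , s₁ , s₂) = (s₁ + r n ≤ᵇ s₂) ∧ (s₂ + r n ≤ᵇ n)

  term : (n : ℕ) → Bool × ℕ × ℕ → Vec Bool (r n) → Vec ℕ n → ℚ₊
  term n (rev , s₁ , s₂) U w = prodTo n (λ i → x ^^ kw w i ⊗ capped p 2 (Pairs.condition n (r n) rev s₁ s₂ (at false U) i) (at 0 w i))

  Φ : (n : ℕ) → Vec ℕ n → ℚ₊
  Φ n w = sumL (places n) (λ q → sumL (vecs bools (r n)) (λ U → (ind (apart n q) ⊗ (u ^^ n ⊗ h ^^ g)) ⊗ term n q U w))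

  length-places : ∀ n → length (places n) ≡ 2 * (suc n * suc n)
  length-places n = trans (length-cartesianProduct bools (cartesianProduct (upTo (suc n)) (upTo (suc n)))) (cong (2 *_)
    (trans (length-cartesianProduct (upTo (suc n)) (upTo (suc n))) (cong (λ z → z * z) (length-upTo (suc n)))))

  -- The exponent 6 adds 2 for the choice of the two intervals, 1 for absorbing the letters at least
  -- 3 and 3 for the penalty in each row.
  total-bound : x ≼ x₀ → x ⊕ x ⊗ x ≼ 𝟙 → ι 3 ⊗ frac 1 N′ ≼ frac 1 9999 → ∀ n →
    sumL (vecs (upTo A) n) (Φ n) ≼ (ι 2 ⊗ (ι N ⊗ ι N)) ⊗ (u ^^ (6 * n) ⊗ (h ^^ g ⊗ frac 4 4 ^^ r n))
  total-bound x≼ x+x² 3p≼ n = begin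
    sumL W (Φ n)
      ≈⟨ ≈-trans (sumL-swap W (places n) _) (sumL-cong (places n) (λ q → ≈-trans (sumL-swap W (vecs bools (r n)) _)
           (sumL-cong (vecs bools (r n)) (λ U → sumL-⊗ˡ W _ _)))) ⟩
    sumL (places n) (λ q → sumL (vecs bools (r n)) (λ U → (ind (apart n q) ⊗ (u ^^ n ⊗ h ^^ g)) ⊗ sumL W (term n q U)))
      ≤⟨ sumL-bound (places n) each ⟩
    ι (length (places n)) ⊗ ((u ^^ n ⊗ h ^^ g) ⊗ (u ^^ (3 * n) ⊗ frac 4 4 ^^ r n))
      ≤⟨ ⊗-monoˡ _ (≼-trans (≈⇒≼ (≈-trans (≈-reflexive (cong ι (length-places n))) (≈-trans (ι-⊗ 2 _) (⊗-cong ≈-refl (ι-⊗ (suc n) (suc n))))))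
           (⊗-monoʳ (ι 2) (⊗-mono (ι[1+n]≼ N′ n) (ι[1+n]≼ N′ n)))) ⟩
    (ι 2 ⊗ ((ι N ⊗ u ^^ n) ⊗ (ι N ⊗ u ^^ n))) ⊗ ((u ^^ n ⊗ h ^^ g) ⊗ (u ^^ (3 * n) ⊗ frac 4 4 ^^ r n))
      ≈⟨ rearrange (ι 2) (ι N) (u ^^ n) (h ^^ g) (u ^^ (3 * n)) (frac 4 4 ^^ r n) ⟩
    (ι 2 ⊗ (ι N ⊗ ι N)) ⊗ (((u ^^ n ⊗ u ^^ n) ⊗ (u ^^ n ⊗ u ^^ (3 * n))) ⊗ (h ^^ g ⊗ frac 4 4 ^^ r n))
      ≈⟨ ⊗-cong ≈-refl (⊗-cong powers ≈-refl) ⟩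
    (ι 2 ⊗ (ι N ⊗ ι N)) ⊗ (u ^^ (6 * n) ⊗ (h ^^ g ⊗ frac 4 4 ^^ r n)) ∎
    where
    open ≼-Reasoning
    W : List (Vec ℕ n)
    W = vecs (upTo A) n
    rearrange : ∀ a N u H u3 f → (a ⊗ ((N ⊗ u) ⊗ (N ⊗ u))) ⊗ ((u ⊗ H) ⊗ (u3 ⊗ f)) ≈ (a ⊗ (N ⊗ N)) ⊗ (((u ⊗ u) ⊗ (u ⊗ u3)) ⊗ (H ⊗ f))
    rearrange = solve 6 (λ a N u H u3 f → (a :* ((N :* u) :* (N :* u))) :* ((u :* H) :* (u3 :* f)) := (a :* (N :* N)) :* (((u :* u) :* (u :* u3)) :* (H :* f))) ≈-refl
      where open ℚ₊-Solver
    powers : (u ^^ n ⊗ u ^^ n) ⊗ (u ^^ n ⊗ u ^^ (3 * n)) ≈ u ^^ (6 * n)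
    powers = ≈-trans (⊗-cong (≈-sym (^^-+ u n n)) (≈-sym (^^-+ u n (3 * n)))) (≈-trans (≈-sym (^^-+ u (n + n) (n + 3 * n)))
      (≈-reflexive (cong (u ^^_) (solve 1 (λ n → (n :+ n) :+ (n :+ con 3 :* n) := con 6 :* n) refl n))))
      where open +-*-Solver
    each : ∀ q → sumL (vecs bools (r n)) (λ U → (ind (apart n q) ⊗ (u ^^ n ⊗ h ^^ g)) ⊗ sumL W (term n q U))
      ≼ (u ^^ n ⊗ h ^^ g) ⊗ (u ^^ (3 * n) ⊗ frac 4 4 ^^ r n)
    each q@(rev , s₁ , s₂) with apart n q in e
    ... | false = ≼-trans (≈⇒≼ (≈-trans (sumL-cong (vecs bools (r n)) (λ U → ≈-trans (⊗-cong (⊗-zeroˡ _) ≈-refl) (⊗-zeroˡ _))) (sumL-𝟘 (vecs bools (r n))))) 𝟘≼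
    ... | true  = begin
      sumL (vecs bools (r n)) (λ U → (𝟙 ⊗ (u ^^ n ⊗ h ^^ g)) ⊗ sumL W (term n q U))
        ≈⟨ ≈-trans (sumL-⊗ˡ (vecs bools (r n)) _ _) (⊗-cong (⊗-identityˡ _) ≈-refl) ⟩
      (u ^^ n ⊗ h ^^ g) ⊗ sumL (vecs bools (r n)) (λ U → sumL W (term n q U))
        ≤⟨ ⊗-monoʳ _ (≼-trans (sumL-mono (vecs bools (r n)) (λ U → ≼-trans
             (≈⇒≼ (sum-of-products 0 (upTo A) n (λ i α → x ^^ suc α ⊗ capped p 2 (Pairs.condition n (r n) rev s₁ s₂ (at false U) i) α)))
             (Pairs.pair-product n (r n) A N′ x x≼ x+x² 3p≼ rev s₁ s₂ (at false U) (≤ᵇ-true⁻ (proj₁ (∧-true⁻ {s₁ + r n ≤ᵇ s₂} e))) (≤ᵇ-true⁻ (proj₂ (∧-true⁻ {s₁ + r n ≤ᵇ s₂} e))))))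
             (≼-trans (≈⇒≼ (sumL-⊗ˡ (vecs bools (r n)) _ _)) (⊗-monoʳ _ (Pairs.sum-pairs n (r n))))) ⟩
      (u ^^ n ⊗ h ^^ g) ⊗ (u ^^ (3 * n) ⊗ frac 4 4 ^^ r n) ∎

  module _ {n : ℕ} (w : Vec ℕ n) (ineq : KunzInequalities w) (hx : h ⊗ x ≈ 𝟙) (sum≡g : sumTo n (kw w) ≡ g)
    (few : suc N′ * suc N′ * countUpTo n (λ i → 3 ≤ᵇ kw w i) ≤ n) where

    open KunzInequalities ineq

    private
      K : ℕ → ℕ
      K = kw w
      ρ : ℕ
      ρ = r n

    matched⇒𝟙≼Φ : ∀ rev s₁ s₂ → s₁ + ρ ≤ s₂ → s₂ + ρ ≤ n →
      (∀ t → t < ρ → K (s₁ + t) ≡ 1 → Pairs.forced n ρ rev true (at 0 w (s₂ + Pairs.mirror n ρ rev t)) ≡ true) → 𝟙 ≼ Φ n w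
    matched⇒𝟙≼Φ rev s₁ s₂ s₁+r≤s₂ s₂+r≤n match = ≼-trans 𝟙≼summand
      (≼-trans (∈⇒≼sumL (vecs bools ρ) (λ U → (ind (apart n q) ⊗ (u ^^ n ⊗ h ^^ g)) ⊗ term n q U w) (at-∈-bools U))
        (∈⇒≼sumL (places n) (λ q → sumL (vecs bools ρ) (λ U → (ind (apart n q) ⊗ (u ^^ n ⊗ h ^^ g)) ⊗ term n q U w))
          (∈-cartesianProduct⁺ (∈-bools rev) (∈-cartesianProduct⁺ (∈-upTo⁺ (s≤s (≤-trans (m≤m+n s₁ ρ) (≤-trans s₁+r≤s₂ s₂≤n)))) (∈-upTo⁺ (s≤s s₂≤n))))))
      where
      open Pairs n ρ using (mirror; mirror<r; mirror-involutive; forced; condition)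
      s₂≤n : s₂ ≤ n
      s₂≤n = ≤-trans (m≤m+n s₂ ρ) s₂+r≤n
      q : Bool × ℕ × ℕ
      q = rev , s₁ , s₂
      -- The summand that charges `w` is the one in which `U` is the actual set of ones in the first
      -- interval.
      U : Vec Bool ρ
      U = tabV ρ (λ t → K (s₁ + t) ≡ᵇ 1)
      U≡ : ∀ t → t < ρ → at false U t ≡ (K (s₁ + t) ≡ᵇ 1)
      U≡ = at-tabV false ρ _
      eqᵇ-refl : ∀ b → eqᵇ b b ≡ true
      eqᵇ-refl true  = refl
      eqᵇ-refl false = refl
      holds : ∀ i → i < n → condition rev s₁ s₂ (at false U) i (at 0 w i) ≡ true
      holds i i<n with interval s₁ ρ i in e₁ | interval s₂ ρ i in e₂
      ... | true | _ = let lo , hi = interval⁻ {s₁} {ρ} e₁ ; eq = m+[n∸m]≡n lo in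
        trans (cong (λ b → eqᵇ b (at 0 w i ≡ᵇ 0)) (trans (U≡ (i ∸ s₁) (+-cancelˡ-< s₁ _ _ (subst (_< s₁ + ρ) (sym eq) hi)))
          (cong (λ z → at 0 w z ≡ᵇ 0) eq))) (eqᵇ-refl (at 0 w i ≡ᵇ 0))
      ... | false | false = refl
      ... | false | true = go (at false U (mirror rev t)) refl
        where
        t : ℕ
        t = i ∸ s₂
        eq : s₂ + t ≡ i
        eq = m+[n∸m]≡n (proj₁ (interval⁻ {s₂} {ρ} e₂))
        t<ρ : t < ρ
        t<ρ = +-cancelˡ-< s₂ _ _ (subst (_< s₂ + ρ) (sym eq) (proj₂ (interval⁻ {s₂} {ρ} e₂)))
        go : ∀ b → at false U (mirror rev t) ≡ b → forced rev b (at 0 w i) ≡ true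
        go false _ = refl
        go true  e = subst (λ z → forced rev true (at 0 w z) ≡ true) (trans (cong (s₂ +_) (mirror-involutive rev t t<ρ)) eq)
          (match (mirror rev t) (mirror<r rev t t<ρ) (≡ᵇ-true⁻ {K (s₁ + mirror rev t)} {1} (trans (sym (U≡ (mirror rev t) (mirror<r rev t t<ρ))) e)))
      p≼𝟙 : p ≼ 𝟙
      p≼𝟙 = frac-≼ (≤-trans (≤-reflexive (*-identityʳ 1)) (s≤s z≤n))
      capped⁺ : ∀ f α → f α ≡ true → p ^ᵇ (3 ≤ᵇ suc α) ≼ capped p 2 f α
      capped⁺ f 0 e rewrite e = ≼-refl
      capped⁺ f 1 e rewrite e = ≼-refl
      capped⁺ f (suc (suc α)) e = ≼-refl
      coefficients : 𝟙 ≼ u ^^ n ⊗ prodTo n (λ i → capped p 2 (condition rev s₁ s₂ (at false U) i) (at 0 w i))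
      coefficients = ≼-trans (absorb N′ _ n few) (⊗-monoʳ _ (≼-trans (proj₂ (prodTo-^ᵇ n p (λ i → 3 ≤ᵇ K i)))
        (prodTo-mono n (λ i i<n → capped⁺ (condition rev s₁ s₂ (at false U) i) (at 0 w i) (holds i i<n)))))
      𝟙≼summand : 𝟙 ≼ (ind (apart n q) ⊗ (u ^^ n ⊗ h ^^ g)) ⊗ term n q U w
      𝟙≼summand = begin
        𝟙                                                    ≤⟨ 𝟙≼⊗ coefficients (proj₂ (inverse-powers g hx)) ⟩
        (u ^^ n ⊗ Co) ⊗ (h ^^ g ⊗ x ^^ g)                    ≈⟨ e (u ^^ n) Co (h ^^ g) (x ^^ g) ⟩
        (𝟙 ⊗ (u ^^ n ⊗ h ^^ g)) ⊗ (x ^^ g ⊗ Co)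
          ≈⟨ ⊗-cong (⊗-cong (≈-reflexive (cong ind (sym (∧-true (≤ᵇ-true s₁+r≤s₂) (≤ᵇ-true s₂+r≤n))))) ≈-refl)
               (≈-trans (⊗-cong (≈-trans (≈-reflexive (cong (x ^^_) (sym sum≡g))) (≈-sym (word-weight w x))) ≈-refl) (≈-sym (prodTo-⊗ n _ _))) ⟩
        (ind (apart n q) ⊗ (u ^^ n ⊗ h ^^ g)) ⊗ term n q U w ∎
        where
        open ≼-Reasoning
        Co : ℚ₊
        Co = prodTo n (λ i → capped p 2 (condition rev s₁ s₂ (at false U) i) (at 0 w i))
        e : ∀ a b c d → (a ⊗ b) ⊗ (c ⊗ d) ≈ (𝟙 ⊗ (a ⊗ c)) ⊗ (d ⊗ b)
        e = solve 4 (λ a b c d → (a :* b) :* (c :* d) := (con 1 :* (a :* c)) :* (d :* b)) ≈-refl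
          where open ℚ₊-Solver

    private
      not-one : ∀ k → k ≢ 1 → Pairs.forced n ρ true true (pred k) ≡ true ⊎ k ≡ 0
      not-one zero          _ = inj₂ refl
      not-one (suc zero)    f = ⊥-elim (f refl)
      not-one (suc (suc k)) _ = inj₁ refl

      reflected : ∀ j → K j ≢ 1 → Pairs.forced n ρ true true (at 0 w j) ≡ true
      reflected j f with not-one (K j) f
      ... | inj₁ e = e

      -- If position `l` is not a sum of two ones, then `t` and `l - 1 - t` never both carry a 1.
      -- The condition `2ρ ≤ l` keeps the two reflected intervals apart.
      no-sum⇒𝟙≼Φ : ∀ l → ρ + ρ ≤ l → l ≤ n → (∀ t → t < ρ → K t ≡ 1 → K (l ∸ suc t) ≢ 1) → 𝟙 ≼ Φ n w
      no-sum⇒𝟙≼Φ l 2ρ≤l l≤n none = matched⇒𝟙≼Φ true 0 (l ∸ ρ) (m+n≤o⇒m≤o∸n ρ 2ρ≤l)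
        (≤-trans (≤-reflexive (m∸n+n≡m ρ≤l)) l≤n)
        (λ t t<ρ Kt → reflected (l ∸ ρ + (ρ ∸ suc t)) (λ e → none t t<ρ Kt (subst (λ z → K z ≡ 1) (shift t t<ρ) e)))
        where
        ρ≤l : ρ ≤ l
        ρ≤l = ≤-trans (m≤m+n ρ ρ) 2ρ≤l
        shift : ∀ t → t < ρ → l ∸ ρ + (ρ ∸ suc t) ≡ l ∸ suc t
        shift t t<ρ = trans (sym (+-∸-assoc (l ∸ ρ) t<ρ)) (cong (_∸ suc t) (m∸n+n≡m ρ≤l))

    -- Each failure of typicality links `ρ` pairs. A missing sum, or a letter at least 4, forbids
    -- two ones in a reflected pair; a small gap that does not escape forces the letter 1 to
    -- propagate along a translation.
    typical-or : 5 * ρ < n → (𝟙 ≼ Φ n w) ⊎ Typical w ρ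
    typical-or 5ρ<n with search n bad-sum | search n bad-depth | search (suc n) bad-gap
      where
      bad-sum bad-depth bad-gap : ℕ → Bool
      bad-sum l = (ρ + ρ ≤ᵇ l) ∧ not (anyUpTo ρ (λ t → (K t ≡ᵇ 1) ∧ (K (l ∸ suc t) ≡ᵇ 1)))
      bad-depth l = 4 ≤ᵇ K l
      bad-gap z = ((ρ ≤ᵇ z) ∧ (z + ρ ≤ᵇ n)) ∧ not (anyUpTo ρ (λ t → (K t ≡ᵇ 1) ∧ (2 ≤ᵇ K (t + z))))
    ... | inj₁ (l , l<n , e) | _ | _ = inj₁ (no-sum⇒𝟙≼Φ l (≤ᵇ-true⁻ (proj₁ (∧-true⁻ {ρ + ρ ≤ᵇ l} e))) (<⇒≤ l<n)
          (λ t t<ρ Kt Kl → true≢false (trans (sym (anyUpTo⁺ ρ {λ t → (K t ≡ᵇ 1) ∧ (K (l ∸ suc t) ≡ᵇ 1)} t t<ρ (∧-true (≡ᵇ-true Kt) (≡ᵇ-true Kl))))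
            (not-true⁻ (proj₂ (∧-true⁻ {ρ + ρ ≤ᵇ l} e))))))
    ... | inj₂ _ | inj₁ (l , l<n , e) | _ with ρ + ρ ≤? l
    ...   | yes 2ρ≤l = inj₁ (no-sum⇒𝟙≼Φ l 2ρ≤l (<⇒≤ l<n) (λ t t<ρ Kt Kl → <⇒≱ (≤-trans (s≤s (s≤s (s≤s z≤n))) (≤ᵇ-true⁻ {4} {K l} e))
              (≤-trans (≤-reflexive (cong K (sym (eq t t<ρ)))) (≤-trans (ineq-< t (l ∸ suc t) (subst (_< n) (sym (eq t t<ρ)) l<n)) (≤-reflexive (cong₂ _+_ Kt Kl))))))
      where
      eq : ∀ t → t < ρ → suc (t + (l ∸ suc t)) ≡ l
      eq t t<ρ = m+[n∸m]≡n (≤-trans t<ρ (≤-trans (m≤m+n ρ ρ) 2ρ≤l))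
    -- A large letter near the start has too few sums below it, so the wrapped ones are used:
    -- `suc l + t` and `n - 1 - t` wrap to `l`, and two ones there would give a letter at most 3.
    -- Room for both intervals comes from `5ρ < n`.
    ...   | no 2ρ≰l = inj₁ (matched⇒𝟙≼Φ true (suc l) (n ∸ ρ) (m+n≤o⇒m≤o∸n (suc l + ρ) wide) (≤-reflexive (m∸n+n≡m ρ≤n))
              (λ t t<ρ Kt → reflected (n ∸ ρ + (ρ ∸ suc t)) (λ Kj → <⇒≱ (≤ᵇ-true⁻ {4} {K l} e)
                (≤-trans (ineq-> (suc l + t) (n ∸ ρ + (ρ ∸ suc t)) l (<-≤-trans (+-monoʳ-< (suc l) t<ρ) (≤-trans (m≤m+n (suc l + ρ) ρ) wide)) (j<n t t<ρ) l<n (sums t t<ρ))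
                  (s≤s (≤-reflexive (cong₂ _+_ Kt Kj)))))))
      where
      wide : suc l + ρ + ρ ≤ n
      wide = ≤-trans (+-monoˡ-≤ ρ (+-monoˡ-≤ ρ (≰⇒> 2ρ≰l))) (≤-trans (≤-trans (m≤m+n _ ρ) (≤-reflexive (solve 1 (λ r → (((r :+ r) :+ r) :+ r) :+ r := con 5 :* r) refl ρ))) (<⇒≤ 5ρ<n))
        where open +-*-Solver
      ρ≤n : ρ ≤ n
      ρ≤n = ≤-trans (m≤n+m ρ (suc l + ρ)) wide
      jeq : ∀ t → t < ρ → n ∸ ρ + (ρ ∸ suc t) ≡ n ∸ suc t
      jeq t t<ρ = trans (sym (+-∸-assoc (n ∸ ρ) t<ρ)) (cong (_∸ suc t) (m∸n+n≡m ρ≤n))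
      j<n : ∀ t → t < ρ → n ∸ ρ + (ρ ∸ suc t) < n
      j<n t t<ρ = subst (_< n) (sym (jeq t t<ρ)) (∸-monoʳ-< z<s (≤-trans t<ρ ρ≤n))
      sums : ∀ t → t < ρ → (suc l + t) + (n ∸ ρ + (ρ ∸ suc t)) ≡ l + n
      sums t t<ρ = trans (cong (suc l + t +_) (jeq t t<ρ)) (trans (cong (_+ (n ∸ suc t)) (sym (+-suc l t)))
        (trans (+-assoc l (suc t) _) (cong (l +_) (m+[n∸m]≡n (≤-trans t<ρ ρ≤n)))))
    typical-or 5ρ<n | inj₂ _ | inj₂ _ | inj₁ (z , _ , e) with ∧-true⁻ {(ρ ≤ᵇ z) ∧ (z + ρ ≤ᵇ n)} e
    ... | e₁ , e₂ = inj₁ (matched⇒𝟙≼Φ false 0 z (≤ᵇ-true⁻ (proj₁ (∧-true⁻ {ρ ≤ᵇ z} e₁))) (≤ᵇ-true⁻ (proj₂ (∧-true⁻ {ρ ≤ᵇ z} e₁)))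
          (λ t t<ρ Kt → follows t t<ρ Kt (at 0 w (z + t)) refl))
      where
      follows : ∀ t → t < ρ → K t ≡ 1 → ∀ k → at 0 w (z + t) ≡ k → Pairs.forced n ρ false true k ≡ true
      follows t t<ρ Kt zero    _  = refl
      follows t t<ρ Kt (suc k) eq = ⊥-elim (true≢false (trans (sym (anyUpTo⁺ ρ {λ t → (K t ≡ᵇ 1) ∧ (2 ≤ᵇ K (t + z))} t t<ρ
        (∧-true (≡ᵇ-true Kt) (≤ᵇ-true (≤-trans (s≤s (s≤s z≤n)) (≤-reflexive (sym (trans (cong K (+-comm t z)) (cong suc eq))))))))) (not-true⁻ e₂)))
    typical-or 5ρ<n | inj₂ sums-ok | inj₂ depth-ok | inj₂ gaps-ok = inj₂ (record { sums = sums ; depth≤3 = depth≤3 ; escapes = escapes })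
      where
      sums : ∀ l → ρ + ρ ≤ l → l < n → ∃[ i ] ∃[ j ] (suc (i + j) ≡ l × K i ≡ 1 × K j ≡ 1)
      sums l 2ρ≤l l<n with anyUpTo ρ (λ t → (K t ≡ᵇ 1) ∧ (K (l ∸ suc t) ≡ᵇ 1)) in ea | sums-ok l l<n
      ... | false | e = ⊥-elim (true≢false (trans (sym (∧-true (≤ᵇ-true 2ρ≤l) refl)) e))
      ... | true  | _ with anyUpTo⁻ ρ ea
      ...   | t , t<ρ , e′ with ∧-true⁻ {K t ≡ᵇ 1} e′
      ...   | Kt , Kl = t , l ∸ suc t , m+[n∸m]≡n (≤-trans t<ρ (≤-trans (m≤m+n ρ ρ) 2ρ≤l)) , ≡ᵇ-true⁻ {K t} Kt , ≡ᵇ-true⁻ {K (l ∸ suc t)} Kl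
      depth≤3 : ∀ l → l < n → K l ≤ 3
      depth≤3 l l<n = s≤s⁻¹ (≤ᵇ-false⁻ {4} {K l} (depth-ok l l<n))
      escapes : ∀ z → ρ ≤ z → z + ρ ≤ n → ∃[ j ] (j + z < n × K j ≡ 1 × 2 ≤ K (j + z))
      escapes z ρ≤z z+ρ≤n with anyUpTo ρ (λ t → (K t ≡ᵇ 1) ∧ (2 ≤ᵇ K (t + z))) in ea | gaps-ok z (s≤s (≤-trans (m≤m+n z ρ) z+ρ≤n))
      ... | false | e = ⊥-elim (true≢false (trans (sym (∧-true (∧-true (≤ᵇ-true ρ≤z) (≤ᵇ-true z+ρ≤n)) refl)) e))
      ... | true  | _ with anyUpTo⁻ ρ ea
      ...   | t , t<ρ , e′ with ∧-true⁻ {K t ≡ᵇ 1} e′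
      ...   | Kt , Kz = t , <-≤-trans (+-monoˡ-< z t<ρ) (≤-trans (≤-reflexive (+-comm ρ z)) z+ρ≤n) , ≡ᵇ-true⁻ {K t} Kt , ≤ᵇ-true⁻ {2} {K (t + z)} Kz

-- Powers of 1 + 1/N, Fibonacci quotients and tilts

≼-cancelʳ : ∀ {a b} k → 0 < k → a ⊗ ι k ≼ b ⊗ ι k → a ≼ b
≼-cancelʳ {a} {b} (suc k) _ p = begin
  a                               ≈⟨ e a ⟨
  (a ⊗ ι (suc k)) ⊗ frac 1 k      ≤⟨ ⊗-monoˡ _ p ⟩
  (b ⊗ ι (suc k)) ⊗ frac 1 k      ≈⟨ e b ⟩
  b                               ∎
  where
  open ≼-Reasoning
  e : ∀ a → (a ⊗ ι (suc k)) ⊗ frac 1 k ≈ a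
  e a = ≈-trans (⊗-assoc a _ _) (≈-trans (⊗-cong ≈-refl (frac-ι 1 k)) (⊗-identityʳ a))

-- This is `(1 + 1/N)^n ≤ N / (N - n)`, multiplied out. Each factor `1 + 1/N` is at most `k + 1`
-- over `k` for `k < N`, and these quotients telescope.
bernoulli-upper : ∀ N′ n → n ≤ suc N′ → 1+1/ N′ ^^ n ⊗ ι (suc N′ ∸ n) ≼ ι (suc N′)
bernoulli-upper N′ zero    _    = ≈⇒≼ (⊗-identityˡ _)
bernoulli-upper N′ (suc n) n<N = begin
  (u ⊗ u ^^ n) ⊗ ι k              ≈⟨ e u (u ^^ n) (ι k) ⟩
  u ^^ n ⊗ (u ⊗ ι k)              ≤⟨ ⊗-monoʳ (u ^^ n) step ⟩
  u ^^ n ⊗ ι (suc N′ ∸ n)         ≤⟨ bernoulli-upper N′ n (<⇒≤ n<N) ⟩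
  ι (suc N′)                      ∎
  where
  open ≼-Reasoning
  u : ℚ₊
  u = 1+1/ N′
  k : ℕ
  k = N′ ∸ n
  e : ∀ a b c → (a ⊗ b) ⊗ c ≈ b ⊗ (a ⊗ c)
  e = solve 3 (λ a b c → (a :* b) :* c := b :* (a :* c)) ≈-refl
    where open ℚ₊-Solver
  step : u ⊗ ι k ≼ ι (suc N′ ∸ n)
  step = ≼-trans (≈⇒≼ (frac-⊗ (suc (suc N′)) N′ k 0)) (≼-trans (frac-≼ (ineq N′ k (m∸n≤m N′ n)))
    (≈⇒≼ (≈-reflexive (cong ι (sym (+-∸-assoc 1 (s≤s⁻¹ n<N)))))))
    where
    ineq : ∀ N k → k ≤ N → (suc (suc N) * k) * 1 ≤ suc k * suc (0 + N * 1)
    ineq N k k≤N = ≤-trans (≤-reflexive (solve 2 (λ N k → ((con 2 :+ N) :* k) :* con 1 := (con 1 :+ N) :* k :+ k) refl N k))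
      (≤-trans (+-monoʳ-≤ (suc N * k) (≤-trans k≤N (n≤1+n N))) (≤-reflexive (solve 2 (λ N k → (con 1 :+ N) :* k :+ (con 1 :+ N) := (con 1 :+ k) :* (con 1 :+ (con 0 :+ N :* con 1))) refl N k)))
      where open +-*-Solver

-- Compares `N / (N - n)` with `(t + 2) / (t + 1)`, which is what `1+1/ t` denotes. It is the way a
-- large `N` is made to fit below a fixed saving.
power≼1+1/ : ∀ N′ n t → n * suc (suc t) ≤ suc N′ → 1+1/ N′ ^^ n ≼ 1+1/ t
power≼1+1/ N′ n t p = ≼-cancelʳ (N ∸ n) (m<n⇒0<n∸m n<N) (≼-trans (bernoulli-upper N′ n (<⇒≤ n<N)) N≼)
  where
  N : ℕ
  N = suc N′
  strict : ∀ n → n * suc (suc t) ≤ N → n < N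
  strict zero    _ = z<s
  strict (suc n) q = ≤-trans (≤-trans (m≤m+n (suc (suc n)) (t + n * suc t)) (≤-reflexive
    (solve 2 (λ n t → (con 2 :+ n) :+ (t :+ n :* (con 1 :+ t)) := (con 1 :+ n) :* (con 2 :+ t)) refl n t))) q
    where open +-*-Solver
  n<N : n < N
  n<N = strict n p
  k : ℕ
  k = N ∸ n
  N≡ : n + k ≡ N
  N≡ = m+[n∸m]≡n (<⇒≤ n<N)
  N≼ : ι N ≼ 1+1/ t ⊗ ι k
  N≼ = ≼-trans (frac-≼ ineq) (proj₂ (frac-⊗ (suc (suc t)) t k 0))
    where
    open ≤-Reasoning
    open +-*-Solver
    ineq : N * suc (0 + t * 1) ≤ (suc (suc t) * k) * 1
    ineq = +-cancelˡ-≤ N _ _ (begin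
      N + N * suc (0 + t * 1)        ≡⟨ solve 2 (λ N t → N :+ N :* (con 1 :+ (con 0 :+ t :* con 1)) := (con 2 :+ t) :* N) refl N t ⟩
      suc (suc t) * N                ≡⟨ cong (suc (suc t) *_) N≡ ⟨
      suc (suc t) * (n + k)          ≡⟨ solve 3 (λ t n k → (con 2 :+ t) :* (n :+ k) := n :* (con 2 :+ t) :+ ((con 2 :+ t) :* k) :* con 1) refl t n k ⟩
      n * suc (suc t) + (suc (suc t) * k) * 1  ≤⟨ +-monoˡ-≤ _ p ⟩
      N + (suc (suc t) * k) * 1      ∎)

-- Every second convergent P/R of the golden ratio: 3/2, 8/5, 21/13, ….
convergent : ℕ → ℕ × ℕ
convergent zero    = 3 , 2
convergent (suc j) = let P , R = convergent j in 2 * P + R , P + R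

P⟨_⟩ R⟨_⟩ : ℕ → ℕ
P⟨ j ⟩ = proj₁ (convergent j)
R⟨ j ⟩ = proj₂ (convergent j)

-- `golden` places `P / R` just below φ. The upper bounds 2, 5/3, 13/8, 34/21 form an inductive
-- ladder, each rung following from the previous one at the preceding quotient; the last one yields
-- `x ≤ 34/55`.
record Convergent (P R : ℕ) : Set where
  field
    golden : P * P + 1 ≡ P * R + R * R
    R≤P    : R ≤ P
    3R≤2P  : 3 * R ≤ 2 * P
    P≤2R   : P ≤ 2 * R
    3P≤5R  : 3 * P ≤ 5 * R
    8P≤13R : 8 * P ≤ 13 * R
    21P≤34R : 21 * P ≤ 34 * R
    R>0    : 0 < R

isConvergent : ∀ j → Convergent P⟨ j ⟩ R⟨ j ⟩
isConvergent zero = record { golden = refl ; R≤P = ≤ᵇ-true⁻ refl ; 3R≤2P = ≤ᵇ-true⁻ refl ; P≤2R = ≤ᵇ-true⁻ refl ; 3P≤5R = ≤ᵇ-true⁻ refl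
  ; 8P≤13R = ≤ᵇ-true⁻ refl ; 21P≤34R = ≤ᵇ-true⁻ refl ; R>0 = z<s }
isConvergent (suc j) = record
  { golden = +-cancelʳ-≡ (P * R + R * R) _ _ (begin-equality
      (2 * P + R) * (2 * P + R) + 1 + (P * R + R * R)
        ≡⟨ solve 2 (λ P R → (con 2 :* P :+ R) :* (con 2 :* P :+ R) :+ con 1 :+ (P :* R :+ R :* R)
             := ((con 2 :* P :+ R) :* (P :+ R) :+ (P :+ R) :* (P :+ R)) :+ (P :* P :+ con 1)) refl P R ⟩
      ((2 * P + R) * (P + R) + (P + R) * (P + R)) + (P * P + 1)
        ≡⟨ cong (((2 * P + R) * (P + R) + (P + R) * (P + R)) +_) golden ⟩
      ((2 * P + R) * (P + R) + (P + R) * (P + R)) + (P * R + R * R) ∎)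
  ; R≤P = +-monoˡ-≤ R (m≤m+n P (P + 0))
  ; 3R≤2P = linear (solve 2 (λ P R → con 3 :* (P :+ R) := (con 3 :* P :+ con 2 :* R) :+ R) refl P R)
      (+-monoʳ-≤ (3 * P + 2 * R) R≤P) (solve 2 (λ P R → (con 3 :* P :+ con 2 :* R) :+ P := con 2 :* (con 2 :* P :+ R)) refl P R)
  ; P≤2R = linear refl (m≤m+n (2 * P + R) R) (solve 2 (λ P R → (con 2 :* P :+ R) :+ R := con 2 :* (P :+ R)) refl P R)
  ; 3P≤5R = linear (solve 2 (λ P R → con 3 :* (con 2 :* P :+ R) := (con 5 :* P :+ con 3 :* R) :+ P) refl P R)
      (+-monoʳ-≤ (5 * P + 3 * R) P≤2R) (solve 2 (λ P R → (con 5 :* P :+ con 3 :* R) :+ con 2 :* R := con 5 :* (P :+ R)) refl P R)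
  ; 8P≤13R = linear (solve 2 (λ P R → con 8 :* (con 2 :* P :+ R) := (con 13 :* P :+ con 8 :* R) :+ con 3 :* P) refl P R)
      (+-monoʳ-≤ (13 * P + 8 * R) 3P≤5R) (solve 2 (λ P R → (con 13 :* P :+ con 8 :* R) :+ con 5 :* R := con 13 :* (P :+ R)) refl P R)
  ; 21P≤34R = linear (solve 2 (λ P R → con 21 :* (con 2 :* P :+ R) := (con 34 :* P :+ con 21 :* R) :+ con 8 :* P) refl P R)
      (+-monoʳ-≤ (34 * P + 21 * R) 8P≤13R) (solve 2 (λ P R → (con 34 :* P :+ con 21 :* R) :+ con 13 :* R := con 34 :* (P :+ R)) refl P R)
  ; R>0 = ≤-trans R>0 (m≤n+m R P) }
  where
  open Convergent (isConvergent j)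
  open +-*-Solver
  open ≤-Reasoning
  P R : ℕ
  P = P⟨ j ⟩
  R = R⟨ j ⟩
  linear : ∀ {a b c d : ℕ} → a ≡ b → b ≤ c → c ≡ d → a ≤ d
  linear refl p refl = p

R-grows : ∀ j → j ≤ R⟨ j ⟩
R-grows zero    = z≤n
R-grows (suc j) = +-mono-≤ (≤-trans (Convergent.R>0 (isConvergent j)) (Convergent.R≤P (isConvergent j))) (R-grows j)

P-grows : ∀ j → j ≤ P⟨ j ⟩
P-grows j = ≤-trans (R-grows j) (Convergent.R≤P (isConvergent j))

-- If `Z² ≥ B² + M²`, then `Z` exceeds `B` by any `k` with `2Bk + k² < M²`. Quadratic facts about √5
-- thus become linear gaps without roots.
square-gap : ∀ B k Z M → k * (2 * B + k) < M * M → B * B + M * M ≤ Z * Z → B + k ≤ Z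
square-gap B k Z M small large = ≮⇒≥ (λ Z<B+k → <⇒≱ (+-monoʳ-< (B * B) small) (≤-trans large (≤-trans (*-mono-≤ (<⇒≤ Z<B+k) (<⇒≤ Z<B+k))
  (≤-reflexive (solve 2 (λ B k → (B :+ k) :* (B :+ k) := B :* B :+ k :* (con 2 :* B :+ k)) refl B k)))))
  where open +-*-Solver

small-product : ∀ A k M → 3 * (suc A * k) ≤ M → 0 < M → k * (2 * (A * M) + k) < M * M
small-product A k M p M>0 = *-cancelˡ-< 9 _ _ (begin-strict
  9 * (k * (2 * (A * M) + k))                    ≡⟨ solve 3 (λ A k M → con 9 :* (k :* (con 2 :* (A :* M) :+ k)) := con 6 :* ((con 3 :* (A :* k)) :* M) :+ (con 3 :* k) :* (con 3 :* k)) refl A k M ⟩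
  6 * ((3 * (A * k)) * M) + (3 * k) * (3 * k)    ≤⟨ +-mono-≤ (*-monoʳ-≤ 6 (*-monoˡ-≤ M Ak)) (*-mono-≤ k≤ k≤) ⟩
  6 * (M * M) + M * M                            <⟨ m<m+n _ (*-monoʳ-< 2 (*-mono-< M>0 M>0)) ⟩
  6 * (M * M) + M * M + 2 * (M * M)              ≡⟨ solve 1 (λ M → con 6 :* (M :* M) :+ M :* M :+ con 2 :* (M :* M) := con 9 :* (M :* M)) refl M ⟩
  9 * (M * M)                                    ∎)
  where
  open ≤-Reasoning
  open +-*-Solver
  Ak : 3 * (A * k) ≤ M
  Ak = ≤-trans (*-monoʳ-≤ 3 (m≤n+m (A * k) k)) p
  k≤ : 3 * k ≤ M
  k≤ = ≤-trans (*-monoʳ-≤ 3 (m≤m+n k (A * k))) p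

-- The tilted rows are below 1.  With Y = P/R, x = V R / ((V + 1) P) and the tilt
-- s = 1 + 1/T the inequalities are cleared of denominators; T/V > 1/√5
-- (respectively T/V > (5 - √5)/10) enters through the lower bounds for T (P + 2R).
module TiltInequalities (P R T V : ℕ) (conv : Convergent P R) (T≤V : T ≤ V) where
  open Convergent conv
  open ≤-Reasoning
  open +-*-Solver

  private
    k : ℕ
    k = T * suc V + 1

    -- The margin `k` pays for the `+ 1` in `golden`, which enters multiplied by `T (V + 1)²`, and
    -- for strictness.
    k-absorbs : T * (suc V * suc V) + 1 ≤ suc V * (R * k)
    k-absorbs = begin
      T * (suc V * suc V) + 1            ≤⟨ +-monoʳ-≤ _ (s≤s z≤n) ⟩
      T * (suc V * suc V) + suc V        ≡⟨ solve 2 (λ T V → T :* ((con 1 :+ V) :* (con 1 :+ V)) :+ (con 1 :+ V) := (con 1 :+ V) :* (con 1 :* (T :* (con 1 :+ V) :+ con 1))) refl T V ⟩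
      suc V * (1 * k)                    ≤⟨ *-monoʳ-≤ (suc V) (*-monoˡ-≤ k R>0) ⟩
      suc V * (R * k)                    ∎

  first-row : suc V * P + k ≤ T * (P + 2 * R) →
    suc T * (R * V) * (P * suc V) + R * V * (R * V) * T < T * ((P * suc V) * (P * suc V))
  first-row Z≥ = +-cancelʳ-≤ (T * (suc V * suc V) + T * (R * R)) _ _ (begin
    suc (suc T * (R * V) * (P * suc V) + R * V * (R * V) * T) + (T * (suc V * suc V) + T * (R * R))
      ≡⟨ solve 4 (λ P R T V → (con 1 :+ ((con 1 :+ T) :* (R :* V) :* (P :* (con 1 :+ V)) :+ R :* V :* (R :* V) :* T)) :+ (T :* ((con 1 :+ V) :* (con 1 :+ V)) :+ T :* (R :* R))
           := (T :* ((con 1 :+ V) :* (con 1 :+ V)) :+ con 1) :+ T :* (R :* R) :+ (R :* P) :* ((con 1 :+ V) :* V) :+ (T :* (R :* V) :* (P :* (con 1 :+ V)) :+ R :* V :* (R :* V) :* T)) refl P R T V ⟩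
    (T * (suc V * suc V) + 1) + T * (R * R) + (R * P) * (suc V * V) + X
      ≤⟨ +-monoˡ-≤ X (+-monoˡ-≤ ((R * P) * (suc V * V)) (+-mono-≤ k-absorbs (*-mono-≤ (≤-trans T≤V (n≤1+n V)) (*-monoʳ-≤ R R≤P)))) ⟩
    suc V * (R * k) + suc V * (R * P) + (R * P) * (suc V * V) + X
      ≡⟨ solve 5 (λ P R V k X → (con 1 :+ V) :* (R :* k) :+ (con 1 :+ V) :* (R :* P) :+ (R :* P) :* ((con 1 :+ V) :* V) :+ X
           := (con 1 :+ V) :* (R :* ((con 1 :+ V) :* P :+ k)) :+ X) refl P R V k X ⟩
    suc V * (R * (suc V * P + k)) + X
      ≤⟨ +-monoˡ-≤ X (*-monoʳ-≤ (suc V) (*-monoʳ-≤ R Z≥)) ⟩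
    suc V * (R * (T * (P + 2 * R))) + X
      ≡⟨ solve 4 (λ P R T V → (con 1 :+ V) :* (R :* (T :* (P :+ con 2 :* R))) :+ (T :* (R :* V) :* (P :* (con 1 :+ V)) :+ R :* V :* (R :* V) :* T)
           := T :* ((con 1 :+ V) :* (con 1 :+ V)) :* (P :* R :+ R :* R) :+ T :* (R :* R)) refl P R T V ⟩
    T * (suc V * suc V) * (P * R + R * R) + T * (R * R)
      ≡⟨ cong (λ z → T * (suc V * suc V) * z + T * (R * R)) golden ⟨
    T * (suc V * suc V) * (P * P + 1) + T * (R * R)
      ≡⟨ solve 4 (λ P R T V → T :* ((con 1 :+ V) :* (con 1 :+ V)) :* (P :* P :+ con 1) :+ T :* (R :* R)
           := T :* ((P :* (con 1 :+ V)) :* (P :* (con 1 :+ V))) :+ (T :* ((con 1 :+ V) :* (con 1 :+ V)) :+ T :* (R :* R))) refl P R T V ⟩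
    T * ((P * suc V) * (P * suc V)) + (T * (suc V * suc V) + T * (R * R)) ∎)
    where
    X : ℕ
    X = T * (R * V) * (P * suc V) + R * V * (R * V) * T

  second-row : V * R + k ≤ T * (P + 2 * R) →
    T * (R * V) * (P * suc V) + R * V * (R * V) * suc T < T * ((P * suc V) * (P * suc V))
  second-row Z≥ = +-cancelʳ-≤ (T * (suc V * suc V) + T * (R * R)) _ _ (begin
    suc (T * (R * V) * (P * suc V) + R * V * (R * V) * suc T) + (T * (suc V * suc V) + T * (R * R))
      ≡⟨ solve 4 (λ P R T V → (con 1 :+ (T :* (R :* V) :* (P :* (con 1 :+ V)) :+ R :* V :* (R :* V) :* (con 1 :+ T))) :+ (T :* ((con 1 :+ V) :* (con 1 :+ V)) :+ T :* (R :* R))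
           := (T :* ((con 1 :+ V) :* (con 1 :+ V)) :+ con 1) :+ T :* (R :* R) :+ (R :* R) :* (V :* V) :+ (T :* (R :* V) :* (P :* (con 1 :+ V)) :+ R :* V :* (R :* V) :* T)) refl P R T V ⟩
    (T * (suc V * suc V) + 1) + T * (R * R) + (R * R) * (V * V) + X
      ≤⟨ +-monoˡ-≤ X (+-monoˡ-≤ ((R * R) * (V * V)) (+-mono-≤ k-absorbs (*-monoˡ-≤ (R * R) T≤V))) ⟩
    suc V * (R * k) + V * (R * R) + (R * R) * (V * V) + X
      ≡⟨ solve 4 (λ R V k X → (con 1 :+ V) :* (R :* k) :+ V :* (R :* R) :+ (R :* R) :* (V :* V) :+ X
           := (con 1 :+ V) :* (R :* (V :* R :+ k)) :+ X) refl R V k X ⟩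
    suc V * (R * (V * R + k)) + X
      ≤⟨ +-monoˡ-≤ X (*-monoʳ-≤ (suc V) (*-monoʳ-≤ R Z≥)) ⟩
    suc V * (R * (T * (P + 2 * R))) + X
      ≡⟨ solve 4 (λ P R T V → (con 1 :+ V) :* (R :* (T :* (P :+ con 2 :* R))) :+ (T :* (R :* V) :* (P :* (con 1 :+ V)) :+ R :* V :* (R :* V) :* T)
           := T :* ((con 1 :+ V) :* (con 1 :+ V)) :* (P :* R :+ R :* R) :+ T :* (R :* R)) refl P R T V ⟩
    T * (suc V * suc V) * (P * R + R * R) + T * (R * R)
      ≡⟨ cong (λ z → T * (suc V * suc V) * z + T * (R * R)) golden ⟨
    T * (suc V * suc V) * (P * P + 1) + T * (R * R)
      ≡⟨ solve 4 (λ P R T V → T :* ((con 1 :+ V) :* (con 1 :+ V)) :* (P :* P :+ con 1) :+ T :* (R :* R)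
           := T :* ((P :* (con 1 :+ V)) :* (P :* (con 1 :+ V))) :+ (T :* ((con 1 :+ V) :* (con 1 :+ V)) :+ T :* (R :* R))) refl P R T V ⟩
    T * ((P * suc V) * (P * suc V)) + (T * (suc V * suc V) + T * (R * R)) ∎)
    where
    X : ℕ
    X = T * (R * V) * (P * suc V) + R * V * (R * V) * T

  -- (P + 2R)² = 5P² + 4
  first-gap : suc V * suc V + 1 ≤ 5 * (T * T) → 3 * (suc (suc V) * k) ≤ P → suc V * P + k ≤ T * (P + 2 * R)
  first-gap 5T² P-large = square-gap (suc V * P) k (T * (P + 2 * R)) P
    (small-product (suc V) k P P-large (≤-trans R>0 R≤P)) (begin
      suc V * P * (suc V * P) + P * P              ≡⟨ solve 2 (λ A P → A :* P :* (A :* P) :+ P :* P := (A :* A :+ con 1) :* (P :* P)) refl (suc V) P ⟩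
      (suc V * suc V + 1) * (P * P)                ≤⟨ *-monoˡ-≤ (P * P) 5T² ⟩
      5 * (T * T) * (P * P)                        ≤⟨ m≤m+n _ (4 * (T * T)) ⟩
      5 * (T * T) * (P * P) + 4 * (T * T)          ≡⟨ solve 2 (λ P T → con 5 :* (T :* T) :* (P :* P) :+ con 4 :* (T :* T) := (T :* T) :* (P :* P :+ con 4 :* (P :* P :+ con 1))) refl P T ⟩
      (T * T) * (P * P + 4 * (P * P + 1))          ≡⟨ cong (λ z → (T * T) * (P * P + 4 * z)) golden ⟩
      (T * T) * (P * P + 4 * (P * R + R * R))      ≡⟨ solve 3 (λ P R T → (T :* T) :* (P :* P :+ con 4 :* (P :* R :+ R :* R)) := T :* (P :+ con 2 :* R) :* (T :* (P :+ con 2 :* R))) refl P R T ⟩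
      T * (P + 2 * R) * (T * (P + 2 * R))          ∎)

  -- (2P - R)² = 5R² - 4, with P = R + D
  second-gap : ∀ B → B + 5 * T ≡ 2 * V → B * B + 2 ≤ 5 * (T * T) → 3 * (suc B * (2 * k)) ≤ R → 2 * T ≤ R → V * R + k ≤ T * (P + 2 * R)
  second-gap B B+5T 5T² R-large 2T≤R = *-cancelˡ-≤ 2 (begin
    2 * (V * R + k)                      ≡⟨ solve 3 (λ V R k → con 2 :* (V :* R :+ k) := (con 2 :* V) :* R :+ con 2 :* k) refl V R k ⟩
    (2 * V) * R + 2 * k                  ≡⟨ cong (λ z → z * R + 2 * k) B+5T ⟨
    (B + 5 * T) * R + 2 * k              ≡⟨ solve 4 (λ B T R k → (B :+ con 5 :* T) :* R :+ con 2 :* k := (B :* R :+ con 2 :* k) :+ con 5 :* T :* R) refl B T R k ⟩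
    (B * R + 2 * k) + 5 * T * R          ≤⟨ +-monoˡ-≤ (5 * T * R) gap ⟩
    T * W + 5 * T * R                    ≡⟨ solve 3 (λ T R D → T :* (R :+ con 2 :* D) :+ con 5 :* T :* R := con 2 :* (T :* ((R :+ D) :+ con 2 :* R))) refl T R D ⟩
    2 * (T * ((R + D) + 2 * R))          ≡⟨ cong (λ z → 2 * (T * (z + 2 * R))) R+D ⟩
    2 * (T * (P + 2 * R))                ∎)
    where
    D W : ℕ
    D = P ∸ R
    W = R + 2 * D
    R+D : R + D ≡ P
    R+D = m+[n∸m]≡n R≤P
    RD : R * D + D * D + 1 ≡ R * R
    RD = +-cancelˡ-≡ (R * R + R * D) _ _ (trans
      (solve 2 (λ R D → (R :* R :+ R :* D) :+ (R :* D :+ D :* D :+ con 1) := (R :+ D) :* (R :+ D) :+ con 1) refl R D)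
      (trans (subst (λ z → z * z + 1 ≡ z * R + R * R) (sym R+D) golden) (solve 2 (λ R D → (R :+ D) :* R :+ R :* R := (R :* R :+ R :* D) :+ R :* R) refl R D)))
    W² : T * W * (T * W) + 4 * (T * T) ≡ 5 * (T * T) * (R * R)
    W² = trans (solve 3 (λ T R D → T :* (R :+ con 2 :* D) :* (T :* (R :+ con 2 :* D)) :+ con 4 :* (T :* T) := (T :* T) :* (R :* R :+ con 4 :* (R :* D :+ D :* D :+ con 1))) refl T R D)
      (trans (cong (λ z → (T * T) * (R * R + 4 * z)) RD) (solve 2 (λ T R → (T :* T) :* (R :* R :+ con 4 :* (R :* R)) := con 5 :* (T :* T) :* (R :* R)) refl T R))
    gap : B * R + 2 * k ≤ T * W
    gap = square-gap (B * R) (2 * k) (T * W) R (small-product B (2 * k) R R-large R>0) (+-cancelʳ-≤ (4 * (T * T)) _ _ (begin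
      B * R * (B * R) + R * R + 4 * (T * T)        ≡⟨ solve 3 (λ B R T → B :* R :* (B :* R) :+ R :* R :+ con 4 :* (T :* T) := B :* B :* (R :* R) :+ R :* R :+ (con 2 :* T) :* (con 2 :* T)) refl B R T ⟩
      B * B * (R * R) + R * R + (2 * T) * (2 * T)  ≤⟨ +-monoʳ-≤ (B * B * (R * R) + R * R) (*-mono-≤ 2T≤R 2T≤R) ⟩
      B * B * (R * R) + R * R + R * R              ≡⟨ solve 2 (λ B R → B :* B :* (R :* R) :+ R :* R :+ R :* R := (B :* B :+ con 2) :* (R :* R)) refl B R ⟩
      (B * B + 2) * (R * R)                        ≤⟨ *-monoˡ-≤ (R * R) 5T² ⟩
      5 * (T * T) * (R * R)                        ≡⟨ W² ⟨
      T * W * (T * W) + 4 * (T * T)                ∎))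

Y⟨_⟩ : ℕ → ℚ₊
Y⟨ j ⟩ = frac P⟨ j ⟩ (pred R⟨ j ⟩)

tilted-sum : Bool → ℚ₊ → ℚ₊ → ℚ₊
tilted-sum false s x = s ⊗ x ⊕ x ⊗ x
tilted-sum true  s x = x ⊕ s ⊗ (x ⊗ x)

-- A tilt s > 1 of the weight of the letter 1 (or 2, if second holds) which does
-- not increase the total weight although it is worth more than a rate below φ
-- on words where that letter has frequency c/d.
record Tilt (second : Bool) (c d : ℕ) : Set where
  field
    j     : ℕ
    X x s : ℚ₊
    Xx≈𝟙  : X ⊗ x ≈ 𝟙
    𝟙≼X   : 𝟙 ≼ X
    𝟙≼s   : 𝟙 ≼ s
    x≼2/3 : x ≼ frac 2 2
    power : X ^^ d ≼ s ^^ c ⊗ Y⟨ j ⟩ ^^ d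
    N₀    : ℕ
    row≼  : ∀ N′ → N₀ ≤ suc N′ → tilted-sum second s x ⊕ ι 3 ⊗ frac 1 N′ ≼ 𝟙

-- Strictness between integers leaves a slack of at least `1 / (T Q²)` in the row, and the penalty
-- `3/N` fits into it.
clear-first : ∀ T′ z Q′ N′ → suc (suc T′) * z * suc Q′ + z * z * suc T′ < suc T′ * (suc Q′ * suc Q′) →
  3 * (suc T′ * (suc Q′ * suc Q′)) ≤ suc N′ → (1+1/ T′ ⊗ frac z Q′ ⊕ frac z Q′ ⊗ frac z Q′) ⊕ ι 3 ⊗ frac 1 N′ ≼ 𝟙
clear-first T′ z Q′ N′ core large = ≼-trans (≈⇒≼ (≈-trans (⊕-cong (≈-trans (⊕-cong (frac-⊗ (suc (suc T′)) T′ z Q′) (frac-⊗ z Q′ z Q′)) (frac-⊕ _ _ _ _)) (frac-⊗ 3 0 1 N′)) (frac-⊕ _ _ _ _)))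
  (frac-≼ (ineq (suc T′) (suc Q′) (suc N′) core large))
  where
  open ≤-Reasoning
  open +-*-Solver
  ineq : ∀ T Q N → suc T * z * Q + z * z * T < T * (Q * Q) → 3 * (T * (Q * Q)) ≤ N →
    ((suc T * z * (Q * Q) + z * z * (T * Q)) * (1 * N) + 3 * 1 * ((T * Q) * (Q * Q))) * 1 ≤ 1 * (((T * Q) * (Q * Q)) * (1 * N))
  ineq T Q N core large = begin
    ((suc T * z * (Q * Q) + z * z * (T * Q)) * (1 * N) + 3 * 1 * ((T * Q) * (Q * Q))) * 1
      ≡⟨ solve 4 (λ T z Q N → (((con 1 :+ T) :* z :* (Q :* Q) :+ z :* z :* (T :* Q)) :* (con 1 :* N) :+ con 3 :* con 1 :* ((T :* Q) :* (Q :* Q))) :* con 1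
           := Q :* (((con 1 :+ T) :* z :* Q :+ z :* z :* T) :* N :+ con 3 :* (T :* (Q :* Q)))) refl T z Q N ⟩
    Q * ((suc T * z * Q + z * z * T) * N + 3 * (T * (Q * Q)))
      ≤⟨ *-monoʳ-≤ Q (+-monoʳ-≤ _ large) ⟩
    Q * ((suc T * z * Q + z * z * T) * N + N)
      ≡⟨ cong (Q *_) (+-comm _ N) ⟩
    Q * (suc (suc T * z * Q + z * z * T) * N)
      ≤⟨ *-monoʳ-≤ Q (*-monoˡ-≤ N core) ⟩
    Q * (T * (Q * Q) * N)
      ≡⟨ solve 3 (λ T Q N → Q :* (T :* (Q :* Q) :* N) := con 1 :* (((T :* Q) :* (Q :* Q)) :* (con 1 :* N))) refl T Q N ⟩
    1 * (((T * Q) * (Q * Q)) * (1 * N)) ∎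

clear-second : ∀ T′ z Q′ N′ → suc T′ * z * suc Q′ + z * z * suc (suc T′) < suc T′ * (suc Q′ * suc Q′) →
  3 * (suc T′ * (suc Q′ * suc Q′)) ≤ suc N′ → (frac z Q′ ⊕ 1+1/ T′ ⊗ (frac z Q′ ⊗ frac z Q′)) ⊕ ι 3 ⊗ frac 1 N′ ≼ 𝟙
clear-second T′ z Q′ N′ core large = ≼-trans (≈⇒≼ (≈-trans (⊕-cong (≈-trans (⊕-cong ≈-refl (≈-trans (⊗-cong ≈-refl (frac-⊗ z Q′ z Q′)) (frac-⊗ (suc (suc T′)) T′ (z * z) _))) (frac-⊕ z Q′ _ _)) (frac-⊗ 3 0 1 N′)) (frac-⊕ _ _ _ _)))
  (frac-≼ (ineq (suc T′) (suc Q′) (suc N′) core large))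
  where
  open ≤-Reasoning
  open +-*-Solver
  ineq : ∀ T Q N → T * z * Q + z * z * suc T < T * (Q * Q) → 3 * (T * (Q * Q)) ≤ N →
    ((z * (T * (Q * Q)) + suc T * (z * z) * Q) * (1 * N) + 3 * 1 * (Q * (T * (Q * Q)))) * 1 ≤ 1 * ((Q * (T * (Q * Q))) * (1 * N))
  ineq T Q N core large = begin
    ((z * (T * (Q * Q)) + suc T * (z * z) * Q) * (1 * N) + 3 * 1 * (Q * (T * (Q * Q)))) * 1
      ≡⟨ solve 4 (λ T z Q N → ((z :* (T :* (Q :* Q)) :+ (con 1 :+ T) :* (z :* z) :* Q) :* (con 1 :* N) :+ con 3 :* con 1 :* (Q :* (T :* (Q :* Q)))) :* con 1
           := Q :* ((T :* z :* Q :+ z :* z :* (con 1 :+ T)) :* N :+ con 3 :* (T :* (Q :* Q)))) refl T z Q N ⟩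
    Q * ((T * z * Q + z * z * suc T) * N + 3 * (T * (Q * Q)))
      ≤⟨ *-monoʳ-≤ Q (+-monoʳ-≤ _ large) ⟩
    Q * ((T * z * Q + z * z * suc T) * N + N)
      ≡⟨ cong (Q *_) (+-comm _ N) ⟩
    Q * (suc (T * z * Q + z * z * suc T) * N)
      ≤⟨ *-monoʳ-≤ Q (*-monoˡ-≤ N core) ⟩
    Q * (T * (Q * Q) * N)
      ≡⟨ solve 3 (λ T Q N → Q :* (T :* (Q :* Q) :* N) := con 1 :* ((Q :* (T :* (Q :* Q))) :* (con 1 :* N))) refl T Q N ⟩
    1 * ((Q * (T * (Q * Q))) * (1 * N)) ∎

clear : ∀ second T′ z Q′ N′ →
  (if second then suc T′ * z * suc Q′ + z * z * suc (suc T′) else suc (suc T′) * z * suc Q′ + z * z * suc T′) < suc T′ * (suc Q′ * suc Q′) →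
  3 * (suc T′ * (suc Q′ * suc Q′)) ≤ suc N′ → tilted-sum second (1+1/ T′) (frac z Q′) ⊕ ι 3 ⊗ frac 1 N′ ≼ 𝟙
clear false = clear-first
clear true  = clear-second

suc-pred> : ∀ {n} → 0 < n → suc (pred n) ≡ n
suc-pred> {n} n>0 = suc-pred n {{>-nonZero n>0}}

-- The tilt must satisfy `(1 + 1/V)^d ≤ (1 + 1/T)^c`. With these `T` and `V` both sides are compared
-- with `1 + 1/(5d²)`: the left one by the upper Bernoulli bound, the right one since
-- `c / T = 1/(5d²)`. The ratio `T / V` falls short of `c / d` only by the factor `5d² / (5d² + 1)`.
module TiltFrom (second : Bool) (c d : ℕ) (c>0 : 0 < c) (d>0 : 0 < d) (j : ℕ) where

  T V P R Q : ℕ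
  T = 5 * (d * d) * c
  V = d * (5 * (d * d) + 1)
  P = P⟨ j ⟩
  R = R⟨ j ⟩
  Q = P * suc V

  open Convergent (isConvergent j)

  private
    dd>0 : 0 < 5 * (d * d)
    dd>0 = *-mono-< {0} {5} z<s (*-mono-< d>0 d>0)
    T>0 : 0 < T
    T>0 = *-mono-< dd>0 c>0
    V>0 : 0 < V
    V>0 = *-mono-< d>0 (≤-trans z<s (m≤n+m 1 (5 * (d * d))))
    P>0 : 0 < P
    P>0 = ≤-trans R>0 R≤P
    Q>0 : 0 < Q
    Q>0 = *-mono-< P>0 z<s
    T′ V′ Q′ t : ℕ
    T′ = pred T
    V′ = pred V
    Q′ = pred Q
    t  = pred (5 * (d * d))

  tilt : (if second then T * (R * V) * Q + R * V * (R * V) * suc T else suc T * (R * V) * Q + R * V * (R * V) * T) < T * (Q * Q) →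
    Tilt second c d
  tilt core = record
    { j = j ; X = Y⟨ j ⟩ ⊗ 1+1/ V′ ; x = frac (R * V) Q′ ; s = 1+1/ T′
    ; Xx≈𝟙 = ≈-trans (⊗-cong (frac-⊗ P (pred R) (suc (suc V′)) V′) ≈-refl) (≈-trans (frac-⊗ _ _ (R * V) Q′) (frac-≈ inverse))
    ; 𝟙≼X = 𝟙≼⊗ (frac-≼ (≤-trans (≤-reflexive (trans (*-identityˡ _) (suc-pred> R>0))) (≤-trans R≤P (≤-reflexive (sym (*-identityʳ P)))))) (𝟙≼1+1/ V′)
    ; 𝟙≼s = 𝟙≼1+1/ T′
    ; x≼2/3 = frac-≼ (≤-trans below (≤-reflexive (cong (2 *_) (sym (suc-pred> Q>0)))))
    ; power = ≼-trans (≈⇒≼ (^^-⊗ _ _ d)) (≼-trans (≈⇒≼ (⊗-comm _ _)) (⊗-monoˡ _ (≼-trans v^d tilt^c)))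
    ; N₀ = 3 * (T * (Q * Q))
    ; row≼ = λ N′ large → clear second T′ (R * V) Q′ N′ (subst₂ (λ T Q → (if second then T * (R * V) * Q + R * V * (R * V) * suc T else suc T * (R * V) * Q + R * V * (R * V) * T) < T * (Q * Q))
        (sym (suc-pred> T>0)) (sym (suc-pred> Q>0)) core)
        (≤-trans (≤-reflexive (cong₂ (λ T Q → 3 * (T * (Q * Q))) (suc-pred> T>0) (suc-pred> Q>0))) large) }
    where
    open +-*-Solver
    inverse : P * suc (suc V′) * (R * V) * 1 ≡ 1 * suc (Q′ + (V′ + pred R * suc V′) * suc Q′)
    inverse = begin
      P * suc (suc V′) * (R * V) * 1                      ≡⟨ cong (λ z → P * suc z * (R * V) * 1) (suc-pred> V>0) ⟩
      P * suc V * (R * V) * 1                             ≡⟨ solve 4 (λ P V R W → P :* (con 1 :+ V) :* (R :* W) :* con 1 := con 1 :* ((R :* W) :* (P :* (con 1 :+ V)))) refl P V R V ⟩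
      1 * (R * V * Q)                                     ≡⟨ cong₂ (λ a b → 1 * (a * b)) (cong₂ _*_ (sym (suc-pred> R>0)) (sym (suc-pred> V>0))) (sym (suc-pred> Q>0)) ⟩
      1 * ((suc (pred R) * suc V′) * suc Q′)              ∎
      where open ≡-Reasoning
    below : R * V * 3 ≤ 2 * Q
    below = begin
      R * V * 3            ≡⟨ solve 2 (λ R V → R :* V :* con 3 := (con 3 :* R) :* V) refl R V ⟩
      (3 * R) * V          ≤⟨ *-mono-≤ 3R≤2P (n≤1+n V) ⟩
      (2 * P) * suc V      ≡⟨ *-assoc 2 P (suc V) ⟩
      2 * Q                ∎
      where open ≤-Reasoning
    v^d : 1+1/ V′ ^^ d ≼ 1+1/ t
    v^d = power≼1+1/ V′ d t (≤-reflexive (trans (cong (λ z → d * suc z) (suc-pred> dd>0)) (trans (cong (d *_) (+-comm 1 _)) (sym (suc-pred> V>0)))))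
    tilt^c : 1+1/ t ≼ 1+1/ T′ ^^ c
    tilt^c = begin
      1+1/ t                        ≈⟨ 1+1/≈ t ⟩
      𝟙 ⊕ frac 1 t                  ≤⟨ ⊕-monoʳ 𝟙 (≼-trans (frac-≼ same) (proj₂ (frac-⊗ c 0 1 T′))) ⟩
      𝟙 ⊕ ι c ⊗ frac 1 T′           ≤⟨ bernoulli (frac 1 T′) c ⟩
      (𝟙 ⊕ frac 1 T′) ^^ c          ≈⟨ ^^-cong c (1+1/≈ T′) ⟨
      1+1/ T′ ^^ c                  ∎
      where
      open ≼-Reasoning
      same : 1 * suc (T′ + 0) ≤ c * 1 * suc t
      same = ≤-reflexive (trans (trans (*-identityˡ _) (trans (cong suc (+-identityʳ T′)) (suc-pred> T>0)))
        (trans (*-comm (5 * (d * d)) c) (cong₂ _*_ (sym (*-identityʳ c)) (sym (suc-pred> dd>0)))))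

first-tilt : ∀ c d → 0 < c → 0 < d → c ≤ d → d * d + 1 ≤ 5 * (c * c) → Tilt false c d
first-tilt c d@(suc e) c>0 d>0 c≤d d²<5c² = TiltFrom.tilt false c d c>0 d>0 j (I.first-row (I.first-gap 5T² (P-grows j)))
  where
  open ≤-Reasoning
  open +-*-Solver
  T V j : ℕ
  T = 5 * (d * d) * c
  V = d * (5 * (d * d) + 1)
  j = 3 * (suc (suc V) * (T * suc V + 1))
  T≤V : T ≤ V
  T≤V = begin
    5 * (d * d) * c        ≤⟨ *-monoʳ-≤ (5 * (d * d)) c≤d ⟩
    5 * (d * d) * d        ≡⟨ *-comm (5 * (d * d)) d ⟩
    d * (5 * (d * d))      ≤⟨ *-monoʳ-≤ d (m≤m+n _ 1) ⟩
    V                      ∎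
  module I = TiltInequalities P⟨ j ⟩ R⟨ j ⟩ T V (isConvergent j) T≤V
  5T² : suc V * suc V + 1 ≤ 5 * (T * T)
  5T² = begin
    suc V * suc V + 1
      -- The difference of the two sides, expanded in `e = d - 1`, has nonnegative coefficients.
      ≤⟨ m≤m+n _ (26 * e + 59 * (e * e) + 50 * (e * e * e) + 15 * (e * e * e * e)) ⟩
    suc V * suc V + 1 + (26 * e + 59 * (e * e) + 50 * (e * e * e) + 15 * (e * e * e * e))
      ≡⟨ solve 1 (λ e → let d = con 1 :+ e ; W = con 1 :+ d :* (con 5 :* (d :* d) :+ con 1) in
           W :* W :+ con 1 :+ (con 26 :* e :+ con 59 :* (e :* e) :+ con 50 :* (e :* e :* e) :+ con 15 :* (e :* e :* e :* e))
           := (con 5 :* (d :* d)) :* (con 5 :* (d :* d)) :* (d :* d :+ con 1)) refl e ⟩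
    (5 * (d * d)) * (5 * (d * d)) * (d * d + 1)
      ≤⟨ *-monoʳ-≤ ((5 * (d * d)) * (5 * (d * d))) d²<5c² ⟩
    (5 * (d * d)) * (5 * (d * d)) * (5 * (c * c))
      ≡⟨ solve 2 (λ D c → D :* D :* (con 5 :* (c :* c)) := con 5 :* ((D :* c) :* (D :* c))) refl (5 * (d * d)) c ⟩
    5 * (T * T) ∎

second-tilt : ∀ c d → 0 < c → 0 < d → 5 * c ≤ 2 * d → d * d + 5 * (c * c) + 1 ≤ 5 * (d * c) → Tilt true c d
second-tilt c d c>0 d>0 5c≤2d quad = TiltFrom.tilt true c d c>0 d>0 j (I.second-row (I.second-gap B B+5T 5T² (≤-trans (m≤m+n j₀ (2 * T)) (R-grows j)) (≤-trans (m≤n+m (2 * T) j₀) (R-grows j))))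
  where
  open ≤-Reasoning
  open +-*-Solver
  T V B j₀ j : ℕ
  T = 5 * (d * d) * c
  V = d * (5 * (d * d) + 1)
  -- With this `B`, the condition `T / V > (5 - √5)/10` reads `B < √5 T`.
  B = 2 * V ∸ 5 * T
  j₀ = 3 * (suc B * (2 * (T * suc V + 1)))
  j = j₀ + 2 * T
  5T≤2V : 5 * T ≤ 2 * V
  5T≤2V = begin
    5 * T                        ≡⟨ solve 2 (λ d c → con 5 :* (con 5 :* (d :* d) :* c) := con 5 :* (d :* d) :* (con 5 :* c)) refl d c ⟩
    5 * (d * d) * (5 * c)        ≤⟨ *-monoʳ-≤ (5 * (d * d)) 5c≤2d ⟩
    5 * (d * d) * (2 * d)        ≡⟨ solve 1 (λ d → con 5 :* (d :* d) :* (con 2 :* d) := con 2 :* (d :* (con 5 :* (d :* d)))) refl d ⟩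
    2 * (d * (5 * (d * d)))      ≤⟨ *-monoʳ-≤ 2 (*-monoʳ-≤ d (m≤m+n _ 1)) ⟩
    2 * V                        ∎
  T≤V : T ≤ V
  T≤V = *-cancelˡ-≤ 2 (≤-trans (*-monoˡ-≤ T {2} {5} (s≤s (s≤s z≤n))) 5T≤2V)
  module I = TiltInequalities P⟨ j ⟩ R⟨ j ⟩ T V (isConvergent j) T≤V
  B+5T : B + 5 * T ≡ 2 * V
  B+5T = m∸n+n≡m 5T≤2V
  1≤d² : 1 ≤ d * d
  1≤d² = *-mono-< {0} d>0 d>0
  bracket : (5 * (d * d) + 1) * (5 * (d * d) + 1) + 125 * (d * d) * (c * c) + 1 ≤ 25 * (d * c) * (5 * (d * d) + 1)
  bracket = begin
    (5 * (d * d) + 1) * (5 * (d * d) + 1) + 125 * (d * d) * (c * c) + 1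
      ≡⟨ solve 2 (λ D C → (con 5 :* D :+ con 1) :* (con 5 :* D :+ con 1) :+ con 125 :* D :* C :+ con 1 := (con 25 :* D :* D :+ con 125 :* D :* C :+ con 10 :* D) :+ con 2) refl (d * d) (c * c) ⟩
    (25 * (d * d) * (d * d) + 125 * (d * d) * (c * c) + 10 * (d * d)) + 2
      ≤⟨ +-monoʳ-≤ (25 * (d * d) * (d * d) + 125 * (d * d) * (c * c) + 10 * (d * d)) (≤-trans (s≤s (s≤s z≤n)) (*-monoʳ-≤ 15 1≤d²)) ⟩
    (25 * (d * d) * (d * d) + 125 * (d * d) * (c * c) + 10 * (d * d)) + 15 * (d * d)
      ≡⟨ solve 2 (λ D C → (con 25 :* D :* D :+ con 125 :* D :* C :+ con 10 :* D) :+ con 15 :* D := con 25 :* D :* (D :+ con 5 :* C :+ con 1)) refl (d * d) (c * c) ⟩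
    25 * (d * d) * (d * d + 5 * (c * c) + 1)
      ≤⟨ *-monoʳ-≤ (25 * (d * d)) quad ⟩
    25 * (d * d) * (5 * (d * c))
      ≤⟨ m≤m+n _ (25 * (d * c)) ⟩
    25 * (d * d) * (5 * (d * c)) + 25 * (d * c)
      ≡⟨ solve 2 (λ D C → con 25 :* D :* (con 5 :* C) :+ con 25 :* C := con 25 :* C :* (con 5 :* D :+ con 1)) refl (d * d) (d * c) ⟩
    25 * (d * c) * (5 * (d * d) + 1) ∎
  5T² : B * B + 2 ≤ 5 * (T * T)
  5T² = +-cancelʳ-≤ (10 * (B * T) + 50 * (T * T) + 20 * (T * T)) _ _ (begin
    B * B + 2 + (10 * (B * T) + 50 * (T * T) + 20 * (T * T))
      ≡⟨ solve 2 (λ B T → B :* B :+ con 2 :+ (con 10 :* (B :* T) :+ con 50 :* (T :* T) :+ con 20 :* (T :* T)) := (B :+ con 5 :* T) :* (B :+ con 5 :* T) :+ con 45 :* (T :* T) :+ con 2) refl B T ⟩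
    (B + 5 * T) * (B + 5 * T) + 45 * (T * T) + 2
      ≡⟨ cong (λ z → z * z + 45 * (T * T) + 2) B+5T ⟩
    (2 * V) * (2 * V) + 45 * (T * T) + 2
      ≡⟨ solve 2 (λ V T → (con 2 :* V) :* (con 2 :* V) :+ con 45 :* (T :* T) :+ con 2 := (con 4 :* (V :* V) :+ con 20 :* (T :* T) :+ con 2) :+ con 25 :* (T :* T)) refl V T ⟩
    (4 * (V * V) + 20 * (T * T) + 2) + 25 * (T * T)
      ≤⟨ +-monoˡ-≤ (25 * (T * T)) quadratic ⟩
    20 * (V * T) + 25 * (T * T)
      ≡⟨ solve 2 (λ V T → con 20 :* (V :* T) :+ con 25 :* (T :* T) := (con 10 :* T) :* (con 2 :* V) :+ con 25 :* (T :* T)) refl V T ⟩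
    (10 * T) * (2 * V) + 25 * (T * T)
      ≡⟨ cong (λ z → (10 * T) * z + 25 * (T * T)) B+5T ⟨
    (10 * T) * (B + 5 * T) + 25 * (T * T)
      ≡⟨ solve 2 (λ B T → (con 10 :* T) :* (B :+ con 5 :* T) :+ con 25 :* (T :* T) := con 5 :* (T :* T) :+ (con 10 :* (B :* T) :+ con 50 :* (T :* T) :+ con 20 :* (T :* T))) refl B T ⟩
    5 * (T * T) + (10 * (B * T) + 50 * (T * T) + 20 * (T * T)) ∎)
    where
    quadratic : 4 * (V * V) + 20 * (T * T) + 2 ≤ 20 * (V * T)
    quadratic = begin
      4 * (V * V) + 20 * (T * T) + 2
        ≤⟨ +-monoʳ-≤ (4 * (V * V) + 20 * (T * T)) (≤-trans (s≤s (s≤s z≤n)) (*-monoʳ-≤ 4 1≤d²)) ⟩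
      4 * (V * V) + 20 * (T * T) + 4 * (d * d)
        ≡⟨ solve 2 (λ d c → let D = con 5 :* (d :* d) ; W = d :* (D :+ con 1) ; S = D :* c in
             con 4 :* (W :* W) :+ con 20 :* (S :* S) :+ con 4 :* (d :* d) := con 4 :* (d :* d) :* ((D :+ con 1) :* (D :+ con 1) :+ con 125 :* (d :* d) :* (c :* c) :+ con 1)) refl d c ⟩
      4 * (d * d) * ((5 * (d * d) + 1) * (5 * (d * d) + 1) + 125 * (d * d) * (c * c) + 1)
        ≤⟨ *-monoʳ-≤ (4 * (d * d)) bracket ⟩
      4 * (d * d) * (25 * (d * c) * (5 * (d * d) + 1))
        ≡⟨ solve 2 (λ d c → let D = con 5 :* (d :* d) in con 4 :* (d :* d) :* (con 25 :* (d :* c) :* (D :+ con 1)) := con 20 :* ((d :* (D :+ con 1)) :* (D :* c))) refl d c ⟩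
      20 * (V * T) ∎

-- Words with few letters and words with a frequent letter

-- Short words need no structure: at x = 4/5 a row weighs at most 4, and `4 ≤ (61/50)^7`. With at
-- most g/7 letters this gives the rate 5/4 * 61/50 = 61/40, below φ.
module FewParts (g A : ℕ) where

  Φ : (n : ℕ) → Vec ℕ n → ℚ₊
  Φ n w = (ind (7 * n ≤ᵇ g) ⊗ frac 5 3 ^^ g) ⊗ prodTo n (λ i → frac 4 4 ^^ kw w i)

  few-parts⇒𝟙≼Φ : ∀ {n} (w : Vec ℕ n) → sumTo n (kw w) ≡ g → 7 * n ≤ g → 𝟙 ≼ Φ n w
  few-parts⇒𝟙≼Φ {n} w sum≡g 7n≤g = proj₂ (≈-trans (⊗-cong (≈-trans (⊗-cong (≈-reflexive (cong ind (≤ᵇ-true 7n≤g))) ≈-refl) (⊗-identityˡ _))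
    (≈-trans (word-weight w (frac 4 4)) (≈-reflexive (cong (frac 4 4 ^^_) sum≡g)))) (inverse-powers g (≈-trans (frac-⊗ 5 3 4 4) (frac-≈ refl))))

  total-bound : ∀ n → sumL (vecs (upTo A) n) (Φ n) ≼ frac 61 39 ^^ g
  total-bound n with 7 * n ≤? g
  ... | no 7n≰g = ≼-trans (≈⇒≼ (≈-trans (sumL-cong (vecs (upTo A) n) (λ w → ≈-trans (⊗-cong (≈-trans (⊗-cong (≈-reflexive (cong ind (≤ᵇ-false (≰⇒> 7n≰g)))) ≈-refl) (⊗-zeroˡ _)) ≈-refl) (⊗-zeroˡ _)))
        (sumL-𝟘 (vecs (upTo A) n)))) 𝟘≼
  ... | yes 7n≤g = begin
    sumL (vecs (upTo A) n) (Φ n)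
      ≈⟨ sumL-⊗ˡ (vecs (upTo A) n) _ _ ⟩
    (ind (7 * n ≤ᵇ g) ⊗ frac 5 3 ^^ g) ⊗ sumL (vecs (upTo A) n) (λ w → prodTo n (λ i → frac 4 4 ^^ kw w i))
      ≤⟨ ⊗-mono (≼-trans (⊗-monoˡ _ (ind≼𝟙 _)) (≈⇒≼ (⊗-identityˡ _))) (≼-trans (≈⇒≼ (sum-of-products 0 (upTo A) n (λ _ α → frac 4 4 ^^ suc α)))
           (≼-trans (prodTo-mono n (λ _ _ → row)) (≈⇒≼ (prodTo-const n (ι 4))))) ⟩
    frac 5 3 ^^ g ⊗ ι 4 ^^ n
      ≤⟨ ⊗-monoʳ _ (≼-trans (^^-mono n four) (≼-trans (proj₂ (^^-* (frac 61 49) 7 n)) (^^-monoʳ (frac-≼ (≤ᵇ-true⁻ refl)) 7n≤g))) ⟩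
    frac 5 3 ^^ g ⊗ frac 61 49 ^^ g
      ≈⟨ ^^-⊗ _ _ g ⟨
    (frac 5 3 ⊗ frac 61 49) ^^ g
      ≈⟨ ^^-cong g (≈-trans (frac-⊗ 5 3 61 49) (frac-≈ refl)) ⟩
    frac 61 39 ^^ g ∎
    where
    open ≼-Reasoning
    row : sumL (upTo A) (λ α → frac 4 4 ^^ suc α) ≼ ι 4
    row = ≼-trans (≈⇒≼ (sumL-⊗ˡ (upTo A) (frac 4 4) _)) (≼-trans (⊗-monoʳ _ (geometric A {frac 4 4} {ι 5}
      (≼-trans (⊕-monoʳ 𝟙 (≈⇒≼ (frac-⊗ 4 4 5 0))) (≼-trans (≈⇒≼ (frac-⊕ 1 0 20 4)) (frac-≼ (≤ᵇ-true⁻ refl)))))) (≼-trans (≈⇒≼ (frac-⊗ 4 4 5 0)) (frac-≼ (≤ᵇ-true⁻ refl))))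
    a² : frac 61 49 ^^ 2 ≈ frac 3721 2499
    a² = ≈-trans (⊗-cong ≈-refl (⊗-identityʳ _)) (frac-⊗ 61 49 61 49)
    four : ι 4 ≼ frac 61 49 ^^ 7
    four = begin
      ι 4                                               ≤⟨ frac-≼ (≤ᵇ-true⁻ refl) ⟩
      frac (3721 * 3721 * 3721 * 61) 781249999999       ≈⟨ frac-≈ refl ⟩
      _                                                 ≈⟨ frac-⊗ (3721 * (3721 * 3721)) _ 61 49 ⟨
      frac (3721 * (3721 * 3721)) _ ⊗ frac 61 49        ≈⟨ ⊗-cong (frac-⊗ 3721 2499 (3721 * 3721) _) ≈-refl ⟨
      (frac 3721 2499 ⊗ frac (3721 * 3721) _) ⊗ frac 61 49    ≈⟨ ⊗-cong (⊗-cong a² (≈-trans (⊗-cong a² a²) (frac-⊗ 3721 2499 3721 2499))) ≈-refl ⟨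
      (frac 61 49 ^^ 2 ⊗ (frac 61 49 ^^ 2 ⊗ frac 61 49 ^^ 2)) ⊗ frac 61 49
        ≈⟨ ⊗-cong (⊗-cong ≈-refl (^^-+ (frac 61 49) 2 2)) ≈-refl ⟨
      (frac 61 49 ^^ 2 ⊗ frac 61 49 ^^ 4) ⊗ frac 61 49  ≈⟨ ⊗-cong (^^-+ (frac 61 49) 2 4) ≈-refl ⟨
      frac 61 49 ^^ 6 ⊗ frac 61 49                      ≈⟨ ⊗-comm _ _ ⟩
      frac 61 49 ^^ 7                                   ∎

tilted-weight : Bool → (s p : ℚ₊) → ℕ → ℚ₊
tilted-weight b s p 0             = s ^ᵇ not b
tilted-weight b s p 1             = s ^ᵇ b
tilted-weight b s p (suc (suc α)) = p

module FrequentLetter (second : Bool) (c d′ : ℕ) (τ : Tilt second c (suc d′)) (N′ g A : ℕ) where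
  open Tilt τ

  private
    d : ℕ
    d = suc d′
    p u Y : ℚ₊
    p = frac 1 N′
    u = 1+1/ N′
    Y = Y⟨ j ⟩

  letter : ℕ
  letter = if second then 2 else 1

  frequency : ∀ {n} → Vec ℕ n → ℕ
  frequency {n} w = countUpTo n (λ i → kw w i ≡ᵇ letter)

  weight : ℕ → ℚ₊
  weight = tilted-weight second s p

  -- To undo `x ^ g` the factor `X ^ g` is required. The smaller `Y ^ g` is enough because the tilt
  -- supplies the rest on words with a frequent letter, up to `X ^ d` for the remainder of `g`
  -- modulo `d`.
  Φ : (n : ℕ) → Vec ℕ n → ℚ₊
  Φ n w = (X ^^ d ⊗ (Y ^^ g ⊗ u ^^ n)) ⊗ prodTo n (λ i → x ^^ kw w i ⊗ weight (at 0 w i))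

  row : N₀ ≤ suc N′ → sumL (upTo A) (λ α → x ^^ suc α ⊗ weight α) ≼ 𝟙
  row large = ≼-trans (go A) (row≼ N′ large)
    where
    open ≼-Reasoning
    x≼𝟙 : x ≼ 𝟙
    x≼𝟙 = ≼-trans x≼2/3 (frac-≼ (≤ᵇ-true⁻ refl))
    head : (x ⊗ 𝟙) ⊗ s ^ᵇ not second ⊕ (x ⊗ (x ⊗ 𝟙)) ⊗ s ^ᵇ second ≈ tilted-sum second s x
    head = by second
      where
      by : ∀ b → (x ⊗ 𝟙) ⊗ s ^ᵇ not b ⊕ (x ⊗ (x ⊗ 𝟙)) ⊗ s ^ᵇ b ≈ tilted-sum b s x
      by false = ⊕-cong (≈-trans (⊗-cong (⊗-identityʳ x) ≈-refl) (⊗-comm x s)) (≈-trans (⊗-identityʳ _) (⊗-cong ≈-refl (⊗-identityʳ x)))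
      by true  = ⊕-cong (≈-trans (⊗-identityʳ _) (⊗-identityʳ x)) (≈-trans (⊗-cong (⊗-cong ≈-refl (⊗-identityʳ x)) ≈-refl) (⊗-comm _ s))
    tail : ∀ A → sumL (upTo A) (λ α → x ^^ suc (suc (suc α)) ⊗ p) ≼ ι 3 ⊗ p
    tail A = ≼-trans (≈⇒≼ (sumL-⊗ʳ (upTo A) p _)) (⊗-monoˡ p (≼-trans (sumL-mono (upTo A) (λ α → ^^-antiʳ x≼𝟙 (≤-trans (n≤1+n α) (≤-trans (n≤1+n _) (n≤1+n _))))) (geometric₃ A x x≼2/3)))
    go : ∀ A → sumL (upTo A) (λ α → x ^^ suc α ⊗ weight α) ≼ tilted-sum second s x ⊕ ι 3 ⊗ p
    go zero = 𝟘≼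
    go (suc zero) = ≼-trans (≼-trans (⊕-monoʳ _ 𝟘≼) (≈⇒≼ head)) (≼-⊕ˡ _ _)
    go (suc (suc A)) = begin
      sumL (upTo (suc (suc A))) (λ α → x ^^ suc α ⊗ weight α)
        ≡⟨ trans (sumL-upTo-suc (suc A) _) (cong ((x ⊗ 𝟙) ⊗ s ^ᵇ not second ⊕_) (sumL-upTo-suc A _)) ⟩
      (x ⊗ 𝟙) ⊗ s ^ᵇ not second ⊕ ((x ⊗ (x ⊗ 𝟙)) ⊗ s ^ᵇ second ⊕ sumL (upTo A) (λ α → x ^^ suc (suc (suc α)) ⊗ p))
        ≈⟨ ⊕-assoc _ _ _ ⟨
      ((x ⊗ 𝟙) ⊗ s ^ᵇ not second ⊕ (x ⊗ (x ⊗ 𝟙)) ⊗ s ^ᵇ second) ⊕ sumL (upTo A) (λ α → x ^^ suc (suc (suc α)) ⊗ p)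
        ≤⟨ ⊕-mono (≈⇒≼ head) (tail A) ⟩
      tilted-sum second s x ⊕ ι 3 ⊗ p ∎

  total-bound : N₀ ≤ suc N′ → ∀ n → sumL (vecs (upTo A) n) (Φ n) ≼ X ^^ d ⊗ (Y ^^ g ⊗ u ^^ n)
  total-bound large n = begin
    sumL (vecs (upTo A) n) (Φ n)
      ≈⟨ ≈-trans (sumL-⊗ˡ (vecs (upTo A) n) _ _) (⊗-cong ≈-refl (sum-of-products 0 (upTo A) n (λ _ α → x ^^ suc α ⊗ weight α))) ⟩
    (X ^^ d ⊗ (Y ^^ g ⊗ u ^^ n)) ⊗ prodTo n (λ _ → sumL (upTo A) (λ α → x ^^ suc α ⊗ weight α))
      ≤⟨ ⊗-monoʳ _ (≼-trans (prodTo-mono n (λ _ _ → row large)) (≈⇒≼ (≈-trans (prodTo-const n 𝟙) (𝟙^^ n)))) ⟩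
    (X ^^ d ⊗ (Y ^^ g ⊗ u ^^ n)) ⊗ 𝟙
      ≈⟨ ⊗-identityʳ _ ⟩
    X ^^ d ⊗ (Y ^^ g ⊗ u ^^ n) ∎
    where open ≼-Reasoning

  𝟙≼Y : 𝟙 ≼ Y
  𝟙≼Y = frac-≼ (≤-trans (≤-reflexive (trans (*-identityˡ _) (suc-pred> (Convergent.R>0 (isConvergent j)))))
    (≤-trans (Convergent.R≤P (isConvergent j)) (≤-reflexive (sym (*-identityʳ P⟨ j ⟩)))))

  -- The exponents g and f are compared through g = d (g / d) + g % d.
  power′ : ∀ f → c * g ≤ f * d → X ^^ g ≼ X ^^ d ⊗ (s ^^ f ⊗ Y ^^ g)
  power′ f cg≤fd = begin
    X ^^ g                                          ≡⟨ cong (X ^^_) (m≡m%n+[m/n]*n g d) ⟩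
    X ^^ (g % d + g / d * d)                        ≈⟨ ^^-+ X (g % d) (g / d * d) ⟩
    X ^^ (g % d) ⊗ X ^^ (g / d * d)                 ≤⟨ ⊗-mono (^^-monoʳ 𝟙≼X (<⇒≤ (m%n<n g d))) steps ⟩
    X ^^ d ⊗ (s ^^ f ⊗ Y ^^ g)                      ∎
    where
    open ≼-Reasoning
    k : ℕ
    k = g / d
    ck≤f : c * k ≤ f
    ck≤f = *-cancelʳ-≤ (c * k) f d (≤-trans (≤-reflexive (*-assoc c k d)) (≤-trans (*-monoʳ-≤ c (m/n*n≤m g d)) cg≤fd))
    steps : X ^^ (k * d) ≼ s ^^ f ⊗ Y ^^ g
    steps = begin
      X ^^ (k * d)                           ≡⟨ cong (X ^^_) (*-comm k d) ⟩
      X ^^ (d * k)                           ≈⟨ ^^-* X d k ⟩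
      (X ^^ d) ^^ k                          ≤⟨ ^^-mono k power ⟩
      (s ^^ c ⊗ Y ^^ d) ^^ k                 ≈⟨ ^^-⊗ _ _ k ⟩
      (s ^^ c) ^^ k ⊗ (Y ^^ d) ^^ k          ≈⟨ ⊗-cong (^^-* s c k) (^^-* Y d k) ⟨
      s ^^ (c * k) ⊗ Y ^^ (d * k)            ≤⟨ ⊗-mono (^^-monoʳ 𝟙≼s ck≤f) (^^-monoʳ 𝟙≼Y (≤-trans (≤-reflexive (*-comm d k)) (m/n*n≤m g d))) ⟩
      s ^^ f ⊗ Y ^^ g                        ∎

  frequent⇒𝟙≼Φ : ∀ {n} (w : Vec ℕ n) → sumTo n (kw w) ≡ g → suc N′ * suc N′ * countUpTo n (λ i → 3 ≤ᵇ kw w i) ≤ n →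
    c * g ≤ frequency w * d → 𝟙 ≼ Φ n w
  frequent⇒𝟙≼Φ {n} w sum≡g few frequent = begin
    𝟙                                                             ≤⟨ 𝟙≼⊗ (proj₂ (inverse-powers g Xx≈𝟙)) (absorb N′ _ n few) ⟩
    (X ^^ g ⊗ x ^^ g) ⊗ (u ^^ n ⊗ p ^^ t)                         ≤⟨ ⊗-monoˡ _ (⊗-monoˡ _ (power′ (frequency w) frequent)) ⟩
    ((X ^^ d ⊗ (s ^^ f ⊗ Y ^^ g)) ⊗ x ^^ g) ⊗ (u ^^ n ⊗ p ^^ t)   ≈⟨ rearrange _ _ _ _ _ _ ⟩
    (X ^^ d ⊗ (Y ^^ g ⊗ u ^^ n)) ⊗ (x ^^ g ⊗ (s ^^ f ⊗ p ^^ t))   ≈⟨ ⊗-cong ≈-refl (⊗-cong (≈-trans (≈-reflexive (cong (x ^^_) (sym sum≡g))) (≈-sym (word-weight w x)))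
                                                                        (≈-trans (≈-sym (⊗-cong (prodTo-^ᵇ n s _) (prodTo-^ᵇ n p _))) (≈-sym (prodTo-⊗ n _ _)))) ⟩
    (X ^^ d ⊗ (Y ^^ g ⊗ u ^^ n)) ⊗ (prodTo n (λ i → x ^^ kw w i) ⊗ prodTo n (λ i → s ^ᵇ (kw w i ≡ᵇ letter) ⊗ p ^ᵇ (3 ≤ᵇ kw w i)))
                                                                  ≈⟨ ⊗-cong ≈-refl (prodTo-⊗ n _ _) ⟨
    (X ^^ d ⊗ (Y ^^ g ⊗ u ^^ n)) ⊗ prodTo n (λ i → x ^^ kw w i ⊗ (s ^ᵇ (kw w i ≡ᵇ letter) ⊗ p ^ᵇ (3 ≤ᵇ kw w i)))
                                                                  ≈⟨ ⊗-cong ≈-refl (prodTo-cong n (λ i _ → ⊗-cong ≈-refl (same second (at 0 w i)))) ⟩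
    Φ n w                                                         ∎
    where
    open ≼-Reasoning
    f t : ℕ
    f = frequency w
    t = countUpTo n (λ i → 3 ≤ᵇ kw w i)
    rearrange : ∀ a b c d e f → ((a ⊗ (b ⊗ c)) ⊗ d) ⊗ (e ⊗ f) ≈ (a ⊗ (c ⊗ e)) ⊗ (d ⊗ (b ⊗ f))
    rearrange = solve 6 (λ a b c d e f → ((a :* (b :* c)) :* d) :* (e :* f) := (a :* (c :* e)) :* (d :* (b :* f))) ≈-refl
      where open ℚ₊-Solver
    same : ∀ b α → s ^ᵇ (suc α ≡ᵇ (if b then 2 else 1)) ⊗ p ^ᵇ (3 ≤ᵇ suc α) ≈ tilted-weight b s p α
    same false 0             = ⊗-identityʳ _
    same false 1             = ⊗-identityʳ _
    same false (suc (suc α)) = ⊗-identityˡ _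
    same true  0             = ⊗-identityʳ _
    same true  1             = ⊗-identityʳ _
    same true  (suc (suc zero))    = ⊗-identityˡ _
    same true  (suc (suc (suc α))) = ⊗-identityˡ _

-- Growth rates below the golden ratio

h⟨_⟩ x⟨_⟩ : ℕ → ℚ₊
h⟨ j ⟩ = frac (P⟨ j ⟩ + R⟨ j ⟩) (pred P⟨ j ⟩)
x⟨ j ⟩ = frac P⟨ j ⟩ (pred (P⟨ j ⟩ + R⟨ j ⟩))

module Weights (j : ℕ) where
  open Convergent (isConvergent j)
  open ≤-Reasoning
  open +-*-Solver

  private
    P R : ℕ
    P = P⟨ j ⟩
    R = R⟨ j ⟩
    P>0 : 0 < P
    P>0 = ≤-trans R>0 R≤P
    P+R>0 : 0 < P + R
    P+R>0 = ≤-trans P>0 (m≤m+n P R)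

  hx≈𝟙 : h⟨ j ⟩ ⊗ x⟨ j ⟩ ≈ 𝟙
  hx≈𝟙 = ≈-trans (frac-⊗ (P + R) (pred P) P (pred (P + R))) (frac-≈ (trans (*-identityʳ _) (trans (trans (*-comm (P + R) P)
    (cong₂ _*_ (sym (suc-pred> P>0)) (sym (suc-pred> P+R>0)))) (sym (*-identityˡ (suc (pred P) * suc (pred (P + R))))))))

  x≼x₀ : x⟨ j ⟩ ≼ x₀
  x≼x₀ = frac-≼ (begin
    P * 55                     ≡⟨ solve 1 (λ P → P :* con 55 := con 21 :* P :+ con 34 :* P) refl P ⟩
    21 * P + 34 * P            ≤⟨ +-monoˡ-≤ (34 * P) 21P≤34R ⟩
    34 * R + 34 * P            ≡⟨ solve 2 (λ P R → con 34 :* R :+ con 34 :* P := con 34 :* (P :+ R)) refl P R ⟩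
    34 * (P + R)               ≡⟨ cong (34 *_) (suc-pred> {P + R} P+R>0) ⟨
    34 * suc (pred (P + R))    ∎)

  x+x²≼𝟙 : x⟨ j ⟩ ⊕ x⟨ j ⟩ ⊗ x⟨ j ⟩ ≼ 𝟙
  x+x²≼𝟙 = ≼-trans (≈⇒≼ (≈-trans (⊕-cong ≈-refl (frac-⊗ P _ P _)) (frac-⊕ P _ (P * P) _))) (frac-≼ (ineq (P + R) (pred (P + R)) (suc-pred> P+R>0) refl))
    where
    ineq : ∀ Q Q′ → suc Q′ ≡ Q → Q ≡ P + R →
      (P * suc (Q′ + Q′ * suc Q′) + (P * P) * suc Q′) * 1 ≤ 1 * suc ((Q′ + Q′ * suc Q′) + Q′ * suc (Q′ + Q′ * suc Q′))
    ineq Q Q′ refl eq = begin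
      (P * (Q * Q) + (P * P) * Q) * 1       ≡⟨ solve 2 (λ P Q → (P :* (Q :* Q) :+ (P :* P) :* Q) :* con 1 := Q :* (P :* Q :+ P :* P)) refl P Q ⟩
      Q * (P * Q + P * P)                   ≤⟨ *-monoʳ-≤ Q small ⟩
      Q * (Q * Q)                           ≡⟨ *-identityˡ _ ⟨
      1 * (Q * (Q * Q))                     ∎
      where
      small : P * Q + P * P ≤ Q * Q
      small = begin
        P * Q + P * P                ≡⟨ cong (λ z → P * z + P * P) eq ⟩
        P * (P + R) + P * P          ≤⟨ +-monoʳ-≤ (P * (P + R)) (≤-trans (m≤m+n (P * P) 1) (≤-reflexive golden)) ⟩
        P * (P + R) + (P * R + R * R) ≡⟨ solve 2 (λ P R → P :* (P :+ R) :+ (P :* R :+ R :* R) := (P :+ R) :* (P :+ R)) refl P R ⟩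
        (P + R) * (P + R)            ≡⟨ cong (λ z → z * z) eq ⟨
        Q * Q                        ∎

  -- By `golden`, the quotient of `h` by `Y` is `R (P + R) / P² = 1 + 1/P²`.
  h≼uY : ∀ N′ → suc N′ ≤ P → h⟨ j ⟩ ≼ 1+1/ N′ ⊗ Y⟨ j ⟩
  h≼uY N′ N≤P = ≼-trans (frac-≼ (begin
      (P + R) * (suc N′ * suc (pred R))        ≡⟨ cong (λ z → (P + R) * (suc N′ * z)) (suc-pred> R>0) ⟩
      (P + R) * (suc N′ * R)                   ≡⟨ solve 3 (λ P R N → (P :+ R) :* (N :* R) := N :* (P :* R :+ R :* R)) refl P R (suc N′) ⟩
      suc N′ * (P * R + R * R)                 ≡⟨ cong (suc N′ *_) golden ⟨
      suc N′ * (P * P + 1)                     ≡⟨ solve 2 (λ P N → N :* (P :* P :+ con 1) := N :* (P :* P) :+ N) refl P (suc N′) ⟩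
      suc N′ * (P * P) + suc N′                ≤⟨ +-monoʳ-≤ (suc N′ * (P * P)) (≤-trans N≤P (m≤m*n P P {{>-nonZero P>0}})) ⟩
      suc N′ * (P * P) + P * P                 ≡⟨ solve 2 (λ P N → N :* (P :* P) :+ P :* P := (con 1 :+ N) :* P :* P) refl P (suc N′) ⟩
      suc (suc N′) * P * P                     ≡⟨ cong (suc (suc N′) * P *_) (suc-pred> P>0) ⟨
      suc (suc N′) * P * suc (pred P)          ∎)) (proj₂ (frac-⊗ (suc (suc N′)) N′ P (pred R)))

  -- Consecutive rates have the exact quotient `1 + 1/(P (P + R))`; this is the room between a
  -- negligible class and the lower bound on the number of semigroups.
  gap : ℕ
  gap = pred (P * (P + R))

  Y-step : 1+1/ gap ⊗ Y⟨ j ⟩ ≼ Y⟨ suc j ⟩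
  Y-step = ≼-trans (≈⇒≼ (frac-⊗ (suc (suc gap)) gap P (pred R))) (frac-≼ (≤-reflexive (begin-equality
      suc (suc gap) * P * suc (pred (P + R))      ≡⟨ cong₂ (λ a b → suc a * P * b) gap≡ (suc-pred> P+R>0) ⟩
      suc (P * (P + R)) * P * (P + R)             ≡⟨ solve 2 (λ P R → (con 1 :+ P :* (P :+ R)) :* P :* (P :+ R) := ((P :* P :+ con 1) :+ P :* R) :* (P :* (P :+ R))) refl P R ⟩
      ((P * P + 1) + P * R) * (P * (P + R))       ≡⟨ cong (λ z → (z + P * R) * (P * (P + R))) golden ⟩
      ((P * R + R * R) + P * R) * (P * (P + R))   ≡⟨ solve 2 (λ P R → ((P :* R :+ R :* R) :+ P :* R) :* (P :* (P :+ R)) := (con 2 :* P :+ R) :* (P :* (P :+ R) :* R)) refl P R ⟩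
      (2 * P + R) * (P * (P + R) * R)             ≡⟨ cong₂ (λ a b → (2 * P + R) * (a * b)) gap≡ (suc-pred> R>0) ⟨
      (2 * P + R) * (suc gap * suc (pred R))      ∎)))
    where
    gap≡ : suc gap ≡ P * (P + R)
    gap≡ = suc-pred> (*-mono-< P>0 P+R>0)

  Y-mono : Y⟨ j ⟩ ≼ Y⟨ suc j ⟩
  Y-mono = ≼-trans (≼-trans (proj₂ (⊗-identityˡ _)) (⊗-monoˡ _ (𝟙≼1+1/ gap))) Y-step

  Y≼2 : Y⟨ j ⟩ ≼ ι 2
  Y≼2 = frac-≼ (≤-trans (≤-reflexive (*-identityʳ P)) (≤-trans P≤2R (≤-reflexive (cong (2 *_) (sym (suc-pred> R>0))))))

  Y²≼Y+1 : Y⟨ j ⟩ ⊗ Y⟨ j ⟩ ≼ Y⟨ j ⟩ ⊕ 𝟙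
  Y²≼Y+1 = ≼-trans (≈⇒≼ (frac-⊗ P (pred R) P (pred R))) (≼-trans (frac-≼ (ineq (pred R) (suc-pred> R>0))) (proj₂ (frac-⊕ P (pred R) 1 0)))
    where
    ineq : ∀ R′ → suc R′ ≡ R → (P * P) * suc (0 + R′ * 1) ≤ (P * 1 + 1 * suc R′) * suc (R′ + R′ * suc R′)
    ineq R′ eq = begin
      (P * P) * suc (0 + R′ * 1)                  ≡⟨ solve 2 (λ P r → (P :* P) :* (con 1 :+ (con 0 :+ r :* con 1)) := (P :* P) :* (con 1 :+ r)) refl P R′ ⟩
      (P * P) * suc R′                            ≤⟨ *-monoˡ-≤ (suc R′) (≤-trans (m≤m+n (P * P) 1) (≤-reflexive (trans golden (cong (λ z → P * z + z * z) (sym eq))))) ⟩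
      (P * suc R′ + suc R′ * suc R′) * suc R′     ≡⟨ solve 2 (λ P R → (P :* R :+ R :* R) :* R := (P :* con 1 :+ con 1 :* R) :* (R :* R)) refl P (suc R′) ⟩
      (P * 1 + 1 * suc R′) * (suc R′ * suc R′)    ∎

  𝟙≼Y : 𝟙 ≼ Y⟨ j ⟩
  𝟙≼Y = frac-≼ (≤-trans (≤-reflexive (trans (*-identityˡ _) (suc-pred> R>0))) (≤-trans R≤P (≤-reflexive (sym (*-identityʳ P)))))

Y-monotone : ∀ {i j} → i ≤ j → Y⟨ i ⟩ ≼ Y⟨ j ⟩
Y-monotone {i} {j} i≤j = subst (λ z → Y⟨ i ⟩ ≼ Y⟨ z ⟩) (m+[n∸m]≡n i≤j) (go (j ∸ i))
  where
  go : ∀ k → Y⟨ i ⟩ ≼ Y⟨ i + k ⟩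
  go zero    = ≈⇒≼ (≈-reflexive (cong Y⟨_⟩ (sym (+-identityʳ i))))
  go (suc k) = ≼-trans (go k) (≼-trans (Weights.Y-mono (i + k)) (≈⇒≼ (≈-reflexive (cong Y⟨_⟩ (sym (+-suc i k))))))

-- Y⟨ j ⟩ increases to φ, so f grows at a rate strictly below φ.
record Negligible (f : ℕ → ℚ₊) : Set where
  field
    j  : ℕ
    C  : ℚ₊
    g₀ : ℕ
    bounded : ∀ g → g₀ ≤ g → f g ≼ C ⊗ Y⟨ j ⟩ ^^ g

negligible-⊕ : ∀ {f₁ f₂} → Negligible f₁ → Negligible f₂ → Negligible (λ g → f₁ g ⊕ f₂ g)
negligible-⊕ {f₁} {f₂} n₁ n₂ = record
  { j = j ; C = N₁.C ⊕ N₂.C ; g₀ = N₁.g₀ + N₂.g₀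
  ; bounded = λ g p → ≼-trans (⊕-mono
      (≼-trans (N₁.bounded g (≤-trans (m≤m+n _ _) p)) (⊗-monoʳ N₁.C (^^-mono g (Y-monotone (m≤m+n N₁.j N₂.j)))))
      (≼-trans (N₂.bounded g (≤-trans (m≤n+m _ _) p)) (⊗-monoʳ N₂.C (^^-mono g (Y-monotone (m≤n+m N₂.j N₁.j))))))
      (proj₂ (⊗-distribʳ-⊕ _ N₁.C N₂.C)) }
  where
  module N₁ = Negligible n₁
  module N₂ = Negligible n₂
  j : ℕ
  j = N₁.j + N₂.j

-- The `g + 1` possible lengths are charged to one extra factor `u ^ g`.
total≼ : ∀ N′ g A Φ B → (∀ n → n ≤ g → 1+1/ N′ ^^ g ⊗ sumL (vecs (upTo A) n) (Φ n) ≼ B) → total (suc g) A Φ ≼ ι (suc N′) ⊗ B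
total≼ N′ g A Φ B bound = ≼-cancelʳ (suc g) z<s (begin
  total (suc g) A Φ ⊗ ι (suc g)                                             ≈⟨ sumL-⊗ʳ (upTo (suc g)) (ι (suc g)) _ ⟨
  sumL (upTo (suc g)) (λ n → sumL (vecs (upTo A) n) (Φ n) ⊗ ι (suc g))      ≤⟨ sumL-mono-∈ (upTo (suc g)) (λ n n∈ → each n (s≤s⁻¹ (∈-upTo⁻ n∈))) ⟩
  sumL (upTo (suc g)) (λ n → ι (suc N′) ⊗ B)                                ≈⟨ ≈-trans (sumL-const (upTo (suc g)) _) (≈-trans (⊗-cong (≈-reflexive (cong ι (length-upTo (suc g)))) ≈-refl) (⊗-comm _ _)) ⟩
  (ι (suc N′) ⊗ B) ⊗ ι (suc g)                                              ∎)
  where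
  open ≼-Reasoning
  each : ∀ n → n ≤ g → sumL (vecs (upTo A) n) (Φ n) ⊗ ι (suc g) ≼ ι (suc N′) ⊗ B
  each n n≤g = ≼-trans (⊗-monoʳ _ (ι[1+n]≼ N′ g)) (≼-trans (≈⇒≼ (e _ _ _)) (⊗-monoʳ _ (bound n n≤g)))
    where
    e : ∀ a b c → a ⊗ (b ⊗ c) ≈ b ⊗ (c ⊗ a)
    e = solve 3 (λ a b c → a :* (b :* c) := b :* (c :* a)) ≈-refl
      where open ℚ₊-Solver

≤-div : ∀ n e′ → n ≤ suc e′ * suc (n / suc e′)
≤-div n e′ = begin
  n                                        ≡⟨ m≡m%n+[m/n]*n n (suc e′) ⟩
  n % suc e′ + n / suc e′ * suc e′         ≤⟨ +-monoˡ-≤ _ (<⇒≤ (m%n<n n (suc e′))) ⟩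
  suc (n / suc e′) * suc e′                ≡⟨ *-comm (suc (n / suc e′)) (suc e′) ⟩
  suc e′ * suc (n / suc e′)                ∎
  where open ≤-Reasoning

threshold-for : (k e′ t : ℕ) → ℕ
threshold-for k e′ t = suc k * (7 * suc e′) * suc (suc t)

-- Since `g ≤ 7n`, all slack factors together are at most `u ^ ((k + 1) * 7e)` for each of the
-- `n / e + 1` units, where `e = suc e′`. The threshold on `N` makes each unit at most `1+1/ t`,
-- which one factor `θ` cancels; a single unit is left over as a constant.
saving : ∀ N′ k e′ t {θ h Y : ℚ₊} g n → h ≼ 1+1/ N′ ⊗ Y → 1+1/ t ⊗ θ ≼ 𝟙 → threshold-for k e′ t ≤ suc N′ → g ≤ 7 * n →
  1+1/ N′ ^^ (k * g) ⊗ (h ^^ g ⊗ θ ^^ (n / suc e′)) ≼ 1+1/ t ⊗ Y ^^ g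
saving N′ k e′ t {θ} {h} {Y} g n h≼ θ≼ large g≤7n = begin
  u ^^ (k * g) ⊗ (h ^^ g ⊗ θ ^^ q)                           ≤⟨ ⊗-monoʳ _ (⊗-monoˡ _ (≼-trans (^^-mono g h≼) (≈⇒≼ (^^-⊗ u Y g)))) ⟩
  u ^^ (k * g) ⊗ ((u ^^ g ⊗ Y ^^ g) ⊗ θ ^^ q)                ≈⟨ e₁ _ _ _ _ ⟩
  (u ^^ g ⊗ u ^^ (k * g)) ⊗ (θ ^^ q ⊗ Y ^^ g)                ≈⟨ ⊗-cong (^^-+ u g (k * g)) ≈-refl ⟨
  u ^^ (suc k * g) ⊗ (θ ^^ q ⊗ Y ^^ g)                       ≤⟨ ⊗-monoˡ _ (≼-trans (^^-monoʳ (𝟙≼1+1/ N′) exponent) (≈⇒≼ (^^-* u (suc k * (7 * suc e′)) (suc q)))) ⟩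
  (u ^^ (suc k * (7 * suc e′))) ^^ suc q ⊗ (θ ^^ q ⊗ Y ^^ g) ≤⟨ ⊗-monoˡ _ (^^-mono (suc q) (power≼1+1/ N′ (suc k * (7 * suc e′)) t large)) ⟩
  (v ⊗ v ^^ q) ⊗ (θ ^^ q ⊗ Y ^^ g)                           ≈⟨ e₂ _ _ _ _ ⟩
  (v ^^ q ⊗ θ ^^ q) ⊗ (v ⊗ Y ^^ g)                           ≤⟨ ⊗-monoˡ _ (≼-trans (proj₂ (^^-⊗ v θ q)) (^^≼𝟙 q θ≼)) ⟩
  𝟙 ⊗ (v ⊗ Y ^^ g)                                           ≈⟨ ⊗-identityˡ _ ⟩
  v ⊗ Y ^^ g                                                 ∎
  where
  open ≼-Reasoning
  u v : ℚ₊
  u = 1+1/ N′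
  v = 1+1/ t
  q : ℕ
  q = n / suc e′
  exponent : suc k * g ≤ suc k * (7 * suc e′) * suc q
  exponent = ≤-trans (*-monoʳ-≤ (suc k) (≤-trans g≤7n (*-monoʳ-≤ 7 (≤-div n e′))))
    (≤-reflexive (solve 3 (λ k e q → k :* (con 7 :* (e :* q)) := k :* (con 7 :* e) :* q) refl (suc k) (suc e′) (suc q)))
    where open +-*-Solver
  open ℚ₊-Solver using (solve; _:=_; _:*_)
  e₁ : ∀ a b c d → a ⊗ ((b ⊗ c) ⊗ d) ≈ (b ⊗ a) ⊗ (d ⊗ c)
  e₁ = solve 4 (λ a b c d → a :* ((b :* c) :* d) := (b :* a) :* (d :* c)) ≈-refl
  e₂ : ∀ a b c d → (a ⊗ b) ⊗ (c ⊗ d) ≈ (b ⊗ c) ⊗ (a ⊗ d)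
  e₂ = solve 4 (λ a b c d → (a :* b) :* (c :* d) := (b :* c) :* (a :* d)) ≈-refl

3p≼1/10000 : ∀ N′ → 30000 ≤ suc N′ → ι 3 ⊗ frac 1 N′ ≼ frac 1 9999
3p≼1/10000 N′ large = ≼-trans (≈⇒≼ (frac-⊗ 3 0 1 N′)) (frac-≼ (≤-trans large (≤-reflexive (sym (trans (*-identityˡ _) (cong suc (+-identityʳ N′)))))))

long : ℕ → ((n : ℕ) → Vec ℕ n → ℚ₊) → (n : ℕ) → Vec ℕ n → ℚ₊
long g Φ n w = ind (g <ᵇ 7 * n) ⊗ Φ n w

long-total : ∀ N′ k e′ t j g A (Φ : (n : ℕ) → Vec ℕ n → ℚ₊) {θ C : ℚ₊} → suc N′ ≤ j → 1+1/ t ⊗ θ ≼ 𝟙 →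
  threshold-for (suc k) e′ t ≤ suc N′ →
  (∀ n → g < 7 * n → sumL (vecs (upTo A) n) (Φ n) ≼ C ⊗ (1+1/ N′ ^^ (k * n) ⊗ (h⟨ j ⟩ ^^ g ⊗ θ ^^ (n / suc e′)))) →
  total (suc g) A (long g Φ) ≼ (ι (suc N′) ⊗ (C ⊗ 1+1/ t)) ⊗ Y⟨ j ⟩ ^^ g
long-total N′ k e′ t j g A Φ {θ} {C} N≤j θ≼ large bound = ≼-trans (total≼ N′ g A (long g Φ) _ each) (≈⇒≼ (≈-trans (⊗-cong ≈-refl (≈-sym (⊗-assoc C _ _))) (≈-sym (⊗-assoc _ _ _))))
  where
  open ≼-Reasoning
  u : ℚ₊
  u = 1+1/ N′
  each : ∀ n → n ≤ g → u ^^ g ⊗ sumL (vecs (upTo A) n) (long g Φ n) ≼ C ⊗ (1+1/ t ⊗ Y⟨ j ⟩ ^^ g)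
  each n n≤g with g <? 7 * n
  ... | no g≮ = ≼-trans (⊗-monoʳ _ (≈⇒≼ (≈-trans (sumL-cong (vecs (upTo A) n) (λ w → ≈-trans (⊗-cong (≈-reflexive (cong ind (<ᵇ-false (≮⇒≥ g≮)))) ≈-refl) (⊗-zeroˡ _))) (sumL-𝟘 (vecs (upTo A) n)))))
        (≼-trans (≈⇒≼ (⊗-zeroʳ _)) 𝟘≼)
  ... | yes g< = begin
    u ^^ g ⊗ sumL (vecs (upTo A) n) (long g Φ n)
      ≤⟨ ⊗-monoʳ _ (≼-trans (sumL-mono (vecs (upTo A) n) (λ w → ≼-trans (⊗-monoˡ _ (ind≼𝟙 _)) (≈⇒≼ (⊗-identityˡ _)))) (bound n g<)) ⟩
    u ^^ g ⊗ (C ⊗ (u ^^ (k * n) ⊗ (h⟨ j ⟩ ^^ g ⊗ θ ^^ (n / suc e′))))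
      ≤⟨ ⊗-monoʳ _ (⊗-monoʳ C (⊗-monoˡ _ (^^-monoʳ (𝟙≼1+1/ N′) (*-monoʳ-≤ k n≤g)))) ⟩
    u ^^ g ⊗ (C ⊗ (u ^^ (k * g) ⊗ (h⟨ j ⟩ ^^ g ⊗ θ ^^ (n / suc e′))))
      ≈⟨ e _ _ _ _ ⟩
    C ⊗ ((u ^^ g ⊗ u ^^ (k * g)) ⊗ (h⟨ j ⟩ ^^ g ⊗ θ ^^ (n / suc e′)))
      ≈⟨ ⊗-cong ≈-refl (⊗-cong (^^-+ u g (k * g)) ≈-refl) ⟨
    C ⊗ (u ^^ (suc k * g) ⊗ (h⟨ j ⟩ ^^ g ⊗ θ ^^ (n / suc e′)))
      ≤⟨ ⊗-monoʳ C (saving N′ (suc k) e′ t g n (Weights.h≼uY j N′ (≤-trans N≤j (P-grows j))) θ≼ large (<⇒≤ g<)) ⟩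
    C ⊗ (1+1/ t ⊗ Y⟨ j ⟩ ^^ g) ∎
    where
    e : ∀ a b c d → a ⊗ (b ⊗ (c ⊗ d)) ≈ b ⊗ ((a ⊗ c) ⊗ d)
    e = solve 4 (λ a b c d → a :* (b :* (c :* d)) := b :* ((a :* c) :* d)) ≈-refl
      where open ℚ₊-Solver

-- Already `N = 21` works: 22/21 * 61/40 is below 8/5, the rate with index 1.
negligible-few-parts : Negligible (λ g → total (suc g) (2 * g) (FewParts.Φ g (2 * g)))
negligible-few-parts = record { j = 1 ; C = ι 21 ; g₀ = 0 ; bounded = λ g _ → ≼-trans
  (total≼ 20 g (2 * g) (FewParts.Φ g (2 * g)) ((1+1/ 20 ⊗ frac 61 39) ^^ g) (λ n _ → ≼-trans (⊗-monoʳ _ (FewParts.total-bound g (2 * g) n)) (proj₂ (^^-⊗ _ _ g))))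
  (⊗-monoʳ _ (^^-mono g (≼-trans (≈⇒≼ (frac-⊗ 22 20 61 39)) (frac-≼ (≤ᵇ-true⁻ refl))))) }

negligible-many-threes : ∀ N′ e′ → 30000 ≤ suc N′ → threshold-for 15 (3 + e′ * 4) 1998 ≤ suc N′ →
  Negligible (λ g → total (suc g) (2 * g) (long g (ManyThrees.Φ N′ e′ g (2 * g) x⟨ suc N′ ⟩ h⟨ suc N′ ⟩)))
negligible-many-threes N′ e′ large large′ = record { j = j ; C = ι (suc N′) ⊗ (Const ⊗ 1+1/ 1998) ; g₀ = 7 ; bounded = bounded }
  where
  j : ℕ
  j = suc N′
  open Weights j
  Const : ℚ₊
  Const = ManyThreesTotal.Constant N′ e′ 0 0 x⟨ j ⟩ h⟨ j ⟩ x≼x₀ x+x²≼𝟙 (3p≼1/10000 N′ large) (≤-trans (≤ᵇ-true⁻ {4} {30000} refl) large)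
  bounded : ∀ g → 7 ≤ g → total (suc g) (2 * g) (long g (ManyThrees.Φ N′ e′ g (2 * g) x⟨ j ⟩ h⟨ j ⟩))
    ≼ (ι (suc N′) ⊗ (Const ⊗ 1+1/ 1998)) ⊗ Y⟨ j ⟩ ^^ g
  bounded g 7≤g = long-total N′ 14 (3 + e′ * 4) 1998 j g (2 * g) _ {C = Const} ≤-refl θ≼ large′ bound
    where
    -- Equality: `1+1/ 1998` is 2000/1999, the reciprocal of `κ`.
    θ≼ : 1+1/ 1998 ⊗ κ ≼ 𝟙
    θ≼ = ≼-trans (≈⇒≼ (frac-⊗ 2000 1998 9995 9999)) (frac-≼ (≤ᵇ-true⁻ refl))
    bound : ∀ n → g < 7 * n → sumL (vecs (upTo (2 * g)) n) (ManyThrees.Φ N′ e′ g (2 * g) x⟨ j ⟩ h⟨ j ⟩ n)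
      ≼ Const ⊗ (1+1/ N′ ^^ (14 * n) ⊗ (h⟨ j ⟩ ^^ g ⊗ κ ^^ (n / suc (3 + e′ * 4))))
    bound n g<7n = subst (λ z → sumL (vecs (upTo (2 * g)) n) (ManyThrees.Φ N′ e′ g (2 * g) x⟨ j ⟩ h⟨ j ⟩ n)
      ≼ Const ⊗ (1+1/ N′ ^^ (14 * n) ⊗ (h⟨ j ⟩ ^^ g ⊗ κ ^^ z)))
      (/-congʳ {m = n} (*-comm 4 (suc e′)))
      (ManyThreesTotal.total-bound N′ e′ g (2 * g) x⟨ j ⟩ h⟨ j ⟩ x≼x₀ x+x²≼𝟙 (3p≼1/10000 N′ large) (≤-trans (≤ᵇ-true⁻ {4} {30000} refl) large) n
        (*-cancelˡ-< 7 1 n (<-≤-trans (s≤s 7≤g) g<7n)))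

negligible-untypical : ∀ N′ e′ → 30000 ≤ suc N′ → threshold-for 7 e′ 3 ≤ suc N′ →
  Negligible (λ g → total (suc g) (2 * g) (long g (Untypical.Φ N′ g (2 * g) (_/ suc e′) x⟨ suc N′ ⟩ h⟨ suc N′ ⟩)))
negligible-untypical N′ e′ large large′ = record { j = j ; C = _ ; g₀ = 0 ; bounded = λ g _ →
  long-total N′ 6 e′ 3 j g (2 * g) _ {C = ι 2 ⊗ (ι (suc N′) ⊗ ι (suc N′))} ≤-refl (≼-trans (≈⇒≼ (frac-⊗ 5 3 4 4)) (frac-≼ (≤ᵇ-true⁻ refl))) large′
    (λ n _ → Untypical.total-bound N′ g (2 * g) (_/ suc e′) x⟨ j ⟩ h⟨ j ⟩ x≼x₀ x+x²≼𝟙 (3p≼1/10000 N′ large) n) }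
  where
  j : ℕ
  j = suc N′
  open Weights j

negligible-frequent-letter : ∀ second c d′ (τ : Tilt second c (suc d′)) N′ → Tilt.N₀ τ ≤ suc N′ → 2 * suc (suc (Weights.gap (Tilt.j τ))) ≤ suc N′ →
  Negligible (λ g → total (suc g) (2 * g) (FrequentLetter.Φ second c d′ τ N′ g (2 * g)))
negligible-frequent-letter second c d′ τ N′ large large′ = record { j = suc j ; C = _ ; g₀ = 0 ; bounded = λ g _ → ≼-trans
  (total≼ N′ g (2 * g) _ (X ^^ suc d′ ⊗ Y⟨ suc j ⟩ ^^ g) (λ n n≤g → each g n n≤g)) (≈⇒≼ (≈-sym (⊗-assoc _ _ _))) }
  where
  open Tilt τ
  open ≼-Reasoning
  u : ℚ₊
  u = 1+1/ N′
  each : ∀ g n → n ≤ g → u ^^ g ⊗ sumL (vecs (upTo (2 * g)) n) (FrequentLetter.Φ second c d′ τ N′ g (2 * g) n) ≼ X ^^ suc d′ ⊗ Y⟨ suc j ⟩ ^^ g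
  each g n n≤g = begin
    u ^^ g ⊗ sumL (vecs (upTo (2 * g)) n) (FrequentLetter.Φ second c d′ τ N′ g (2 * g) n)
      ≤⟨ ⊗-monoʳ _ (≼-trans (FrequentLetter.total-bound second c d′ τ N′ g (2 * g) large n) (⊗-monoʳ _ (⊗-monoʳ _ (^^-monoʳ (𝟙≼1+1/ N′) n≤g)))) ⟩
    u ^^ g ⊗ (X ^^ suc d′ ⊗ (Y⟨ j ⟩ ^^ g ⊗ u ^^ g))
      ≈⟨ e _ _ _ ⟩
    X ^^ suc d′ ⊗ ((u ^^ g ⊗ u ^^ g) ⊗ Y⟨ j ⟩ ^^ g)
      ≈⟨ ⊗-cong ≈-refl (≈-trans (⊗-cong (≈-sym (^^-⊗ u u g)) ≈-refl) (≈-sym (^^-⊗ (u ⊗ u) Y⟨ j ⟩ g))) ⟩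
    X ^^ suc d′ ⊗ ((u ⊗ u) ⊗ Y⟨ j ⟩) ^^ g
      ≤⟨ ⊗-monoʳ _ (^^-mono g (≼-trans (⊗-monoˡ _ (≼-trans (⊗-monoʳ u (proj₂ (⊗-identityʳ u))) (power≼1+1/ N′ 2 (Weights.gap j) large′))) (Weights.Y-step j))) ⟩
    X ^^ suc d′ ⊗ Y⟨ suc j ⟩ ^^ g ∎
    where
    e : ∀ a b c → a ⊗ (b ⊗ (c ⊗ a)) ≈ b ⊗ ((a ⊗ a) ⊗ c)
    e = solve 3 (λ a b c → a :* (b :* (c :* a)) := b :* ((a :* a) :* c)) ≈-refl
      where open ℚ₊-Solver

-- From letter frequencies to the two events

lt√5-difference : ∀ A B M → (∀ k → A ≡ B + k → k * k < 5 * (M * M)) → lt√5 (ℤ.+ A ℤ.- ℤ.+ B) M ≡ true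
lt√5-difference A B M small with B ≤? A
... | yes B≤A = trans (cong (λ z → lt√5 z M) (trans (ℤₚ.m-n≡m⊖n A B) (ℤₚ.⊖-≥ B≤A))) (<ᵇ-true (small (A ∸ B) (sym (m+[n∸m]≡n B≤A))))
... | no B≰A = trans (cong (λ z → lt√5 z M) (trans (ℤₚ.m-n≡m⊖n A B) (ℤₚ.⊖-< (≰⇒> B≰A)))) (negative (B ∸ A) (m<n⇒0<n∸m (≰⇒> B≰A)))
  where
  negative : ∀ k → 0 < k → lt√5 (ℤ.- (ℤ.+ k)) M ≡ true
  negative (suc k) _ = refl

gt√5-difference : ∀ A B M k → A ≡ B + k → 5 * (M * M) < k * k → gt√5 (ℤ.+ A ℤ.- ℤ.+ B) M ≡ true
gt√5-difference A B M k eq large = trans (cong (λ z → gt√5 z M) (trans (ℤₚ.m-n≡m⊖n A B) (trans (ℤₚ.⊖-≥ (≤-trans (m≤m+n B k) (≤-reflexive (sym eq))))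
  (cong ℤ.+_ (trans (cong (_∸ B) eq) (m+n∸m≡n B k)))))) (<ᵇ-true large)

below-√5 : ∀ k d q g v → k * d < 5 * q * v * g → 5 * (v * v) ≤ d * d → k * k < 5 * ((q * g) * (q * g))
below-√5 k d q g v kd< v≤ = *-cancelʳ-< (d * d) _ _ (begin-strict
  k * k * (d * d)                              ≡⟨ solve 2 (λ k d → k :* k :* (d :* d) := (k :* d) :* (k :* d)) refl k d ⟩
  k * d * (k * d)                              <⟨ *-mono-< kd< kd< ⟩
  5 * q * v * g * (5 * q * v * g)              ≡⟨ solve 3 (λ q v g → con 5 :* q :* v :* g :* (con 5 :* q :* v :* g) := con 5 :* ((q :* g) :* (q :* g)) :* (con 5 :* (v :* v))) refl q v g ⟩
  5 * ((q * g) * (q * g)) * (5 * (v * v))      ≤⟨ *-monoʳ-≤ (5 * ((q * g) * (q * g))) v≤ ⟩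
  5 * ((q * g) * (q * g)) * (d * d)            ∎)
  where
  open ≤-Reasoning
  open +-*-Solver

above-√5 : ∀ k d q g z → 5 * q * z * g < k * d → d * d ≤ 5 * (z * z) → 5 * ((q * g) * (q * g)) < k * k
above-√5 k d q g z <kd d≤ = *-cancelʳ-< (d * d) _ _ (begin-strict
  5 * ((q * g) * (q * g)) * (d * d)            ≤⟨ *-monoʳ-≤ (5 * ((q * g) * (q * g))) d≤ ⟩
  5 * ((q * g) * (q * g)) * (5 * (z * z))      ≡⟨ solve 3 (λ q v g → con 5 :* q :* v :* g :* (con 5 :* q :* v :* g) := con 5 :* ((q :* g) :* (q :* g)) :* (con 5 :* (v :* v))) refl q z g ⟨
  5 * q * z * g * (5 * q * z * g)              <⟨ *-mono-< <kd <kd ⟩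
  k * d * (k * d)                              ≡⟨ solve 2 (λ k d → k :* k :* (d :* d) := (k :* d) :* (k :* d)) refl k d ⟨
  k * k * (d * d)                              ∎)
  where
  open ≤-Reasoning
  open +-*-Solver

-- From the frequencies of the letters to the events; d = 2w + z.
module Events (p q d v w z g r e t n₁ n₂ : ℕ) (pd>3q : 3 * q < p * d) (g>6d : 6 * d < g)
  (d≡ : d ≡ 2 * w + z) (5v²≤d² : 5 * (v * v) ≤ d * d) (d²≤5z² : d * d ≤ 5 * (z * z))
  (n₁< : n₁ * d < suc v * g) (n₂< : n₂ * d < suc w * g) (8dr≤g : 8 * d * r ≤ g) (g≤ : g ≤ (n₁ + 2 * n₂) + 6 * r)
  (n₁≤e : n₁ ≤ e) (e≤ : e ≤ n₁ + (4 * r + 3)) (t≤ : t ≤ n₂ + (4 * r + 1)) (n₂≤ : n₂ ≤ 2 * r + t) where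

  open ≤-Reasoning
  open +-*-Solver

  private
    g>0 : 0 < g
    g>0 = ≤-<-trans z≤n g>6d

    qg<pdg : 3 * q * g < p * d * g
    qg<pdg = *-monoˡ-< g {{>-nonZero g>0}} pd>3q

    de≤ : d * e ≤ (2 + v) * g
    de≤ = *-cancelˡ-≤ 2 (begin
      2 * (d * e)                              ≤⟨ *-monoʳ-≤ 2 (*-monoʳ-≤ d e≤) ⟩
      2 * (d * (n₁ + (4 * r + 3)))             ≡⟨ solve 3 (λ d n r → con 2 :* (d :* (n :+ (con 4 :* r :+ con 3))) := con 2 :* (n :* d) :+ (con 8 :* d :* r :+ con 6 :* d)) refl d n₁ r ⟩
      2 * (n₁ * d) + (8 * d * r + 6 * d)       ≤⟨ +-mono-≤ (*-monoʳ-≤ 2 (<⇒≤ n₁<)) (+-mono-≤ 8dr≤g (<⇒≤ g>6d)) ⟩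
      2 * (suc v * g) + (g + g)                ≡⟨ solve 2 (λ v g → con 2 :* ((con 1 :+ v) :* g) :+ (g :+ g) := con 2 :* ((con 2 :+ v) :* g)) refl v g ⟩
      2 * ((2 + v) * g)                        ∎)

    dt≤ : d * t ≤ (2 + w) * g
    dt≤ = *-cancelˡ-≤ 2 (begin
      2 * (d * t)                              ≤⟨ *-monoʳ-≤ 2 (*-monoʳ-≤ d t≤) ⟩
      2 * (d * (n₂ + (4 * r + 1)))             ≡⟨ solve 3 (λ d n r → con 2 :* (d :* (n :+ (con 4 :* r :+ con 1))) := con 2 :* (n :* d) :+ (con 8 :* d :* r :+ con 2 :* d)) refl d n₂ r ⟩
      2 * (n₂ * d) + (8 * d * r + 2 * d)       ≤⟨ +-mono-≤ (*-monoʳ-≤ 2 (<⇒≤ n₂<)) (+-mono-≤ 8dr≤g (≤-trans (*-monoˡ-≤ d {2} {6} (s≤s (s≤s z≤n))) (<⇒≤ g>6d))) ⟩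
      2 * (suc w * g) + (g + g)                ≡⟨ solve 2 (λ v g → con 2 :* ((con 1 :+ v) :* g) :+ (g :+ g) := con 2 :* ((con 2 :+ v) :* g)) refl w g ⟩
      2 * ((2 + w) * g)                        ∎)

    -- Few twos force many ones: `g` is almost `n₁ + 2 n₂`, so the upper bound on `n₂` turns into a
    -- lower bound on `e`.
    zg≤ : z * g ≤ d * e + 3 * g
    zg≤ = +-cancelˡ-≤ (2 * w * g) _ _ (begin
      2 * w * g + z * g                        ≡⟨ *-distribʳ-+ g (2 * w) z ⟨
      (2 * w + z) * g                          ≡⟨ cong (_* g) d≡ ⟨
      d * g                                    ≤⟨ *-monoʳ-≤ d g≤ ⟩
      d * ((n₁ + 2 * n₂) + 6 * r)              ≡⟨ solve 4 (λ d a b r → d :* ((a :+ con 2 :* b) :+ con 6 :* r) := d :* a :+ con 2 :* (b :* d) :+ con 6 :* d :* r) refl d n₁ n₂ r ⟩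
      d * n₁ + 2 * (n₂ * d) + 6 * d * r        ≤⟨ +-mono-≤ (+-mono-≤ (*-monoʳ-≤ d n₁≤e) (*-monoʳ-≤ 2 (<⇒≤ n₂<))) (≤-trans (*-monoˡ-≤ r (*-monoˡ-≤ d {6} {8} (≤ᵇ-true⁻ refl))) 8dr≤g) ⟩
      d * e + 2 * (suc w * g) + g              ≡⟨ solve 3 (λ X w g → X :+ con 2 :* ((con 1 :+ w) :* g) :+ g := con 2 :* w :* g :+ (X :+ con 3 :* g)) refl (d * e) w g ⟩
      2 * w * g + (d * e + 3 * g)              ∎)

    -- Dually, the upper bound on the number of ones turns into a lower bound on `t`.
    dg≤ : d * g ≤ 2 * (d * t) + (3 + v) * g
    dg≤ = begin
      d * g                                              ≤⟨ *-monoʳ-≤ d (≤-trans g≤ (+-monoˡ-≤ (6 * r) (+-monoʳ-≤ n₁ (*-monoʳ-≤ 2 n₂≤)))) ⟩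
      d * ((n₁ + 2 * (2 * r + t)) + 6 * r)               ≡⟨ solve 4 (λ d a r t → d :* ((a :+ con 2 :* (con 2 :* r :+ t)) :+ con 6 :* r) := con 2 :* (d :* t) :+ (a :* d :+ con 10 :* d :* r)) refl d n₁ r t ⟩
      2 * (d * t) + (n₁ * d + 10 * d * r)                ≤⟨ +-monoʳ-≤ (2 * (d * t)) (+-mono-≤ (<⇒≤ n₁<) (≤-trans (*-monoˡ-≤ r (*-monoˡ-≤ d {10} {16} (≤ᵇ-true⁻ refl)))
                                                              (≤-trans (≤-reflexive (solve 2 (λ d r → con 16 :* d :* r := con 2 :* (con 8 :* d :* r)) refl d r)) (*-monoʳ-≤ 2 8dr≤g)))) ⟩
      2 * (d * t) + (suc v * g + 2 * g)                  ≡⟨ cong (2 * (d * t) +_) (sym (*-distribʳ-+ g (suc v) 2)) ⟩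
      2 * (d * t) + (suc v + 2) * g                      ≡⟨ cong (λ z → 2 * (d * t) + z * g) (+-comm (suc v) 2) ⟩
      2 * (d * t) + (3 + v) * g                          ∎

  edim-band : band√5 (ℤ.+ (5 * q * e) ℤ.- ℤ.+ (5 * p * g)) (ℤ.+ (5 * q * e) ℤ.+ ℤ.+ (5 * p * g)) (q * g) ≡ true
  edim-band = ∧-true (lt√5-difference (5 * q * e) (5 * p * g) (q * g) (λ k eq → below-√5 k d q g v (upper k eq) 5v²≤d²))
    (<ᵇ-true (above-√5 (5 * q * e + 5 * p * g) d q g z lower d²≤5z²))
    where
    upper : ∀ k → 5 * q * e ≡ 5 * p * g + k → k * d < 5 * q * v * g
    upper k eq = +-cancelˡ-< (5 * (p * d * g)) _ _ (begin-strict
      5 * (p * d * g) + k * d              ≡⟨ solve 4 (λ p d g k → con 5 :* (p :* d :* g) :+ k :* d := (con 5 :* p :* g :+ k) :* d) refl p d g k ⟩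
      (5 * p * g + k) * d                  ≡⟨ cong (_* d) eq ⟨
      5 * q * e * d                        ≡⟨ solve 3 (λ q e d → con 5 :* q :* e :* d := con 5 :* q :* (d :* e)) refl q e d ⟩
      5 * q * (d * e)                      ≤⟨ *-monoʳ-≤ (5 * q) de≤ ⟩
      5 * q * ((2 + v) * g)                ≤⟨ m≤m+n _ (5 * (q * g)) ⟩
      5 * q * ((2 + v) * g) + 5 * (q * g)  ≡⟨ solve 3 (λ q v g → con 5 :* q :* ((con 2 :+ v) :* g) :+ con 5 :* (q :* g) := con 5 :* (con 3 :* q :* g) :+ con 5 :* q :* v :* g) refl q v g ⟩
      5 * (3 * q * g) + 5 * q * v * g      <⟨ +-monoˡ-< (5 * q * v * g) (*-monoʳ-< 5 qg<pdg) ⟩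
      5 * (p * d * g) + 5 * q * v * g      ∎)
    lower : 5 * q * z * g < (5 * q * e + 5 * p * g) * d
    lower = begin-strict
      5 * q * z * g                        ≡⟨ *-assoc (5 * q) z g ⟩
      5 * q * (z * g)                      ≤⟨ *-monoʳ-≤ (5 * q) zg≤ ⟩
      5 * q * (d * e + 3 * g)              ≡⟨ solve 3 (λ q X g → con 5 :* q :* (X :+ con 3 :* g) := con 5 :* q :* X :+ con 5 :* (con 3 :* q :* g)) refl q (d * e) g ⟩
      5 * q * (d * e) + 5 * (3 * q * g)    <⟨ +-monoʳ-< (5 * q * (d * e)) (*-monoʳ-< 5 qg<pdg) ⟩
      5 * q * (d * e) + 5 * (p * d * g)    ≡⟨ solve 5 (λ p q e d g → con 5 :* q :* (d :* e) :+ con 5 :* (p :* d :* g) := (con 5 :* q :* e :+ con 5 :* p :* g) :* d) refl p q e d g ⟩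
      (5 * q * e + 5 * p * g) * d          ∎

  type-band : band√5 (ℤ.+ (5 * q * g) ℤ.- ℤ.+ (10 * q * t) ℤ.- ℤ.+ (10 * p * g)) (ℤ.+ (5 * q * g) ℤ.- ℤ.+ (10 * q * t) ℤ.+ ℤ.+ (10 * p * g)) (q * g) ≡ true
  type-band = ∧-true
    (trans (cong (λ i → lt√5 i (q * g)) (subtract (5 * q * g) (10 * q * t) (10 * p * g)))
      (lt√5-difference (5 * q * g) (10 * q * t + 10 * p * g) (q * g) (λ k eq → below-√5 k d q g v (upper k eq) 5v²≤d²)))
    (trans (cong (λ i → gt√5 i (q * g)) (add (5 * q * g) (10 * q * t) (10 * p * g)))
      (gt√5-difference (5 * q * g + 10 * p * g) (10 * q * t) (q * g) k₀ k₀≡ (above-√5 k₀ d q g z lower d²≤5z²)))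
    where
    subtract : ∀ A B C → ℤ.+ A ℤ.- ℤ.+ B ℤ.- ℤ.+ C ≡ ℤ.+ A ℤ.- ℤ.+ (B + C)
    subtract A B C = trans (ℤₚ.+-assoc (ℤ.+ A) (ℤ.- (ℤ.+ B)) (ℤ.- (ℤ.+ C))) (cong (λ y → (ℤ.+ A) ℤ.+ y) (sym (ℤₚ.neg-distrib-+ (ℤ.+ B) (ℤ.+ C))))
    add : ∀ A B C → ℤ.+ A ℤ.- ℤ.+ B ℤ.+ ℤ.+ C ≡ ℤ.+ (A + C) ℤ.- ℤ.+ B
    add A B C = trans (ℤₚ.+-assoc (ℤ.+ A) (ℤ.- (ℤ.+ B)) (ℤ.+ C)) (trans (cong (λ y → (ℤ.+ A) ℤ.+ y) (ℤₚ.+-comm (ℤ.- (ℤ.+ B)) (ℤ.+ C)))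
      (sym (ℤₚ.+-assoc (ℤ.+ A) (ℤ.+ C) (ℤ.- (ℤ.+ B)))))
    upper : ∀ k → 5 * q * g ≡ 10 * q * t + 10 * p * g + k → k * d < 5 * q * v * g
    upper k eq = +-cancelˡ-< (10 * q * (d * t) + 10 * (p * d * g)) _ _ (begin-strict
      10 * q * (d * t) + 10 * (p * d * g) + k * d       ≡⟨ solve 6 (λ p q t d g k → con 10 :* q :* (d :* t) :+ con 10 :* (p :* d :* g) :+ k :* d := (con 10 :* q :* t :+ con 10 :* p :* g :+ k) :* d) refl p q t d g k ⟩
      (10 * q * t + 10 * p * g + k) * d                 ≡⟨ cong (_* d) eq ⟨
      5 * q * g * d                                     ≡⟨ solve 3 (λ q g d → con 5 :* q :* g :* d := con 5 :* q :* (d :* g)) refl q g d ⟩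
      5 * q * (d * g)                                   ≤⟨ *-monoʳ-≤ (5 * q) dg≤ ⟩
      5 * q * (2 * (d * t) + (3 + v) * g)               ≤⟨ m≤m+n _ (15 * (q * g)) ⟩
      5 * q * (2 * (d * t) + (3 + v) * g) + 15 * (q * g) ≡⟨ solve 4 (λ q X v g → con 5 :* q :* (con 2 :* X :+ (con 3 :+ v) :* g) :+ con 15 :* (q :* g) := con 10 :* q :* X :+ con 10 :* (con 3 :* q :* g) :+ con 5 :* q :* v :* g) refl q (d * t) v g ⟩
      10 * q * (d * t) + 10 * (3 * q * g) + 5 * q * v * g  <⟨ +-monoˡ-< (5 * q * v * g) (+-monoʳ-< (10 * q * (d * t)) (*-monoʳ-< 10 qg<pdg)) ⟩
      10 * q * (d * t) + 10 * (p * d * g) + 5 * q * v * g  ∎)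
    room : 10 * q * t * d + 5 * q * z * g < (5 * q * g + 10 * p * g) * d
    room = begin-strict
      10 * q * t * d + 5 * q * z * g                    ≡⟨ cong (_+ 5 * q * z * g) (solve 3 (λ q t d → con 10 :* q :* t :* d := con 10 :* q :* (d :* t)) refl q t d) ⟩
      10 * q * (d * t) + 5 * q * z * g                  ≤⟨ +-monoˡ-≤ (5 * q * z * g) (*-monoʳ-≤ (10 * q) dt≤) ⟩
      10 * q * ((2 + w) * g) + 5 * q * z * g            ≤⟨ m≤m+n _ (10 * (q * g)) ⟩
      10 * q * ((2 + w) * g) + 5 * q * z * g + 10 * (q * g) ≡⟨ solve 4 (λ q w z g → con 10 :* q :* ((con 2 :+ w) :* g) :+ con 5 :* q :* z :* g :+ con 10 :* (q :* g) := con 5 :* q :* g :* (con 2 :* w :+ z) :+ con 10 :* (con 3 :* q :* g)) refl q w z g ⟩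
      5 * q * g * (2 * w + z) + 10 * (3 * q * g)        ≡⟨ cong (λ x → 5 * q * g * x + 10 * (3 * q * g)) d≡ ⟨
      5 * q * g * d + 10 * (3 * q * g)                  <⟨ +-monoʳ-< (5 * q * g * d) (*-monoʳ-< 10 qg<pdg) ⟩
      5 * q * g * d + 10 * (p * d * g)                  ≡⟨ solve 4 (λ p q d g → con 5 :* q :* g :* d :+ con 10 :* (p :* d :* g) := (con 5 :* q :* g :+ con 10 :* p :* g) :* d) refl p q d g ⟩
      (5 * q * g + 10 * p * g) * d                      ∎
    B≤ : 10 * q * t ≤ 5 * q * g + 10 * p * g
    B≤ = <⇒≤ (*-cancelʳ-< d _ _ (≤-<-trans (m≤m+n (10 * q * t * d) _) room))
    k₀ : ℕ
    k₀ = (5 * q * g + 10 * p * g) ∸ 10 * q * t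
    k₀≡ : 5 * q * g + 10 * p * g ≡ 10 * q * t + k₀
    k₀≡ = sym (m+[n∸m]≡n B≤)
    lower : 5 * q * z * g < k₀ * d
    lower = +-cancelˡ-< (10 * q * t * d) _ _ (<-≤-trans room (≤-reflexive (trans (cong (_* d) k₀≡) (*-distribʳ-+ d (10 * q * t) k₀))))

-- v and w are the largest integers with v / d ≤ 1/√5 and w / d ≤ (5 - √5) / 10.
record Frequencies (d : ℕ) : Set where
  field
    v w z : ℕ
    d²<5c₁² : d * d + 1 ≤ 5 * (suc v * suc v)
    c₁≤d    : suc v ≤ d
    5v²≤d²  : 5 * (v * v) ≤ d * d
    c₂-quad : d * d + 5 * (suc w * suc w) + 1 ≤ 5 * (d * suc w)
    5c₂≤2d  : 5 * suc w ≤ 2 * d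
    d≡      : d ≡ 2 * w + z
    d²≤5z²  : d * d ≤ 5 * (z * z)

below-least : ∀ L (P : ℕ → Bool) {n} → P L ≡ true → (∀ i → i < n → P i ≡ false) → n ≤ L
below-least L P PL lt = ≮⇒≥ (λ L<n → true≢false (trans (sym PL) (lt L L<n)))

-- The test `above₂` holds for `c / d` strictly between (5 - √5)/10 and (5 + √5)/10, with a margin.
-- Taking `d` divisible by 3 provides the witness `d₀ / d = 1/3` in that range, so the least
-- solution is near the lower end.
module FindFrequencies (d d₀ : ℕ) (d≡3d₀ : d ≡ 3 * d₀) (d₀>0 : 0 < d₀) where
  private
    open ≤-Reasoning
    open +-*-Solver

    above₁ above₂ : ℕ → Bool
    above₁ c = d * d + 1 ≤ᵇ 5 * (c * c)
    above₂ c = d * d + 5 * (c * c) + 1 ≤ᵇ 5 * (d * c)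

    d>0 : 0 < d
    d>0 = ≤-trans d₀>0 (≤-trans (m≤m+n d₀ _) (≤-reflexive (sym d≡3d₀)))

    d-above₁ : d * d + 1 ≤ 5 * (d * d)
    d-above₁ = +-monoʳ-≤ (d * d) (≤-trans (*-mono-< {0} d>0 d>0) (m≤m+n (d * d) (3 * (d * d))))

    d₀-above₂ : d * d + 5 * (d₀ * d₀) + 1 ≤ 5 * (d * d₀)
    d₀-above₂ = begin
      d * d + 5 * (d₀ * d₀) + 1                      ≤⟨ +-monoʳ-≤ (d * d + 5 * (d₀ * d₀)) (*-mono-< {0} d₀>0 d₀>0) ⟩
      d * d + 5 * (d₀ * d₀) + d₀ * d₀                ≡⟨ cong (λ z → z * z + 5 * (d₀ * d₀) + d₀ * d₀) d≡3d₀ ⟩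
      (3 * d₀) * (3 * d₀) + 5 * (d₀ * d₀) + d₀ * d₀  ≡⟨ solve 1 (λ x → (con 3 :* x) :* (con 3 :* x) :+ con 5 :* (x :* x) :+ x :* x := con 5 :* ((con 3 :* x) :* x)) refl d₀ ⟩
      5 * ((3 * d₀) * d₀)                            ≡⟨ cong (λ z → 5 * (z * d₀)) d≡3d₀ ⟨
      5 * (d * d₀)                                   ∎

    expand : ∀ d w z → d ≡ 2 * w + z → d * d + 4 * (d * d + 5 * (w * w)) ≡ 5 * (z * z) + 20 * (d * w)
    expand .(2 * w + z) w z refl = solve 2 (λ w z → let d = con 2 :* w :+ z in d :* d :+ con 4 :* (d :* d :+ con 5 :* (w :* w)) := con 5 :* (z :* z) :+ con 20 :* (d :* w)) refl w z

    Find₁ Find₂ : Set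
    Find₁ = ∃[ v ] (d * d + 1 ≤ 5 * (suc v * suc v) × suc v ≤ d × 5 * (v * v) ≤ d * d)
    Find₂ = ∃[ w ] (d * d + 5 * (suc w * suc w) + 1 ≤ 5 * (d * suc w) × suc w ≤ d₀ × 5 * (d * w) ≤ d * d + 5 * (w * w))

    drop-1 : ∀ {a b} → a < b + 1 → a ≤ b
    drop-1 {a} {b} p = s≤s⁻¹ (≤-trans p (≤-reflexive (+-comm b 1)))

    zero₁ : above₁ 0 ≢ true
    zero₁ a = <⇒≱ (m≤n+m 1 (d * d)) (≤ᵇ-true⁻ {d * d + 1} {0} a)

    zero₂ : above₂ 0 ≢ true
    zero₂ a = <⇒≱ (m≤n+m 1 (d * d + 5 * (0 * 0))) (≤-trans (≤ᵇ-true⁻ {d * d + 5 * (0 * 0) + 1} {5 * (d * 0)} a) (≤-reflexive (cong (5 *_) (*-zeroʳ d))))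

    find₁ : ∃[ c ] (above₁ c ≡ true × (∀ i → i < c → above₁ i ≡ false)) → Find₁
    find₁ (zero , a , _) = ⊥-elim (zero₁ a)
    find₁ (suc v , a , lt) = v , ≤ᵇ-true⁻ {d * d + 1} a , below-least d above₁ (≤ᵇ-true d-above₁) lt , drop-1 (≤ᵇ-false⁻ {d * d + 1} {5 * (v * v)} (lt v ≤-refl))

    find₂ : ∃[ c ] (above₂ c ≡ true × (∀ i → i < c → above₂ i ≡ false)) → Find₂
    find₂ (zero , a , _) = ⊥-elim (zero₂ a)
    find₂ (suc w , a , lt) = w , ≤ᵇ-true⁻ {d * d + 5 * (suc w * suc w) + 1} {5 * (d * suc w)} a , below-least d₀ above₂ (≤ᵇ-true d₀-above₂) lt
      , drop-1 {5 * (d * w)} {d * d + 5 * (w * w)} (≤ᵇ-false⁻ {d * d + 5 * (w * w) + 1} {5 * (d * w)} (lt w ≤-refl))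

    lemma₂₀ : ∀ X → 20 * X ≡ 4 * (5 * X)
    lemma₂₀ = solve 1 (λ X → con 20 :* X := con 4 :* (con 5 :* X)) refl

  frequencies : Frequencies d
  frequencies = build (find₁ (least d above₁ (≤ᵇ-true d-above₁))) (find₂ (least d₀ above₂ (≤ᵇ-true d₀-above₂)))
    where
    build : Find₁ → Find₂ → Frequencies d
    build (v , d²< , c₁≤d , 5v²≤) (w , quad , c₂≤d₀ , w-fails) = record
      { v = v ; w = w ; z = d ∸ 2 * w ; d²<5c₁² = d²< ; c₁≤d = c₁≤d ; 5v²≤d² = 5v²≤ ; c₂-quad = quad
      ; 5c₂≤2d = ≤-trans (*-monoʳ-≤ 5 c₂≤d₀) (≤-trans (*-monoˡ-≤ d₀ {5} {6} (≤ᵇ-true⁻ refl)) (≤-reflexive (trans (*-assoc 2 3 d₀) (cong (2 *_) (sym d≡3d₀)))))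
      ; d≡ = sym (m+[n∸m]≡n 2w≤d)
      -- Failure of the test at `w` gives `5dw ≤ d² + 5w²`; with `d = 2w + z` this becomes
      -- `d² ≤ 5z²`, that is, `z / d` is at least 1/√5.
      ; d²≤5z² = +-cancelʳ-≤ (20 * (d * w)) _ _ (begin
          d * d + 20 * (d * w)                        ≡⟨ cong (d * d +_) (lemma₂₀ (d * w)) ⟩
          d * d + 4 * (5 * (d * w))                   ≤⟨ +-monoʳ-≤ (d * d) (*-monoʳ-≤ 4 w-fails) ⟩
          d * d + 4 * (d * d + 5 * (w * w))           ≡⟨ expand d w (d ∸ 2 * w) (sym (m+[n∸m]≡n 2w≤d)) ⟩
          5 * ((d ∸ 2 * w) * (d ∸ 2 * w)) + 20 * (d * w) ∎) }
      where
      2w≤d : 2 * w ≤ d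
      2w≤d = ≤-trans (*-mono-≤ {2} {3} (≤ᵇ-true⁻ refl) (≤-trans (n≤1+n w) c₂≤d₀)) (≤-reflexive (sym d≡3d₀))

-- From negligible exceptions to probability one

countWhere-split : {A : Set} (xs : List A) (S E : A → Bool) →
  countWhere xs S ≡ countWhere xs (λ v → S v ∧ E v) + countWhere xs (λ v → S v ∧ not (E v))
countWhere-split []       S E = refl
countWhere-split (x ∷ xs) S E = trans (cong₂ _+_ (countWhere-split xs S E) (split (S x) (E x))) (+-interchange (countWhere xs (λ v → S v ∧ E v)) (countWhere xs (λ v → S v ∧ not (E v))) (bit (S x ∧ E x)) (bit (S x ∧ not (E x))))
  where
  split : ∀ a b → bit a ≡ bit (a ∧ b) + bit (a ∧ not b)
  split false b     = refl
  split true  true  = refl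
  split true  false = refl

exceptions : ((g : ℕ) → Vec Bool (window g) → Bool) → ℕ → ℕ
exceptions E g = countWhere (allVecs (window g)) (λ v → inSg g v ∧ not (E g v))

-- |𝒮_g| grows at least like Y⟨ j + 1 ⟩ ^ g, faster than any multiple of Y⟨ j ⟩ ^ g.
negligible⇒tendsToOne : ∀ E f g₁ → Negligible f → (∀ g → g₁ ≤ g → ι (exceptions E g) ≼ f g) → ProbTendsToOne E
negligible⇒tendsToOne E f g₁ neg few a b a>0 b>0 = 2 + (g₀ + g₁ + suc gap * k) , conclude
  where
  open Negligible neg
  open Weights j using (gap; Y-step; 𝟙≼Y)
  m k : ℕ
  m = proj₁ (archimedean C)
  k = 8 * (b * m)
  conclude : ∀ g → 2 + (g₀ + g₁ + suc gap * k) ≤ g → b * cardSg g < b * cardEvent E g + a * cardSg g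
  conclude (suc (suc g′)) (s≤s (s≤s large)) = begin-strict
    b * cardSg g                                  ≡⟨ cong (b *_) (countWhere-split (allVecs (window g)) (inSg g) (E g)) ⟩
    b * (cardEvent E g + exceptions E g)          ≡⟨ *-distribˡ-+ b (cardEvent E g) (exceptions E g) ⟩
    b * cardEvent E g + b * exceptions E g        <⟨ +-monoʳ-< (b * cardEvent E g) (<-≤-trans rare (m≤n*m (cardSg g) a {{>-nonZero a>0}})) ⟩
    b * cardEvent E g + a * cardSg g              ∎
    where
    open ≤-Reasoning
    g : ℕ
    g = suc (suc g′)
    up : ∀ {x} → x ≤ g₀ + g₁ + suc gap * k → x ≤ g
    up p = ≤-trans p (≤-trans large (≤-trans (n≤1+n g′) (n≤1+n _)))
    Y Z : ℚ₊
    Y = Y⟨ j ⟩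
    Z = Y⟨ suc j ⟩
    -- The 8 is 2 * 2 * 2: the growth bound has a factor 2 and exponent `g - 2`, and each of the two
    -- missing factors `Z` is at most 2.
    Z^g≼ : Z ^^ g ≼ ι (8 * cardSg g)
    Z^g≼ = ≼-trans (proj₂ (⊗-assoc Z Z _)) (≼-trans (⊗-mono (⊗-mono (Weights.Y≼2 (suc j)) (Weights.Y≼2 (suc j)))
        (cardSg-growth Z (Weights.Y≼2 (suc j)) (Weights.Y²≼Y+1 (suc j)) g′))
      (≈⇒≼ (≈-trans (≈-sym (⊗-assoc _ _ _)) (≈-trans (⊗-cong (≈-trans (⊗-cong (≈-sym (ι-⊗ 2 2)) ≈-refl) (≈-sym (ι-⊗ 4 2))) ≈-refl) (≈-sym (ι-⊗ 8 (cardSg g)))))))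
    k≼ : ι k ⊕ 𝟙 ≼ 1+1/ gap ^^ g
    k≼ = R.begin
      ι k ⊕ 𝟙                               R.≈⟨ ⊕-comm _ _ ⟩
      𝟙 ⊕ ι k                               R.≈⟨ ⊕-cong ≈-refl (≈-trans (≈-sym (⊗-identityʳ _)) (≈-trans (⊗-cong ≈-refl (≈-sym (frac-ι 1 gap))) (≈-trans (≈-sym (⊗-assoc _ _ _)) (⊗-cong (≈-trans (≈-sym (ι-⊗ k (suc gap))) (≈-reflexive (cong ι (*-comm k (suc gap))))) ≈-refl)))) ⟩
      𝟙 ⊕ ι (suc gap * k) ⊗ frac 1 gap      R.≤⟨ ⊕-monoʳ 𝟙 (⊗-monoˡ _ (ι-mono (up (m≤n+m (suc gap * k) (g₀ + g₁))))) ⟩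
      𝟙 ⊕ ι g ⊗ frac 1 gap                  R.≤⟨ ≼-trans (bernoulli (frac 1 gap) g) (^^-mono g (proj₂ (1+1/≈ gap))) ⟩
      1+1/ gap ^^ g                         R.∎
      where module R = ≼-Reasoning
    scaled : ι (8 * (b * exceptions E g) + 1) ≼ ι (8 * cardSg g)
    scaled = R.begin
      ι (8 * (b * exceptions E g) + 1)      R.≈⟨ ≈-trans (ι-⊕ _ 1) (⊕-cong (≈-trans (≈-reflexive (cong ι (sym (*-assoc 8 b _)))) (ι-⊗ (8 * b) _)) ≈-refl) ⟩
      ι (8 * b) ⊗ ι (exceptions E g) ⊕ 𝟙    R.≤⟨ ⊕-mono (⊗-monoʳ _ (≼-trans (few g (up (≤-trans (m≤n+m g₁ g₀) (m≤m+n _ _))))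
                                                  (≼-trans (bounded g (up (≤-trans (m≤m+n g₀ g₁) (m≤m+n _ _)))) (⊗-monoˡ _ (proj₂ (archimedean C)))))) (𝟙≼^^ g 𝟙≼Y) ⟩
      ι (8 * b) ⊗ (ι m ⊗ Y ^^ g) ⊕ Y ^^ g   R.≈⟨ ⊕-cong (≈-trans (≈-sym (⊗-assoc _ _ _)) (⊗-cong (≈-trans (≈-sym (ι-⊗ (8 * b) m)) (≈-reflexive (cong ι (*-assoc 8 b m)))) ≈-refl)) (≈-sym (⊗-identityˡ _)) ⟩
      ι k ⊗ Y ^^ g ⊕ 𝟙 ⊗ Y ^^ g             R.≈⟨ ⊗-distribʳ-⊕ _ _ _ ⟨
      (ι k ⊕ 𝟙) ⊗ Y ^^ g                    R.≤⟨ ⊗-monoˡ _ k≼ ⟩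
      1+1/ gap ^^ g ⊗ Y ^^ g                R.≈⟨ ^^-⊗ _ _ g ⟨
      (1+1/ gap ⊗ Y) ^^ g                   R.≤⟨ ^^-mono g Y-step ⟩
      Z ^^ g                                R.≤⟨ Z^g≼ ⟩
      ι (8 * cardSg g)                      R.∎
      where module R = ≼-Reasoning
    rare : b * exceptions E g < cardSg g
    rare = *-cancelˡ-< 8 _ _ (≤-trans (≤-reflexive (+-comm 1 _)) (ι-reflect scaled))

kunzWord′ : ∀ L → 0 < L → (v : Vec Bool L) → isNumSg v ≡ true → ∃[ n ] ∃[ w ] KunzWord v n w
kunzWord′ (suc L) _ = kunzWord

-- Every word is either charged to a negligible class or ordinary

module Classification (d′ c₁ c₂ : ℕ) (τ₁ : Tilt false c₁ (suc d′)) (τ₂ : Tilt true c₂ (suc d′)) (N₁ N₂ : ℕ) where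

  -- By these choices `suc e′` is `(N₁ + 1)²`, the density of letters at least 3 that `absorb`
  -- tolerates, and `suc eᵣ` is `8d`, so that an error of order `n / suc eᵣ` is of order `g / d`.
  d e′ eᵣ j₁ j₂ : ℕ
  d  = suc d′
  e′ = N₁ + N₁ * suc N₁
  eᵣ = d′ + 7 * suc d′
  j₁ = suc N₁
  j₂ = suc N₂

  Φ₁ Φ₂ Φ₃ Φ₄ Φ₅ Φ : ℕ → (n : ℕ) → Vec ℕ n → ℚ₊
  Φ₁ g = FewParts.Φ g (2 * g)
  Φ₂ g = long g (ManyThrees.Φ N₂ e′ g (2 * g) x⟨ j₂ ⟩ h⟨ j₂ ⟩)
  Φ₃ g = long g (Untypical.Φ N₁ g (2 * g) (_/ suc eᵣ) x⟨ j₁ ⟩ h⟨ j₁ ⟩)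
  Φ₄ g = FrequentLetter.Φ false c₁ d′ τ₁ N₁ g (2 * g)
  Φ₅ g = FrequentLetter.Φ true c₂ d′ τ₂ N₁ g (2 * g)
  Φ g n w = Φ₁ g n w ⊕ (Φ₂ g n w ⊕ (Φ₃ g n w ⊕ (Φ₄ g n w ⊕ Φ₅ g n w)))

  weight-of-exceptions : ℕ → ℚ₊
  weight-of-exceptions g = total (suc g) (2 * g) (Φ₁ g) ⊕ (total (suc g) (2 * g) (Φ₂ g) ⊕ (total (suc g) (2 * g) (Φ₃ g)
    ⊕ (total (suc g) (2 * g) (Φ₄ g) ⊕ total (suc g) (2 * g) (Φ₅ g))))

  total-Φ : ∀ g → total (suc g) (2 * g) (Φ g) ≈ weight-of-exceptions g
  total-Φ g = ≈-trans (total-⊕ (suc g) (2 * g) (Φ₁ g) _) (⊕-cong ≈-refl (≈-trans (total-⊕ (suc g) (2 * g) (Φ₂ g) _) (⊕-cong ≈-refl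
    (≈-trans (total-⊕ (suc g) (2 * g) (Φ₃ g) _) (⊕-cong ≈-refl (total-⊕ (suc g) (2 * g) (Φ₄ g) (Φ₅ g)))))))

  enough : ℕ
  enough = 4 * (suc e′ * suc (ManyThrees.E N₂ e′ 0 0 𝟙 𝟙))

  record Ordinary (g n : ℕ) (w : Vec ℕ n) : Set where
    field
      typical : Typical w (n / suc eᵣ)
      ones<   : ones w * d < c₁ * g
      twos<   : twos w * d < c₂ * g

  private
    in₂ : ∀ {a b} → 𝟙 ≼ b → 𝟙 ≼ a ⊕ b
    in₂ {a} {b} p = ≼-trans p (≼-⊕ʳ a b)
    in₁ : ∀ {a b} → 𝟙 ≼ a → 𝟙 ≼ a ⊕ b
    in₁ {a} {b} p = ≼-trans p (≼-⊕ˡ a b)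

    long⁺ : ∀ g Ψ {n} (w : Vec ℕ n) → g < 7 * n → 𝟙 ≼ Ψ n w → 𝟙 ≼ long g Ψ n w
    long⁺ g Ψ {n} w g<7n p = ≼-trans p (≼-trans (proj₂ (⊗-identityˡ _)) (⊗-monoˡ _ (≈⇒≼ (≈-reflexive (cong ind (sym (<ᵇ-true g<7n)))))))

  module Classify (e≤N₂ : 4 * suc e′ ≤ suc N₂) (g : ℕ) {n : ℕ} (w : Vec ℕ n) (ineq : KunzInequalities w) (sum≡g : sumTo n (kw w) ≡ g)
    (small : ∀ i → i < n → at 0 w i * suc n < 2 * g) (large : 7 * enough ≤ g) where

    Weighed : Set
    Weighed = 𝟙 ≼ Φ g n w

    weighed₁ : 𝟙 ≼ Φ₁ g n w → Weighed
    weighed₁ = in₁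
    weighed₂ : 𝟙 ≼ Φ₂ g n w → Weighed
    weighed₂ r = in₂ {Φ₁ g n w} (in₁ r)
    weighed₃ : 𝟙 ≼ Φ₃ g n w → Weighed
    weighed₃ r = in₂ {Φ₁ g n w} (in₂ {Φ₂ g n w} (in₁ r))
    weighed₄ : 𝟙 ≼ Φ₄ g n w → Weighed
    weighed₄ r = in₂ {Φ₁ g n w} (in₂ {Φ₂ g n w} (in₂ {Φ₃ g n w} (in₁ r)))
    weighed₅ : 𝟙 ≼ Φ₅ g n w → Weighed
    weighed₅ r = in₂ {Φ₁ g n w} (in₂ {Φ₂ g n w} (in₂ {Φ₃ g n w} (in₂ {Φ₄ g n w} r)))

    threes : ℕ
    threes = countUpTo n (λ i → 3 ≤ᵇ kw w i)

    by-frequency : suc e′ * threes ≤ n → Typical w (n / suc eᵣ) → Dec (c₁ * g ≤ ones w * d) → Dec (c₂ * g ≤ twos w * d) → Weighed ⊎ Ordinary g n w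
    by-frequency few typ (yes f) _       = inj₁ (weighed₄ (FrequentLetter.frequent⇒𝟙≼Φ false c₁ d′ τ₁ N₁ g (2 * g) w sum≡g few f))
    by-frequency few typ (no _)  (yes f) = inj₁ (weighed₅ (FrequentLetter.frequent⇒𝟙≼Φ true c₂ d′ τ₂ N₁ g (2 * g) w sum≡g few f))
    by-frequency few typ (no a)  (no b)  = inj₂ (record { typical = typ ; ones< = ≰⇒> a ; twos< = ≰⇒> b })

    module _ (g<7n : g < 7 * n) where

      n>0 : 0 < n
      n>0 = ≰⇒> (λ n≤0 → <⇒≱ g<7n (≤-trans (*-monoʳ-≤ 7 n≤0) z≤n))

      5r<n : ∀ r → r * suc eᵣ ≤ n → 5 * r < n
      5r<n zero    _ = n>0
      5r<n (suc r) p = ≤-trans (≤-trans (s≤s (m≤m+n (5 * suc r) (2 + r * 3))) (≤-trans (≤-reflexive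
          (solve 1 (λ r → con 1 :+ (con 5 :* (con 1 :+ r) :+ (con 2 :+ r :* con 3)) := (con 1 :+ r) :* con 8) refl r))
          (*-monoʳ-≤ (suc r) (m≤m*n 8 (suc d′))))) p
        where open +-*-Solver

      K≤14 : ∀ i → i < n → kw w i ≤ 14
      K≤14 i i<n = *-cancelʳ-< (suc n) (at 0 w i) 14 (<-trans (small i i<n) (<-≤-trans (*-monoʳ-< 2 g<7n)
        (≤-trans (≤-reflexive (sym (*-assoc 2 7 n))) (*-monoʳ-≤ 14 (n≤1+n n)))))

      by-type : suc e′ * threes ≤ n → (𝟙 ≼ Untypical.Φ N₁ g (2 * g) (_/ suc eᵣ) x⟨ j₁ ⟩ h⟨ j₁ ⟩ n w) ⊎ Typical w (n / suc eᵣ) → Weighed ⊎ Ordinary g n w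
      by-type few (inj₁ r)   = inj₁ (weighed₃ (long⁺ g (Untypical.Φ N₁ g (2 * g) (_/ suc eᵣ) x⟨ j₁ ⟩ h⟨ j₁ ⟩) w g<7n r))
      by-type few (inj₂ typ) = by-frequency few typ (c₁ * g ≤? ones w * d) (c₂ * g ≤? twos w * d)

      by-threes : Dec (suc e′ * threes ≤ n) → Weighed ⊎ Ordinary g n w
      by-threes (no many) = inj₁ (weighed₂ (long⁺ g (ManyThrees.Φ N₂ e′ g (2 * g) x⟨ j₂ ⟩ h⟨ j₂ ⟩) w g<7n
        (ManyThrees.many-threes⇒𝟙≼Φ N₂ e′ g (2 * g) x⟨ j₂ ⟩ h⟨ j₂ ⟩ w ineq (Weights.hx≈𝟙 j₂) sum≡g K≤14 e≤N₂
          (*-cancelˡ-≤ 7 (≤-trans large (<⇒≤ g<7n))) (≰⇒> many))))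
      by-threes (yes few) = by-type few (Untypical.typical-or N₁ g (2 * g) (_/ suc eᵣ) x⟨ j₁ ⟩ h⟨ j₁ ⟩ w ineq (Weights.hx≈𝟙 j₁) sum≡g few
        (5r<n (n / suc eᵣ) (m/n*n≤m n (suc eᵣ))))

    by-length : Dec (7 * n ≤ g) → Weighed ⊎ Ordinary g n w
    by-length (yes 7n≤g) = inj₁ (weighed₁ (FewParts.few-parts⇒𝟙≼Φ g (2 * g) w sum≡g 7n≤g))
    by-length (no 7n≰g)  = by-threes (≰⇒> 7n≰g) (suc e′ * threes ≤? n)

    classify : Weighed ⊎ Ordinary g n w
    classify = by-length (7 * n ≤? g)

  -- A semigroup outside `E` cannot have an ordinary word, so by the classification its word weighs
  -- at least 1; the number of exceptions is then bounded by the total weight.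
  ordinary⇒tendsToOne : ∀ E g₁ → Negligible weight-of-exceptions → 4 * suc e′ ≤ suc N₂ →
    (∀ g → g₁ ≤ g → ∀ v {n} {w : Vec ℕ n} → KunzWord v n w → genus v ≡ g → n ≤ g → Ordinary g n w → E g v ≡ true) → ProbTendsToOne E
  ordinary⇒tendsToOne E g₁ neg e≤N₂ holds = negligible⇒tendsToOne E weight-of-exceptions (suc (g₁ + 7 * enough)) neg few
    where
    few : ∀ g → suc (g₁ + 7 * enough) ≤ g → ι (exceptions E g) ≼ weight-of-exceptions g
    few g large = ≼-trans (count≼total (window g) (suc g) (2 * g) (λ v → inSg g v ∧ not (E g v)) (Φ g) code) (≈⇒≼ (total-Φ g))
      where
      code : ∀ v → inSg g v ∧ not (E g v) ≡ true → ∃[ n ] ∃[ w ] (n < suc g × (∀ i → i < n → at 0 w i < 2 * g) × decode (window g) n w ≡ v × 𝟙 ≼ Φ g n w)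
      code v bad = from (kunzWord′ (window g) (≤-trans (≤-trans (s≤s z≤n) large) (m≤m+n g _)) v (proj₁ (∧-true⁻ {isNumSg v} in-Sg)))
        where
        in-Sg : inSg g v ≡ true
        in-Sg = proj₁ (∧-true⁻ {inSg g v} bad)
        E-fails : E g v ≢ true
        E-fails e = true≢false (trans (sym e) (not-true⁻ (proj₂ (∧-true⁻ {inSg g v} bad))))
        genus≡g : genus v ≡ g
        genus≡g = ≡ᵇ-true⁻ {genus v} (proj₂ (∧-true⁻ {isNumSg v} in-Sg))
        all-one : ∀ n → sumTo n (λ _ → 1) ≡ n
        all-one zero    = refl
        all-one (suc n) = trans (cong (_+ 1) (all-one n)) (+-comm n 1)
        from : ∃[ n ] ∃[ w ] KunzWord v n w → ∃[ n ] ∃[ w ] (n < suc g × (∀ i → i < n → at 0 w i < 2 * g) × decode (window g) n w ≡ v × 𝟙 ≼ Φ g n w)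
        from (n , w , k) = n , w , s≤s n≤g , (λ i i<n → ≤-<-trans (m≤m*n (at 0 w i) (suc n)) (KunzWord.kw-<L k i i<n)) , KunzWord.decoded k
          , [ id , (λ o → ⊥-elim (E-fails (holds g (≤-trans (m≤m+n g₁ (7 * enough)) (≤-trans (n≤1+n _) large)) v k genus≡g n≤g o))) ]′
              (Classify.classify e≤N₂ g w (kunzInequalities k) sum≡g (KunzWord.kw-<L k) (≤-trans (m≤n+m (7 * enough) g₁) (≤-trans (n≤1+n _) large)))
          where
          sum≡g : sumTo n (kw w) ≡ g
          sum≡g = trans (KunzWord.sum-kw k) genus≡g
          n≤g : n ≤ g
          n≤g = ≤-trans (≤-trans (≤-reflexive (sym (all-one n))) (sumTo-mono n (λ i _ → s≤s z≤n))) (≤-reflexive sum≡g)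

letter-bound : ∀ α b → (2 ≤ α → suc α ≤ 3 × b ≡ true) → suc α ≤ (bit (suc α ≡ᵇ 1) + bit (suc α ≡ᵇ 2) * 2) + bit b * 3
letter-bound 0             b h = s≤s z≤n
letter-bound 1             b h = s≤s (s≤s z≤n)
letter-bound (suc (suc α)) b h with h (s≤s (s≤s z≤n))
... | α≤ , refl = ≤-trans α≤ (m≤n+m 3 (bit (suc (suc (suc α)) ≡ᵇ 1) + bit (suc (suc (suc α)) ≡ᵇ 2) * 2))

-- The letters above 2 of a typical word sit at fewer than 2r positions and are at most 3.
typical-sum : ∀ {L n} {v : Vec Bool L} {w : Vec ℕ n} {r} → KunzWord v n w → Typical w r →
  sumTo n (kw w) ≤ (ones w + 2 * twos w) + 6 * r
typical-sum {n = n} {w = w} {r} k typ = begin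
  sumTo n (kw w)
    ≤⟨ sumTo-mono n (λ i i<n → letter-bound (at 0 w i) (near i) (λ 2≤α → Typical.depth≤3 typ i i<n , close i i<n 2≤α)) ⟩
  sumTo n (λ i → (f₁ i + f₂ i * 2) + f₃ i * 3)
    ≡⟨ sumTo-+ n (λ i → f₁ i + f₂ i * 2) (λ i → f₃ i * 3) ⟩
  sumTo n (λ i → f₁ i + f₂ i * 2) + sumTo n (λ i → f₃ i * 3)
    ≡⟨ cong₂ _+_ (trans (sumTo-+ n f₁ (λ i → f₂ i * 2)) (cong (sumTo n f₁ +_) (sumTo-*ʳ n f₂ 2))) (sumTo-*ʳ n f₃ 3) ⟩
  (sumTo n f₁ + sumTo n f₂ * 2) + sumTo n f₃ * 3
    ≡⟨ cong₂ (λ x y → x + y * 3) (cong₂ (λ x y → x + y * 2) (count≡sum n is-one) (count≡sum n is-two)) (count≡sum n near) ⟨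
  (ones w + twos w * 2) + countUpTo n near * 3
    ≤⟨ +-monoʳ-≤ (ones w + twos w * 2) (*-monoˡ-≤ 3 (count-interval 0 (r + r) n)) ⟩
  (ones w + twos w * 2) + (r + r) * 3
    ≡⟨ collect (ones w) (twos w) r ⟩
  (ones w + 2 * twos w) + 6 * r ∎
  where
  open ≤-Reasoning
  is-one is-two near : ℕ → Bool
  is-one i = kw w i ≡ᵇ 1
  is-two i = kw w i ≡ᵇ 2
  near = interval 0 (r + r)
  f₁ f₂ f₃ : ℕ → ℕ
  f₁ i = bit (is-one i)
  f₂ i = bit (is-two i)
  f₃ i = bit (near i)
  close : ∀ i → i < n → 2 ≤ at 0 w i → near i ≡ true
  close i i<n 2≤α = interval⁺ {0} {r + r} z≤n (≰⇒> (λ p → <⇒≱ (s≤s 2≤α) (Invariants.K≤2 k typ i p i<n)))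
  collect : ∀ a b r → (a + b * 2) + (r + r) * 3 ≡ (a + 2 * b) + 6 * r
  collect = solve 3 (λ a b r → (a :+ b :* con 2) :+ (r :+ r) :* con 3 := (a :+ con 2 :* b) :+ con 6 :* r) refl
    where open +-*-Solver

-- Choice of the parameters

-- `N₁` must beat the fixed savings of the pairs and of the tilts. The saving for many letters at
-- least 3 is only of order `n / N₁²` in the exponent, hence the separate and larger `N₂`, chosen
-- after `N₁`.
record Large (d′ : ℕ) {c₁ c₂ : ℕ} (τ₁ : Tilt false c₁ (suc d′)) (τ₂ : Tilt true c₂ (suc d′)) (N₁ N₂ e′ : ℕ) : Set where
  field
    30000≤₁ : 30000 ≤ suc N₁
    saves₁  : threshold-for 7 (d′ + 7 * suc d′) 3 ≤ suc N₁
    first₁  : Tilt.N₀ τ₁ ≤ suc N₁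
    first₂  : 2 * suc (suc (Weights.gap (Tilt.j τ₁))) ≤ suc N₁
    second₁ : Tilt.N₀ τ₂ ≤ suc N₁
    second₂ : 2 * suc (suc (Weights.gap (Tilt.j τ₂))) ≤ suc N₁
    30000≤₂ : 30000 ≤ suc N₂
    saves₂  : threshold-for 15 (3 + e′ * 4) 1998 ≤ suc N₂
    blocks  : 4 * suc e′ ≤ suc N₂

six-terms : ∀ a b c d e f → ∃[ N ] (a ≤ N × b ≤ N × c ≤ N × d ≤ N × e ≤ N × f ≤ N)
six-terms a b c d e f = a + (b + (c + (d + (e + f))))
  , m≤m+n a _ , up a (m≤m+n b _) , up a (up b (m≤m+n c _)) , up a (up b (up c (m≤m+n d _)))
  , up a (up b (up c (up d (m≤m+n e f)))) , up a (up b (up c (up d (m≤n+m f e))))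
  where
  up : ∀ a {x y} → x ≤ y → x ≤ a + y
  up a p = ≤-trans p (m≤n+m _ a)

large-exists : ∀ d′ {c₁ c₂} (τ₁ : Tilt false c₁ (suc d′)) (τ₂ : Tilt true c₂ (suc d′)) → ∃[ N₁ ] ∃[ N₂ ] Large d′ τ₁ τ₂ N₁ N₂ (N₁ + N₁ * suc N₁)
large-exists d′ τ₁ τ₂ = outer (six-terms 30000 (threshold-for 7 (d′ + 7 * suc d′) 3) (Tilt.N₀ τ₁) (2 * suc (suc (Weights.gap (Tilt.j τ₁)))) (Tilt.N₀ τ₂) (2 * suc (suc (Weights.gap (Tilt.j τ₂)))))
  where
  outer : ∃[ N ] (30000 ≤ N × threshold-for 7 (d′ + 7 * suc d′) 3 ≤ N × Tilt.N₀ τ₁ ≤ N × 2 * suc (suc (Weights.gap (Tilt.j τ₁))) ≤ N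
      × Tilt.N₀ τ₂ ≤ N × 2 * suc (suc (Weights.gap (Tilt.j τ₂))) ≤ N) → ∃[ N₁ ] ∃[ N₂ ] Large d′ τ₁ τ₂ N₁ N₂ (N₁ + N₁ * suc N₁)
  outer (N₁ , a , b , c , d , e , f) = inner (six-terms 30000 (threshold-for 15 (3 + (N₁ + N₁ * suc N₁) * 4) 1998) (4 * suc (N₁ + N₁ * suc N₁)) 0 0 0)
    where
    inner : ∃[ N ] (30000 ≤ N × threshold-for 15 (3 + (N₁ + N₁ * suc N₁) * 4) 1998 ≤ N × 4 * suc (N₁ + N₁ * suc N₁) ≤ N × 0 ≤ N × 0 ≤ N × 0 ≤ N) → ∃[ N₁ ] ∃[ N₂ ] Large d′ τ₁ τ₂ N₁ N₂ (N₁ + N₁ * suc N₁)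
    inner (N₂ , a′ , b′ , c′ , _) = N₁ , N₂ , record
      { 30000≤₁ = m≤n⇒m≤1+n a ; saves₁ = m≤n⇒m≤1+n b ; first₁ = m≤n⇒m≤1+n c ; first₂ = m≤n⇒m≤1+n d ; second₁ = m≤n⇒m≤1+n e ; second₂ = m≤n⇒m≤1+n f
      ; 30000≤₂ = m≤n⇒m≤1+n a′ ; saves₂ = m≤n⇒m≤1+n b′ ; blocks = m≤n⇒m≤1+n c′ }

module WithFrequencies (p q d′ v w z N₁ N₂ : ℕ) (τ₁ : Tilt false (suc v) (suc d′)) (τ₂ : Tilt true (suc w) (suc d′))
  (L : Large d′ τ₁ τ₂ N₁ N₂ (N₁ + N₁ * suc N₁)) (pd>3q : 3 * q < p * suc d′)
  (5v²≤d² : 5 * (v * v) ≤ suc d′ * suc d′) (d≡ : suc d′ ≡ 2 * w + z) (d²≤5z² : suc d′ * suc d′ ≤ 5 * (z * z)) where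
  open Large L

  module Cl = Classification d′ (suc v) (suc w) τ₁ τ₂ N₁ N₂

  negligible : Negligible Cl.weight-of-exceptions
  negligible = negligible-⊕ negligible-few-parts (negligible-⊕ (negligible-many-threes N₂ (N₁ + N₁ * suc N₁) 30000≤₂ saves₂)
    (negligible-⊕ (negligible-untypical N₁ (d′ + 7 * suc d′) 30000≤₁ saves₁)
      (negligible-⊕ (negligible-frequent-letter false (suc v) d′ τ₁ N₁ first₁ first₂) (negligible-frequent-letter true (suc w) d′ τ₂ N₁ second₁ second₂))))

  module _ (g : ℕ) (large : suc (6 * suc d′) ≤ g) (u : Vec Bool (window g)) {n : ℕ} {ω : Vec ℕ n} (k : KunzWord u n ω)
    (genus≡g : genus u ≡ g) (n≤g : n ≤ g) (o : Cl.Ordinary g n ω) where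
    open Cl.Ordinary o
    private
      r : ℕ
      r = n / suc (d′ + 7 * suc d′)
      module I = Invariants k typical
      8dr≤g : 8 * suc d′ * r ≤ g
      8dr≤g = ≤-trans (≤-reflexive (*-comm (8 * suc d′) r)) (≤-trans (m/n*n≤m n (suc (d′ + 7 * suc d′))) n≤g)
      g≤ : g ≤ (ones ω + 2 * twos ω) + 6 * r
      g≤ = ≤-trans (≤-reflexive (sym (trans (KunzWord.sum-kw k) genus≡g))) (typical-sum k typical)
      e≤ : edim u ≤ ones ω + (4 * r + 3)
      e≤ = ≤-trans I.edim≤ (≤-reflexive (solve 2 (λ a r → (con 1 :+ a) :+ ((con 1 :+ (r :+ r)) :+ (con 1 :+ (r :+ r))) := a :+ (con 4 :* r :+ con 3)) refl (ones ω) r))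
        where open +-*-Solver
      t≤ : type u ≤ twos ω + (4 * r + 1)
      t≤ = ≤-trans I.type≤ (≤-reflexive (solve 2 (λ a r → (r :+ r) :+ (a :+ (con 1 :+ (r :+ r))) := a :+ (con 4 :* r :+ con 1)) refl (twos ω) r))
        where open +-*-Solver
      n₂≤ : twos ω ≤ 2 * r + type u
      n₂≤ = ≤-trans I.twos≤type (≤-reflexive (cong (λ z → (r + z) + type u) (sym (+-identityʳ r))))
      module Ev = Events p q (suc d′) v w z g r (edim u) (type u) (ones ω) (twos ω) pd>3q large d≡ 5v²≤d² d²≤5z² ones< twos< 8dr≤g g≤ I.ones≤edim e≤ t≤ n₂≤

    edim-holds : edimEvent p q g u ≡ true
    edim-holds = Ev.edim-band

    type-holds : typeEvent p q g u ≡ true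
    type-holds = Ev.type-band

  both : ProbTendsToOne (edimEvent p q) × ProbTendsToOne (typeEvent p q)
  both = Cl.ordinary⇒tendsToOne (edimEvent p q) (suc (6 * suc d′)) negligible blocks edim-holds
       , Cl.ordinary⇒tendsToOne (typeEvent p q) (suc (6 * suc d′)) negligible blocks type-holds

theorem1p5 : (p q : ℕ) → 0 < p → 0 < q →
    ProbTendsToOne (edimEvent p q) × ProbTendsToOne (typeEvent p q)
theorem1p5 p q p>0 q>0 = build (FindFrequencies.frequencies (suc d′) (suc q) refl z<s)
  where
  -- The denominator `suc d′` is `3 (q + 1)`: rounding to multiples of `1 / d` and the boundary
  -- terms together cost at most `3 / d`, which is below `p / q`.
  d′ : ℕ
  d′ = q + (suc q + (suc q + 0))
  pd>3q : 3 * q < p * suc d′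
  pd>3q = ≤-trans (≤-trans (s≤s (+-monoʳ-≤ q (+-mono-≤ (n≤1+n q) (+-monoˡ-≤ 0 (n≤1+n q))))) (≤-reflexive (sym (*-identityˡ (suc d′))))) (*-monoˡ-≤ (suc d′) p>0)
  build : Frequencies (suc d′) → ProbTendsToOne (edimEvent p q) × ProbTendsToOne (typeEvent p q)
  build fr = conclude (large-exists d′ τ₁ τ₂)
    where
    open Frequencies fr
    τ₁ : Tilt false (suc v) (suc d′)
    τ₁ = first-tilt (suc v) (suc d′) z<s z<s c₁≤d d²<5c₁²
    τ₂ : Tilt true (suc w) (suc d′)
    τ₂ = second-tilt (suc w) (suc d′) z<s z<s 5c₂≤2d c₂-quad
    conclude : ∃[ N₁ ] ∃[ N₂ ] Large d′ τ₁ τ₂ N₁ N₂ (N₁ + N₁ * suc N₁) → ProbTendsToOne (edimEvent p q) × ProbTendsToOne (typeEvent p q)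
    conclude (N₁ , N₂ , L) = WithFrequencies.both p q d′ v w z N₁ N₂ τ₁ τ₂ L pd>3q 5v²≤d² d≡ d²≤5z²
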